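{- For every $\alpha'>0$ there exist constants $c>0$ and $C\geq 1$ such that for every function $p=p(n)\in(0,1]$ with $p\geq C(\log n/n)^{1/2}$, asymptotically almost surely (i.e. with probability tending to $1$ as $n\to\infty$) the binomial random graph $G\in G(n,p)$ satisfies the following: every subgraph $H\subseteq G$ with $e(H)\geq \alpha' e(G)$ contains a copy of the grid graph $G_{s,s}$ for any positive integer $s\leq \frac{c}{p}$.
   Context: $G(n,p)$ is the binomial random graph on vertex set $[n]=\{1,\dots,n\}$, in which each of the $\binom n2$ possible edges is included independently with probability $p=p(n)$. For a graph $F$, $e(F)$ denotes its number of edges. The $s\times t$ grid graph $G_{s,t}$ has vertex set $[s]\times[t]$, and $uv$ is an edge if and only if $u$ and $v$ differ in exactly one coordinate, by exactly one. A copy of a graph $F$ in $H$ is a (not necessarily induced) subgraph of $H$ isomorphic to $F$. -}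

module Defs where

import Algebra.Definitions.RawSemiring
open import Data.Bool.Base using (Bool; true; false; T)
open import Data.Fin.Base using (Fin; toℕ)
open import Data.Fin.Properties using (_<?_)
open import Data.Fin.Subset using (Subset; inside; outside; _∈_; _⊆_; ⊤)
  renaming (∣_∣ to card)
open import Data.Fin.Subset.Properties using (∈⊤)
open import Data.Integer.Base as ℤ using (+_; 1ℤ)
import Data.Integer.Properties as ℤₚ
open import Data.List.Base as List
  using (List; []; _∷_; _++_; map; foldr; filter; filterᵇ; allFin; cartesianProduct; length)
open import Data.Nat.Base as ℕ using (ℕ; zero; suc; NonZero)
import Data.Nat.Properties as ℕₚ
open import Data.Product using (Σ; Σ-syntax; ∃; ∃-syntax; _×_; _,_; proj₁; proj₂; uncurry)
open import Data.Rational.Base as ℚ using (ℚ; 0ℚ; 1ℚ; ½; mkℚ)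
import Data.Rational.Properties as ℚₚ
open import Data.Rational.Solver using (module +-*-Solver)
import Data.Rational.Unnormalised.Base as ℚᵘ
import Data.Rational.Unnormalised.Properties as ℚᵘₚ
open import Data.Sum using (_⊎_; inj₁; inj₂)
open import Data.Vec.Base using ([]; _∷_)
open import Function.Definitions using (Injective)
open import Level using (0ℓ)
open import Relation.Binary.Core using (Rel)
open import Relation.Binary.PropositionalEquality

Eventually : (ℕ → Set) → Set
Eventually P = ∃[ N ] ∀ n → N ℕ.≤ n → P n

-- Real numbers: Cauchy sequences of rationals, with _≃_ as equality.

infix  4 _≃_ _≤_ _<_
infixl 6 _+_ _-_
infixl 7 _*_
infix  8 -_

IsCauchy : (ℕ → ℚ) → Set
IsCauchy x = ∀ ε → 0ℚ ℚ.< ε →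
  ∃[ N ] ∀ m n → N ℕ.≤ m → N ℕ.≤ n → ℚ.∣ x m ℚ.- x n ∣ ℚ.≤ ε

record ℝ : Set where
  constructor mkℝ
  field
    seq    : ℕ → ℚ
    cauchy : IsCauchy seq
open ℝ public

_≃_ _≤_ _<_ : ℝ → ℝ → Set
x ≃ y = ∀ ε → 0ℚ ℚ.< ε → Eventually λ n → ℚ.∣ seq x n ℚ.- seq y n ∣ ℚ.≤ ε
x ≤ y = ∀ ε → 0ℚ ℚ.< ε → Eventually λ n → seq x n ℚ.≤ seq y n ℚ.+ ε
x < y = ∃[ ε ] 0ℚ ℚ.< ε × Eventually λ n → seq x n ℚ.+ ε ℚ.≤ seq y n

module CauchyLemmas where
  halves : ∀ ε → ε ℚ.* ½ ℚ.+ ε ℚ.* ½ ≡ ε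
  halves ε = trans (sym (ℚₚ.*-distribˡ-+ ε ½ ½)) (ℚₚ.*-identityʳ ε)

  *-pos : ∀ {p q} → 0ℚ ℚ.< p → 0ℚ ℚ.< q → 0ℚ ℚ.< p ℚ.* q
  *-pos {p} {q} 0<p 0<q =
    ℚₚ.positive⁻¹ (p ℚ.* q) {{ℚₚ.pos*pos⇒pos p {{ℚ.positive 0<p}} q {{ℚ.positive 0<q}}}}

  *-mono-nonNeg : ∀ {p q r s} → 0ℚ ℚ.≤ p → 0ℚ ℚ.≤ s → p ℚ.≤ q → r ℚ.≤ s →
                  p ℚ.* r ℚ.≤ q ℚ.* s
  *-mono-nonNeg {p} {q} {r} {s} 0≤p 0≤s p≤q r≤s = ℚₚ.≤-trans
    (ℚₚ.*-monoˡ-≤-nonNeg p {{ℚ.nonNegative 0≤p}} r≤s)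
    (ℚₚ.*-monoʳ-≤-nonNeg s {{ℚ.nonNegative 0≤s}} p≤q)

  ∣x-x∣≤ε : ∀ x {ε} → 0ℚ ℚ.< ε → ℚ.∣ x ℚ.- x ∣ ℚ.≤ ε
  ∣x-x∣≤ε x 0<ε rewrite ℚₚ.+-inverseʳ x = ℚₚ.<⇒≤ 0<ε

  +-cauchy : ∀ {x y} → IsCauchy x → IsCauchy y → IsCauchy (λ n → x n ℚ.+ y n)
  +-cauchy {x} {y} cx cy ε 0<ε
    with cx (ε ℚ.* ½) (*-pos 0<ε (ℚₚ.positive⁻¹ ½)) | cy (ε ℚ.* ½) (*-pos 0<ε (ℚₚ.positive⁻¹ ½))
  ... | M , hM | N , hN = M ℕ.⊔ N , λ m n m≥ n≥ → begin
      ℚ.∣ (x m ℚ.+ y m) ℚ.- (x n ℚ.+ y n) ∣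
        ≡⟨ cong ℚ.∣_∣ (rearrange (x m) (y m) (x n) (y n)) ⟩
      ℚ.∣ (x m ℚ.- x n) ℚ.+ (y m ℚ.- y n) ∣
        ≤⟨ ℚₚ.∣p+q∣≤∣p∣+∣q∣ (x m ℚ.- x n) (y m ℚ.- y n) ⟩
      ℚ.∣ x m ℚ.- x n ∣ ℚ.+ ℚ.∣ y m ℚ.- y n ∣
        ≤⟨ ℚₚ.+-mono-≤
             (hM m n (ℕₚ.≤-trans (ℕₚ.m≤m⊔n M N) m≥) (ℕₚ.≤-trans (ℕₚ.m≤m⊔n M N) n≥))
             (hN m n (ℕₚ.≤-trans (ℕₚ.m≤n⊔m M N) m≥) (ℕₚ.≤-trans (ℕₚ.m≤n⊔m M N) n≥)) ⟩
      ε ℚ.* ½ ℚ.+ ε ℚ.* ½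
        ≡⟨ halves ε ⟩
      ε ∎
    where
    open ℚₚ.≤-Reasoning
    rearrange : ∀ a b c d → (a ℚ.+ b) ℚ.- (c ℚ.+ d) ≡ (a ℚ.- c) ℚ.+ (b ℚ.- d)
    rearrange = solve 4 (λ a b c d →
      (a :+ b) :- (c :+ d) := (a :- c) :+ (b :- d)) refl
      where open +-*-Solver

  neg-cauchy : ∀ {x} → IsCauchy x → IsCauchy (λ n → ℚ.- x n)
  neg-cauchy {x} cx ε 0<ε with cx ε 0<ε
  ... | N , hN = N , λ m n m≥ n≥ → subst (ℚ._≤ ε)
      (trans (sym (ℚₚ.∣-p∣≡∣p∣ (x m ℚ.- x n)))
             (cong ℚ.∣_∣ (ℚₚ.neg-distrib-+ (x m) (ℚ.- x n))))
      (hN m n m≥ n≥)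

  cauchy-bounded : ∀ {x} → IsCauchy x →
    ∃[ B ] 0ℚ ℚ.< B × Eventually λ n → ℚ.∣ x n ∣ ℚ.≤ B
  cauchy-bounded {x} cx with cx 1ℚ (ℚₚ.positive⁻¹ 1ℚ)
  ... | N , hN = 1ℚ ℚ.+ ℚ.∣ x N ∣ , 0<B , N , λ n n≥ → begin
      ℚ.∣ x n ∣                         ≡⟨ cong ℚ.∣_∣ (split (x n) (x N)) ⟩
      ℚ.∣ (x n ℚ.- x N) ℚ.+ x N ∣       ≤⟨ ℚₚ.∣p+q∣≤∣p∣+∣q∣ (x n ℚ.- x N) (x N) ⟩
      ℚ.∣ x n ℚ.- x N ∣ ℚ.+ ℚ.∣ x N ∣   ≤⟨ ℚₚ.+-monoˡ-≤ ℚ.∣ x N ∣ (hN n N n≥ ℕₚ.≤-refl) ⟩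
      1ℚ ℚ.+ ℚ.∣ x N ∣                  ∎
    where
    open ℚₚ.≤-Reasoning
    0<B : 0ℚ ℚ.< 1ℚ ℚ.+ ℚ.∣ x N ∣
    0<B = ℚₚ.+-mono-<-≤ (ℚₚ.positive⁻¹ 1ℚ) (ℚₚ.0≤∣p∣ (x N))
    split : ∀ a b → a ≡ (a ℚ.- b) ℚ.+ b
    split = solve 2 (λ a b → a := (a :- b) :+ b) refl
      where open +-*-Solver

  divide : ∀ {ε B} → 0ℚ ℚ.< ε → 0ℚ ℚ.< B → ∃[ δ ] 0ℚ ℚ.< δ × B ℚ.* δ ≡ ε
  divide {ε} {B} 0<ε 0<B = 1/B ℚ.* ε
    , *-pos (ℚₚ.positive⁻¹ 1/B {{ℚₚ.1/pos⇒pos B {{ℚ.positive 0<B}}}}) 0<ε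
    , trans (sym (ℚₚ.*-assoc B 1/B ε))
        (trans (cong (ℚ._* ε) (ℚₚ.*-inverseʳ B {{B≢0}})) (ℚₚ.*-identityˡ ε))
    where
    B≢0 : ℚ.NonZero B
    B≢0 = ℚₚ.pos⇒nonZero B {{ℚ.positive 0<B}}
    1/B : ℚ
    1/B = (ℚ.1/ B) {{B≢0}}

  *-close : ∀ {a b c d A B δ η ε} →
    ℚ.∣ a ∣ ℚ.≤ A → ℚ.∣ d ∣ ℚ.≤ B → 0ℚ ℚ.< δ → 0ℚ ℚ.< η →
    ℚ.∣ b ℚ.- d ∣ ℚ.≤ δ → ℚ.∣ a ℚ.- c ∣ ℚ.≤ η →
    A ℚ.* δ ≡ ε ℚ.* ½ → B ℚ.* η ≡ ε ℚ.* ½ →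
    ℚ.∣ a ℚ.* b ℚ.- c ℚ.* d ∣ ℚ.≤ ε
  *-close {a} {b} {c} {d} {A} {B} {δ} {η} {ε} a≤ d≤ 0<δ 0<η bd≤ ac≤ Aδ Bη = begin
      ℚ.∣ a ℚ.* b ℚ.- c ℚ.* d ∣
        ≡⟨ cong ℚ.∣_∣ (rearrange a b c d) ⟩
      ℚ.∣ a ℚ.* (b ℚ.- d) ℚ.+ d ℚ.* (a ℚ.- c) ∣
        ≤⟨ ℚₚ.∣p+q∣≤∣p∣+∣q∣ (a ℚ.* (b ℚ.- d)) (d ℚ.* (a ℚ.- c)) ⟩
      ℚ.∣ a ℚ.* (b ℚ.- d) ∣ ℚ.+ ℚ.∣ d ℚ.* (a ℚ.- c) ∣
        ≡⟨ cong₂ ℚ._+_ (ℚₚ.∣p*q∣≡∣p∣*∣q∣ a (b ℚ.- d)) (ℚₚ.∣p*q∣≡∣p∣*∣q∣ d (a ℚ.- c)) ⟩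
      ℚ.∣ a ∣ ℚ.* ℚ.∣ b ℚ.- d ∣ ℚ.+ ℚ.∣ d ∣ ℚ.* ℚ.∣ a ℚ.- c ∣
        ≤⟨ ℚₚ.+-mono-≤ (*-mono-nonNeg (ℚₚ.0≤∣p∣ a) (ℚₚ.<⇒≤ 0<δ) a≤ bd≤)
                       (*-mono-nonNeg (ℚₚ.0≤∣p∣ d) (ℚₚ.<⇒≤ 0<η) d≤ ac≤) ⟩
      A ℚ.* δ ℚ.+ B ℚ.* η
        ≡⟨ cong₂ ℚ._+_ Aδ Bη ⟩
      ε ℚ.* ½ ℚ.+ ε ℚ.* ½
        ≡⟨ halves ε ⟩
      ε ∎
    where
    open ℚₚ.≤-Reasoning
    rearrange : ∀ a b c d →
      a ℚ.* b ℚ.- c ℚ.* d ≡ a ℚ.* (b ℚ.- d) ℚ.+ d ℚ.* (a ℚ.- c)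
    rearrange = solve 4 (λ a b c d →
      a :* b :- c :* d := a :* (b :- d) :+ d :* (a :- c)) refl
      where open +-*-Solver

  *-cauchy : ∀ {x y} → IsCauchy x → IsCauchy y → IsCauchy (λ n → x n ℚ.* y n)
  *-cauchy {x} {y} cx cy ε 0<ε =
    let A , 0<A , I , hA = cauchy-bounded {x} cx
        B , 0<B , J , hB = cauchy-bounded {y} cy
        0<ε/2 = *-pos 0<ε (ℚₚ.positive⁻¹ ½)
        δ , 0<δ , Aδ = divide 0<ε/2 0<A
        η , 0<η , Bη = divide 0<ε/2 0<B
        M , hM = cx η 0<η
        N , hN = cy δ 0<δ
        I⊔J≤ = λ {k} → ℕₚ.m⊔n≤o⇒m≤o {k} (I ℕ.⊔ J) (M ℕ.⊔ N)
        M⊔N≤ = λ {k} → ℕₚ.m⊔n≤o⇒n≤o {k} (I ℕ.⊔ J) (M ℕ.⊔ N)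
    in (I ℕ.⊔ J) ℕ.⊔ (M ℕ.⊔ N) , λ m n m≥ n≥ →
      *-close {x m} {y m} {x n} {y n} (hA m (ℕₚ.m⊔n≤o⇒m≤o I J (I⊔J≤ m≥))) (hB n (ℕₚ.m⊔n≤o⇒n≤o I J (I⊔J≤ n≥))) 0<δ 0<η
        (hN m n (ℕₚ.m⊔n≤o⇒n≤o M N (M⊔N≤ m≥)) (ℕₚ.m⊔n≤o⇒n≤o M N (M⊔N≤ n≥)))
        (hM m n (ℕₚ.m⊔n≤o⇒m≤o M N (M⊔N≤ m≥)) (ℕₚ.m⊔n≤o⇒m≤o M N (M⊔N≤ n≥)))
        Aδ Bη

open CauchyLemmas

fromℚ : ℚ → ℝ
fromℚ q = mkℝ (λ _ → q) λ ε 0<ε → 0 , λ _ _ _ _ → ∣x-x∣≤ε q 0<ε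

fromℕ : ℕ → ℝ
fromℕ n = fromℚ ((+ n) ℚ./ 1)

0ℝ 1ℝ : ℝ
0ℝ = fromℚ 0ℚ
1ℝ = fromℚ 1ℚ

_+_ _*_ : ℝ → ℝ → ℝ
x + y = mkℝ (λ n → seq x n ℚ.+ seq y n) (+-cauchy {seq x} {seq y} (cauchy x) (cauchy y))
x * y = mkℝ (λ n → seq x n ℚ.* seq y n) (*-cauchy {seq x} {seq y} (cauchy x) (cauchy y))

-_ : ℝ → ℝ
- x = mkℝ (λ n → ℚ.- seq x n) (neg-cauchy {seq x} (cauchy x))

_-_ : ℝ → ℝ → ℝ
x - y = x + (- y)

_isSqrtOf_ : ℝ → ℝ → Set
r isSqrtOf x = 0ℝ ≤ r × r * r ≃ x

open Algebra.Definitions.RawSemiring ℚ.+-*-rawSemiring public using () renaming (_^_ to _^ℚ_)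

-- Partial sums of y + y²/2 + y³/3 + ⋯ = -log (1 - y), for 0 ≤ y < 1.
mercator : ℚ → ℕ → ℚ
mercator y zero    = 0ℚ
mercator y (suc j) = mercator y j ℚ.+ (y ^ℚ suc j) ℚ.* (1ℤ ℚ./ suc j)

module LogLemmas where
  0≤y^ : ∀ {y} → 0ℚ ℚ.≤ y → ∀ j → 0ℚ ℚ.≤ y ^ℚ j
  0≤y^ 0≤y zero    = ℚₚ.nonNegative⁻¹ 1ℚ
  0≤y^ {y} 0≤y (suc j) = ℚₚ.nonNegative⁻¹ (y ^ℚ suc j)
    {{ℚₚ.nonNeg*nonNeg⇒nonNeg y {{ℚ.nonNegative 0≤y}} (y ^ℚ j) {{ℚ.nonNegative (0≤y^ 0≤y j)}}}}

  y^≤1 : ∀ {y} → 0ℚ ℚ.≤ y → y ℚ.≤ 1ℚ → ∀ j → y ^ℚ j ℚ.≤ 1ℚ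
  y^≤1 0≤y y≤1 zero    = ℚₚ.≤-refl
  y^≤1 0≤y y≤1 (suc j) =
    *-mono-nonNeg 0≤y (ℚₚ.nonNegative⁻¹ 1ℚ) y≤1 (y^≤1 0≤y y≤1 j)

  1/n-pos : ∀ n .{{_ : NonZero n}} → 0ℚ ℚ.< 1ℤ ℚ./ n
  1/n-pos n = ℚₚ.positive⁻¹ (1ℤ ℚ./ n) {{ℚₚ.normalize-pos 1 n}}

  /-cancel-≤ : ∀ m (q : ℚ) → 1ℤ ℤ.* ℚ.↧ q ℤ.≤ ℚ.↥ q ℤ.* (+ suc m) → 1ℤ ℚ./ suc m ℚ.≤ q
  /-cancel-≤ m q@record{} h = ℚₚ.toℚᵘ-cancel-≤
    (ℚᵘₚ.≤-trans (ℚᵘₚ.≤-reflexive (ℚₚ.toℚᵘ-fromℚᵘ (ℚᵘ.mkℚᵘ 1ℤ m))) (ℚᵘ.*≤* h))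

  1/n≤1 : ∀ n .{{_ : NonZero n}} → 1ℤ ℚ./ n ℚ.≤ 1ℚ
  1/n≤1 (suc k) = /-cancel-≤ k 1ℚ (ℤ.+≤+ (ℕ.s≤s ℕ.z≤n))

  archimedean : ∀ ε → 0ℚ ℚ.< ε → Eventually λ n → 1ℤ ℚ./ suc n ℚ.≤ ε
  archimedean ε@(mkℚ (+ zero) _ _) (ℚ.*<* (ℤ.+<+ ()))
  archimedean ε@(mkℚ ℤ.-[1+ _ ] _ _) (ℚ.*<* ())
  archimedean ε@(mkℚ (+ suc a) d _) _ = d , λ n d≤n →
    /-cancel-≤ n ε (ℤ.+≤+ (ℕₚ.*-mono-≤ {1} {suc a} (ℕ.s≤s ℕ.z≤n) (ℕ.s≤s d≤n)))

  mercator-cauchy : ∀ {y} → 0ℚ ℚ.≤ y → y ℚ.< 1ℚ → IsCauchy (mercator y)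
  mercator-cauchy {y} 0≤y y<1 ε 0<ε = N , close
    where
    S = mercator y
    gap = 1ℚ ℚ.- y
    0<gap : 0ℚ ℚ.< gap
    0<gap = subst (ℚ._< gap) (ℚₚ.+-inverseʳ y) (ℚₚ.+-monoˡ-< (ℚ.- y) y<1)
    N = proj₁ (archimedean (ε ℚ.* gap) (*-pos 0<ε 0<gap))
    hN = proj₂ (archimedean (ε ℚ.* gap) (*-pos 0<ε 0<gap))

    mono : ∀ m d → S m ℚ.≤ S (d ℕ.+ m)
    mono m zero    = ℚₚ.≤-refl
    mono m (suc d) = ℚₚ.≤-trans (mono m d) (subst (ℚ._≤ S (suc d ℕ.+ m)) (ℚₚ.+-identityʳ (S j))
      (ℚₚ.+-monoʳ-≤ (S j) (ℚₚ.nonNegative⁻¹ t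
        {{ℚₚ.nonNeg*nonNeg⇒nonNeg (y ^ℚ suc j) {{ℚ.nonNegative (0≤y^ 0≤y (suc j))}}
            (1ℤ ℚ./ suc j) {{ℚ.nonNegative (ℚₚ.<⇒≤ (1/n-pos (suc j)))}}}})))
      where
      j = d ℕ.+ m
      t = (y ^ℚ suc j) ℚ.* (1ℤ ℚ./ suc j)

    telescope : ∀ s p → s ℚ.+ p ℚ.* (ε ℚ.* (1ℚ ℚ.- y)) ℚ.+ ε ℚ.* (y ℚ.* p) ≡ s ℚ.+ ε ℚ.* p
    telescope s p = solve 4 (λ s p ε y →
        s :+ p :* (ε :* (con 1ℚ :- y)) :+ ε :* (y :* p) := s :+ ε :* p) refl s p ε y
      where open +-*-Solver

    step : ∀ j → N ℕ.≤ j →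
      S (suc j) ℚ.+ ε ℚ.* (y ^ℚ suc (suc j)) ℚ.≤ S j ℚ.+ ε ℚ.* (y ^ℚ suc j)
    step j j≥ = subst (S (suc j) ℚ.+ ε ℚ.* (y ^ℚ suc (suc j)) ℚ.≤_) (telescope (S j) (y ^ℚ suc j))
      (ℚₚ.+-monoˡ-≤ (ε ℚ.* (y ^ℚ suc (suc j))) (ℚₚ.+-monoʳ-≤ (S j)
        (ℚₚ.*-monoˡ-≤-nonNeg (y ^ℚ suc j) {{ℚ.nonNegative (0≤y^ 0≤y (suc j))}} (hN j j≥))))

    decay : ∀ m → N ℕ.≤ m → ∀ d →
      S (d ℕ.+ m) ℚ.+ ε ℚ.* (y ^ℚ suc (d ℕ.+ m)) ℚ.≤ S m ℚ.+ ε ℚ.* (y ^ℚ suc m)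
    decay m m≥ zero    = ℚₚ.≤-refl
    decay m m≥ (suc d) =
      ℚₚ.≤-trans (step (d ℕ.+ m) (ℕₚ.≤-trans m≥ (ℕₚ.m≤n+m m d))) (decay m m≥ d)

    0≤εy^ : ∀ j → 0ℚ ℚ.≤ ε ℚ.* (y ^ℚ j)
    0≤εy^ j = ℚₚ.nonNegative⁻¹ (ε ℚ.* (y ^ℚ j)) {{ℚₚ.nonNeg*nonNeg⇒nonNeg
      ε {{ℚ.nonNegative (ℚₚ.<⇒≤ 0<ε)}} (y ^ℚ j) {{ℚ.nonNegative (0≤y^ 0≤y j)}}}}

    upper : ∀ m → N ℕ.≤ m → ∀ d → S (d ℕ.+ m) ℚ.≤ S m ℚ.+ ε
    upper m m≥ d = begin
      S (d ℕ.+ m)                                   ≡⟨ ℚₚ.+-identityʳ (S (d ℕ.+ m)) ⟨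
      S (d ℕ.+ m) ℚ.+ 0ℚ                            ≤⟨ ℚₚ.+-monoʳ-≤ (S (d ℕ.+ m)) (0≤εy^ (suc (d ℕ.+ m))) ⟩
      S (d ℕ.+ m) ℚ.+ ε ℚ.* (y ^ℚ suc (d ℕ.+ m))    ≤⟨ decay m m≥ d ⟩
      S m ℚ.+ ε ℚ.* (y ^ℚ suc m)                    ≤⟨ ℚₚ.+-monoʳ-≤ (S m)
                                                        (ℚₚ.*-monoˡ-≤-nonNeg ε {{ℚ.nonNegative (ℚₚ.<⇒≤ 0<ε)}}
                                                          (y^≤1 0≤y (ℚₚ.<⇒≤ y<1) (suc m))) ⟩
      S m ℚ.+ ε ℚ.* 1ℚ                              ≡⟨ cong (S m ℚ.+_) (ℚₚ.*-identityʳ ε) ⟩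
      S m ℚ.+ ε                                     ∎
      where open ℚₚ.≤-Reasoning

    cancel : ∀ a b → (a ℚ.+ b) ℚ.- a ≡ b
    cancel = solve 2 (λ a b → (a :+ b) :- a := b) refl
      where open +-*-Solver

    ordered : ∀ m n → N ℕ.≤ m → m ℕ.≤ n → ℚ.∣ S n ℚ.- S m ∣ ℚ.≤ ε
    ordered m n m≥ m≤n = subst (λ k → ℚ.∣ S k ℚ.- S m ∣ ℚ.≤ ε) (ℕₚ.m∸n+n≡m m≤n)
      (subst (ℚ._≤ ε) (sym (ℚₚ.0≤p⇒∣p∣≡p lower)) (subst (S (d ℕ.+ m) ℚ.- S m ℚ.≤_) (cancel (S m) ε)
        (ℚₚ.+-monoˡ-≤ (ℚ.- S m) (upper m m≥ d))))
      where
      d = n ℕ.∸ m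
      lower : 0ℚ ℚ.≤ S (d ℕ.+ m) ℚ.- S m
      lower = subst (ℚ._≤ S (d ℕ.+ m) ℚ.- S m) (ℚₚ.+-inverseʳ (S m))
        (ℚₚ.+-monoˡ-≤ (ℚ.- S m) (mono m d))

    flip : ∀ a b → ℚ.∣ a ℚ.- b ∣ ≡ ℚ.∣ b ℚ.- a ∣
    flip a b = trans (sym (ℚₚ.∣-p∣≡∣p∣ (a ℚ.- b))) (cong ℚ.∣_∣ (neg a b))
      where
      neg : ∀ a b → ℚ.- (a ℚ.- b) ≡ b ℚ.- a
      neg = solve 2 (λ a b → :- (a :- b) := b :- a) refl
        where open +-*-Solver

    close : ∀ m n → N ℕ.≤ m → N ℕ.≤ n → ℚ.∣ S m ℚ.- S n ∣ ℚ.≤ ε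
    close m n m≥ n≥ with ℕₚ.≤-total m n
    ... | inj₁ m≤n = subst (ℚ._≤ ε) (flip (S n) (S m)) (ordered m n m≥ m≤n)
    ... | inj₂ n≤m = ordered n m n≥ n≤m

open LogLemmas

-- Natural logarithm: log n = -log (1 - y) with y = 1 - 1/n.
log : (n : ℕ) → .{{NonZero n}} → ℝ
log n = mkℝ (mercator y) (mercator-cauchy 0≤y y<1)
  where
  y = 1ℚ ℚ.- (1ℤ ℚ./ n)
  0≤y : 0ℚ ℚ.≤ y
  0≤y = subst (ℚ._≤ y) (ℚₚ.+-inverseʳ (1ℤ ℚ./ n)) (ℚₚ.+-monoˡ-≤ (ℚ.- (1ℤ ℚ./ n)) (1/n≤1 n))
  y<1 : y ℚ.< 1ℚ
  y<1 = ℚₚ.+-monoʳ-< 1ℚ (ℚₚ.neg-antimono-< (1/n-pos n))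

-- The 2-element subsets of [n], each listed once as (i , j) with i < j.
pairs : ∀ n → List (Fin n × Fin n)
pairs n = filter (λ (i , j) → i <? j) (cartesianProduct (allFin n) (allFin n))

EdgeSet : ℕ → Set
EdgeSet n = Subset (length (pairs n))

-- Simple graphs whose vertex set is a subset of [n].
record Graph (n : ℕ) : Set where
  field
    verts    : Subset n
    edges    : EdgeSet n
    incident : ∀ {k} → k ∈ edges →
               let (i , j) = List.lookup (pairs n) k in i ∈ verts × j ∈ verts
open Graph public

e : ∀ {n} → Graph n → ℕ
e H = card (edges H)

Adj : ∀ {n} → Graph n → Rel (Fin n) 0ℓ
Adj {n} H u v = ∃[ k ] k ∈ edges H ×
  (List.lookup (pairs n) k ≡ (u , v) ⊎ List.lookup (pairs n) k ≡ (v , u))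

infix 4 _⊑_
_⊑_ : ∀ {n} → Graph n → Graph n → Set
H ⊑ G = verts H ⊆ verts G × edges H ⊆ edges G

spanning : ∀ {n} → EdgeSet n → Graph n
spanning E = record { verts = ⊤ ; edges = E ; incident = λ _ → ∈⊤ , ∈⊤ }

GridAdj : ∀ s t → Rel (Fin s × Fin t) 0ℓ
GridAdj s t (i , j) (i′ , j′) =
  (ℕ.∣ toℕ i - toℕ i′ ∣ ≡ 1 × j ≡ j′) ⊎ (i ≡ i′ × ℕ.∣ toℕ j - toℕ j′ ∣ ≡ 1)

-- A copy of F in H is given by an injective, adjacency-preserving map
-- V(F) → V(H); its image, with the images of the edges of F, is the subgraph.
ContainsCopy : ∀ {n} {V : Set} → Rel V 0ℓ → Graph n → Set
ContainsCopy {n} {V} _~_ H = Σ[ f ∈ (V → Fin n) ]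
  Injective _≡_ _≡_ f ×
  (∀ v → f v ∈ verts H) ×
  (∀ {u v} → u ~ v → Adj H (f u) (f v))

-- The probability that the random subset of an m-element set, containing each
-- element independently with probability p, equals a given one.
weight : ∀ {m} → ℝ → Subset m → ℝ
weight p []            = 1ℝ
weight p (inside ∷ E)  = p * weight p E
weight p (outside ∷ E) = (1ℝ - p) * weight p E

subsets : ∀ m → List (Subset m)
subsets zero    = [] ∷ []
subsets (suc m) = map (outside ∷_) (subsets m) ++ map (inside ∷_) (subsets m)

prob : ∀ {m} → ℝ → (Subset m → Bool) → ℝ
prob {m} p χ = foldr _+_ 0ℝ (map (weight p) (filterᵇ χ (subsets m)))

-- P(G(n,p) satisfies A) ≥ q.  Since A need not be decidable (it may involve
-- comparing real numbers), this says that A contains a decidable event of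
-- probability at least q; classically one may take that event to be A itself.
ProbAtLeast : ∀ {n} → ℝ → (Graph n → Set) → ℝ → Set
ProbAtLeast {n} p A q = Σ[ χ ∈ (EdgeSet n → Bool) ]
  (∀ E → T (χ E) → A (spanning E)) × q ≤ prob p χ

AAS : (ℕ → ℝ) → (∀ n → Graph n → Set) → Set
AAS p A = ∀ (ε : ℝ) → 0ℝ < ε → Eventually λ n → ProbAtLeast (p n) (A n) (1ℝ - ε)

module Submission where

-- Write p ≈ 1/k, so that n ≥ Λ k² log n. By a density increment, H contains a
-- lower-regular pair of sets of linear size, which is cut into four parts P ρ γ, where
-- ρ is the parity of the row and γ that of the column of a grid vertex. A list of O(k)
-- vertices, chosen greedily, has neighbourhoods covering nearly all of a part B. There
-- are only n^O(k) lists, so in G(n,p) nearly every v has few neighbours in the uncovered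
-- rest of B; this is where n p² ≥ C² log n is used. Consequently, for any two such
-- vertices v and v′ in adjacent columns, every two large subsets of their neighbourhoods
-- in the next row's parts are joined by an edge. After passing to subsets of large
-- minimum degree, the grid is built row by row: a path through the neighbourhoods of the
-- previous row is found backwards. The path is injective because codegrees are
-- O(n p²) and s ≤ c / p, and it avoids the earlier rows because few vertices have many
-- neighbours in a set of s² = O(n / log n) vertices.
--
-- For rational p = A/B the exceptional events are bounded by exponential moments, with
-- the integral weights A^e (B - A)^(m - e), where m is the number of pairs of vertices;
-- a real p is replaced by its approximants.

-- Two obstacles shape the proof. The neighbourhoods in which a row is sought have about n/k
-- vertices, a factor k below the scale at which the pair is regular; and H is chosen after G, so
-- the random input must hold for all subgraphs at once. The edges F of H between S and B decide
-- which part of B each v in Z leaves uncovered, and the slots from Z to these parts are disjoint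
-- from F. Adding up P(F ⊆ G) over all F costs a factor (1 + p)^(|S||B|), at most exp(|S||B|/k),
-- which is of the order of the quantities compared. Choosing a list for every v costs a further
-- n^O(kn), and exp(n²/k) absorbs this when n is a large multiple of k² log n. An edge into an
-- uncovered part carries weight 2^g: the larger the constant g, the smaller the proportion of bad
-- vertices, at the price of a regularity scale x of about 2^(-g) times the size of a part. That
-- fixes the order of the constants: the density 1/(ak), then G, then E′, then Θ and Λ.

open import Data.Bool.Base using (Bool; true; false; _∧_; _∨_; not; if_then_else_)
open import Data.Empty using (⊥; ⊥-elim)
open import Data.Fin.Base using (Fin; zero; suc; toℕ)
open import Data.Nat.Tactic.RingSolver using (solve-∀)
open import Data.Product using (Σ-syntax; ∃-syntax; _×_; _,_; proj₁; proj₂)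
open import Data.Sum using (_⊎_; inj₁; inj₂)
open import Relation.Nullary using (¬_; Dec; yes; no; does)
open import Relation.Binary.PropositionalEquality hiding (J; [_])

-- Sums over sets of vertices

module VertexSets where
  open import Data.Nat.Base
  open import Data.Nat.Properties
  open import Data.Fin.Properties using (any?) renaming (_≟_ to _≟F_)
  open import Data.Bool.Properties using () renaming (_≟_ to _≟B_)
  open import Relation.Nullary.Decidable using (_×-dec_)
  import Algebra.Properties.CommutativeMonoid.Sum +-0-commutativeMonoid as Sum
  import Algebra.Properties.Semiring.Sum +-*-semiring as Sum′

  -- Turns a linear combination of inequalities into a semiring identity.
  lin : ∀ {x y P Q} s → P ≤ Q → y + P ≡ x + Q + s → x ≤ y
  lin {x} {y} {P} {Q} s P≤Q eq = +-cancelʳ-≤ P x y (begin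
    x + P        ≤⟨ +-monoʳ-≤ x P≤Q ⟩
    x + Q        ≤⟨ m≤m+n (x + Q) s ⟩
    x + Q + s    ≡⟨ eq ⟨
    y + P        ∎)
    where open ≤-Reasoning

  infixl 6 _⊕_
  _⊕_ : ∀ {a b c d} → a ≤ b → c ≤ d → a + c ≤ b + d
  _⊕_ = +-mono-≤

  infixr 6.5 _⊗_
  _⊗_ : ∀ {a b} c → a ≤ b → c * a ≤ c * b
  c ⊗ h = *-monoʳ-≤ c h

  cancel-* : ∀ {a b} c → 0 < c → c * a ≤ c * b → a ≤ b
  cancel-* c 0<c = *-cancelˡ-≤ c {{>-nonZero 0<c}}

  ∧-intro : ∀ {a b} → a ≡ true → b ≡ true → a ∧ b ≡ true
  ∧-intro refl refl = refl

  ∧-elimˡ : ∀ {a b} → a ∧ b ≡ true → a ≡ true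
  ∧-elimˡ {true} _ = refl

  ∧-elimʳ : ∀ {a b} → a ∧ b ≡ true → b ≡ true
  ∧-elimʳ {true} h = h

  not-intro : ∀ {a} → ¬ (a ≡ true) → not a ≡ true
  not-intro {true}  h = ⊥-elim (h refl)
  not-intro {false} _ = refl

  not-elim : ∀ {a} → not a ≡ true → ¬ (a ≡ true)
  not-elim {false} _ ()

  does-true : ∀ {ℓ} {P : Set ℓ} {P? : Dec P} → does P? ≡ true → P
  does-true {P? = yes p} _ = p

  true-does : ∀ {ℓ} {P : Set ℓ} (P? : Dec P) → P → does P? ≡ true
  true-does (yes _) _ = refl
  true-does (no ¬p) p = ⊥-elim (¬p p)

  VSet : ℕ → Set
  VSet n = Fin n → Bool

  private variable
    n : ℕ
    X Y Z : VSet n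
    d d′ : Fin n → ℕ

  infix 4 _∈_ _⊆_
  _∈_ : Fin n → VSet n → Set
  i ∈ X = X i ≡ true

  _⊆_ : VSet n → VSet n → Set
  X ⊆ Y = ∀ i → i ∈ X → i ∈ Y

  infixl 7 _∩_ _∖_
  _∩_ _∖_ : VSet n → VSet n → VSet n
  (X ∩ Y) i = X i ∧ Y i
  (X ∖ Y) i = X i ∧ not (Y i)

  Disjoint : VSet n → VSet n → Set
  Disjoint X Y = ∀ i → i ∈ X → i ∈ Y → ⊥

  𝟙 : Bool → ℕ
  𝟙 true  = 1
  𝟙 false = 0

  𝟙-mono : ∀ {a b} → (a ≡ true → b ≡ true) → 𝟙 a ≤ 𝟙 b
  𝟙-mono {true}  h rewrite h refl = ≤-refl
  𝟙-mono {false} h = z≤n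

  𝟙≤1 : ∀ b → 𝟙 b ≤ 1
  𝟙≤1 true  = ≤-refl
  𝟙≤1 false = z≤n

  𝟙-∧ : ∀ a b → 𝟙 (a ∧ b) ≡ 𝟙 a * 𝟙 b
  𝟙-∧ true  b = sym (+-identityʳ (𝟙 b))
  𝟙-∧ false b = refl

  opaque
    sum : ∀ {n} → (Fin n → ℕ) → ℕ
    sum = Sum.sum

    sum-zero : (d : Fin 0 → ℕ) → sum d ≡ 0
    sum-zero d = refl

    sum-suc : ∀ {n} (d : Fin (suc n) → ℕ) → sum d ≡ d zero + sum (λ i → d (suc i))
    sum-suc d = refl

    sum-mono : ∀ {n} {d d′ : Fin n → ℕ} → (∀ i → d i ≤ d′ i) → sum d ≤ sum d′
    sum-mono {zero}  h = z≤n
    sum-mono {suc n} h = +-mono-≤ (h zero) (sum-mono (λ i → h (suc i)))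

    sum-cong : ∀ {n} {d d′ : Fin n → ℕ} → (∀ i → d i ≡ d′ i) → sum d ≡ sum d′
    sum-cong = Sum.sum-cong-≗

    sum-const : ∀ n c → sum {n} (λ _ → c) ≡ n * c
    sum-const zero    c = refl
    sum-const (suc n) c = cong (c +_) (sum-const n c)

    sum-+ : ∀ {n} (d d′ : Fin n → ℕ) → sum (λ i → d i + d′ i) ≡ sum d + sum d′
    sum-+ = Sum.∑-distrib-+

    sum-* : ∀ {n} c (d : Fin n → ℕ) → sum (λ i → c * d i) ≡ c * sum d
    sum-* c d = sym (Sum′.*-distribˡ-sum c d)

    sum-swap : ∀ {m n} (f : Fin m → Fin n → ℕ) → sum (λ i → sum (λ j → f i j)) ≡ sum (λ j → sum (λ i → f i j))
    sum-swap = Sum.∑-comm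

    term≤sum : ∀ {n} (d : Fin n → ℕ) i → d i ≤ sum d
    term≤sum d zero    = m≤m+n (d zero) _
    term≤sum d (suc i) = ≤-trans (term≤sum (λ j → d (suc j)) i) (m≤n+m _ (d zero))

  opaque
    # : VSet n → ℕ
    # X = sum (λ i → 𝟙 (X i))

    ∑ : VSet n → (Fin n → ℕ) → ℕ
    ∑ X d = sum (λ i → 𝟙 (X i) * d i)

    #-def : (X : VSet n) → # X ≡ sum (λ i → 𝟙 (X i))
    #-def X = refl

    ∑-def : (X : VSet n) (d : Fin n → ℕ) → ∑ X d ≡ sum (λ i → 𝟙 (X i) * d i)
    ∑-def X d = refl

    #-mono : X ⊆ Y → # X ≤ # Y
    #-mono h = sum-mono (λ i → 𝟙-mono (h i))

    #-cong : (∀ i → X i ≡ Y i) → # X ≡ # Y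
    #-cong h = sum-cong (λ i → cong 𝟙 (h i))

    #≤n : (X : VSet n) → # X ≤ n
    #≤n {n} X = ≤-trans (sum-mono (λ i → 𝟙≤1 (X i)))
      (≤-reflexive (trans (sum-const n 1) (*-identityʳ n)))

    ∑-mono : (∀ i → i ∈ X → d i ≤ d′ i) → ∑ X d ≤ ∑ X d′
    ∑-mono {X = X} {d} {d′} h = sum-mono term
      where
      term : ∀ i → 𝟙 (X i) * d i ≤ 𝟙 (X i) * d′ i
      term i with X i in eq
      ... | true  = *-monoʳ-≤ 1 (h i eq)
      ... | false = z≤n

    ∑-⊆ : X ⊆ Y → ∑ X d ≤ ∑ Y d
    ∑-⊆ {d = d} h = sum-mono (λ i → *-monoˡ-≤ (d i) (𝟙-mono (h i)))

    ∑-cong : (∀ i → i ∈ X → d i ≡ d′ i) → ∑ X d ≡ ∑ X d′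
    ∑-cong h = ≤-antisym (∑-mono (λ i m → ≤-reflexive (h i m))) (∑-mono (λ i m → ≤-reflexive (sym (h i m))))

    ∑-const : (X : VSet n) → ∀ c → ∑ X (λ _ → c) ≡ # X * c
    ∑-const X c = trans (sum-cong (λ i → *-comm (𝟙 (X i)) c)) (trans (sum-* c (λ i → 𝟙 (X i))) (*-comm c (# X)))

    ∑-+ : (X : VSet n) (d d′ : Fin n → ℕ) → ∑ X (λ i → d i + d′ i) ≡ ∑ X d + ∑ X d′
    ∑-+ X d d′ = trans (sum-cong (λ i → *-distribˡ-+ (𝟙 (X i)) (d i) (d′ i))) (sum-+ _ _)

    ∑-* : (X : VSet n) → ∀ c (d : Fin n → ℕ) → ∑ X (λ i → c * d i) ≡ c * ∑ X d
    ∑-* X c d = trans (sum-cong (λ i → comm (𝟙 (X i)) c (d i))) (sum-* c _)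
      where
      comm : ∀ a b c → a * (b * c) ≡ b * (a * c)
      comm = solve-∀

    ∑-split : (X Y : VSet n) (d : Fin n → ℕ) → ∑ X d ≡ ∑ (X ∩ Y) d + ∑ (X ∖ Y) d
    ∑-split X Y d = trans (sum-cong (λ i → term (X i) (Y i) (d i))) (sum-+ _ _)
      where
      term : ∀ x y c → 𝟙 x * c ≡ 𝟙 (x ∧ y) * c + 𝟙 (x ∧ not y) * c
      term true  true  c = sym (+-identityʳ (c + 0))
      term true  false c = refl
      term false _     c = refl

    #-split : (X Y : VSet n) → # X ≡ # (X ∩ Y) + # (X ∖ Y)
    #-split X Y = trans (sum-cong (λ i → term (X i) (Y i))) (sum-+ _ _)
      where
      term : ∀ x y → 𝟙 x ≡ 𝟙 (x ∧ y) + 𝟙 (x ∧ not y)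
      term true  true  = refl
      term true  false = refl
      term false _     = refl

    #-∩⊆ : Y ⊆ X → # (X ∩ Y) ≡ # Y
    #-∩⊆ h = ≤-antisym (#-mono (λ i m → ∧-elimʳ m)) (#-mono (λ i m → ∧-intro (h i m) m))

    #-∖ : Y ⊆ X → # X ≡ # Y + # (X ∖ Y)
    #-∖ {Y = Y} {X} h = trans (#-split X Y) (cong (_+ # (X ∖ Y)) (#-∩⊆ h))

    ∑-∖ : (d : Fin n → ℕ) → Y ⊆ X → ∑ X d ≡ ∑ Y d + ∑ (X ∖ Y) d
    ∑-∖ {Y = Y} {X} d h = trans (∑-split X Y d) (cong (_+ ∑ (X ∖ Y) d)
      (≤-antisym (∑-⊆ {X = X ∩ Y} {Y} {d} (λ i m → ∧-elimʳ m)) (∑-⊆ {X = Y} {X ∩ Y} {d} (λ i m → ∧-intro (h i m)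
        m))))

  ∈-any : (X : VSet n) → 0 < # X → ∃[ i ] i ∈ X
  ∈-any {n} X 0<X with any? (λ i → X i ≟B true)
  ... | yes p = p
  ... | no ¬p = ⊥-elim (<-irrefl refl (≤-trans 0<X (≤-trans
    (#-mono {Y = λ _ → false} (λ i m → ⊥-elim (¬p (i , m))))
    (≤-reflexive (trans (#-def {n} _) (trans (sum-const n 0) (*-zeroʳ n)))))))

  average : (X : VSet n) (d : Fin n → ℕ) → ∀ c → 0 < # X → c * # X ≤ ∑ X d → ∃[ i ] i ∈ X × c ≤ d i
  average X d c 0<X h with any? (λ i → (X i ≟B true) ×-dec (c ≤? d i))
  ... | yes p = p
  ... | no ¬p = ⊥-elim (<-irrefl refl (≤-trans (+-monoˡ-≤ (∑ X d) 0<X) (begin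
    # X + ∑ X d                ≡⟨ cong (_+ ∑ X d) (trans (sym (*-identityʳ (# X))) (sym (∑-const X 1))) ⟩
    ∑ X (λ _ → 1) + ∑ X d      ≡⟨ ∑-+ X (λ _ → 1) d ⟨
    ∑ X (λ i → suc (d i))      ≤⟨ ∑-mono (λ i m → ≰⇒> (λ c≤ → ¬p (i , m , c≤))) ⟩
    ∑ X (λ _ → c)              ≡⟨ ∑-const X c ⟩
    # X * c                    ≡⟨ *-comm (# X) c ⟩
    c * # X                    ≤⟨ h ⟩
    ∑ X d                      ∎)))
    where open ≤-Reasoning

  below-average : (X : VSet n) (d : Fin n → ℕ) → 0 < # X → ∃[ i ] i ∈ X × # X * d i ≤ ∑ X d
  below-average X d 0<X with any? (λ i → (X i ≟B true) ×-dec (# X * d i ≤? ∑ X d))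
  ... | yes p = p
  ... | no ¬p = ⊥-elim (<-irrefl refl (≤-trans (+-monoˡ-≤ (# X * ∑ X d) 0<X) (begin
    # X + # X * ∑ X d                      ≡⟨ *-suc (# X) (∑ X d) ⟨
    # X * suc (∑ X d)                      ≡⟨ ∑-const X (suc (∑ X d)) ⟨
    ∑ X (λ _ → suc (∑ X d))                ≤⟨ ∑-mono (λ i m → ≰⇒> (λ c≤ → ¬p (i , m , c≤))) ⟩
    ∑ X (λ i → # X * d i)                  ≡⟨ ∑-* X (# X) d ⟩
    # X * ∑ X d                            ∎)))
    where open ≤-Reasoning

  ⁅_⁆ : Fin n → VSet n
  ⁅ i ⁆ j = does (i ≟F j)

  ∈⁅⁆ : ∀ {n} (i j : Fin n) → j ∈ ⁅ i ⁆ → i ≡ j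
  ∈⁅⁆ i j = does-true {P? = i ≟F j}

  sum-⁅⁆ : ∀ {n} (i : Fin n) (d : Fin n → ℕ) → ∑ ⁅ i ⁆ d ≡ d i
  sum-⁅⁆ {suc n} zero d = trans (trans (∑-def _ d) (sum-suc _)) (trans (cong₂ _+_ (*-identityˡ (d zero))
    (trans (sum-const n 0) (*-zeroʳ n))) (+-identityʳ (d zero)))
  sum-⁅⁆ (suc i) d = trans (trans (∑-def _ d) (sum-suc _)) (trans (sym (∑-def _ _))
    (sum-⁅⁆ i (λ j → d (suc j))))

  ⁅⁆-⊆ : ∀ {i} → i ∈ X → ⁅ i ⁆ ⊆ X
  ⁅⁆-⊆ {X = X} {i} i∈X j m = subst (_∈ X) (∈⁅⁆ i j m) i∈X

  ∑-remove : ∀ {i} (d : Fin n → ℕ) → i ∈ X → ∑ X d ≡ d i + ∑ (X ∖ ⁅ i ⁆) d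
  ∑-remove {X = X} {i} d i∈X = trans (∑-∖ {X = X} d (⁅⁆-⊆ {X = X} i∈X)) (cong (_+ ∑ (X ∖ ⁅ i ⁆) d) (sum-⁅⁆ i d))

  #⁅⁆ : (i : Fin n) → # ⁅ i ⁆ ≡ 1
  #⁅⁆ i = trans (sym (*-identityʳ (# ⁅ i ⁆))) (trans (sym (∑-const ⁅ i ⁆ 1)) (sum-⁅⁆ i (λ _ → 1)))

  #-remove : ∀ {i} → i ∈ X → # X ≡ suc (# (X ∖ ⁅ i ⁆))
  #-remove {X = X} {i} i∈X = trans (#-∖ {X = X} (⁅⁆-⊆ {X = X} i∈X)) (cong (_+ # (X ∖ ⁅ i ⁆)) (#⁅⁆ i))

  ∖-⊆ : (X Y : VSet n) → X ∖ Y ⊆ X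
  ∖-⊆ X Y i m = ∧-elimˡ m

  -- Repeatedly delete an element of at most average weight.
  densest : ∀ (X : VSet n) (d : Fin n → ℕ) t → t ≤ # X →
    ∃[ X′ ] X′ ⊆ X × # X′ ≡ t × t * ∑ X d ≤ # X * ∑ X′ d
  densest {n} X d t t≤X = go (# X ∸ t) X (sym (m∸n+n≡m t≤X))
    where
    go : ∀ j (X : VSet n) → # X ≡ j + t → ∃[ X′ ] X′ ⊆ X × # X′ ≡ t × t * ∑ X d ≤ # X * ∑ X′ d
    go zero    X eq = X , (λ _ m → m) , eq , ≤-reflexive (cong (_* ∑ X d) (sym eq))
    go (suc j) X eq =
      let i , i∈X , low = below-average X d (subst (0 <_) (sym eq) z<s)
          X₁ = X ∖ ⁅ i ⁆
          eq₁ = suc-injective (trans (sym (#-remove {X = X} i∈X)) eq)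
          X′ , X′⊆ , #X′ , h = go j X₁ eq₁
      in X′ , (λ v m → ∖-⊆ X ⁅ i ⁆ v (X′⊆ v m)) , #X′ , step i X X′ i∈X low eq₁ eq h #X′
      where
      step : ∀ i X X′ → i ∈ X → # X * d i ≤ ∑ X d → # (X ∖ ⁅ i ⁆) ≡ j + t → # X ≡ suc (j + t) →
        t * ∑ (X ∖ ⁅ i ⁆) d ≤ # (X ∖ ⁅ i ⁆) * ∑ X′ d → # X′ ≡ t → t * ∑ X d ≤ # X * ∑ X′ d
      step i X X′ i∈X low eq₁ eq h #X′ with j + t in s
      -- Here `X` is a singleton and `t` is 0. Otherwise the inequality can be divided by `suc c`,
      -- the size of `X` without `i`.
      ... | zero  = subst (_≤ # X * ∑ X′ d) (sym (cong (_* ∑ X d) (m+n≡0⇒n≡0 j s))) z≤n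
      ... | suc c rewrite eq | eq₁ | ∑-remove {X = X} {i} d i∈X = cancel-* (suc c) z<s
        (lin 0 (t ⊗ low ⊕ suc (suc c) ⊗ h) (identity c t (d i) (∑ (X ∖ ⁅ i ⁆) d) (∑ X′ d)))
        where
        identity : ∀ c t x y z →
          suc c * (suc (suc c) * z) + (t * (suc (suc c) * x) + suc (suc c) * (t * y)) ≡
          suc c * (t * (x + y)) + (t * (x + y) + suc (suc c) * (suc c * z)) + 0
        identity = solve-∀

  opaque
    subset-of-size : ∀ (X : VSet n) t → t ≤ # X → ∃[ X′ ] X′ ⊆ X × # X′ ≡ t
    subset-of-size X t t≤ = let X′ , ⊆X , eq , _ = densest X (λ _ → 0) t t≤ in X′ , ⊆X , eq

-- Density increment

module BipartiteDensity where
  open import Data.Nat.Base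
  open import Data.Nat.Properties
  open import Data.Fin.Subset.Properties using (anySubset?)
  open import Data.Vec.Base using (lookup; tabulate)
  open import Data.Vec.Properties using (lookup∘tabulate)
  open import Relation.Nullary.Decidable using (_×-dec_; map′)
  open import Data.Fin.Properties using (all?)
  open VertexSets

  Adjacency : ℕ → Set
  Adjacency n = Fin n → Fin n → Bool

  Symmetric : ∀ {n} → Adjacency n → Set
  Symmetric h = ∀ i j → h i j ≡ h j i

  Irreflexive : ∀ {n} → Adjacency n → Set
  Irreflexive h = ∀ i → h i i ≡ false

  module _ {n : ℕ} where
    -- The search runs over bit vectors; `resp` carries `P` back along the pointwise equality
    -- between a set and its table.
    search : (P : VSet n → Set) → (∀ X → Dec (P X)) → (∀ X Y → (∀ i → X i ≡ Y i) → P X → P Y) →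
      Dec (∃[ X ] P X)
    search P P? resp = map′ (λ (xs , p) → lookup xs , p)
      (λ (X , p) → tabulate X , resp X _ (λ i → sym (lookup∘tabulate X i)) p)
      (anySubset? (λ xs → P? (lookup xs)))

    -- An edge with both ends in X ∩ Y is counted twice.
    e : Adjacency n → VSet n → VSet n → ℕ
    e h X Y = ∑ X (λ i → # (Y ∩ h i))

    #-∩-∑ : (X Y : VSet n) → # (X ∩ Y) ≡ ∑ X (λ i → 𝟙 (Y i))
    #-∩-∑ X Y = trans (#-def _) (trans (sum-cong (λ i → 𝟙-∧ (X i) (Y i))) (sym (∑-def X _)))

    e-raw : (h : Adjacency n) (X Y : VSet n) →
      e h X Y ≡ sum (λ i → sum (λ j → 𝟙 (X i) * (𝟙 (Y j) * 𝟙 (h i j))))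
    e-raw h X Y = trans (∑-def X _) (sum-cong (λ i →
      trans (cong (𝟙 (X i) *_) (trans (#-∩-∑ Y (h i)) (∑-def Y _))) (sym (sum-* (𝟙 (X i)) _))))

    e-sym : ∀ h → Symmetric h → ∀ X Y → e h X Y ≡ e h Y X
    e-sym h h-sym X Y = trans (e-raw h X Y) (trans (sum-swap _) (trans
      (sum-cong (λ i → sum-cong (λ j → trans (comm (𝟙 (X j)) (𝟙 (Y i)) (𝟙 (h j i)))
        (cong (λ b → 𝟙 (Y i) * (𝟙 (X j) * 𝟙 b)) (h-sym j i)))))
      (sym (e-raw h Y X))))
      where
      comm : ∀ a b c → a * (b * c) ≡ b * (a * c)
      comm = solve-∀

    e-mono : ∀ h {X X′ Y Y′} → X ⊆ X′ → Y ⊆ Y′ → e h X Y ≤ e h X′ Y′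
    e-mono h {X} {X′} {Y} {Y′} hX hY = ≤-trans
      (∑-mono (λ i _ → #-mono {X = Y ∩ h i} {Y′ ∩ h i} (λ j m → ∧-intro (hY j (∧-elimˡ m)) (∧-elimʳ m))))
      (∑-⊆ {d = λ i → # (Y′ ∩ h i)} hX)

    e-cong : ∀ h {X X′ Y Y′} → (∀ i → X i ≡ X′ i) → (∀ i → Y i ≡ Y′ i) → e h X Y ≡ e h X′ Y′
    e-cong h hX hY = ≤-antisym
      (e-mono h (λ i m → trans (sym (hX i)) m) (λ i m → trans (sym (hY i)) m))
      (e-mono h (λ i m → trans (hX i) m) (λ i m → trans (hY i) m))

    e-splitˡ : ∀ h {X A} B → X ⊆ A → e h A B ≡ e h X B + e h (A ∖ X) B
    e-splitˡ h B X⊆A = ∑-∖ (λ i → # (B ∩ h i)) X⊆A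

    e-splitʳ : ∀ h → Symmetric h → ∀ {Y B} A → Y ⊆ B → e h A B ≡ e h A Y + e h A (B ∖ Y)
    e-splitʳ h h-sym {Y} {B} A Y⊆B = trans (e-sym h h-sym A B)
      (trans (e-splitˡ h A Y⊆B) (cong₂ _+_ (e-sym h h-sym Y A) (e-sym h h-sym (B ∖ Y) A)))

    complement : Adjacency n → Adjacency n
    complement h i j = not (h i j)

    e-complement : ∀ h X Y → e h X Y + e (complement h) X Y ≡ # X * # Y
    e-complement h X Y = trans (sym (∑-+ X _ _))
      (trans (∑-cong {X = X} (λ i _ → sym (#-split Y (h i)))) (∑-const X (# Y)))

    module _ (h : Adjacency n) (h-sym : Symmetric h) where
      -- `densest` is applied to the degrees into the other side, first in `A` and then in `B` with
      -- respect to the shrunken `A′`; neither step lowers the density.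
      trim-dense : ∀ {A B x} → 0 < x → x ≤ # A → x ≤ # B →
        ∃[ A′ ] ∃[ B′ ] A′ ⊆ A × B′ ⊆ B × # A′ ≡ x × # B′ ≡ x ×
          x * x * e h A B ≤ # A * # B * e h A′ B′
      trim-dense {A} {B} {x} 0<x x≤A x≤B =
        let A′ , A′⊆ , #A′ , hA = densest A (λ i → # (B ∩ h i)) x x≤A
            B′ , B′⊆ , #B′ , hB = densest B (λ i → # (A′ ∩ h i)) x x≤B
            hB′ = subst₂ (λ u v → x * u ≤ # B * v) (e-sym h h-sym B A′) (e-sym h h-sym B′ A′) hB
        in A′ , B′ , A′⊆ , B′⊆ , #A′ , #B′ ,
           lin 0 (x ⊗ hA ⊕ # A ⊗ hB′) (identity x (e h A B) (# A) (e h A′ B) (# B) (e h A′ B′))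
        where
        identity : ∀ x E a E₁ b E₂ → a * b * E₂ + (x * (x * E) + a * (x * E₁)) ≡
          x * x * E + (x * (a * E₁) + a * (b * E₂)) + 0
        identity = solve-∀

    -- Density in the complement is one minus density, so a dense trimming of the complement is a
    -- sparse trimming here.
    trim-sparse : ∀ h → Symmetric h → ∀ {A B x} → 0 < x → x ≤ # A → x ≤ # B →
        ∃[ A′ ] ∃[ B′ ] A′ ⊆ A × B′ ⊆ B × # A′ ≡ x × # B′ ≡ x ×
          # A * # B * e h A′ B′ ≤ x * x * e h A B
    trim-sparse h h-sym {A} {B} {x} 0<x x≤A x≤B =
      let A′ , B′ , A′⊆ , B′⊆ , #A′ , #B′ , dense =
            trim-dense (complement h) (λ i j → cong not (h-sym i j)) {A} {B} 0<x x≤A x≤B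
          total = e-complement h A B
          total′ = trans (e-complement h A′ B′) (cong₂ _*_ #A′ #B′)
      in A′ , B′ , A′⊆ , B′⊆ , #A′ , #B′ , lin 0
           (dense ⊕ # A * # B ⊗ ≤-reflexive total′ ⊕ x * x ⊗ ≤-reflexive (sym total))
           (identity x (# A) (# B) (e h A B) (e (complement h) A B) (e h A′ B′) (e (complement h) A′ B′))
      where
      identity : ∀ x a b E c E′ c′ →
        x * x * E + (x * x * c + a * b * (E′ + c′) + x * x * (a * b)) ≡
        a * b * E′ + (a * b * c′ + a * b * (x * x) + x * x * (E + c)) + 0
      identity = solve-∀

  -- Vertices are placed one at a time on the side that cuts at least half of the
  -- edges to the earlier ones.
  max-cut : ∀ {n} (h : Adjacency n) → Symmetric h → Irreflexive h →
    ∃[ A ] sum (λ i → sum (λ j → 𝟙 (h i j))) ≤ 4 * e h A (λ i → not (A i))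
  max-cut h h-sym h-irr = let c , le = go h h-sym h-irr in
    c , subst (λ t → sum (λ i → sum (λ j → 𝟙 (h i j))) ≤ 4 * t) (sym (e-raw h c _)) le
    where
    weight : ∀ {n} → Adjacency n → VSet n → Fin n → Fin n → ℕ
    weight h c i j = 𝟙 (c i) * (𝟙 (not (c j)) * 𝟙 (h i j))

    sum-suc² : ∀ {n} (f : Fin (suc n) → Fin (suc n) → ℕ) → sum (λ i → sum (f i)) ≡
      f zero zero + sum (λ j → f zero (suc j)) +
      (sum (λ i → f (suc i) zero) + sum (λ i → sum (λ j → f (suc i) (suc j))))
    sum-suc² f = trans (sum-suc _) (cong₂ _+_ (sum-suc _)
      (trans (sum-cong (λ i → sum-suc _)) (sum-+ _ _)))

    extend : ∀ {n} → Bool → VSet n → VSet (suc n)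
    extend b c zero    = b
    extend b c (suc i) = c i

    sum-0 : ∀ {n} {d : Fin n → ℕ} → (∀ i → d i ≡ 0) → sum d ≡ 0
    sum-0 {n} z = trans (sum-cong z) (trans (sum-const n 0) (*-zeroʳ n))

    -- The left side counts each edge twice and the right side counts each cut edge once, so the
    -- factor 4 means that half of the edges are cut.
    go : ∀ {n} (h : Adjacency n) → Symmetric h → Irreflexive h →
      ∃[ c ] sum (λ i → sum (λ j → 𝟙 (h i j))) ≤ 4 * sum (λ i → sum (weight h c i))
    go {zero} h h-sym h-irr = (λ ()) , ≤-trans (≤-reflexive (sum-zero _)) z≤n
    go {suc n} h h-sym h-irr with go (λ i j → h (suc i) (suc j)) (λ i j → h-sym _ _) (λ i → h-irr _)
    ... | c , ih = choose (≤-total x y)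
      where
      x y t w : ℕ
      x = sum (λ j → 𝟙 (c j) * 𝟙 (h zero (suc j)))
      y = sum (λ j → 𝟙 (not (c j)) * 𝟙 (h zero (suc j)))
      t = sum (λ i → sum (λ j → 𝟙 (h (suc i) (suc j))))
      w = sum (λ i → sum (weight (λ i j → h (suc i) (suc j)) c i))

      total : sum (λ i → sum (λ j → 𝟙 (h i j))) ≡ (x + y) + ((x + y) + t)
      total = trans (sum-suc² _) (cong₂ _+_
        (trans (cong (λ b → 𝟙 b + sum (λ j → 𝟙 (h zero (suc j)))) (h-irr zero)) row)
        (cong (_+ t) (trans (sum-cong (λ i → cong 𝟙 (h-sym (suc i) zero))) row)))
        where
        split : ∀ b d → 𝟙 d ≡ 𝟙 b * 𝟙 d + 𝟙 (not b) * 𝟙 d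
        split true  true  = refl
        split true  false = refl
        split false true  = refl
        split false false = refl
        row : sum (λ j → 𝟙 (h zero (suc j))) ≡ x + y
        row = trans (sum-cong (λ j → split (c j) (h zero (suc j)))) (sum-+ _ _)

      w-true : sum (λ i → sum (weight h (extend true c) i)) ≡ y + w
      w-true = trans (sum-suc² _) (cong₂ _+_ (sum-cong (λ j → *-identityˡ _))
        (cong (_+ w) (sum-0 (λ i → *-zeroʳ (𝟙 (c i))))))

      w-false : sum (λ i → sum (weight h (extend false c) i)) ≡ x + w
      w-false = trans (sum-suc² _) (cong₂ _+_ (sum-0 (λ j → refl))
        (cong (_+ w) (sum-cong (λ i → cong (𝟙 (c i) *_)
          (trans (*-identityˡ _) (cong 𝟙 (h-sym (suc i) zero)))))))

      bound : ∀ x y t w → x ≤ y → t ≤ 4 * w → (x + y) + ((x + y) + t) ≤ 4 * (y + w)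
      bound x y t w x≤y ih = lin 0 (2 ⊗ x≤y ⊕ ih) (identity x y t w)
        where
        identity : ∀ x y t w → 4 * (y + w) + (2 * x + t) ≡ (x + y) + ((x + y) + t) + (2 * y + 4 * w) + 0
        identity = solve-∀

      choose : x ≤ y ⊎ y ≤ x →
        ∃[ c ] sum (λ i → sum (λ j → 𝟙 (h i j))) ≤ 4 * sum (λ i → sum (weight h c i))
      choose (inj₁ x≤y) = extend true c , ≤-trans (≤-reflexive total)
        (≤-trans (bound x y t w x≤y ih) (*-monoʳ-≤ 4 (≤-reflexive (sym w-true))))
      choose (inj₂ y≤x) = extend false c , ≤-trans
        (≤-reflexive (trans total (cong₂ _+_ (+-comm x y) (cong (_+ t) (+-comm x y)))))
        (≤-trans (bound y x t w y≤x ih) (*-monoʳ-≤ 4 (≤-reflexive (sym w-false))))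

  -- Bernoulli's inequality (1 + 1/x)^t ≥ 1 + t/x, cleared of denominators. It stops the density
  -- increment and also bounds the exponential moments.
  bernoulli : ∀ x t → x ^ t * (x + t) ≤ suc x ^ t * x
  bernoulli x zero    = ≤-reflexive (cong (1 *_) (+-identityʳ x))
  bernoulli x (suc t) = lin (x ^ t * t) (suc x ⊗ bernoulli x t) (identity x t (x ^ t) (suc x ^ t))
    where
    identity : ∀ x t p q → (suc x * q) * x + suc x * (p * (x + t)) ≡
      (x * p) * (x + suc t) + suc x * (q * x) + p * t
    identity = solve-∀

  -- A pair of sets of density at least 1/(ak) that is not lower-regular contains a pair
  -- denser by a factor 1 + 1/F; the density is at most 5/k, so this stops.
  module Increment {n : ℕ} (k a E₁ : ℕ) (h : Adjacency n) (h-sym : Symmetric h)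
    (cap : ∀ A B → Disjoint A B → k * e h A B ≤ 4 * (# A * # B) + 3 * (n * k))
    (0<a : 0 < a) (0<k : 0 < k) (0<E₁ : 0 < E₁) where

    E = suc E₁
    F = 2 * (E * E)
    D = a * k

    -- The threshold is half of the initial density 1/D, however dense the pair has become since.
    -- Asking for a lower bound only ensures that every failure yields a denser pair.
    LowerRegular : VSet n → VSet n → ℕ → Set
    LowerRegular A B x = ∀ X Y → X ⊆ A → Y ⊆ B → x ≤ # X → x ≤ # Y → # X * # Y ≤ 2 * D * e h X Y

    record Pair (N : ℕ) : Set where
      field
        A B      : VSet n
        disjoint : Disjoint A B
        #A       : # A ≡ N
        #B       : # B ≡ N

    -- The density is at least (G/P)/D. An increment multiplies G/P by (F + 1)/F, so `G` and `P`
    -- will be powers of `suc F` and `F`.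
    record Denser (N G P : ℕ) : Set where
      field
        pair    : Pair N
        density : N * N * G ≤ e h (Pair.A pair) (Pair.B pair) * D * P

    module Step {x G P : ℕ} (0<x : 0 < x) (P≤G : P ≤ G) (dense : Denser (E * x) G P) where
      open Denser dense
      open Pair pair

      Sparse : VSet n → VSet n → Set
      Sparse X Y = (∀ i → i ∈ X → i ∈ A) × (∀ i → i ∈ Y → i ∈ B) ×
        # X ≡ x × # Y ≡ x × e h X Y * (2 * D) < x * x

      ⊆? : ∀ (X Y : VSet n) → Dec (∀ i → i ∈ X → i ∈ Y)
      ⊆? X Y = all? λ i → dec (X i) (Y i)
        where
        dec : ∀ a b → Dec (a ≡ true → b ≡ true)
        dec true  true  = yes λ _ → refl
        dec true  false = no λ f → case (f refl)
          where
          case : false ≡ true → ⊥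
          case ()
        dec false b     = yes λ ()

      sparse? : ∀ X Y → Dec (Sparse X Y)
      sparse? X Y = ⊆? X A ×-dec (⊆? Y B ×-dec (# X ≟ x ×-dec (# Y ≟ x ×-dec (e h X Y * (2 * D) <? x * x))))

      sparse-resp : ∀ {X X′ Y Y′} → (∀ i → X i ≡ X′ i) → (∀ i → Y i ≡ Y′ i) → Sparse X Y → Sparse X′ Y′
      sparse-resp {X} {X′} {Y} {Y′} hX hY (X⊆ , Y⊆ , #X , #Y , lt) =
        (λ i m → X⊆ i (trans (hX i) m)) , (λ i m → Y⊆ i (trans (hY i) m)) ,
        trans (sym (#-cong {X = X} hX)) #X , trans (sym (#-cong {X = Y} hY)) #Y ,
        subst (λ t → t * (2 * D) < x * x) (e-cong h hX hY) lt

      any-sparse? : Dec (∃[ X ] ∃[ Y ] Sparse X Y)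
      any-sparse? = search _ (λ X → search _ (sparse? X) (λ Y Y′ eq → sparse-resp {X} {X} {Y} {Y′} (λ _ → refl)
        eq))
        (λ X X′ eq (Y , s) → Y , sparse-resp {X} {X′} {Y} {Y} eq (λ _ → refl) s)

      -- A violating pair of any sizes from `x` on trims to one of size exactly `x`, so the finite
      -- search for `Sparse` pairs settles lower-regularity.
      lower-regular : ¬ (∃[ X ] ∃[ Y ] Sparse X Y) → LowerRegular A B x
      lower-regular none X Y X⊆ Y⊆ x≤X x≤Y = ≮⇒≥ λ lt →
        let X′ , Y′ , X′⊆ , Y′⊆ , #X′ , #Y′ , le = trim-sparse h h-sym {X} {Y} 0<x x≤X x≤Y
        in none (X′ , Y′ , (λ i m → X⊆ i (X′⊆ i m)) , (λ i m → Y⊆ i (Y′⊆ i m)) , #X′ , #Y′ ,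
             scale (# X * # Y) (e h X′ Y′) (2 * D) (x * x) (e h X Y) (*-mono-< 0<x 0<x) le lt)
        where
        scale : ∀ m e′ D s e → 0 < s → m * e′ ≤ s * e → D * e < m → e′ * D < s
        scale m e′ D s e 0<s le lt = *-cancelˡ-< m _ _ (begin-strict
          m * (e′ * D)  ≡⟨ *-assoc m e′ D ⟨
          m * e′ * D    ≤⟨ *-monoˡ-≤ D le ⟩
          s * e * D     ≡⟨ trans (*-assoc s e D) (cong (s *_) (*-comm e D)) ⟩
          s * (D * e)   <⟨ *-monoʳ-< s {{>-nonZero 0<s}} lt ⟩
          s * m         ≡⟨ *-comm s m ⟩
          m * s         ∎)
          where open ≤-Reasoning

      shrink : ∀ {A′ B′} → A′ ⊆ A → B′ ⊆ B → x ≤ # A′ → x ≤ # B′ →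
        # A′ * # B′ * (G * suc F) ≤ e h A′ B′ * D * (P * F) → Denser x (G * suc F) (P * F)
      shrink {A′} {B′} A′⊆ B′⊆ x≤A′ x≤B′ le =
        let A″ , B″ , A″⊆ , B″⊆ , #A″ , #B″ , le′ = trim-dense h h-sym {A′} {B′} 0<x x≤A′ x≤B′
        in record
        { pair = record
          { A = A″ ; B = B″ ; #A = #A″ ; #B = #B″
          ; disjoint = λ i mA mB → disjoint i (A′⊆ i (A″⊆ i mA)) (B′⊆ i (B″⊆ i mB)) }
        ; density = denser (# A′ * # B′) (e h A″ B″) (D) (P * F) (x * x) (G * suc F) (e h A′ B′)
            (*-mono-< (<-≤-trans 0<x x≤A′) (<-≤-trans 0<x x≤B′)) le le′ }
        where
        denser : ∀ m e″ D Q s R e′ → 0 < m → m * R ≤ e′ * D * Q → s * e′ ≤ m * e″ → s * R ≤ e″ * D * Q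
        denser m e″ D Q s R e′ 0<m le le′ =
          cancel-* m 0<m (lin 0 (s ⊗ le ⊕ D * Q ⊗ le′) (identity m e″ D Q s R e′))
          where
          identity : ∀ m e″ D Q s R e′ → m * (e″ * D * Q) + (s * (m * R) + D * Q * (s * e′)) ≡
            m * (s * R) + (s * (e′ * D * Q) + D * Q * (m * e″)) + 0
          identity = solve-∀

      y = E₁ * x

      x≤y : x ≤ y
      x≤y = m≤n*m x E₁ {{>-nonZero 0<E₁}}

      -- The rest of A × B splits into (A ∖ X) × B and X × (B ∖ Y). The pair X, Y occupies a share
      -- 1/E² of A × B and, as `P≤G`, has less than half of the density bound (G/P)/D. Were neither
      -- remaining piece denser by the factor 1 + 1/F, then with 1/E² = 2/F the total would be below
      -- 1 - 2/F² times that bound.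
      increment : ∀ {X Y} → Sparse X Y → Denser x (G * suc F) (P * F)
      increment {X} {Y} (X⊆ , Y⊆ , #X , #Y , lt) = choose
        (y * (E * x) * (G * suc F) ≤? e h (A ∖ X) B * D * (P * F))
        (x * y * (G * suc F) ≤? e h X (B ∖ Y) * D * (P * F))
        where
        #A∖X : # (A ∖ X) ≡ y
        #A∖X = +-cancelˡ-≡ x _ _ (trans (cong (_+ # (A ∖ X)) (sym #X)) (trans (sym (#-∖ {Y = X} X⊆)) #A))
        #B∖Y : # (B ∖ Y) ≡ y
        #B∖Y = +-cancelˡ-≡ x _ _ (trans (cong (_+ # (B ∖ Y)) (sym #Y)) (trans (sym (#-∖ {Y = Y} Y⊆)) #B))
        x≤Ex : x ≤ E * x
        x≤Ex = m≤m+n x y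
        splitted : e h A B ≡ e h X Y + e h X (B ∖ Y) + e h (A ∖ X) B
        splitted = trans (e-splitˡ h B X⊆) (cong (_+ e h (A ∖ X) B) (e-splitʳ h h-sym X Y⊆))
        contradiction : ∀ E₁ x G P D e₁ e₂ e₃ e₀ → let E = suc E₁ ; F = 2 * (E * E) ; y = E₁ * x in
          e₀ ≡ e₃ + e₂ + e₁ → P ≤ G → E * x * (E * x) * G ≤ e₀ * D * P → e₃ * (2 * D) < x * x →
          e₁ * D * (P * F) < y * (E * x) * (G * suc F) → e₂ * D * (P * F) < x * y * (G * suc F) → ⊥
        contradiction E₁ x G P D e₁ e₂ e₃ _ refl P≤G density lt ¬1 ¬2 =
          n≮0 (lin {1} {0} (3 + 2 * (G * (x * x)))
            (2 * Φ ⊗ ≤-trans density (≤-reflexive (distrib e₃ e₂ e₁ D P))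
              ⊕ 2 ⊗ ≤-trans (≤-reflexive (cong suc (assoc e₁ D P Φ))) ¬1
              ⊕ 2 ⊗ ≤-trans (≤-reflexive (cong suc (assoc e₂ D P Φ))) ¬2
              ⊕ Φ ⊗ ≤-trans (≤-reflexive (comm e₃ D P)) (*-mono-≤ (<⇒≤ lt) P≤G)
              ⊕ G ⊗ ≤-reflexive (square E₁ x))
            (identity x (E₁ * x) Φ G (e₁ * D * P) (e₂ * D * P) (e₃ * D * P)))
          where
          Φ = 2 * (suc E₁ * suc E₁)
          assoc : ∀ e D P F → e * D * P * F ≡ e * D * (P * F)
          assoc = solve-∀
          distrib : ∀ a b c D P → (a + b + c) * D * P ≡ a * D * P + b * D * P + c * D * P
          distrib = solve-∀
          comm : ∀ e D P → 2 * (e * D * P) ≡ e * (2 * D) * P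
          comm = solve-∀
          square : ∀ E₁ x → let E = suc E₁ in 2 * (E * x * (E * x)) ≡ 2 * (E * E) * (x * x)
          square = solve-∀
          identity : ∀ x y F G v₁ v₂ v₃ → let N = x + y in
            0 + (2 * F * (N * N * G) + 2 * suc (v₁ * F) + 2 * suc (v₂ * F) + F * (2 * v₃) + G * (2 * (N * N))) ≡
            1 + (2 * F * (v₃ + v₂ + v₁) + 2 * (y * N * (G * suc F)) + 2 * (x * y * (G * suc F))
                 + F * (x * x * G) + G * (F * (x * x))) + (3 + 2 * (G * (x * x)))
          identity = solve-∀
        choose : Dec _ → Dec _ → Denser x (G * suc F) (P * F)
        choose (yes le) _ = shrink (∖-⊆ A X) (λ _ m → m) (subst (x ≤_) (sym #A∖X) x≤y)
          (subst (x ≤_) (sym #B) x≤Ex)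
          (subst (λ t → t * (G * suc F) ≤ e h (A ∖ X) B * D * (P * F)) (sym (cong₂ _*_ #A∖X #B)) le)
        choose (no _) (yes le) = shrink X⊆ (∖-⊆ B Y) (≤-reflexive (sym #X)) (subst (x ≤_) (sym #B∖Y) x≤y)
          (subst (λ t → t * (G * suc F) ≤ e h X (B ∖ Y) * D * (P * F)) (sym (cong₂ _*_ #X #B∖Y)) le)
        choose (no ¬1) (no ¬2) = ⊥-elim (contradiction E₁ x G P D (e h (A ∖ X) B) (e h X (B ∖ Y)) (e h X Y)
          (e h A B)
          splitted P≤G density lt (≰⇒> ¬1) (≰⇒> ¬2))

      step : LowerRegular A B x ⊎ Denser x (G * suc F) (P * F)
      step = choose any-sparse?
        where
        choose : Dec (∃[ X ] ∃[ Y ] Sparse X Y) → LowerRegular A B x ⊎ Denser x (G * suc F) (P * F)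
        choose (yes (X , Y , s)) = inj₂ (increment {X} {Y} s)
        choose (no none) = inj₁ (lower-regular none)

    module _ {y₀ : ℕ} (0<y₀ : 0 < y₀) (large : 3 * (n * k) ≤ y₀ * y₀) where
      -- (1 + 1/F)^(5aF) ≥ 1 + 5a by Bernoulli, so this many increments on top of 1/(ak) would
      -- exceed the density 5/k.
      rounds = 5 * a * F

      record Regular : Set where
        field
          {x}     : ℕ
          y₀≤x    : y₀ ≤ x
          pair    : Pair (E * x)
          regular : LowerRegular (Pair.A pair) (Pair.B pair) x

      0<F : 0 < F
      0<F = z<s

      impossible : ¬ (Denser y₀ (suc F ^ rounds) (F ^ rounds))
      impossible dense = <-irrefl refl (begin-strict
        G * F                  ≤⟨ cancel-* (y₀ * y₀) (*-mono-< 0<y₀ 0<y₀) bound ⟩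
        5 * a * P * F          <⟨ m<n+m (5 * a * P * F) (*-mono-< {0} {P} (m^n>0 F rounds) 0<F) ⟩
        P * F + 5 * a * P * F  ≡⟨ assoc P F a ⟩
        P * (F + 5 * a * F)    ≤⟨ bernoulli F rounds ⟩
        G * F                  ∎)
        where
        open ≤-Reasoning
        open Denser dense
        open Pair pair
        G = suc F ^ rounds
        P = F ^ rounds
        assoc : ∀ P F a → P * F + 5 * a * P * F ≡ P * (F + 5 * a * F)
        assoc = solve-∀
        bound-arith : ∀ y G F a k P N nk u v → u ≡ y → v ≡ y → y * y * G ≤ N * (a * k) * P →
          k * N ≤ 4 * (u * v) + 3 * nk → 3 * nk ≤ y * y → y * y * (G * F) ≤ y * y * (5 * a * P * F)
        bound-arith y G F a k P N nk _ _ refl refl h₁ h₂ h₃ =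
          lin 0 (F ⊗ h₁ ⊕ a * P * F ⊗ h₂ ⊕ a * P * F ⊗ h₃) (identity (y * y) G F a k P N (3 * nk))
          where
          identity : ∀ s G F a k P N u → s * (5 * a * P * F) + (F * (s * G) + a * P * F * (k * N) + a * P * F *
            u) ≡
            s * (G * F) + (F * (N * (a * k) * P) + a * P * F * (4 * s + u) + a * P * F * s) + 0
          identity = solve-∀
        bound : y₀ * y₀ * (G * F) ≤ y₀ * y₀ * (5 * a * P * F)
        bound = bound-arith y₀ G F a k P (e h A B) (n * k) (# A) (# B) #A #B density (cap A B disjoint) large

      -- An increment shrinks both sets by the factor `E`. With `t` rounds left they have
      -- `E ^ t * y₀` vertices, and `j` increments have been made.
      iterate : ∀ t j → t + j ≡ rounds → Denser (E ^ t * y₀) (suc F ^ j) (F ^ j) → Regular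
      iterate zero j refl dense = ⊥-elim (impossible (subst (λ N → Denser N _ _) (+-identityʳ y₀) dense))
      iterate (suc t) j eq dense = continue (Step.step 0<x (^-monoˡ-≤ j (n≤1+n F)) dense′)
        where
        x = E ^ t * y₀
        y₀≤x : y₀ ≤ x
        y₀≤x = m≤n*m y₀ (E ^ t) {{>-nonZero (m^n>0 E t)}}
        0<x : 0 < x
        0<x = <-≤-trans 0<y₀ y₀≤x
        dense′ : Denser (E * x) (suc F ^ j) (F ^ j)
        dense′ = subst (λ N → Denser N (suc F ^ j) (F ^ j)) (*-assoc E (E ^ t) y₀) dense
        continue : LowerRegular (Pair.A (Denser.pair dense′)) (Pair.B (Denser.pair dense′)) x ⊎
          Denser x (suc F ^ j * suc F) (F ^ j * F) → Regular
        continue (inj₁ reg)   = record { y₀≤x = y₀≤x ; pair = Denser.pair dense′ ; regular = reg }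
        continue (inj₂ dense) = iterate t (suc j) (trans (+-suc t j) eq)
          (subst₂ (Denser x) (*-comm (suc F ^ j) (suc F)) (*-comm (F ^ j) F) dense)

      -- The cut has at least n²/(ak) edges. If one side had fewer than `N₀` ≤ n/(8a) vertices,
      -- `cap` would allow at most n²/(2ak) + 3n edges, which is less because 6ak < n. So both sides
      -- can be trimmed to `N₀` to start the iteration.
      regular-pair : Irreflexive h → 4 * (n * n) ≤ a * k * sum (λ i → sum (λ j → 𝟙 (h i j))) →
        8 * a * (E ^ rounds * y₀) ≤ n → 6 * (a * k) < n → Regular
      regular-pair h-irr edges small k<n = iterate rounds 0 (+-identityʳ rounds) (record
        { pair = record
          { A = A′ ; B = B′ ; #A = #A′ ; #B = #B′
          ; disjoint = λ i mA mB → not-elim (B′⊆ i mB) (A′⊆ i mA) }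
        ; density = cancel-* (n * n) 0<nn (dense-arith (n * n) (N₀ * N₀) D (e h A B) (e h A′ B′) (# A * # B)
            nn≤ le (*-mono-≤ (#≤n A) (#≤n B))) })
        where
        N₀ = E ^ rounds * y₀
        A = proj₁ (max-cut h h-sym h-irr)
        B : VSet n
        B i = not (A i)
        0<nn : 0 < n * n
        0<nn = *-mono-< (≤-<-trans z≤n k<n) (≤-<-trans z≤n k<n)
        0<N₀ : 0 < N₀
        0<N₀ = *-mono-< (m^n>0 E rounds) 0<y₀
        dense-arith : ∀ s t D e e′ m → s ≤ D * e → t * e ≤ m * e′ → m ≤ s → s * (t * 1) ≤ s * (e′ * D * 1)
        dense-arith s t D e e′ m h₁ h₂ h₃ = lin 0 (t ⊗ h₁ ⊕ D ⊗ h₂ ⊕ e′ * D ⊗ h₃) (identity s t D e e′ m)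
          where
          identity : ∀ s t D e e′ m → s * (e′ * D * 1) + (t * s + D * (t * e) + e′ * D * m) ≡
            s * (t * 1) + (t * (D * e) + D * (m * e′) + e′ * D * s) + 0
          identity = solve-∀
        nn≤ : n * n ≤ D * e h A B
        nn≤ = cancel-* 4 z<s (≤-trans edges (≤-trans (*-monoʳ-≤ D (proj₂ (max-cut h h-sym h-irr)))
          (≤-reflexive (comm D (e h A B)))))
          where
          comm : ∀ D e → D * (4 * e) ≡ 4 * (D * e)
          comm = solve-∀
        capped : k * e h A B ≤ 4 * (# A * # B) + 3 * (n * k)
        capped = cap A B (λ i mA mB → not-elim mB mA)
        small-arith : ∀ a k n e m u N → 0 < n → n * n ≤ a * k * e → k * e ≤ 4 * m + 3 * (n * k) → m ≤ u * n →
          u ≤ N → 8 * a * N ≤ n → 6 * (a * k) < n → ⊥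
        small-arith a k n e m u N 0<n h₁ h₂ h₃ h₄ h₅ h₆ = n≮0 (lin {1} {0} 0
          (2 ⊗ h₁ ⊕ 2 * a ⊗ h₂ ⊕ 8 * a ⊗ h₃ ⊕ 8 * a * n ⊗ h₄ ⊕ n ⊗ h₅ ⊕ *-monoˡ-< n {{>-nonZero 0<n}} h₆)
          (identity a k n e m u N))
          where
          identity : ∀ a k n e m u N → 0 + (2 * (n * n) + 2 * a * (k * e) + 8 * a * m + 8 * a * n * u + n *
            (8 * a * N) + suc (6 * (a * k) * n)) ≡
            1 + (2 * (a * k * e) + 2 * a * (4 * m + 3 * (n * k)) + 8 * a * (u * n) + 8 * a * n * N + n * n + n *
              n) + 0
          identity = solve-∀
        too-small : ∀ u → # A * # B ≤ u * n → ¬ (u < N₀)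
        too-small u le u< = small-arith a k n (e h A B) (# A * # B) u N₀ (≤-<-trans z≤n k<n) nn≤ capped le
          (<⇒≤ u<) small k<n
        A≥ : N₀ ≤ # A
        A≥ = ≮⇒≥ (too-small (# A) (*-monoʳ-≤ (# A) (#≤n B)))
        B≥ : N₀ ≤ # B
        B≥ = ≮⇒≥ (too-small (# B) (≤-trans (*-monoˡ-≤ (# B) (#≤n A)) (≤-reflexive (*-comm n (# B)))))
        trimmed = trim-dense h h-sym {A} {B} 0<N₀ A≥ B≥
        A′ = proj₁ trimmed
        B′ = proj₁ (proj₂ trimmed)
        A′⊆ = proj₁ (proj₂ (proj₂ trimmed))
        B′⊆ = proj₁ (proj₂ (proj₂ (proj₂ trimmed)))
        #A′ = proj₁ (proj₂ (proj₂ (proj₂ (proj₂ trimmed))))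
        #B′ = proj₁ (proj₂ (proj₂ (proj₂ (proj₂ (proj₂ trimmed)))))
        le = proj₂ (proj₂ (proj₂ (proj₂ (proj₂ (proj₂ trimmed)))))

-- Inheritance of regularity

module Coverings where
  open import Data.Nat.Base
  open import Data.Nat.Properties
  open import Data.Fin.Properties using (any?)
  open import Data.Bool.Properties using () renaming (_≟_ to _≟B_)
  open import Data.List.Base using (List; []; _∷_; length)
  open import Data.List.Relation.Unary.All using (All; []; _∷_; all?)
  open import Relation.Nullary.Decidable using (_×-dec_; _⊎-dec_; map′)
  open VertexSets
  open BipartiteDensity

  anyList? : ∀ {n} L (P : List (Fin n) → Set) → (∀ xs → Dec (P xs)) → Dec (∃[ xs ] length xs ≤ L × P xs)
  anyList? zero P P? = map′ (λ p → [] , z≤n , p) (λ { ([] , _ , p) → p }) (P? [])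
  anyList? (suc L) P P? = map′
    (λ { (inj₁ p) → [] , z≤n , p ; (inj₂ (i , xs , le , p)) → i ∷ xs , s≤s le , p })
    (λ { ([] , _ , p) → inj₁ p ; (i ∷ xs , s≤s le , p) → inj₂ (i , xs , le , p) })
    (P? [] ⊎-dec any? (λ i → anyList? L (λ xs → P (i ∷ xs)) (λ xs → P? (i ∷ xs))))

  cov : ∀ {n} → Adjacency n → List (Fin n) → VSet n
  cov h []       y = false
  cov h (u ∷ xs) y = h u y ∨ cov h xs y

  cov⇒∈ : ∀ {n} (h : Adjacency n) (X : VSet n) xs y → All (_∈ X) xs → y ∈ cov h xs → ∃[ u ] u ∈ X × h u y ≡ true
  cov⇒∈ h X (u ∷ xs) y (u∈X ∷ xs⊆X) y∈ = choose (h u y) refl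
    where
    choose : ∀ b → h u y ≡ b → ∃[ u ] u ∈ X × h u y ≡ true
    choose true  eq = u , u∈X , eq
    choose false eq = cov⇒∈ h X xs y xs⊆X (trans (sym (cong (_∨ cov h xs y) eq)) y∈)

  #-cov : ∀ {n} (h : Adjacency n) (Q : VSet n) τ xs → All (λ u → # (Q ∩ h u) ≤ τ) xs → # (Q ∩ cov h xs) ≤ length
    xs * τ
  #-cov {n} h Q τ [] [] = ≤-reflexive (trans (#-cong {Y = λ _ → false} (λ i → ∧-false (Q i)))
    (trans (#-def _) (trans (sum-const n 0) (*-zeroʳ n))))
    where
    ∧-false : ∀ b → b ∧ false ≡ false
    ∧-false true  = refl
    ∧-false false = refl
  #-cov h Q τ (u ∷ xs) (le ∷ les) = ≤-trans (≤-reflexive (#-split (Q ∩ cov h (u ∷ xs)) (h u)))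
    (+-mono-≤
      (≤-trans (#-mono {Y = Q ∩ h u} (λ i m → ∧-intro (∧-elimˡ (∧-elimˡ m)) (∧-elimʳ {_} {h u i} m))) le)
      (≤-trans (#-mono {Y = Q ∩ cov h xs} (λ i → rest (Q i) (h u i) (cov h xs i))) (#-cov h Q τ xs les)))
    where
    rest : ∀ q b c → (q ∧ (b ∨ c)) ∧ not b ≡ true → q ∧ c ≡ true
    rest true false c m = ∧-elimˡ m

  -- The pseudorandomness of the host graph, as inherited by its subgraph h: a small
  -- uncovered part of B meets few edges at the vertices v ∈ Z, even though it may
  -- depend on v through a list X v of at most L vertices of S.
  Expansion : ∀ {n} → Adjacency n → (k ℓ L g : ℕ) → Set
  Expansion {n} h k ℓ L g = ∀ (S B Z : VSet n) → Disjoint S B → Disjoint S Z → Disjoint B Z →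
    (X : Fin n → List (Fin n)) → (∀ v → length (X v) ≤ L) → (∀ v → All (_∈ S) (X v)) →
    g * k * ∑ Z (λ v → # ((B ∖ cov h (X v)) ∩ h v)) ≤
    2 * (2 ^ g * ∑ Z (λ v → # (B ∖ cov h (X v))) + # S * # B) + k * (2 * n + ℓ * (L * n) + ℓ)

  -- As long as `u` vertices are uncovered, the next vertex of the list covers at least q/Q of them.
  -- The second alternative records the accumulated progress without division.
  greedy : ∀ {n} (h : Adjacency n) (X B : VSet n) u q Q →
    (∀ U → U ⊆ B → u ≤ # U → ∃[ i ] i ∈ X × q ≤ Q * # (U ∩ h i)) →
    ∀ t → ∃[ xs ] length xs ≤ t × All (_∈ X) xs ×
      (# (B ∖ cov h xs) < u ⊎ q * t + Q * # (B ∖ cov h xs) ≤ Q * # B)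
  greedy h X B u q Q next zero = [] , z≤n , [] , inj₂
    (≤-trans (≤-reflexive (cong (_+ Q * # (B ∖ cov h [])) (*-zeroʳ q)))
    (*-monoʳ-≤ Q (#-mono (∖-⊆ B (cov h [])))))
  greedy {n} h X B u q Q next (suc t) = continue (greedy h X B u q Q next t)
    where
    Goal = ∃[ xs ] length xs ≤ suc t × All (_∈ X) xs ×
      (# (B ∖ cov h xs) < u ⊎ q * suc t + Q * # (B ∖ cov h xs) ≤ Q * # B)
    arith : ∀ q t Q b c d e → d ≡ c + e → q * t + Q * d ≤ b → q ≤ Q * c → q * suc t + Q * e ≤ b
    arith q t Q b c _ e refl h₁ h₂ = lin 0 (h₁ ⊕ h₂) (identity q t Q b c e)
      where
      identity : ∀ q t Q b c e → b + (q * t + Q * (c + e) + q) ≡ q * suc t + Q * e + (b + Q * c) + 0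
      identity = solve-∀
    continue : (∃[ xs ] length xs ≤ t × All (_∈ X) xs ×
      (# (B ∖ cov h xs) < u ⊎ q * t + Q * # (B ∖ cov h xs) ≤ Q * # B)) → Goal
    continue (xs , len , xs⊆ , inj₁ lt) = xs , m≤n⇒m≤1+n len , xs⊆ , inj₁ lt
    continue (xs , len , xs⊆ , inj₂ le) = split (# (B ∖ cov h xs) <? u)
      where
      U = B ∖ cov h xs
      split : Dec (# U < u) → Goal
      split (yes lt) = xs , m≤n⇒m≤1+n len , xs⊆ , inj₁ lt
      split (no ¬lt) = let i , i∈X , q≤ = next U (∖-⊆ B (cov h xs)) (≮⇒≥ ¬lt) in
        i ∷ xs , s≤s len , i∈X ∷ xs⊆ ,
        inj₂ (arith q t Q (Q * # B) (# (U ∩ h i)) (# U) (# (B ∖ cov h (i ∷ xs)))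
          (trans (#-split U (h i)) (cong (# (U ∩ h i) +_) (#-cong (λ y → bool (B y) (h i y) (cov h xs y))))) le
            q≤)
        where
        bool : ∀ b c d → (b ∧ not d) ∧ not c ≡ b ∧ not (c ∨ d)
        bool true  true  true  = refl
        bool true  true  false = refl
        bool true  false true  = refl
        bool true  false false = refl
        bool false _     _     = refl

  cover : ∀ {n} (h : Adjacency n) (X B : VSet n) u q Q → 0 < Q →
    (∀ U → U ⊆ B → u ≤ # U → ∃[ i ] i ∈ X × q ≤ Q * # (U ∩ h i)) →
    ∀ t → Q * # B ≤ q * t → ∃[ xs ] length xs ≤ t × All (_∈ X) xs × # (B ∖ cov h xs) ≤ u
  cover h X B u q Q 0<Q next t enough = finish (greedy h X B u q Q next t)
    where
    finish : (∃[ xs ] length xs ≤ t × All (_∈ X) xs ×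
      (# (B ∖ cov h xs) < u ⊎ q * t + Q * # (B ∖ cov h xs) ≤ Q * # B)) →
      ∃[ xs ] length xs ≤ t × All (_∈ X) xs × # (B ∖ cov h xs) ≤ u
    finish (xs , len , xs⊆ , inj₁ lt) = xs , len , xs⊆ , <⇒≤ lt
    -- The progress `q * t` already accounts for all of `B`, so nothing is uncovered.
    finish (xs , len , xs⊆ , inj₂ le) = xs , len , xs⊆ , ≤-trans
      (cancel-* Q 0<Q (≤-trans (+-cancelˡ-≤ (q * t) _ _
        (≤-trans le (≤-trans enough (≤-reflexive (sym (+-identityʳ _))))))
        (≤-reflexive (sym (*-zeroʳ Q))))) z≤n

  module Goodness {n : ℕ} (h : Adjacency n) (h-sym : Symmetric h) (D E′ x r τ L : ℕ)
    (0<D : 0 < D) (0<x : 0 < x) (0<r : 0 < r)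
    (L₁≤L : 2 * D * E′ ≤ L) (τ≤ : 2 * D * E′ * τ ≤ r) (τ≥ : 2 * r * E′ ≤ τ * L) where

    m = E′ * x

    -- About 2x/k neighbours of `v` are expected in the uncovered part, and `r` will be far larger.
    -- Badness refers to all short lists because the list used against a good vertex is found only
    -- later and depends on the candidate sets.
    Witness : (S B : VSet n) → Fin n → List (Fin n) → Set
    Witness S B v xs = All (_∈ S) xs × # (B ∖ cov h xs) ≤ 2 * x × r ≤ # ((B ∖ cov h xs) ∩ h v)

    Bad : (S B : VSet n) → Fin n → Set
    Bad S B v = ∃[ xs ] length xs ≤ L × Witness S B v xs

    bad? : ∀ S B v → Dec (Bad S B v)
    bad? S B v = anyList? L (Witness S B v) (λ xs → all? (λ i → S i ≟B true) xs ×-dec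
      (# (B ∖ cov h xs) ≤? 2 * x ×-dec r ≤? # ((B ∖ cov h xs) ∩ h v)))

    BadSet : (T S B : VSet n) → VSet n
    BadSet T S B v = T v ∧ does (bad? S B v)

    -- With z bad vertices, `Expansion` gives (g + 1)krz ≤ 2^(g+1) 4xz + 2m² + error. The first term
    -- on the right is at most krz and cancels one of the g + 1 shares; the error is at most m². So
    -- gkrz ≤ 3m², and m ≤ 128akr gives z ≤ 384am/g < m/2.
    few-bad : ∀ k ℓ a g → Expansion h k ℓ L (suc g) → ∀ T S B → Disjoint S B → Disjoint S T → Disjoint B T →
      # S ≡ m → # B ≡ m → 0 < m → 768 * a < g → 2 ^ suc g * (4 * x) ≤ k * r →
      k * (2 * n + ℓ * (L * n) + ℓ) ≤ m * m → m ≤ 128 * a * (k * r) → 2 * # (BadSet T S B) ≤ m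
    few-bad k ℓ a g expansion T S B S#B S#T B#T #S #B 0<m a<g x≤ error≤ m≤ = ≮⇒≥ λ m<2z →
      arith a g (k * r) (# Z) m (2 ^ suc g) x (k * (2 * n + ℓ * (L * n) + ℓ)) 0<m main x≤ error≤ m≤ a<g
        (<⇒≤ m<2z)
      where
      Z = BadSet T S B
      -- Each bad vertex brings its own witness. `Expansion` wants a list at every vertex, and
      -- elsewhere the empty list serves.
      list : ∀ {v} → Dec (Bad S B v) → List (Fin n)
      list (yes (xs , _)) = xs
      list (no _) = []
      list-length : ∀ {v} (d : Dec (Bad S B v)) → length (list d) ≤ L
      list-length (yes (_ , len , _)) = len
      list-length (no _) = z≤n
      list-⊆ : ∀ {v} (d : Dec (Bad S B v)) → All (_∈ S) (list d)
      list-⊆ (yes (_ , _ , xs⊆ , _)) = xs⊆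
      list-⊆ (no _) = []
      list-small : ∀ {v} (d : Dec (Bad S B v)) → does d ≡ true → # (B ∖ cov h (list d)) ≤ 2 * x
      list-small (yes (_ , _ , _ , le , _)) _ = le
      list-large : ∀ {v} (d : Dec (Bad S B v)) → does d ≡ true → r ≤ # ((B ∖ cov h (list d)) ∩ h v)
      list-large (yes (_ , _ , _ , _ , le)) _ = le
      X : Fin n → List (Fin n)
      X v = list (bad? S B v)
      Z⊆T : ∀ i → i ∈ Z → i ∈ T
      Z⊆T i mem = ∧-elimˡ mem
      main : suc g * (k * r) * # Z ≤ 2 * (2 ^ suc g * (# Z * (2 * x)) + m * m) + k * (2 * n + ℓ * (L * n) + ℓ)
      main = begin
        suc g * (k * r) * # Z   ≡⟨ assoc (suc g) k r (# Z) ⟩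
        suc g * k * (# Z * r)   ≡⟨ cong (suc g * k *_) (sym (∑-const Z r)) ⟩
        suc g * k * ∑ Z (λ _ → r)   ≤⟨ *-monoʳ-≤ (suc g * k) (∑-mono {X = Z} (λ v mem → list-large (bad? S B v)
          (∧-elimʳ {T v} mem))) ⟩
        suc g * k * ∑ Z (λ v → # ((B ∖ cov h (X v)) ∩ h v))
          ≤⟨ expansion S B Z S#B (λ i s z → S#T i s (Z⊆T i z)) (λ i b z → B#T i b (Z⊆T i z)) X
               (λ v → list-length (bad? S B v)) (λ v → list-⊆ (bad? S B v)) ⟩
        2 * (2 ^ suc g * ∑ Z (λ v → # (B ∖ cov h (X v))) + # S * # B) + k * (2 * n + ℓ * (L * n) + ℓ)
          ≤⟨ +-monoˡ-≤ _ (*-monoʳ-≤ 2 (+-mono-≤ (*-monoʳ-≤ (2 ^ suc g)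
               (∑-mono {X = Z} (λ v mem → list-small (bad? S B v) (∧-elimʳ {T v} mem))))
                 (≤-reflexive (cong₂ _*_ #S #B)))) ⟩
        2 * (2 ^ suc g * ∑ Z (λ _ → 2 * x) + m * m) + k * (2 * n + ℓ * (L * n) + ℓ)
          ≡⟨ cong (λ t → 2 * (2 ^ suc g * t + m * m) + k * (2 * n + ℓ * (L * n) + ℓ)) (∑-const Z (2 * x)) ⟩
        2 * (2 ^ suc g * (# Z * (2 * x)) + m * m) + k * (2 * n + ℓ * (L * n) + ℓ)  ∎
        where
        open ≤-Reasoning
        assoc : ∀ g k r z → g * (k * r) * z ≡ g * k * (z * r)
        assoc = solve-∀
      arith : ∀ a g R z m P x w → 0 < m → suc g * R * z ≤ 2 * (P * (z * (2 * x)) + m * m) + w →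
        P * (4 * x) ≤ R → w ≤ m * m → m ≤ 128 * a * R → 768 * a < g → m ≤ 2 * z → ⊥
      arith a g R z m P x w 0<m h₁ h₂ h₃ h₄ h₅ h₆ = <-irrefl refl (begin-strict
        768 * a * (m * m)        <⟨ *-monoˡ-< (m * m) {{>-nonZero (*-mono-< 0<m 0<m)}} h₅ ⟩
        g * (m * m)              ≤⟨ lin 0 (256 * a ⊗ h₁ ⊕ 256 * a * z ⊗ h₂ ⊕ 256 * a ⊗ h₃ ⊕ 2 * g * z ⊗ h₄ ⊕ g *
          m ⊗ h₆)
                                      (identity a g R z m P x w) ⟩
        768 * a * (m * m)        ∎)
        where
        open ≤-Reasoning
        identity : ∀ a g R z m P x w →
          768 * a * (m * m) + (256 * a * (suc g * R * z) + 256 * a * z * (P * (4 * x)) + 256 * a * w + 2 * g * z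
            * m + g * m * m) ≡
          g * (m * m) + (256 * a * (2 * (P * (z * (2 * x)) + m * m) + w) + 256 * a * z * R + 256 * a * (m * m)
            + 2 * g * z * (128 * a * R) + g * m * (2 * z)) + 0
        identity = solve-∀

    module _ (S B : VSet n)
      (regular : ∀ X Y → X ⊆ S → Y ⊆ B → x ≤ # X → x ≤ # Y → # X * # Y ≤ 2 * D * e h X Y) (#B : # B ≡ m) where

      -- Suppose that at least `x` vertices of `S` have fewer than `τ` neighbours in `Q`. By
      -- lower-regularity, `2 * D * E′` of them already cover `B` up to `x`. But together they cover
      -- at most `2 * D * E′ * τ` ≤ `r` vertices of `Q`, so `r` neighbours of `v` remain uncovered
      -- and `v` is bad.
      one-sided : ∀ v → ¬ Bad S B v → ∀ Q → Q ⊆ B → Q ⊆ h v → 2 * r ≤ # Q →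
        # (S ∩ (λ y → does (# (Q ∩ h y) <? τ))) < x
      one-sided v good Q Q⊆B Q⊆v 2r≤Q = ≰⇒> λ x≤F →
        let xs , len , xs⊆ , small = cover h F B x x (2 * D) (*-mono-< {0} {2} z<s 0<D) (next x≤F) (2 * D * E′)
              (≤-reflexive (trans (cong (2 * D *_) #B) (assoc (2 * D) E′ x)))
        in good (xs , ≤-trans len L₁≤L , all∈ xs xs⊆ , ≤-trans small (m≤n*m x 2) , large xs len xs⊆)
        where
        F = S ∩ (λ y → does (# (Q ∩ h y) <? τ))
        assoc : ∀ d e x → d * (e * x) ≡ x * (d * e)
        assoc = solve-∀
        next : x ≤ # F → ∀ U → U ⊆ B → x ≤ # U → ∃[ i ] i ∈ F × x ≤ 2 * D * # (U ∩ h i)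
        next x≤F U U⊆B x≤U =
          let i , i∈F , le = average F (λ i → 2 * D * # (U ∩ h i)) (# U) (<-≤-trans 0<x x≤F)
                (≤-trans (≤-reflexive (*-comm (# U) (# F))) (≤-trans
                  (regular F U (λ j mem → ∧-elimˡ mem) U⊆B x≤F x≤U) (≤-reflexive (sym (∑-* F (2 * D) _)))))
          in i , i∈F , ≤-trans x≤U le
        all∈ : ∀ xs → All (_∈ F) xs → All (_∈ S) xs
        all∈ [] [] = []
        all∈ (_ ∷ xs) (mem ∷ mems) = ∧-elimˡ mem ∷ all∈ xs mems
        all-few : ∀ xs → All (_∈ F) xs → All (λ u → # (Q ∩ h u) ≤ τ) xs
        all-few [] [] = []
        all-few (u ∷ xs) (mem ∷ mems) = <⇒≤ (does-true {P? = # (Q ∩ h u) <? τ} (∧-elimʳ {S u} mem)) ∷ all-few xs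
          mems
        large : ∀ xs → length xs ≤ 2 * D * E′ → All (_∈ F) xs → r ≤ # ((B ∖ cov h xs) ∩ h v)
        large xs len xs⊆ = arith (# (Q ∩ cov h xs)) (# (Q ∖ cov h xs)) r
          (≤-trans 2r≤Q (≤-reflexive (#-split Q (cov h xs))))
          (≤-trans (#-cov h Q τ xs (all-few xs xs⊆)) (≤-trans (*-monoˡ-≤ τ len) τ≤))
          (#-mono (λ i mem → ∧-intro (∧-intro (Q⊆B i (∧-elimˡ mem)) (∧-elimʳ {Q i} mem)) (Q⊆v i (∧-elimˡ mem))))
          where
          arith : ∀ a b r {c} → 2 * r ≤ a + b → a ≤ r → b ≤ c → r ≤ c
          arith a b r {c} h₁ h₂ h₃ = lin 0 (h₁ ⊕ h₂ ⊕ h₃) (identity a b r c)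
            where
            identity : ∀ a b r c → c + (2 * r + a + b) ≡ r + (a + b + r + c) + 0
            identity = solve-∀

    -- Inheritance of lower-regularity by neighbourhoods: X and Q are smaller by a factor
    -- of about k than the sets to which `regular` applies.
    edge-between : ∀ S B →
      (∀ X Y → X ⊆ S → Y ⊆ B → x ≤ # X → x ≤ # Y → # X * # Y ≤ 2 * D * e h X Y) → # S ≡ m → # B ≡ m →
      ∀ v v′ → ¬ Bad S B v → ¬ Bad B S v′ → ∀ X Q → X ⊆ S → X ⊆ h v′ → Q ⊆ B → Q ⊆ h v →
      2 * r ≤ # X → 2 * r ≤ # Q → ∃[ u ] ∃[ y ] u ∈ X × y ∈ Q × h u y ≡ true
    edge-between S B regular #S #B v v′ good good′ X Q X⊆S X⊆v′ Q⊆B Q⊆v 2r≤X 2r≤Q =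
      let y , y∈ = ∈-any (Q ∩ cov h xs) covered
          u , u∈X₀ , huy = cov⇒∈ h X₀ xs y xs⊆ (∧-elimʳ {Q y} y∈)
      in u , y , X₀⊆ u u∈X₀ , ∧-elimˡ y∈ , huy
      where
      -- Size exactly 2r, so that averages over `X₀` have a known denominator.
      X₀ = proj₁ (subset-of-size X (2 * r) 2r≤X)
      X₀⊆ = proj₁ (proj₂ (subset-of-size X (2 * r) 2r≤X))
      #X₀ : # X₀ ≡ 2 * r
      #X₀ = proj₂ (proj₂ (subset-of-size X (2 * r) 2r≤X))
      few : VSet n
      few y = does (# (X₀ ∩ h y) <? τ)
      few< : # (B ∩ few) < x
      few< = one-sided B S (λ X Y X⊆ Y⊆ x≤X x≤Y → subst₂ _≤_ (*-comm (# Y) (# X))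
        (cong (2 * D *_) (e-sym h h-sym Y X))
        (regular Y X Y⊆ X⊆ x≤Y x≤X)) #S v′ good′ X₀ (λ i mem → X⊆S i (X₀⊆ i mem)) (λ i mem → X⊆v′ i (X₀⊆ i mem))
        (≤-reflexive (sym #X₀))
      0<2r : 0 < 2 * r
      0<2r = *-mono-< {0} {2} z<s 0<r
      -- By `one-sided`, applied to `v′` with the sides exchanged, fewer than `x` vertices of `B`
      -- have under `τ` neighbours in `X₀`. Hence at least `x` vertices of `U` have `τ` of them, and
      -- some vertex of `X₀` sees an average share. This is why the list may leave 2x vertices
      -- uncovered.
      next : ∀ U → U ⊆ B → 2 * x ≤ # U → ∃[ i ] i ∈ X₀ × τ * x ≤ 2 * r * # (U ∩ h i)
      next U U⊆B 2x≤U = average X₀ (λ i → 2 * r * # (U ∩ h i)) (τ * x) (subst (0 <_) (sym #X₀) 0<2r) (begin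
        τ * x * # X₀               ≡⟨ trans (cong (τ * x *_) #X₀) (*-comm (τ * x) (2 * r)) ⟩
        2 * r * (τ * x)            ≤⟨ *-monoʳ-≤ (2 * r) (*-monoʳ-≤ τ (rich 2x≤U)) ⟩
        2 * r * (τ * # (U ∖ few))  ≡⟨ cong (2 * r *_) (trans (*-comm τ _) (sym (∑-const (U ∖ few) τ))) ⟩
        2 * r * ∑ (U ∖ few) (λ _ → τ)
          ≤⟨ *-monoʳ-≤ (2 * r) (∑-mono {X = U ∖ few} (λ i mem → ≮⇒≥ (λ lt → not-elim {few i} (∧-elimʳ {U i} mem)
            (true-does (# (X₀ ∩ h i) <? τ) lt)))) ⟩
        2 * r * e h (U ∖ few) X₀   ≤⟨ *-monoʳ-≤ (2 * r) (e-mono h (∖-⊆ U few) (λ _ mem → mem)) ⟩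
        2 * r * e h U X₀           ≡⟨ cong (2 * r *_) (e-sym h h-sym U X₀) ⟩
        2 * r * e h X₀ U           ≡⟨ ∑-* X₀ (2 * r) _ ⟨
        ∑ X₀ (λ i → 2 * r * # (U ∩ h i))  ∎)
        where
        open ≤-Reasoning
        rich : 2 * x ≤ # U → x ≤ # (U ∖ few)
        rich 2x≤U = arith x (# (U ∩ few)) (# (U ∖ few)) (≤-trans 2x≤U (≤-reflexive (#-split U few)))
          (≤-trans (#-mono (λ i mem → ∧-intro (U⊆B i (∧-elimˡ mem)) (∧-elimʳ {U i} mem))) (<⇒≤ few<))
          where
          arith : ∀ x a b → 2 * x ≤ a + b → a ≤ x → x ≤ b
          arith x a b h₁ h₂ = lin 0 (h₁ ⊕ h₂) (identity x a b)
            where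
            identity : ∀ x a b → b + (2 * x + a) ≡ x + (a + b + x) + 0
            identity = solve-∀
      covering : ∃[ xs ] length xs ≤ L × All (_∈ X₀) xs × # (B ∖ cov h xs) ≤ 2 * x
      covering = cover h X₀ B (2 * x) (τ * x) (2 * r) 0<2r next L (begin
        2 * r * # B       ≡⟨ trans (cong (2 * r *_) #B) (sym (*-assoc (2 * r) E′ x)) ⟩
        2 * r * E′ * x    ≤⟨ *-monoˡ-≤ x τ≥ ⟩
        τ * L * x         ≡⟨ comm τ L x ⟩
        τ * x * L         ∎)
        where
        open ≤-Reasoning
        comm : ∀ a b c → a * b * c ≡ a * c * b
        comm = solve-∀
      xs = proj₁ covering
      xs⊆ = proj₁ (proj₂ (proj₂ covering))
      all∈ : ∀ xs → All (_∈ X₀) xs → All (_∈ S) xs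
      all∈ [] [] = []
      all∈ (u ∷ xs) (mem ∷ mems) = X⊆S u (X₀⊆ u mem) ∷ all∈ xs mems
      uncovered< : # ((B ∖ cov h xs) ∩ h v) < r
      uncovered< = ≰⇒> λ r≤ → good (xs , proj₁ (proj₂ covering) , all∈ xs xs⊆ , proj₂ (proj₂ (proj₂ covering)) ,
        r≤)
      covered : 0 < # (Q ∩ cov h xs)
      covered = arith (# (Q ∩ cov h xs)) (# (Q ∖ cov h xs)) r
        (≤-trans 2r≤Q (≤-reflexive (#-split Q (cov h xs))))
        (≤-<-trans (#-mono (λ i mem → ∧-intro (∧-intro (Q⊆B i (∧-elimˡ mem)) (∧-elimʳ {Q i} mem))
          (Q⊆v i (∧-elimˡ mem)))) uncovered<)
        where
        arith : ∀ a b r → 2 * r ≤ a + b → b < r → 0 < a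
        arith a b r h₁ h₂ = lin r (h₁ ⊕ h₂) (identity a b r)
          where
          identity : ∀ a b r → a + (2 * r + suc b) ≡ 1 + (a + b + r) + r
          identity = solve-∀

-- Embedding the grid row by row

module RowByRow where
  open import Data.Nat.Base
  open import Data.Nat.Properties
  open import Data.Fin.Properties using (any?) renaming (_≟_ to _≟F_)
  open import Data.Bool.Properties using () renaming (_≟_ to _≟B_)
  open import Relation.Nullary.Decidable using (_×-dec_; ¬?)
  open VertexSets
  open BipartiteDensity

  module _ {n : ℕ} (h : Adjacency n) (h-sym : Symmetric h) where
    e>0⇒#>0 : ∀ X Y → 0 < e h X Y → 0 < # X
    e>0⇒#>0 X Y 0<e = ≰⇒> λ X≤0 → <-irrefl refl (<-≤-trans 0<e
      (≤-trans (m≤m+n _ _) (≤-trans (≤-reflexive (e-complement h X Y)) (*-monoˡ-≤ (# Y) X≤0))))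

    -- Vertices of low degree are deleted until none is left.
    core : ∀ c X Y → c * (# X + # Y) ≤ e h X Y → 0 < e h X Y →
      ∃[ X′ ] ∃[ Y′ ] X′ ⊆ X × Y′ ⊆ Y × 0 < # X′ × 0 < # Y′ ×
        (∀ v → v ∈ X′ → c ≤ # (Y′ ∩ h v)) × (∀ v → v ∈ Y′ → c ≤ # (X′ ∩ h v))
    core c X Y = go (# X + # Y) X Y ≤-refl
      where
      Result : VSet n → VSet n → Set
      Result X Y = ∃[ X′ ] ∃[ Y′ ] X′ ⊆ X × Y′ ⊆ Y × 0 < # X′ × 0 < # Y′ ×
        (∀ v → v ∈ X′ → c ≤ # (Y′ ∩ h v)) × (∀ v → v ∈ Y′ → c ≤ # (X′ ∩ h v))
      Low : VSet n → VSet n → Fin n → Set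
      Low X Y v = v ∈ X × # (Y ∩ h v) < c
      low? : ∀ X Y v → Dec (Low X Y v)
      low? X Y v = X v ≟B true ×-dec (# (Y ∩ h v) <? c)
      weaken : ∀ {X₁ X Y₁ Y} → X₁ ⊆ X → Y₁ ⊆ Y → Result X₁ Y₁ → Result X Y
      weaken hX hY (X′ , Y′ , X′⊆ , Y′⊆ , rest) = X′ , Y′ , (λ i m → hX i (X′⊆ i m)) , (λ i m → hY i (Y′⊆ i m))
        , rest
      -- A deleted vertex takes fewer than `c` edges with it, so the inequality becomes strict. This
      -- also keeps the number of edges positive, so the process cannot end with empty sets.
      arith : ∀ c a b d E E₁ → E ≡ d + E₁ → d < c → c * (suc a + b) ≤ E → c * (a + b) < E₁
      arith c a b d _ E₁ refl h₁ h₂ = lin 0 (h₁ ⊕ h₂) (identity c a b d E₁)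
        where
        identity : ∀ c a b d E₁ → E₁ + (suc d + c * (suc a + b)) ≡ suc (c * (a + b)) + (c + (d + E₁)) + 0
        identity = solve-∀
      e-remove : ∀ X Y v → v ∈ X → e h X Y ≡ # (Y ∩ h v) + e h (X ∖ ⁅ v ⁆) Y
      e-remove X Y v = ∑-remove (λ i → # (Y ∩ h i))
      go : ∀ t X Y → # X + # Y ≤ t → c * (# X + # Y) ≤ e h X Y → 0 < e h X Y → Result X Y
      choose : ∀ t X Y → # X + # Y ≤ t → c * (# X + # Y) ≤ e h X Y → 0 < e h X Y →
        Dec (∃[ v ] Low X Y v) → Dec (∃[ v ] Low Y X v) → Result X Y
      go t X Y size many pos = choose t X Y size many pos (any? (low? X Y)) (any? (low? Y X))
      choose t X Y size many pos (no ¬lowX) (no ¬lowY) = X , Y , (λ _ m → m) , (λ _ m → m) ,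
        e>0⇒#>0 X Y pos , e>0⇒#>0 Y X (subst (0 <_) (e-sym h h-sym X Y) pos) ,
        (λ v v∈ → ≮⇒≥ λ lt → ¬lowX (v , v∈ , lt)) , (λ v v∈ → ≮⇒≥ λ lt → ¬lowY (v , v∈ , lt))
      choose zero X Y size many pos (yes (v , v∈ , lt)) _ =
        ⊥-elim (n≮0 (<-≤-trans (e>0⇒#>0 X Y pos) (≤-trans (m≤m+n (# X) (# Y)) size)))
      choose zero X Y size many pos (no _) (yes (v , v∈ , lt)) =
        ⊥-elim (n≮0 (<-≤-trans (e>0⇒#>0 X Y pos) (≤-trans (m≤m+n (# X) (# Y)) size)))
      choose (suc t) X Y size many pos (yes (v , v∈ , lt)) _ =
        weaken {X₁ = X ∖ ⁅ v ⁆} {Y₁ = Y} (∖-⊆ X ⁅ v ⁆) (λ _ m → m) (go t (X ∖ ⁅ v ⁆) Y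
          (≤-pred (subst (λ s → s + # Y ≤ suc t) (#-remove {X = X} v∈) size)) (<⇒≤ more) (≤-<-trans z≤n more))
        where
        more = arith c (# (X ∖ ⁅ v ⁆)) (# Y) (# (Y ∩ h v)) (e h X Y) (e h (X ∖ ⁅ v ⁆) Y) (e-remove X Y v v∈) lt
          (subst (λ s → c * (s + # Y) ≤ e h X Y) (#-remove {X = X} v∈) many)
      choose (suc t) X Y size many pos (no _) (yes (v , v∈ , lt)) =
        weaken {X₁ = X} {Y₁ = Y ∖ ⁅ v ⁆} (λ _ m → m) (∖-⊆ Y ⁅ v ⁆) (go t X (Y ∖ ⁅ v ⁆)
          (≤-pred (≤-trans (≤-reflexive (sym (+-suc (# X) _))) (subst (λ s → # X + s ≤ suc t)
            (#-remove {X = Y} v∈) size)))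
          (<⇒≤ more) (≤-<-trans z≤n more))
        where
        more : c * (# X + # (Y ∖ ⁅ v ⁆)) < e h X (Y ∖ ⁅ v ⁆)
        more = subst₂ _<_ (cong (c *_) (+-comm (# (Y ∖ ⁅ v ⁆)) (# X))) (e-sym h h-sym (Y ∖ ⁅ v ⁆) X)
          (arith c (# (Y ∖ ⁅ v ⁆)) (# X) (# (X ∩ h v)) (e h Y X) (e h (Y ∖ ⁅ v ⁆) X) (e-remove Y X v v∈) lt
            (subst₂ _≤_ (cong (c *_) (trans (+-comm (# X) (# Y)) (cong (_+ # X) (#-remove {X = Y} v∈))))
              (e-sym h h-sym X Y) many))

    -- Backwards dynamic programming: R is the set of starting points of paths.
    path : ∀ r s (C : Fin (suc s) → VSet n) → (∀ j → 4 * r ≤ # (C j)) →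
      (∀ j j′ → toℕ j′ ≡ suc (toℕ j) → ∀ X Y → X ⊆ C j → Y ⊆ C j′ → 2 * r ≤ # X → 2 * r ≤ # Y →
        ∃[ u ] ∃[ w ] u ∈ X × w ∈ Y × h u w ≡ true) →
      ∃[ R ] R ⊆ C zero × 2 * r ≤ # R × (∀ u → u ∈ R → Σ[ w ∈ (Fin (suc s) → Fin n) ] w zero ≡ u ×
        (∀ j → w j ∈ C j) ×
        (∀ j j′ → toℕ j′ ≡ suc (toℕ j) → h (w j) (w j′) ≡ true))
    path r zero C large _ = C zero , (λ _ m → m) , ≤-trans (*-monoˡ-≤ r {2} {4} (s≤s (s≤s z≤n))) (large zero) ,
      λ u u∈ → (λ _ → u) , refl , (λ { zero → u∈ }) , λ { zero zero () }
    path r (suc s) C large link = R , (λ _ → ∧-elimˡ) , #R , build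
      where
      tail = path r s (λ j → C (suc j)) (λ j → large (suc j)) (λ j j′ eq → link (suc j) (suc j′) (cong suc eq))
      R₁ = proj₁ tail
      next? : ∀ u → Dec (∃[ w ] w ∈ R₁ × h u w ≡ true)
      next? u = any? λ w → R₁ w ≟B true ×-dec h u w ≟B true
      N : VSet n
      N u = does (next? u)
      R = C zero ∩ N
      -- The vertices without a successor in `R₁` have no edge to `R₁`, and `R₁` has at least 2r
      -- vertices; `link` therefore limits their number.
      stuck< : # (C zero ∖ N) < 2 * r
      stuck< = ≰⇒> λ le →
        let u , w , u∈ , w∈ , huw = link zero (suc zero) refl (C zero ∖ N) R₁ (∖-⊆ (C zero) N)
              (proj₁ (proj₂ tail)) le
                                      (proj₁ (proj₂ (proj₂ tail)))
        in not-elim {N u} (∧-elimʳ {C zero u} u∈) (true-does (next? u) (w , w∈ , huw))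
      #R : 2 * r ≤ # R
      #R = arith r (# R) (# (C zero ∖ N)) (≤-trans (large zero) (≤-reflexive (#-split (C zero) N))) (<⇒≤ stuck<)
        where
        arith : ∀ r a b → 4 * r ≤ a + b → b ≤ 2 * r → 2 * r ≤ a
        arith r a b h₁ h₂ = lin 0 (h₁ ⊕ h₂) (identity r a b)
          where
          identity : ∀ r a b → a + (4 * r + b) ≡ 2 * r + (a + b + 2 * r) + 0
          identity = solve-∀
      build : ∀ u → u ∈ R → Σ[ w ∈ (Fin (suc (suc s)) → Fin n) ] w zero ≡ u × (∀ j → w j ∈ C j) ×
        (∀ j j′ → toℕ j′ ≡ suc (toℕ j) → h (w j) (w j′) ≡ true)
      build u u∈ = w′ , refl , (λ { zero → ∧-elimˡ u∈ ; (suc j) → in-C j }) , adjacent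
        where
        step = does-true {P? = next? u} (∧-elimʳ {C zero u} u∈)
        rest = proj₂ (proj₂ (proj₂ tail)) (proj₁ step) (proj₁ (proj₂ step))
        w = proj₁ rest
        in-C = proj₁ (proj₂ (proj₂ rest))
        w′ : Fin (suc (suc s)) → Fin n
        w′ zero    = u
        w′ (suc j) = w j
        adjacent : ∀ j j′ → toℕ j′ ≡ suc (toℕ j) → h (w′ j) (w′ j′) ≡ true
        adjacent zero (suc zero) refl = trans (cong (h u) (proj₁ (proj₂ rest))) (proj₂ (proj₂ step))
        adjacent (suc j) (suc j′) eq = proj₂ (proj₂ (proj₂ rest)) j j′ (suc-injective eq)

  enumerate : ∀ {n} s (X : VSet n) → s ≤ # X →
    Σ[ φ ∈ (Fin s → Fin n) ] (∀ j → φ j ∈ X) × (∀ i j → φ i ≡ φ j → i ≡ j)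
  enumerate zero X _ = (λ ()) , (λ ()) , λ ()
  enumerate {n} (suc s) X s<X = φ , φ∈ , inj
    where
    first = ∈-any X (≤-<-trans z≤n s<X)
    v = proj₁ first
    rest = enumerate s (X ∖ ⁅ v ⁆) (≤-pred (subst (suc s ≤_) (#-remove {X = X} (proj₂ first)) s<X))
    φ : Fin (suc s) → Fin n
    φ zero    = v
    φ (suc j) = proj₁ rest j
    φ∈ : ∀ j → φ j ∈ X
    φ∈ zero    = proj₂ first
    φ∈ (suc j) = ∖-⊆ X ⁅ v ⁆ (proj₁ rest j) (proj₁ (proj₂ rest) j)
    fresh : ∀ j → ¬ (v ≡ proj₁ rest j)
    fresh j eq = not-elim {⁅ v ⁆ (proj₁ rest j)} (∧-elimʳ {X (proj₁ rest j)} (proj₁ (proj₂ rest) j))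
      (true-does (v ≟F _) eq)
    inj : ∀ i j → φ i ≡ φ j → i ≡ j
    inj zero    zero    _  = refl
    inj zero    (suc j) eq = ⊥-elim (fresh j eq)
    inj (suc i) zero    eq = ⊥-elim (fresh i (sym eq))
    inj (suc i) (suc j) eq = cong suc (proj₂ (proj₂ rest) i j eq)

  #-any : ∀ {n s} (X : VSet n) {P : Fin n → Fin s → Set} (P? : ∀ w i → Dec (P w i)) →
    # (X ∩ (λ w → does (any? (P? w)))) ≤ sum (λ i → # (X ∩ (λ w → does (P? w i))))
  #-any {n} {s} X {P} P? = begin
    # (X ∩ (λ w → does (any? (P? w))))                ≡⟨ #-def _ ⟩
    sum (λ w → 𝟙 (X w ∧ does (any? (P? w))))          ≤⟨ sum-mono (λ w → term w (any? (P? w))) ⟩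
    sum (λ w → sum (λ i → 𝟙 (X w ∧ does (P? w i))))   ≡⟨ sum-swap _ ⟩
    sum (λ i → sum (λ w → 𝟙 (X w ∧ does (P? w i))))   ≡⟨ sum-cong (λ i → sym (#-def _)) ⟩
    sum (λ i → # (X ∩ (λ w → does (P? w i))))         ∎
    where
    open ≤-Reasoning
    term : ∀ w (d : Dec (∃[ i ] P w i)) → 𝟙 (X w ∧ does d) ≤ sum (λ i → 𝟙 (X w ∧ does (P? w i)))
    term w (yes (i , p)) = ≤-trans (𝟙-mono (λ m → ∧-intro (∧-elimˡ {X w} m) (true-does (P? w i) p)))
      (term≤sum (λ i → 𝟙 (X w ∧ does (P? w i))) i)
    term w (no _) = ≤-trans (𝟙-mono {X w ∧ false} {false} (λ m → ∧-elimʳ {X w} m)) z≤n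

  odd : ℕ → Bool
  odd zero    = false
  odd (suc j) = not (odd j)

  record GridIn {n : ℕ} (h : Adjacency n) (s : ℕ) : Set where
    field
      f      : Fin s → Fin s → Fin n
      inj    : ∀ i i′ j j′ → f i j ≡ f i′ j′ → i ≡ i′ × j ≡ j′
      across : ∀ i j j′ → toℕ j′ ≡ suc (toℕ j) → h (f i j) (f i j′) ≡ true
      down   : ∀ i i′ j → toℕ i′ ≡ suc (toℕ i) → h (f i j) (f i′ j) ≡ true
      -- An endpoint of an edge of H lies in its vertex set. In the grid with a single vertex no
      -- grid edge would show this.
      touched : ∀ i j → ∃[ w ] h (f i j) w ≡ true

  module Rows {n : ℕ} (h : Adjacency n) (h-sym : Symmetric h) (k r s : ℕ) (0<k : 0 < k) (0<r : 0 < r)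
    (cap : ∀ A B → Disjoint A B → k * e h A B ≤ 4 * (# A * # B) + 3 * (n * k))
    (codegree : ∀ u v → ¬ (u ≡ v) → k * k * # (h u ∩ h v) ≤ 3 * n)
    (C : Bool → Bool → VSet n)
    (C-disjoint : ∀ ρ γ ρ′ γ′ v → v ∈ C ρ γ → v ∈ C ρ′ γ′ → ρ ≡ ρ′ × γ ≡ γ′)
    (degree : ∀ ρ γ v → v ∈ C ρ γ → 8 * r ≤ # (C (not ρ) γ ∩ h v))
    (nonempty : ∀ ρ γ → 0 < # (C ρ γ))
    (link : ∀ ρ γ v v′ → v ∈ C ρ γ → v′ ∈ C ρ (not γ) → ∀ X Y → X ⊆ C (not ρ) γ → X ⊆ h v →
      Y ⊆ C (not ρ) (not γ) → Y ⊆ h v′ → 2 * r ≤ # X → 2 * r ≤ # Y → ∃[ u ] ∃[ w ] u ∈ X × w ∈ Y × h u w ≡ true)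
    (s≤k : suc s ≤ k) (s≤r : 16 * suc s ≤ r) (n<r² : 12 * n < r * r) (n≤r : suc s * (3 * n) ≤ k * k * r) where

    col : Fin (suc s) → Bool
    col j = odd (toℕ j)

    module Extend (ρ : Bool) (v : Fin (suc s) → Fin n) (v∈ : ∀ j → v j ∈ C ρ (col j))
      (v-inj : ∀ i j → v i ≡ v j → i ≡ j) (U : VSet n) (#U : 16 * # U ≤ k * r) (v-free : ∀ j → # (U ∩ h (v j)) ≤ r) where

      -- The summand `suc s` reserves room for the row about to join `U`, so that the new row meets
      -- the hypothesis `v-free` at the next extension.
      crowded : VSet n
      crowded w = not (U w) ∧ does (r <? # (U ∩ h w) + suc s)

      -- Let z ≥ r be the number of crowded vertices. They send more than zr edges to `U`, up to the
      -- summand (s + 1)z ≤ zr/16. By `cap` there are at most 4z|U|/k + 3n such edges, where 4z|U|/k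
      -- ≤ zr/4 and 3n < r²/4 ≤ zr/4.
      few-crowded : # crowded < r
      few-crowded = ≰⇒> λ r≤z → arith k r (suc s) (# U) (# crowded) (e h crowded U) n 0<k
          heavy (cap crowded U (λ i m → not-elim {U i} (∧-elimˡ m))) s≤r #U r≤z n<r²
        where
        heavy : # crowded * suc r ≤ e h crowded U + # crowded * suc s
        heavy = ≤-trans (≤-reflexive (sym (∑-const crowded (suc r)))) (≤-trans
          (∑-mono {X = crowded} (λ i m → does-true {P? = r <? # (U ∩ h i) + suc s} (∧-elimʳ {not (U i)} m)))
          (≤-reflexive (trans (∑-+ crowded _ _) (cong (e h crowded U +_) (∑-const crowded (suc s))))))
        arith : ∀ k r s u z E n → 0 < k → z * suc r ≤ E + z * s → k * E ≤ 4 * (z * u) + 3 * (n * k) →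
          16 * s ≤ r → 16 * u ≤ k * r → r ≤ z → 12 * n < r * r → ⊥
        arith (suc k) r s u z E n _ h₁ h₂ h₃ h₄ h₅ h₆ = n≮0 (lin {1} {0} (3 + 4 * k + 16 * suc k * z + 7 * suc k
          * z * r)
          (16 * suc k ⊗ h₁ ⊕ 16 ⊗ h₂ ⊕ suc k * z ⊗ h₃ ⊕ 4 * z ⊗ h₄ ⊕ 4 * suc k * r ⊗ h₅ ⊕ 4 * suc k ⊗ h₆)
          (identity k r s u z E n))
          where
          identity : ∀ k r s u z E n →
            0 + (16 * suc k * (z * suc r) + 16 * (suc k * E) + suc k * z * (16 * s) + 4 * z * (16 * u)
              + 4 * suc k * r * r + 4 * suc k * suc (12 * n)) ≡
            1 + (16 * suc k * (E + z * s) + 16 * (4 * (z * u) + 3 * (n * suc k)) + suc k * z * r + 4 * z *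
              (suc k * r)
              + 4 * suc k * r * z + 4 * suc k * (r * r)) + (3 + 4 * k + 16 * suc k * z + 7 * suc k * z * r)
          identity = solve-∀

      Near : Fin (suc s) → Fin n → Fin (suc s) → Set
      Near j w i = ¬ (i ≡ j) × h (v i) w ≡ true

      near? : ∀ j w i → Dec (Near j w i)
      near? j w i = ¬? (i ≟F j) ×-dec h (v i) w ≟B true

      -- Discarding the vertices with a second neighbour in the previous row makes the candidate
      -- sets of different columns disjoint, so any choice of one vertex per column is injective.
      near : Fin (suc s) → VSet n
      near j w = does (any? (near? j w))

      N₀ : Fin (suc s) → VSet n
      N₀ j = C (not ρ) (col j) ∩ h (v j)

      few-near : ∀ j → # (N₀ j ∩ near j) ≤ r
      few-near j = cancel-* (k * k) (*-mono-< 0<k 0<k) (begin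
        k * k * # (N₀ j ∩ near j)                                         ≤⟨ *-monoʳ-≤ (k * k)
          (#-any (N₀ j) (near? j)) ⟩
        k * k * sum (λ i → # (N₀ j ∩ (λ w → does (near? j w i))))         ≡⟨ sum-* (k * k) _ ⟨
        sum (λ i → k * k * # (N₀ j ∩ (λ w → does (near? j w i))))         ≤⟨ sum-mono term ⟩
        sum {suc s} (λ _ → 3 * n)                                         ≡⟨ sum-const (suc s) (3 * n) ⟩
        suc s * (3 * n)                                                   ≤⟨ n≤r ⟩
        k * k * r                                                         ∎)
        where
        open ≤-Reasoning
        term : ∀ i → k * k * # (N₀ j ∩ (λ w → does (near? j w i))) ≤ 3 * n
        term i = choose (i ≟F j)
          where
          choose : Dec (i ≡ j) → k * k * # (N₀ j ∩ (λ w → does (near? j w i))) ≤ 3 * n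
          choose (yes i≡j) = ≤-trans (*-monoʳ-≤ (k * k) (≤-trans
            (#-mono {Y = λ _ → false} (λ w m → ⊥-elim (proj₁ (does-true {P? = near? j w i} (∧-elimʳ {N₀ j w} m))
              i≡j)))
            (≤-reflexive (trans (#-def _) (trans (sum-const n 0) (*-zeroʳ n))))))
              (≤-trans (≤-reflexive (*-zeroʳ (k * k))) z≤n)
          choose (no i≢j) = ≤-trans (*-monoʳ-≤ (k * k) (#-mono {Y = h (v i) ∩ h (v j)}
            (λ w m → ∧-intro (proj₂ (does-true {P? = near? j w i} (∧-elimʳ {N₀ j w} m)))
              (∧-elimʳ {C (not ρ) (col j) w} (∧-elimˡ {N₀ j w} m)))))
            (codegree (v i) (v j) (λ eq → i≢j (v-inj i j eq)))

      N : Fin (suc s) → VSet n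
      N j = ((N₀ j ∖ near j) ∖ U) ∖ crowded

      -- Of the 8r neighbours given by `degree`, at most `r` are lost to each of the codegrees, the
      -- used vertices and the crowded ones.
      large : ∀ j → 4 * r ≤ # (N j)
      large j = arith r (# (N₀ j)) (# (N₀ j ∩ near j)) (# (N₀ j ∖ near j)) (# ((N₀ j ∖ near j) ∩ U))
        (# ((N₀ j ∖ near j) ∖ U))
        (# (((N₀ j ∖ near j) ∖ U) ∩ crowded)) (# (N j)) (degree ρ (col j) (v j) (v∈ j))
        (#-split (N₀ j) (near j)) (#-split (N₀ j ∖ near j) U) (#-split ((N₀ j ∖ near j) ∖ U) crowded)
          (few-near j)
        (≤-trans (#-mono {Y = U ∩ h (v j)} (λ w m → ∧-intro (∧-elimʳ {(N₀ j ∖ near j) w} m)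
          (∧-elimʳ {C (not ρ) (col j) w} (∧-elimˡ (∧-elimˡ {(N₀ j ∖ near j) w} m))))) (v-free j))
        (≤-trans (#-mono {Y = crowded} (λ w m → ∧-elimʳ {((N₀ j ∖ near j) ∖ U) w} m)) (<⇒≤ few-crowded))
        where
        arith : ∀ r a b c d f g t → 8 * r ≤ a → a ≡ b + c → c ≡ d + f → f ≡ g + t → b ≤ r → d ≤ r → g ≤ r → 4 *
          r ≤ t
        arith r _ b _ d _ g t h₁ refl refl refl h₂ h₃ h₄ = lin r (h₁ ⊕ h₂ ⊕ h₃ ⊕ h₄) (identity r b d g t)
          where
          identity : ∀ r b d g t → t + (8 * r + b + d + g) ≡ 4 * r + (b + (d + (g + t)) + r + r + r) + r
          identity = solve-∀

      ∈N₀ : ∀ j w → w ∈ N j → w ∈ N₀ j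
      ∈N₀ j w m = ∧-elimˡ (∧-elimˡ {(N₀ j ∖ near j) w} (∧-elimˡ {((N₀ j ∖ near j) ∖ U) w} m))

      ∉near : ∀ j w → w ∈ N j → ¬ (w ∈ near j)
      ∉near j w m = not-elim {near j w}
        (∧-elimʳ {N₀ j w} (∧-elimˡ {(N₀ j ∖ near j) w} (∧-elimˡ {((N₀ j ∖ near j) ∖ U) w} m)))

      ∉U : ∀ j w → w ∈ N j → ¬ (w ∈ U)
      ∉U j w m = not-elim {U w} (∧-elimʳ {(N₀ j ∖ near j) w} (∧-elimˡ {((N₀ j ∖ near j) ∖ U) w} m))

      sparse : ∀ j w → w ∈ N j → # (U ∩ h w) + suc s ≤ r
      sparse j w m = ≮⇒≥ λ lt → not-elim {crowded w} (∧-elimʳ {((N₀ j ∖ near j) ∖ U) w} m)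
        (∧-intro (not-intro (∉U j w m)) (true-does (r <? # (U ∩ h w) + suc s) lt))

      links : ∀ j j′ → toℕ j′ ≡ suc (toℕ j) → ∀ X Y → X ⊆ N j → Y ⊆ N j′ → 2 * r ≤ # X → 2 * r ≤ # Y →
        ∃[ u ] ∃[ w ] u ∈ X × w ∈ Y × h u w ≡ true
      links j j′ eq X Y X⊆ Y⊆ = link ρ (col j) (v j) (v j′) (v∈ j) (subst (λ γ → v j′ ∈ C ρ γ) (cong odd eq)
        (v∈ j′)) X Y
        (λ i m → ∧-elimˡ (∈N₀ j i (X⊆ i m))) (λ i m → ∧-elimʳ {C (not ρ) (col j) i} (∈N₀ j i (X⊆ i m)))
        (λ i m → subst (λ γ → i ∈ C (not ρ) γ) (cong odd eq) (∧-elimˡ (∈N₀ j′ i (Y⊆ i m))))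
        (λ i m → ∧-elimʳ {C (not ρ) (col j′) i} (∈N₀ j′ i (Y⊆ i m)))

      found = path h h-sym r s N large links
      start = ∈-any (proj₁ found) (<-≤-trans (*-mono-< {0} {2} z<s 0<r) (proj₁ (proj₂ (proj₂ found))))
      row = proj₂ (proj₂ (proj₂ found)) (proj₁ start) (proj₂ start)

      w : Fin (suc s) → Fin n
      w = proj₁ row

      w∈N : ∀ j → w j ∈ N j
      w∈N = proj₁ (proj₂ (proj₂ row))

      w∈ : ∀ j → w j ∈ C (not ρ) (col j)
      w∈ j = ∧-elimˡ (∈N₀ j (w j) (w∈N j))

      w-below : ∀ j → h (v j) (w j) ≡ true
      w-below j = ∧-elimʳ {C (not ρ) (col j) (w j)} (∈N₀ j (w j) (w∈N j))

      w-path : ∀ j j′ → toℕ j′ ≡ suc (toℕ j) → h (w j) (w j′) ≡ true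
      w-path = proj₂ (proj₂ (proj₂ row))

      w-inj : ∀ i j → w i ≡ w j → i ≡ j
      w-inj i j eq = choose (i ≟F j)
        where
        choose : Dec (i ≡ j) → i ≡ j
        choose (yes p) = p
        choose (no ¬p) = ⊥-elim (∉near j (w j) (w∈N j) (true-does (any? (near? j (w j)))
          (i , ¬p , subst (λ t → h (v i) t ≡ true) eq (w-below i))))

    -- Rows are prepended, so index `zero` is the newest row, the one that is extended. `U` collects
    -- the vertices used so far.
    record Grid (t : ℕ) : Set where
      field
        ρ        : Bool
        f        : Fin (suc t) → Fin (suc s) → Fin n
        newest   : ∀ j → f zero j ∈ C ρ (col j)
        inj      : ∀ i i′ j j′ → f i j ≡ f i′ j′ → i ≡ i′ × j ≡ j′
        across   : ∀ i j j′ → toℕ j′ ≡ suc (toℕ j) → h (f i j) (f i j′) ≡ true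
        down     : ∀ i i′ j → toℕ i′ ≡ suc (toℕ i) → h (f i j) (f i′ j) ≡ true
        touched  : ∀ i j → ∃[ w ] h (f i j) w ≡ true
        U        : VSet n
        used     : ∀ i j → f i j ∈ U
        #U       : # U ≤ suc t * suc s
        free     : ∀ j → # (U ∩ h (f zero j)) ≤ r

    _∪image_ : VSet n → (Fin (suc s) → Fin n) → VSet n
    (U ∪image w) x = U x ∨ does (any? (λ j → w j ≟F x))

    ∪-inʳ : ∀ a {b} → b ≡ true → a ∨ b ≡ true
    ∪-inʳ true  _ = refl
    ∪-inʳ false m = m

    #-image : ∀ X U (w : Fin (suc s) → Fin n) → # ((U ∪image w) ∩ X) ≤ # (U ∩ X) + suc s
    #-image X U w = ≤-trans (≤-reflexive (#-split ((U ∪image w) ∩ X) U)) (+-mono-≤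
      (#-mono {Y = U ∩ X} (λ i m → ∧-intro (∧-elimʳ {((U ∪image w) ∩ X) i} m) (∧-elimʳ {(U ∪image w) i}
        (∧-elimˡ {((U ∪image w) ∩ X) i} m))))
      (begin
        # (((U ∪image w) ∩ X) ∖ U)                                          ≤⟨ #-mono
          (λ i m → bool (U i) _ (X i) m) ⟩
        # ((λ _ → true) ∩ (λ x → does (any? (λ j → w j ≟F x))))             ≤⟨ #-any (λ _ → true)
          (λ x j → w j ≟F x) ⟩
        sum (λ j → # ((λ _ → true) ∩ (λ x → does (w j ≟F x))))              ≡⟨ sum-cong (λ j → #⁅⁆ (w j)) ⟩
        sum {suc s} (λ j → 1)                                               ≡⟨ trans (sum-const (suc s) 1)
          (*-identityʳ (suc s)) ⟩
        suc s                                                               ∎))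
      where
      open ≤-Reasoning
      bool : ∀ a b c → ((a ∨ b) ∧ c) ∧ not a ≡ true → b ≡ true
      bool true  b c m = ⊥-elim (not-elim {true} (∧-elimʳ {c} m) refl)
      bool false b c m = ∧-elimˡ {b} {c} (∧-elimˡ {b ∧ c} m)

    ∅ : VSet n
    ∅ _ = false

    #∅ : ∀ X → # (∅ ∩ X) ≡ 0
    #∅ X = trans (#-def _) (trans (sum-const n 0) (*-zeroʳ n))

    #U-bound : ∀ {u} t → t ≤ s → u ≤ suc t * suc s → 16 * u ≤ k * r
    #U-bound {u} t t≤s le = begin
      16 * u                    ≤⟨ *-monoʳ-≤ 16 le ⟩
      16 * (suc t * suc s)      ≡⟨ comm (suc t) (suc s) ⟩
      suc t * (16 * suc s)      ≤⟨ *-mono-≤ (≤-trans (s≤s t≤s) s≤k) s≤r ⟩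
      k * r                     ∎
      where
      open ≤-Reasoning
      comm : ∀ a b → 16 * (a * b) ≡ a * (16 * b)
      comm = solve-∀

    -- The first row extends an auxiliary row of distinct vertices of parity `true`, with nothing
    -- used yet. The auxiliary row is not part of the grid, but its vertices witness `touched`.
    first-row : Grid 0
    first-row = record
      { ρ = false ; f = λ _ → w ; newest = w∈
      ; inj = λ { zero zero j j′ eq → refl , w-inj j j′ eq }
      ; across = λ _ → w-path ; down = λ { zero zero j () }
      ; touched = λ _ j → v j , trans (h-sym (w j) (v j)) (w-below j)
      ; U = ∅ ∪image w ; used = λ _ j → true-does (any? (λ j′ → w j′ ≟F w j)) (j , refl)
      ; #U = ≤-trans (#-mono {Y = (∅ ∪image w) ∩ (λ _ → true)} (λ i m → ∧-intro m refl))
          (≤-trans (#-image (λ _ → true) ∅ w) (≤-reflexive (trans (cong (_+ suc s) (#∅ (λ _ → true)))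
            (sym (+-identityʳ (suc s))))))
      ; free = λ j → ≤-trans (#-image (h (w j)) ∅ w) (sparse j (w j) (w∈N j)) }
      where
      big : ∀ γ → suc s ≤ # (C true γ)
      big γ = let v , v∈ = ∈-any (C false γ) (nonempty false γ) in
        ≤-trans (≤-trans (m≤n*m (suc s) 16) s≤r) (≤-trans (m≤n*m r 8) (≤-trans (degree false γ v v∈)
          (#-mono (λ i m → ∧-elimˡ {C true γ i} m))))
      v : Fin (suc s) → Fin n
      v j = proj₁ (enumerate (suc s) (C true (col j)) (big (col j))) j
      v∈ : ∀ j → v j ∈ C true (col j)
      v∈ j = proj₁ (proj₂ (enumerate (suc s) (C true (col j)) (big (col j)))) j
      v-inj : ∀ i j → v i ≡ v j → i ≡ j
      v-inj i j eq = same (col i) (col j) refl (proj₂ (C-disjoint true (col i) true (col j) (v i) (v∈ i)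
        (subst (_∈ C true (col j)) (sym eq) (v∈ j))))
        where
        φ : Bool → Fin (suc s) → Fin n
        φ γ = proj₁ (enumerate (suc s) (C true γ) (big γ))
        same : ∀ γ γ′ → γ ≡ col i → γ ≡ γ′ → i ≡ j
        same γ γ′ eq₁ eq₂ = proj₂ (proj₂ (enumerate (suc s) (C true (col j)) (big (col j)))) i j
          (trans (cong (λ γ → φ γ i) (sym cols)) eq)
          where
          cols : col i ≡ col j
          cols = proj₂ (C-disjoint true (col i) true (col j) (v i) (v∈ i) (subst (_∈ C true (col j)) (sym eq)
            (v∈ j)))
      open Extend true v v∈ v-inj ∅
        (≤-trans (≤-reflexive (trans (cong (16 *_) (trans (#-def _) (trans (sum-const n 0) (*-zeroʳ n))))
        (*-zeroʳ 16))) z≤n)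
        (λ j → ≤-trans (≤-reflexive (#∅ (h (v j)))) z≤n)

    next-row : ∀ {t} → t < s → Grid t → Grid (suc t)
    next-row {t} t<s G = record
      { ρ = not ρ ; f = f′ ; newest = w∈ ; inj = inj′ ; across = across′ ; down = down′ ; touched = touched′
      ; U = U ∪image w ; used = used′
      ; #U = ≤-trans (#-mono {Y = (U ∪image w) ∩ (λ _ → true)} (λ i m → ∧-intro m refl))
          (≤-trans (#-image (λ _ → true) U w)
            (≤-trans (+-monoˡ-≤ (suc s) (≤-trans (#-mono (λ i m → ∧-elimˡ {U i} m)) #U))
            (≤-reflexive (+-comm (suc t * suc s) (suc s)))))
      ; free = λ j → ≤-trans (#-image (h (w j)) U w) (sparse j (w j) (w∈N j)) }
      where
      open Grid G
      open Extend ρ (f zero) newest (λ i j eq → proj₂ (inj zero zero i j eq)) U (#U-bound t (<⇒≤ t<s) #U) free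
      f′ : Fin (suc (suc t)) → Fin (suc s) → Fin n
      f′ zero    = w
      f′ (suc i) = f i
      fresh : ∀ i j j′ → ¬ (w j ≡ f i j′)
      fresh i j j′ eq = ∉U j (w j) (w∈N j) (subst (_∈ U) (sym eq) (used i j′))
      inj′ : ∀ i i′ j j′ → f′ i j ≡ f′ i′ j′ → i ≡ i′ × j ≡ j′
      inj′ zero    zero     j j′ eq = refl , w-inj j j′ eq
      inj′ zero    (suc i′) j j′ eq = ⊥-elim (fresh i′ j j′ eq)
      inj′ (suc i) zero     j j′ eq = ⊥-elim (fresh i j′ j (sym eq))
      inj′ (suc i) (suc i′) j j′ eq = let p , q = inj i i′ j j′ eq in cong suc p , q
      across′ : ∀ i j j′ → toℕ j′ ≡ suc (toℕ j) → h (f′ i j) (f′ i j′) ≡ true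
      across′ zero    = w-path
      across′ (suc i) = across i
      down′ : ∀ i i′ j → toℕ i′ ≡ suc (toℕ i) → h (f′ i j) (f′ i′ j) ≡ true
      down′ zero    (suc zero) j refl = trans (h-sym (w j) (f zero j)) (w-below j)
      down′ (suc i) (suc i′)   j eq   = down i i′ j (suc-injective eq)
      touched′ : ∀ i j → ∃[ u ] h (f′ i j) u ≡ true
      touched′ zero    j = f zero j , trans (h-sym (w j) (f zero j)) (w-below j)
      touched′ (suc i) j = touched i j
      used′ : ∀ i j → f′ i j ∈ U ∪image w
      used′ zero    j = ∪-inʳ (U (w j)) (true-does (any? (λ j′ → w j′ ≟F w j)) (j , refl))
      used′ (suc i) j = cong (_∨ does (any? (λ j′ → w j′ ≟F f i j))) (used i j)

    grid : ∀ t → t ≤ s → Grid t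
    grid zero    _   = first-row
    grid (suc t) t<s = next-row t<s (grid t (<⇒≤ t<s))

-- Deterministic embedding: parameters and the four parts

module DeterministicEmbedding where
  open import Data.Nat.Base
  open import Data.Nat.Properties
  open import Data.Nat.DivMod using (_/_; m/n*n≤m; m≡m%n+[m/n]*n; m%n<n)
  open import Data.Bool.Properties using (not-involutive)
  open import Data.List.Base using ([])
  open import Data.List.Relation.Unary.All using ([])
  open VertexSets
  open BipartiteDensity
  open Coverings
  open RowByRow

  *-/-≤ : ∀ d m .{{_ : NonZero d}} → d * (m / d) ≤ m
  *-/-≤ d m = ≤-trans (≤-reflexive (*-comm d (m / d))) (m/n*n≤m m d)

  <-suc-/-* : ∀ d m .{{_ : NonZero d}} → m < suc (m / d) * d
  <-suc-/-* d m = ≤-trans (≤-reflexive (cong suc (m≡m%n+[m/n]*n m d))) (+-monoˡ-≤ (m / d * d) (m%n<n m d))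

  -- With `S` empty and no lists nothing is covered, and `Expansion` with g = 1 becomes an upper
  -- bound for the number of edges between disjoint sets.
  expansion⇒cap : ∀ {n} (h : Adjacency n) k ℓ → ℓ ≤ n → Expansion h k ℓ 0 1 →
    ∀ A B → Disjoint A B → k * e h A B ≤ 4 * (# A * # B) + 3 * (n * k)
  expansion⇒cap {n} h k ℓ ℓ≤n expansion A B disjoint =
    arith k ℓ n (e h A B) (# A * # B) ℓ≤n (subst₂ _≤_
      (cong₂ _*_ (*-identityˡ k) (∑-cong {X = A} (λ v _ → #-cong (λ y → bool (B y) (h v y)))))
      (cong (λ t → 2 * t + k * (2 * n + ℓ * 0 + ℓ)) (trans (cong₂ (λ u v → 2 * u + v * # B)
        (trans (∑-cong {X = A} (λ v _ → #-cong (λ y → bool′ (B y)))) (∑-const A (# B)))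
        (trans (#-def _) (trans (sum-const n 0) (*-zeroʳ n)))) (+-identityʳ (2 * (# A * # B)))))
      (expansion (λ _ → false) B A (λ _ ()) (λ _ ()) (λ i b a → disjoint i a b) (λ _ → []) (λ _ → z≤n)
        (λ _ → [])))
    where
    bool′ : ∀ a → a ∧ true ≡ a
    bool′ true  = refl
    bool′ false = refl
    bool : ∀ a b → (a ∧ true) ∧ b ≡ a ∧ b
    bool true  b = refl
    bool false b = refl
    arith : ∀ k ℓ n e m → ℓ ≤ n → k * e ≤ 2 * (2 * m) + k * (2 * n + ℓ * 0 + ℓ) → k * e ≤ 4 * m + 3 * (n * k)
    arith k ℓ n e m h₁ h₂ = lin 0 (k ⊗ h₁ ⊕ h₂) (identity k ℓ n e m)
      where
      identity : ∀ k ℓ n e m → 4 * m + 3 * (n * k) + (k * ℓ + k * e) ≡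
        k * e + (k * n + (2 * (2 * m) + k * (2 * n + ℓ * 0 + ℓ))) + 0
      identity = solve-∀

  module Deterministic {n : ℕ} (h : Adjacency n) (h-sym : Symmetric h) (h-irr : Irreflexive h)
    (k a ℓ y₀ E₁ E′ L G : ℕ) (0<k : 0 < k) (0<a : 0 < a) (0<y₀ : 0 < y₀) (ℓ≤n : ℓ ≤ n)
    (G≡ : G ≡ suc (768 * a)) (E′≡ : E′ ≡ 512 * a * 2 ^ suc G) (E≡ : suc E₁ ≡ 2 * E′)
    (L≡ : L ≡ 8 * (a * k) * (E′ * E′))
    (expansion₁ : Expansion h k ℓ 0 1) (expansion₂ : Expansion h k ℓ L (suc G))
    (codegree : ∀ u v → ¬ (u ≡ v) → k * k * # (h u ∩ h v) ≤ 3 * n)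
    (edges : 4 * (n * n) ≤ a * k * sum (λ i → sum (λ j → 𝟙 (h i j))))
    (small : 8 * a * (suc E₁ ^ (5 * a * (2 * (suc E₁ * suc E₁))) * y₀) ≤ n)
    (n-large : 6 * (a * k) < n) (y₀-large₁ : 3 * (n * k) ≤ y₀ * y₀)
    (y₀-large₂ : k * (2 * n + ℓ * (L * n) + ℓ) ≤ y₀ * y₀)
    (y₀-large₃ : 128 * (a * k) * (2 * (a * k) * E′) ≤ y₀)
    (y₀-large₄ : 128 * (a * k) * (16 * k) ≤ y₀)
    (y₀-large₅ : 128 * (a * k) * (128 * (a * k)) * (12 * n) < y₀ * y₀)
    (s : ℕ) (s≤k : suc s ≤ k) (y₀-large₆ : 128 * a * (suc s * (3 * n)) ≤ k * y₀) where

    D = a * k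

    0<D : 0 < D
    0<D = *-mono-< 0<a 0<k

    0<E′ : 0 < E′
    0<E′ = subst (0 <_) (sym E′≡) (*-mono-< {0} {512 * a} (*-mono-< {0} {512} z<s 0<a) (m^n>0 2 (suc G)))

    1<E′ : 2 ≤ E′
    1<E′ = subst (2 ≤_) (sym E′≡) (*-mono-≤ {2} {512 * a} {1} {2 ^ suc G}
      (*-mono-≤ {2} {512} {1} {a} (s≤s (s≤s z≤n)) 0<a) (m^n>0 2 (suc G)))

    0<E₁ : 0 < E₁
    0<E₁ = ≤-pred (subst (2 ≤_) (sym E≡) (*-monoʳ-≤ 2 0<E′))

    cap = expansion⇒cap h k ℓ ℓ≤n expansion₁

    open Increment k a E₁ h h-sym cap 0<a 0<k 0<E₁ hiding (D)

    found : Regular 0<y₀ y₀-large₁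
    found = regular-pair 0<y₀ y₀-large₁ h-irr edges small n-large

    open Regular found
    open Pair pair

    m = E′ * x

    0<x : 0 < x
    0<x = <-≤-trans 0<y₀ y₀≤x

    y₀≤m : y₀ ≤ m
    y₀≤m = ≤-trans y₀≤x (m≤n*m x E′ {{>-nonZero 0<E′}})

    0<m : 0 < m
    0<m = <-≤-trans 0<y₀ y₀≤m

    2m : suc E₁ * x ≡ m + m
    2m = trans (cong (_* x) E≡) (trans (*-assoc 2 E′ x) (cong (m +_) (+-identityʳ m)))

    instance
      D-nonZero : NonZero (64 * D)
      D-nonZero = >-nonZero (*-mono-< {0} {64} z<s 0<D)

    -- Between sets of u and v ≥ m/2 good vertices there are at least uv/(2D) ≥ (u + v)m/(8D) edges.
    -- `core` thus yields minimum degree m/(8D), and this should be at least 8r.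
    r = m / (64 * D)

    r≤ : 64 * D * r ≤ m
    r≤ = *-/-≤ (64 * D) m

    r≥ : m ≤ 128 * D * r
    r≥ = arith D r m y₀ 0<E′ 0<D y₀≤m y₀-large₃ (<-suc-/-* (64 * D) m) r≤
      where
      arith : ∀ D r m y → 0 < E′ → 0 < D → y ≤ m → 128 * D * (2 * D * E′) ≤ y → m < suc r * (64 * D) → 64 * D *
        r ≤ m → m ≤ 128 * D * r
      arith D zero m y 0<E′ 0<D h₁ h₂ h₃ _ = ⊥-elim (<-irrefl refl (begin-strict
        128 * D                    ≤⟨ m≤m*n (128 * D) (2 * D * E′)
          {{>-nonZero (*-mono-< {0} {2 * D} (*-mono-< {0} {2} z<s 0<D) 0<E′)}} ⟩
        128 * D * (2 * D * E′)     ≤⟨ ≤-trans h₂ h₁ ⟩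
        m                          <⟨ h₃ ⟩
        1 * (64 * D)               ≤⟨ ≤-trans (≤-reflexive (*-identityˡ (64 * D)))
          (*-monoˡ-≤ D {64} {128} (m≤m+n 64 64)) ⟩
        128 * D                    ∎))
        where open ≤-Reasoning
      arith D (suc r) m y _ 0<D h₁ h₂ h₃ _ = ≤-trans (<⇒≤ h₃) (lin (64 * D * r) (≤-refl {0}) (identity D r))
        where
        identity : ∀ D r → 128 * D * suc r + 0 ≡ suc (suc r) * (64 * D) + 0 + 64 * D * r
        identity = solve-∀

    from-y₀ : ∀ {u} → 128 * D * u ≤ y₀ → u ≤ r
    from-y₀ {u} le = cancel-* (128 * D) (*-mono-< {0} {128} z<s 0<D) (≤-trans le (≤-trans y₀≤m r≥))

    L₁ = 2 * D * E′

    0<L₁ : 0 < L₁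
    0<L₁ = *-mono-< {0} {2 * D} (*-mono-< {0} {2} z<s 0<D) 0<E′

    L₁≤r : L₁ ≤ r
    L₁≤r = from-y₀ y₀-large₃

    0<r : 0 < r
    0<r = <-≤-trans 0<L₁ L₁≤r

    instance
      L₁-nonZero : NonZero L₁
      L₁-nonZero = >-nonZero 0<L₁

    τ = r / L₁

    τ≤ : L₁ * τ ≤ r
    τ≤ = *-/-≤ L₁ r

    -- As L₁ ≤ r, rounding down loses at most a factor 2, so τ ≥ r/(4DE′). The factor 8 in `L`
    -- compensates for this.
    τ≥ : 2 * r * E′ ≤ τ * L
    τ≥ = subst (λ t → 2 * r * E′ ≤ τ * t) (sym L≡) (arith D E′ r τ L₁≤r 0<L₁ (<-suc-/-* L₁ r))
      where
      arith : ∀ D E r τ → 2 * D * E ≤ r → 0 < 2 * D * E → r < suc τ * (2 * D * E) → 2 * r * E ≤ τ *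
        (8 * D * (E * E))
      arith D E r zero h₁ _ h₂ = ⊥-elim
        (<-irrefl refl (≤-<-trans h₁ (subst (r <_) (*-identityˡ (2 * D * E)) h₂)))
      arith D E r (suc τ) h₁ _ h₂ = lin (4 * D * E * E * τ) (2 * E ⊗ <⇒≤ h₂) (identity D E r τ)
        where
        identity : ∀ D E r τ → suc τ * (8 * D * (E * E)) + 2 * E * r ≡
          2 * r * E + 2 * E * (suc (suc τ) * (2 * D * E)) + 4 * D * E * E * τ
        identity = solve-∀

    L₁≤L : L₁ ≤ L
    L₁≤L = subst (L₁ ≤_) (sym L≡) (arith D E′ 0<E′)
      where
      arith : ∀ D E → 0 < E → 2 * D * E ≤ 8 * D * (E * E)
      arith D (suc E) _ = lin (8 * D * suc E * E + 6 * D * suc E) (≤-refl {0}) (identity D E)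
        where
        identity : ∀ D E → 8 * D * (suc E * suc E) + 0 ≡ 2 * D * suc E + 0 + (8 * D * suc E * E + 6 * D * suc E)
        identity = solve-∀

    open Goodness h h-sym D E′ x r τ L 0<D 0<x 0<r L₁≤L τ≤ τ≥ hiding (m)

    halve : (X : VSet n) → # X ≡ suc E₁ * x → ∃[ Y ] Y ⊆ X × # Y ≡ m × # (X ∖ Y) ≡ m
    halve X #X =
      let Y , Y⊆ , #Y = subset-of-size X m (≤-trans (m≤m+n m m) (≤-reflexive (sym (trans #X 2m))))
      in Y , Y⊆ , #Y , +-cancelˡ-≡ m _ _ (trans (cong (_+ # (X ∖ Y)) (sym #Y)) (trans (sym (#-∖ {Y = Y} {X} Y⊆))
        (trans #X 2m)))

    -- Grid vertices in rows of parity ρ and columns of parity γ go to P ρ γ.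
    P : Bool → Bool → VSet n
    P false false = proj₁ (halve A #A)
    P true  true  = A ∖ P false false
    P false true  = proj₁ (halve B #B)
    P true  false = B ∖ P false true

    #P : ∀ ρ γ → # (P ρ γ) ≡ m
    #P false false = proj₁ (proj₂ (proj₂ (halve A #A)))
    #P true  true  = proj₂ (proj₂ (proj₂ (halve A #A)))
    #P false true  = proj₁ (proj₂ (proj₂ (halve B #B)))
    #P true  false = proj₂ (proj₂ (proj₂ (halve B #B)))

    A₀⊆ : P false false ⊆ A
    A₀⊆ = proj₁ (proj₂ (halve A #A))

    A₁⊆ : P true true ⊆ A
    A₁⊆ = ∖-⊆ A (P false false)

    B₀⊆ : P false true ⊆ B
    B₀⊆ = proj₁ (proj₂ (halve B #B))

    B₁⊆ : P true false ⊆ B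
    B₁⊆ = ∖-⊆ B (P false true)

    P-disjoint : ∀ ρ γ ρ′ γ′ v → v ∈ P ρ γ → v ∈ P ρ′ γ′ → ρ ≡ ρ′ × γ ≡ γ′
    P-disjoint false false false false v p q = refl , refl
    P-disjoint true  true  true  true  v p q = refl , refl
    P-disjoint false true  false true  v p q = refl , refl
    P-disjoint true  false true  false v p q = refl , refl
    P-disjoint false false true  true  v p q = ⊥-elim (not-elim {P false false v} (∧-elimʳ {A v} q) p)
    P-disjoint true  true  false false v p q = ⊥-elim (not-elim {P false false v} (∧-elimʳ {A v} p) q)
    P-disjoint false true  true  false v p q = ⊥-elim (not-elim {P false true v} (∧-elimʳ {B v} q) p)
    P-disjoint true  false false true  v p q = ⊥-elim (not-elim {P false true v} (∧-elimʳ {B v} p) q)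
    P-disjoint false false false true  v p q = ⊥-elim (disjoint v (A₀⊆ v p) (B₀⊆ v q))
    P-disjoint false false true  false v p q = ⊥-elim (disjoint v (A₀⊆ v p) (B₁⊆ v q))
    P-disjoint true  true  false true  v p q = ⊥-elim (disjoint v (A₁⊆ v p) (B₀⊆ v q))
    P-disjoint true  true  true  false v p q = ⊥-elim (disjoint v (A₁⊆ v p) (B₁⊆ v q))
    P-disjoint false true  false false v p q = ⊥-elim (disjoint v (A₀⊆ v q) (B₀⊆ v p))
    P-disjoint true  false false false v p q = ⊥-elim (disjoint v (A₀⊆ v q) (B₁⊆ v p))
    P-disjoint false true  true  true  v p q = ⊥-elim (disjoint v (A₁⊆ v q) (B₀⊆ v p))
    P-disjoint true  false true  true  v p q = ⊥-elim (disjoint v (A₁⊆ v q) (B₁⊆ v p))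

    RegularPair : VSet n → VSet n → Set
    RegularPair S T = ∀ X Y → X ⊆ S → Y ⊆ T → x ≤ # X → x ≤ # Y → # X * # Y ≤ 2 * D * e h X Y

    restrict : ∀ S T → S ⊆ A → T ⊆ B → RegularPair S T
    restrict S T S⊆ T⊆ X Y X⊆ Y⊆ = regular X Y (λ i mem → S⊆ i (X⊆ i mem)) (λ i mem → T⊆ i (Y⊆ i mem))

    flip : ∀ S T → RegularPair S T → RegularPair T S
    flip S T reg X Y X⊆ Y⊆ x≤X x≤Y = subst₂ _≤_ (*-comm (# Y) (# X)) (cong (2 * D *_) (e-sym h h-sym Y X))
      (reg Y X Y⊆ X⊆ x≤Y x≤X)

    -- Changing one of the two parities moves a part from `A` to `B` or back. So both kinds of grid
    -- edges, along a row and along a column, run inside the regular pair.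
    regular-row : ∀ ρ γ → RegularPair (P ρ (not γ)) (P ρ γ)
    regular-row false true  = restrict (P false false) (P false true) A₀⊆ B₀⊆
    regular-row true  false = restrict (P true true) (P true false) A₁⊆ B₁⊆
    regular-row false false = flip (P false false) (P false true) (restrict (P false false) (P false true) A₀⊆
      B₀⊆)
    regular-row true  true  = flip (P true true) (P true false) (restrict (P true true) (P true false) A₁⊆ B₁⊆)

    regular-column : ∀ γ → RegularPair (P false γ) (P true γ)
    regular-column false = restrict (P false false) (P true false) A₀⊆ B₁⊆
    regular-column true  = flip (P true true) (P false true) (restrict (P true true) (P false true) A₁⊆ B₀⊆)

    -- The next grid vertex in the column of `v` is sought in `P (not ρ) γ`, and its neighbours
    -- along that new row lie in `P (not ρ) (not γ)`, which supplies the lists.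
    Z : Bool → Bool → VSet n
    Z ρ γ = BadSet (P ρ γ) (P (not ρ) (not γ)) (P (not ρ) γ)

    -- This is the origin of `E′`: multiplied by 128a, the left side is `E′ * x`, that is m, and m ≤
    -- 128akr.
    x-small : 2 ^ suc G * (4 * x) ≤ k * r
    x-small = cancel-* (128 * a) (*-mono-< {0} {128} z<s 0<a)
      (≤-trans (≤-reflexive (trans (assoc a (2 ^ suc G) x) (cong (_* x) (sym E′≡))))
      (≤-trans r≥ (≤-reflexive (assoc′ a k r))))
      where
      assoc : ∀ a P x → 128 * a * (P * (4 * x)) ≡ 512 * a * P * x
      assoc = solve-∀
      assoc′ : ∀ a k r → 128 * (a * k) * r ≡ 128 * a * (k * r)
      assoc′ = solve-∀

    not≢ : ∀ b → ¬ (not b ≡ b)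
    not≢ true ()
    not≢ false ()

    few-Z : ∀ ρ γ → 2 * # (Z ρ γ) ≤ m
    few-Z ρ γ = few-bad k ℓ a G expansion₂ (P ρ γ) (P (not ρ) (not γ)) (P (not ρ) γ)
      (λ i p q → not≢ γ (proj₂ (P-disjoint (not ρ) (not γ) (not ρ) γ i p q)))
      (λ i p q → not≢ ρ (proj₁ (P-disjoint (not ρ) (not γ) ρ γ i p q)))
      (λ i p q → not≢ ρ (proj₁ (P-disjoint (not ρ) γ ρ γ i p q)))
      (#P (not ρ) (not γ)) (#P (not ρ) γ) 0<m (≤-reflexive (sym G≡)) x-small
      (≤-trans y₀-large₂ (*-mono-≤ y₀≤m y₀≤m))
      (≤-trans r≥ (≤-reflexive (assoc a k r)))
      where
      assoc : ∀ a k r → 128 * (a * k) * r ≡ 128 * a * (k * r)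
      assoc = solve-∀

    Good : Bool → Bool → VSet n
    Good ρ γ = P ρ γ ∖ Z ρ γ

    many-good : ∀ ρ γ → m ≤ 2 * # (Good ρ γ)
    many-good ρ γ = arith m (# (Z ρ γ)) (# (Good ρ γ))
      (trans (sym (#P ρ γ)) (#-∖ {Y = Z ρ γ} {P ρ γ} (λ i mem → ∧-elimˡ mem))) (few-Z ρ γ)
      where
      arith : ∀ m a b → m ≡ a + b → 2 * a ≤ m → m ≤ 2 * b
      arith _ a b refl h₁ = lin 0 h₁ (identity a b)
        where
        identity : ∀ a b → 2 * b + 2 * a ≡ a + b + (a + b) + 0
        identity = solve-∀

    good : ∀ ρ γ v → v ∈ Good ρ γ → ¬ Bad (P (not ρ) (not γ)) (P (not ρ) γ) v
    good ρ γ v mem bad = not-elim {Z ρ γ v} (∧-elimʳ {P ρ γ v} mem)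
      (∧-intro (∧-elimˡ mem) (true-does (bad? (P (not ρ) (not γ)) (P (not ρ) γ) v) bad))

    x≤good : ∀ ρ γ → x ≤ # (Good ρ γ)
    x≤good ρ γ = cancel-* 2 z<s (≤-trans (*-monoˡ-≤ x 1<E′) (many-good ρ γ))

    dense-columns : ∀ γ → # (Good false γ) * # (Good true γ) ≤ 2 * D * e h (Good false γ) (Good true γ)
    dense-columns γ = regular-column γ (Good false γ) (Good true γ) (∖-⊆ (P false γ) (Z false γ))
      (∖-⊆ (P true γ) (Z true γ)) (x≤good false γ) (x≤good true γ)

    cores : ∀ γ → ∃[ X′ ] ∃[ Y′ ] X′ ⊆ Good false γ × Y′ ⊆ Good true γ × 0 < # X′ × 0 < # Y′ ×
        (∀ v → v ∈ X′ → 8 * r ≤ # (Y′ ∩ h v)) × (∀ v → v ∈ Y′ → 8 * r ≤ # (X′ ∩ h v))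
    cores γ = core h h-sym (8 * r) (Good false γ) (Good true γ)
      (cancel-* (8 * D) (*-mono-< {0} {8} z<s 0<D) (arith D r m (# (Good false γ)) (# (Good true γ))
        (e h (Good false γ) (Good true γ))
        r≤ (many-good false γ) (many-good true γ) (dense-columns γ)))
      (positive (2 * D) (e h (Good false γ) (Good true γ)) (<-≤-trans (*-mono-< (<-≤-trans 0<x (x≤good false γ))
        (<-≤-trans 0<x (x≤good true γ))) (dense-columns γ)))
      where
      positive : ∀ D e → 0 < D * e → 0 < e
      positive D zero h = ⊥-elim (<-irrefl refl (subst (0 <_) (*-zeroʳ D) h))
      positive D (suc e) _ = z<s
      arith : ∀ D r m u v e → 64 * D * r ≤ m → m ≤ 2 * u → m ≤ 2 * v → u * v ≤ 2 * D * e → 8 * D *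
        (8 * r * (u + v)) ≤ 8 * D * e
      arith D r m u v e h₁ h₂ h₃ h₄ = lin 0 ((u + v) ⊗ h₁ ⊕ v ⊗ h₂ ⊕ u ⊗ h₃ ⊕ 4 ⊗ h₄) (identity D r m u v e)
        where
        identity : ∀ D r m u v e → 8 * D * e + ((u + v) * (64 * D * r) + v * m + u * m + 4 * (u * v)) ≡
          8 * D * (8 * r * (u + v)) + ((u + v) * m + v * (2 * u) + u * (2 * v) + 4 * (2 * D * e)) + 0
        identity = solve-∀

    C : Bool → Bool → VSet n
    C false γ = proj₁ (cores γ)
    C true  γ = proj₁ (proj₂ (cores γ))

    C⊆Good : ∀ ρ γ → C ρ γ ⊆ Good ρ γ
    C⊆Good false γ = proj₁ (proj₂ (proj₂ (cores γ)))
    C⊆Good true  γ = proj₁ (proj₂ (proj₂ (proj₂ (cores γ))))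

    C⊆P : ∀ ρ γ → C ρ γ ⊆ P ρ γ
    C⊆P ρ γ v mem = ∧-elimˡ (C⊆Good ρ γ v mem)

    C-nonempty : ∀ ρ γ → 0 < # (C ρ γ)
    C-nonempty false γ = proj₁ (proj₂ (proj₂ (proj₂ (proj₂ (cores γ)))))
    C-nonempty true  γ = proj₁ (proj₂ (proj₂ (proj₂ (proj₂ (proj₂ (cores γ))))))

    C-degree : ∀ ρ γ v → v ∈ C ρ γ → 8 * r ≤ # (C (not ρ) γ ∩ h v)
    C-degree false γ = proj₁ (proj₂ (proj₂ (proj₂ (proj₂ (proj₂ (proj₂ (cores γ)))))))
    C-degree true  γ = proj₂ (proj₂ (proj₂ (proj₂ (proj₂ (proj₂ (proj₂ (cores γ)))))))

    -- The two vertices are good with the parts interchanged: `v` against lists from the part of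
    -- `Y`, `v′` against lists from the part of `X`.
    link : ∀ ρ γ v v′ → v ∈ C ρ γ → v′ ∈ C ρ (not γ) → ∀ X Y → X ⊆ C (not ρ) γ → X ⊆ h v →
      Y ⊆ C (not ρ) (not γ) → Y ⊆ h v′ → 2 * r ≤ # X → 2 * r ≤ # Y → ∃[ u ] ∃[ w ] u ∈ X × w ∈ Y × h u w ≡ true
    link ρ γ v v′ v∈ v′∈ X Y X⊆ X⊆v Y⊆ Y⊆v′ 2r≤X 2r≤Y =
      let w , u , w∈ , u∈ , edge = edge-between (P (not ρ) (not γ)) (P (not ρ) γ) (regular-row (not ρ) γ)
            (#P (not ρ) (not γ)) (#P (not ρ) γ) v v′ (good ρ γ v (C⊆Good ρ γ v v∈))
            (subst (λ γ′ → ¬ Bad (P (not ρ) γ′) (P (not ρ) (not γ)) v′) (not-involutive γ)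
              (good ρ (not γ) v′ (C⊆Good ρ (not γ) v′ v′∈)))
            Y X (λ i mem → C⊆P (not ρ) (not γ) i (Y⊆ i mem)) Y⊆v′ (λ i mem → C⊆P (not ρ) γ i (X⊆ i mem)) X⊆v
              2r≤Y 2r≤X
      in u , w , u∈ , w∈ , trans (h-sym u w) edge

    square : ∀ d r → d * r * (d * r) ≡ d * d * (r * r)
    square = solve-∀

    assoc : ∀ k a r → k * (128 * (a * k) * r) ≡ 128 * a * (k * k * r)
    assoc = solve-∀

    open Rows h h-sym k r s 0<k 0<r cap codegree C
      (λ ρ γ ρ′ γ′ v p q → P-disjoint ρ γ ρ′ γ′ v (C⊆P ρ γ v p) (C⊆P ρ′ γ′ v q)) C-degree C-nonempty link s≤k
      (≤-trans (*-monoʳ-≤ 16 s≤k) (from-y₀ y₀-large₄))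
      (*-cancelˡ-< (128 * D * (128 * D)) _ _
        (<-≤-trans y₀-large₅ (≤-trans (*-mono-≤ (≤-trans y₀≤m r≥) (≤-trans y₀≤m r≥))
        (≤-reflexive (square (128 * D) r)))))
      (cancel-* (128 * a) (*-mono-< {0} {128} z<s 0<a)
        (≤-trans y₀-large₆ (≤-trans (*-monoʳ-≤ k (≤-trans y₀≤m r≥))
        (≤-reflexive (assoc k a r)))))
      using (grid; module Grid)

    result : GridIn h (suc s)
    result = record { f = f ; inj = inj ; across = across ; down = down ; touched = touched }
      where open Grid (grid s ≤-refl)

-- The binomial measure

module ProductMeasure where
  open import Data.Nat.Base
  open import Data.Nat.Properties
  open import Data.Fin.Subset using (Subset; inside; outside)
  open import Data.Bool.ListAction using (any)
  open import Data.List.Base using (List; []; _∷_; _++_; map; length; tabulate)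
  import Data.List.Base as List
  open import Data.List.Membership.Propositional using () renaming (_∈_ to _∈ₗ_)
  open import Data.List.Relation.Unary.Any using (here; there)
  open import Data.Vec.Base using (Vec; []; _∷_; lookup)
  import Algebra.Properties.CommutativeMonoid.Sum *-1-commutativeMonoid as Product
  open VertexSets
  open import Defs using (subsets)

  opaque
    prod : ∀ {n} → (Fin n → ℕ) → ℕ
    prod = Product.sum

    prod-suc : ∀ {n} (d : Fin (suc n) → ℕ) → prod d ≡ d zero * prod (λ i → d (suc i))
    prod-suc d = refl

    prod-zero : (d : Fin 0 → ℕ) → prod d ≡ 1
    prod-zero d = refl

    prod-* : ∀ {n} (d d′ : Fin n → ℕ) → prod (λ i → d i * d′ i) ≡ prod d * prod d′
    prod-* = Product.∑-distrib-+

    prod-cong : ∀ {n} {d d′ : Fin n → ℕ} → (∀ i → d i ≡ d′ i) → prod d ≡ prod d′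
    prod-cong = Product.sum-cong-≗

    prod-mono : ∀ {n} {d d′ : Fin n → ℕ} → (∀ i → d i ≤ d′ i) → prod d ≤ prod d′
    prod-mono {zero}  h = ≤-refl
    prod-mono {suc n} h = *-mono-≤ (h zero) (prod-mono (λ i → h (suc i)))

    prod-^ : ∀ {n} c (d : Fin n → ℕ) → prod (λ i → c ^ d i) ≡ c ^ sum d
    prod-^ {zero}  c d = sym (cong (c ^_) (sum-zero d))
    prod-^ {suc n} c d = trans (cong (c ^ d zero *_) (prod-^ c (λ i → d (suc i))))
      (trans (sym (^-distribˡ-+-* c (d zero) _)) (cong (c ^_) (sym (sum-suc d))))

    prod-const : ∀ n c → prod {n} (λ _ → c) ≡ c ^ n
    prod-const zero    c = refl
    prod-const (suc n) c = cong (c *_) (prod-const n c)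

    prod-0 : ∀ {n} (d : Fin n → ℕ) i → d i ≡ 0 → prod d ≡ 0
    prod-0 d zero    eq = cong (_* prod (λ i → d (suc i))) eq
    prod-0 d (suc i) eq = trans (cong (d zero *_) (prod-0 (λ i → d (suc i)) i eq)) (*-zeroʳ (d zero))

  module _ {A : Set} where
    listSum : List A → (A → ℕ) → ℕ
    listSum []       f = 0
    listSum (x ∷ xs) f = f x + listSum xs f

    listSum-mono : ∀ xs {f g : A → ℕ} → (∀ x → f x ≤ g x) → listSum xs f ≤ listSum xs g
    listSum-mono []       h = z≤n
    listSum-mono (x ∷ xs) h = +-mono-≤ (h x) (listSum-mono xs h)

    listSum-cong : ∀ xs {f g : A → ℕ} → (∀ x → f x ≡ g x) → listSum xs f ≡ listSum xs g
    listSum-cong []       h = refl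
    listSum-cong (x ∷ xs) h = cong₂ _+_ (h x) (listSum-cong xs h)

    listSum-* : ∀ xs c (f : A → ℕ) → listSum xs (λ x → c * f x) ≡ c * listSum xs f
    listSum-* []       c f = sym (*-zeroʳ c)
    listSum-* (x ∷ xs) c f = trans (cong (c * f x +_) (listSum-* xs c f)) (sym (*-distribˡ-+ c (f x) _))

    listSum-+ : ∀ xs (f g : A → ℕ) → listSum xs (λ x → f x + g x) ≡ listSum xs f + listSum xs g
    listSum-+ []       f g = refl
    listSum-+ (x ∷ xs) f g = trans (cong (f x + g x +_) (listSum-+ xs f g))
      (interchange (f x) (g x) (listSum xs f) (listSum xs g))
      where
      interchange : ∀ a b c d → a + b + (c + d) ≡ a + c + (b + d)
      interchange = solve-∀

    listSum-++ : ∀ xs ys (f : A → ℕ) → listSum (xs ++ ys) f ≡ listSum xs f + listSum ys f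
    listSum-++ []       ys f = refl
    listSum-++ (x ∷ xs) ys f = trans (cong (f x +_) (listSum-++ xs ys f)) (sym (+-assoc (f x) _ _))

    listSum-const : ∀ (xs : List A) c → listSum xs (λ _ → c) ≡ length xs * c
    listSum-const []       c = refl
    listSum-const (x ∷ xs) c = cong (c +_) (listSum-const xs c)

    listSum-0 : ∀ (xs : List A) → listSum xs (λ _ → 0) ≡ 0
    listSum-0 xs = trans (listSum-const xs 0) (*-zeroʳ (length xs))

  listSum-map : ∀ {A B : Set} (g : A → B) xs (f : B → ℕ) → listSum (map g xs) f ≡ listSum xs (λ x → f (g x))
  listSum-map g []       f = refl
  listSum-map g (x ∷ xs) f = cong (f (g x) +_) (listSum-map g xs f)

  listSum-swap : ∀ {A B : Set} (xs : List A) (ys : List B) (f : A → B → ℕ) →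
    listSum xs (λ x → listSum ys (f x)) ≡ listSum ys (λ y → listSum xs (λ x → f x y))
  listSum-swap []       ys f = sym (listSum-0 ys)
  listSum-swap (x ∷ xs) ys f = trans (cong (listSum ys (f x) +_) (listSum-swap xs ys f))
    (sym (listSum-+ ys (f x) (λ y → listSum xs (λ x → f x y))))

  listSum-tabulate : ∀ {A : Set} {n} (g : Fin n → A) (f : A → ℕ) → listSum (tabulate g) f ≡ sum (λ i → f (g i))
  listSum-tabulate {n = zero}  g f = sym (sum-zero _)
  listSum-tabulate {n = suc n} g f = trans (cong (f (g zero) +_) (listSum-tabulate (λ i → g (suc i)) f))
    (sym (sum-suc _))

  length-tabulate : ∀ {A : Set} {n} (g : Fin n → A) → length (tabulate g) ≡ n
  length-tabulate {n = zero}  g = refl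
  length-tabulate {n = suc n} g = cong suc (length-tabulate (λ i → g (suc i)))

  any-true : ∀ {A : Set} (p : A → Bool) {x xs} → x ∈ₗ xs → p x ≡ true → any p xs ≡ true
  any-true p {xs = y ∷ ys} (here refl) px rewrite px = refl
  any-true p {xs = y ∷ ys} (there x∈) px with p y
  ... | true  = refl
  ... | false = any-true p x∈ px

  vectors : ∀ {A : Set} → List A → ∀ m → List (Vec A m)
  vectors xs zero    = [] ∷ []
  vectors xs (suc m) = List.cartesianProductWith _∷_ xs (vectors xs m)

  length-vectors : ∀ {A : Set} (xs : List A) m → length (vectors xs m) ≡ length xs ^ m
  length-vectors xs zero    = refl
  length-vectors xs (suc m) = trans (product xs (vectors xs m)) (cong (length xs *_) (length-vectors xs m))
    where
    open import Data.List.Properties using (length-++; length-map)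
    product : ∀ xs (ys : List (Vec _ m)) → length (List.cartesianProductWith _∷_ xs ys) ≡ length xs * length ys
    product []       ys = refl
    product (x ∷ xs) ys = trans (length-++ (map (x ∷_) ys)) (cong₂ _+_ (length-map (x ∷_) ys) (product xs ys))

  ∈-vectors : ∀ {A : Set} {xs : List A} {m} (v : Vec A m) → (∀ i → lookup v i ∈ₗ xs) → v ∈ₗ vectors xs m
  ∈-vectors [] h = here refl
  ∈-vectors (x ∷ v) h = ∈-cartesianProductWith⁺ _∷_ (h zero) (∈-vectors v (λ i → h (suc i)))
    where open import Data.List.Membership.Propositional.Properties using (∈-cartesianProductWith⁺)

  ∈-subsets : ∀ {m} (E : Subset m) → E ∈ₗ subsets m
  ∈-subsets [] = here refl
  ∈-subsets {suc m} (outside ∷ E) = ∈-++⁺ˡ (∈-map⁺ (outside ∷_) (∈-subsets E))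
    where open import Data.List.Membership.Propositional.Properties using (∈-++⁺ˡ; ∈-map⁺)
  ∈-subsets {suc m} (inside ∷ E) = ∈-++⁺ʳ (map (outside ∷_) (subsets m)) (∈-map⁺ (inside ∷_) (∈-subsets E))
    where open import Data.List.Membership.Propositional.Properties using (∈-++⁺ʳ; ∈-map⁺)

  length-subsets : ∀ m → length (subsets m) ≡ 2 ^ m
  length-subsets zero    = refl
  length-subsets (suc m) = trans (length-++ (map (outside ∷_) (subsets m)))
    (cong₂ _+_ (trans (length-map (outside ∷_) (subsets m)) (length-subsets m))
      (trans (trans (length-map (inside ∷_) (subsets m)) (length-subsets m)) (sym (+-identityʳ (2 ^ m)))))
    where open import Data.List.Properties using (length-++; length-map)

  -- With the weights absorbed into f, this is independence of the coordinates.
  sum-prod : ∀ {m} (f : Fin m → Bool → ℕ) →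
    listSum (subsets m) (λ E → prod (λ i → f i (lookup E i))) ≡ prod (λ i → f i false + f i true)
  sum-prod {zero}  f = trans (+-identityʳ _) (trans (prod-zero _) (sym (prod-zero _)))
  sum-prod {suc m} f = begin
    listSum (map (outside ∷_) (subsets m) ++ map (inside ∷_) (subsets m)) φ
      ≡⟨ listSum-++ (map (outside ∷_) (subsets m)) _ φ ⟩
    listSum (map (outside ∷_) (subsets m)) φ + listSum (map (inside ∷_) (subsets m)) φ
      ≡⟨ cong₂ _+_ (half outside) (half inside) ⟩
    f zero false * rest + f zero true * rest
      ≡⟨ *-distribʳ-+ rest (f zero false) (f zero true) ⟨
    (f zero false + f zero true) * rest
      ≡⟨ cong ((f zero false + f zero true) *_) (sum-prod (λ i → f (suc i))) ⟩
    (f zero false + f zero true) * prod (λ i → f (suc i) false + f (suc i) true)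
      ≡⟨ prod-suc _ ⟨
    prod (λ i → f i false + f i true)  ∎
    where
    open ≡-Reasoning
    φ : Subset (suc m) → ℕ
    φ E = prod (λ i → f i (lookup E i))
    rest = listSum (subsets m) (λ E → prod (λ i → f (suc i) (lookup E i)))
    half : ∀ b → listSum (map (b ∷_) (subsets m)) φ ≡ f zero b * rest
    half b = trans (listSum-map (b ∷_) (subsets m) φ) (trans (listSum-cong (subsets m) (λ E → prod-suc _))
      (listSum-* (subsets m) (f zero b) _))

  -- The measure with weights a for the edges and b ∸ a for the non-edges; it is b ^ m
  -- times the probability at p = a / b.
  module Measure (a b : ℕ) {m : ℕ} where
    factor : Bool → ℕ
    factor true  = a
    factor false = b ∸ a

    mass : Subset m → ℕ
    mass E = prod (λ i → factor (lookup E i))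

    μ : (Subset m → Bool) → ℕ
    μ χ = listSum (subsets m) (λ E → mass E * 𝟙 (χ E))

    total : a ≤ b → μ (λ _ → true) ≡ b ^ m
    total a≤b = trans (listSum-cong (subsets m) (λ E → *-identityʳ (mass E)))
      (trans (sum-prod (λ _ → factor)) (trans (prod-cong {d = λ _ → b ∸ a + a} (λ _ → m∸n+n≡m a≤b))
        (prod-const m b)))

    μ-not : ∀ χ → μ χ + μ (λ E → not (χ E)) ≡ μ (λ _ → true)
    μ-not χ = trans (sym (listSum-+ (subsets m) _ _)) (listSum-cong (subsets m) (λ E →
      trans (sym (*-distribˡ-+ (mass E) (𝟙 (χ E)) (𝟙 (not (χ E))))) (cong (mass E *_) (bool (χ E)))))
      where
      bool : ∀ b → 𝟙 b + 𝟙 (not b) ≡ 1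
      bool true  = refl
      bool false = refl

    μ-∨ : ∀ χ χ′ → μ (λ E → χ E ∨ χ′ E) ≤ μ χ + μ χ′
    μ-∨ χ χ′ = ≤-trans (listSum-mono (subsets m) (λ E → ≤-trans (*-monoʳ-≤ (mass E) (bool (χ E) (χ′ E)))
      (≤-reflexive (*-distribˡ-+ (mass E) (𝟙 (χ E)) (𝟙 (χ′ E)))))) (≤-reflexive (listSum-+ (subsets m) _ _))
      where
      bool : ∀ b c → 𝟙 (b ∨ c) ≤ 𝟙 b + 𝟙 c
      bool true  c = s≤s z≤n
      bool false c = ≤-refl

    μ-any : ∀ {I : Set} (χ : I → Subset m → Bool) xs →
      μ (λ E → any (λ i → χ i E) xs) ≤ listSum xs (λ i → μ (χ i))
    μ-any χ []       = ≤-reflexive (trans (listSum-cong (subsets m) (λ E → *-zeroʳ (mass E)))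
      (listSum-0 (subsets m)))
    μ-any χ (x ∷ xs) = ≤-trans (μ-∨ (χ x) (λ E → any (λ i → χ i E) xs)) (+-monoʳ-≤ (μ (χ x)) (μ-any χ xs))

    μ-any-const : ∀ {I : Set} (χ : I → Subset m → Bool) xs C M → (∀ i → C * μ (χ i) ≤ M) →
      C * μ (λ E → any (λ i → χ i E) xs) ≤ length xs * M
    μ-any-const χ xs C M h = begin
      C * μ (λ E → any (λ i → χ i E) xs)   ≤⟨ *-monoʳ-≤ C (μ-any χ xs) ⟩
      C * listSum xs (λ i → μ (χ i))       ≡⟨ listSum-* xs C _ ⟨
      listSum xs (λ i → C * μ (χ i))       ≤⟨ listSum-mono xs h ⟩
      listSum xs (λ _ → M)                 ≡⟨ listSum-const xs M ⟩
      length xs * M                        ∎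
      where open ≤-Reasoning

    -- Markov's inequality for integral weights, with C/D as the threshold for `g`.
    markov : ∀ χ (g : Subset m → ℕ) C D → (∀ E → χ E ≡ true → C ≤ D * g E) →
      C * μ χ ≤ D * listSum (subsets m) (λ E → mass E * g E)
    markov χ g C D h = begin
      C * μ χ                                              ≡⟨ listSum-* (subsets m) C _ ⟨
      listSum (subsets m) (λ E → C * (mass E * 𝟙 (χ E)))   ≤⟨ listSum-mono (subsets m) (λ E → term E (χ E) refl)
        ⟩
      listSum (subsets m) (λ E → D * (mass E * g E))       ≡⟨ listSum-* (subsets m) D _ ⟩
      D * listSum (subsets m) (λ E → mass E * g E)         ∎
      where
      open ≤-Reasoning
      comm : ∀ a b c → a * (b * c) ≡ b * (a * c)
      comm = solve-∀
      term : ∀ E b → χ E ≡ b → C * (mass E * 𝟙 b) ≤ D * (mass E * g E)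
      term E false eq = ≤-trans (≤-reflexive (trans (cong (C *_) (*-zeroʳ (mass E))) (*-zeroʳ C))) z≤n
      term E true  eq = subst₂ _≤_ (sym (trans (comm C (mass E) 1) (cong (mass E *_) (*-identityʳ C))))
        (comm (mass E) D (g E))
        (*-monoʳ-≤ (mass E) (h E eq))

    expectation : (f : Fin m → Bool → ℕ) → listSum (subsets m) (λ E → mass E * prod (λ i → f i (lookup E i))) ≡
      prod (λ i → (b ∸ a) * f i false + a * f i true)
    expectation f = trans (listSum-cong (subsets m) (λ E → sym (prod-* _ _)))
      (sum-prod (λ i e → factor e * f i e))

-- Edge sets and their adjacency matrices

module EdgeSlots where
  open import Data.Nat.Base
  open import Data.Nat.Properties
  import Data.Fin.Base as Fin
  import Data.Fin.Properties as Finₚ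
  open import Data.Fin.Properties using (any?)
  open import Data.Bool.Properties using () renaming (_≟_ to _≟B_)
  open import Data.List.Base using (List; []; _∷_; map; length; filter; allFin; cartesianProduct)
  import Data.List.Base as List
  open import Data.List.Membership.Propositional using () renaming (_∈_ to _∈ₗ_)
  open import Data.List.Membership.Propositional.Properties using (∈-allFin; ∈-filter⁺; ∈-filter⁻; ∈-lookup; ∈-cartesianProduct⁺)
  open import Data.List.Relation.Unary.Any using (index)
  open import Data.List.Relation.Unary.Any.Properties using (lookup-index)
  import Data.List.Relation.Unary.All as All
  open import Data.List.Relation.Unary.AllPairs using (_∷_)
  open import Data.List.Relation.Unary.Unique.Propositional using (Unique)
  open import Data.List.Relation.Unary.Unique.Propositional.Properties using (filter⁺; cartesianProduct⁺; allFin⁺)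
  open import Data.Vec.Base using (lookup)
  open import Data.Product.Properties using (≡-dec)
  open import Relation.Nullary.Decidable using (_×-dec_; _⊎-dec_)
  open import Relation.Binary.Definitions using (tri<; tri≈; tri>)
  open VertexSets
  open BipartiteDensity
  open ProductMeasure
  open import Defs using (pairs; EdgeSet)

  sum-lookup : ∀ {A : Set} (xs : List A) (f : A → ℕ) → sum (λ k → f (List.lookup xs k)) ≡ listSum xs f
  sum-lookup []       f = sum-zero _
  sum-lookup (x ∷ xs) f = trans (sum-suc _) (cong (f x +_) (sum-lookup xs f))

  listSum-filter : ∀ {A : Set} {P : A → Set} (P? : ∀ x → Dec (P x)) xs (f : A → ℕ) →
    listSum (filter P? xs) f ≡ listSum xs (λ x → 𝟙 (does (P? x)) * f x)
  listSum-filter P? []       f = refl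
  listSum-filter P? (x ∷ xs) f with does (P? x)
  ... | true  = cong₂ _+_ (sym (+-identityʳ (f x))) (listSum-filter P? xs f)
  ... | false = listSum-filter P? xs f

  listSum-cartesianProduct : ∀ {A B : Set} (xs : List A) (ys : List B) (f : A × B → ℕ) →
    listSum (cartesianProduct xs ys) f ≡ listSum xs (λ x → listSum ys (λ y → f (x , y)))
  listSum-cartesianProduct []       ys f = refl
  listSum-cartesianProduct (x ∷ xs) ys f = trans (listSum-++ (map (x ,_) ys) _ f)
    (cong₂ _+_ (listSum-map (x ,_) ys f) (listSum-cartesianProduct xs ys f))

  lookup-injective : ∀ {A : Set} {xs : List A} → Unique xs → ∀ i j → List.lookup xs i ≡ List.lookup xs j → i ≡ j
  lookup-injective (x∉ ∷ u) zero    zero    eq = refl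
  lookup-injective (x∉ ∷ u) zero    (suc j) eq = ⊥-elim (All.lookup x∉ (∈-lookup j) eq)
  lookup-injective (x∉ ∷ u) (suc i) zero    eq = ⊥-elim (All.lookup x∉ (∈-lookup i) (sym eq))
  lookup-injective (x∉ ∷ u) (suc i) (suc j) eq = cong suc (lookup-injective u i j eq)

  module Slots (n : ℕ) where
    m : ℕ
    m = length (pairs n)

    pair : Fin m → Fin n × Fin n
    pair = List.lookup (pairs n)

    lo hi : Fin m → Fin n
    lo k = proj₁ (pair k)
    hi k = proj₂ (pair k)

    lo<hi : ∀ k → lo k Fin.< hi k
    lo<hi k = proj₂ (∈-filter⁻ (λ (i , j) → i Finₚ.<? j) {xs = cartesianProduct (allFin n) (allFin n)}
      (∈-lookup k))

    pair-injective : ∀ k k′ → pair k ≡ pair k′ → k ≡ k′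
    pair-injective = lookup-injective (filter⁺ (λ (i , j) → i Finₚ.<? j)
      (cartesianProduct⁺ (allFin⁺ n) (allFin⁺ n)))

    slot : ∀ i j → i Fin.< j → ∃[ k ] pair k ≡ (i , j)
    slot i j i<j = index ij∈ , sym (lookup-index ij∈)
      where
      ij∈ : (i , j) ∈ₗ pairs n
      ij∈ = ∈-filter⁺ (λ (i , j) → i Finₚ.<? j) (∈-cartesianProduct⁺ (∈-allFin i) (∈-allFin j)) i<j

    -- Every ordered pair of distinct vertices lies over exactly one slot, in one of its two orders.
    -- This translates the sums over independent slots into counts over vertices.
    slot-sum : ∀ (θ : Fin n → Fin n → ℕ) → (∀ i → θ i i ≡ 0) →
      sum (λ k → θ (lo k) (hi k) + θ (hi k) (lo k)) ≡ sum (λ i → sum (λ j → θ i j))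
    slot-sum θ θ-irr = begin
      sum (λ k → f (pair k))                                     ≡⟨ sum-lookup (pairs n) f ⟩
      listSum (pairs n) f                                        ≡⟨ listSum-filter (λ (i , j) → i Finₚ.<? j)
        (cartesianProduct (allFin n) (allFin n)) f ⟩
      listSum (cartesianProduct (allFin n) (allFin n)) g         ≡⟨ listSum-cartesianProduct (allFin n)
        (allFin n) g ⟩
      listSum (allFin n) (λ i → listSum (allFin n) (λ j → g (i , j)))
        ≡⟨ trans (listSum-tabulate (λ i → i) _) (sum-cong (λ i → listSum-tabulate (λ i → i) _)) ⟩
      sum (λ i → sum (λ j → lt i j * (θ i j + θ j i)))
        ≡⟨ sum-cong (λ i → trans (sum-cong (λ j → *-distribˡ-+ (lt i j) (θ i j) (θ j i))) (sum-+ _ _)) ⟩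
      sum (λ i → sum (λ j → lt i j * θ i j) + sum (λ j → lt i j * θ j i))
        ≡⟨ trans (sum-+ _ _) (cong (sum (λ i → sum (λ j → lt i j * θ i j)) +_)
          (sum-swap (λ i j → lt i j * θ j i))) ⟩
      sum (λ i → sum (λ j → lt i j * θ i j)) + sum (λ i → sum (λ j → lt j i * θ i j))
        ≡⟨ trans (sym (sum-+ _ _)) (sum-cong (λ i → trans (sym (sum-+ _ _)) (sum-cong (λ j → merge i j)))) ⟩
      sum (λ i → sum (λ j → θ i j))  ∎
      where
      open ≡-Reasoning
      f g : Fin n × Fin n → ℕ
      f (i , j) = θ i j + θ j i
      lt : Fin n → Fin n → ℕ
      lt i j = 𝟙 (does (i Finₚ.<? j))
      g x = 𝟙 (does (proj₁ x Finₚ.<? proj₂ x)) * f x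
      lt-yes : ∀ {i j} → i Fin.< j → lt i j ≡ 1
      lt-yes {i} {j} p = cong 𝟙 (true-does (i Finₚ.<? j) p)
      lt-no : ∀ {i j} → ¬ (i Fin.< j) → lt i j ≡ 0
      lt-no {i} {j} ¬p = cong 𝟙 (no-does (i Finₚ.<? j))
        where
        no-does : (d : Dec (i Fin.< j)) → does d ≡ false
        no-does (yes p) = ⊥-elim (¬p p)
        no-does (no _)  = refl
      merge : ∀ i j → lt i j * θ i j + lt j i * θ i j ≡ θ i j
      merge i j with Finₚ.<-cmp i j
      ... | tri< p _ ¬q = trans (cong₂ (λ u v → u * θ i j + v * θ i j) (lt-yes p) (lt-no ¬q))
        (trans (+-identityʳ _) (+-identityʳ _))
      ... | tri> ¬p _ q = trans (cong₂ (λ u v → u * θ i j + v * θ i j) (lt-no ¬p) (lt-yes q)) (+-identityʳ _)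
      ... | tri≈ _ refl _ = trans (cong (λ u → lt i i * u + lt i i * u) (θ-irr i))
        (trans (cong₂ _+_ (*-zeroʳ (lt i i)) (*-zeroʳ (lt i i))) (sym (θ-irr i)))

    Joins : Fin m → Fin n → Fin n → Set
    Joins k i j = pair k ≡ (i , j) ⊎ pair k ≡ (j , i)

    joined? : ∀ (E : EdgeSet n) i j → Dec (∃[ k ] lookup E k ≡ true × Joins k i j)
    joined? E i j = any? λ k → lookup E k ≟B true ×-dec
      (≡-dec Finₚ._≟_ Finₚ._≟_ (pair k) (i , j) ⊎-dec ≡-dec Finₚ._≟_ Finₚ._≟_ (pair k) (j , i))

    opaque
      adj : EdgeSet n → Adjacency n
      adj E i j = does (joined? E i j)

      adj⇒ : ∀ E i j → adj E i j ≡ true → ∃[ k ] lookup E k ≡ true × Joins k i j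
      adj⇒ E i j = does-true {P? = joined? E i j}

      ⇒adj : ∀ E i j k → lookup E k ≡ true → Joins k i j → adj E i j ≡ true
      ⇒adj E i j k k∈ joins = true-does (joined? E i j) (k , k∈ , joins)

    bool-ext : ∀ {a b} → (a ≡ true → b ≡ true) → (b ≡ true → a ≡ true) → a ≡ b
    bool-ext {true}  {b}     f g = sym (f refl)
    bool-ext {false} {true}  f g = g refl
    bool-ext {false} {false} f g = refl

    -- No other slot joins the same two vertices: `pair` is injective, and the reversed pair is
    -- excluded by `lo<hi`.
    adj-slot : ∀ E k → adj E (lo k) (hi k) ≡ lookup E k
    adj-slot E k = bool-ext unique (λ k∈ → ⇒adj E (lo k) (hi k) k k∈ (inj₁ refl))
      where
      unique : adj E (lo k) (hi k) ≡ true → lookup E k ≡ true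
      unique a with adj⇒ E (lo k) (hi k) a
      ... | k′ , k′∈ , inj₁ eq = subst (λ k → lookup E k ≡ true) (pair-injective k′ k eq) k′∈
      ... | k′ , k′∈ , inj₂ eq = ⊥-elim (<-asym (lo<hi k) (subst₂ (λ u v → u Fin.< v) (cong proj₁ eq)
        (cong proj₂ eq) (lo<hi k′)))

    adj-sym : ∀ E → Symmetric (adj E)
    adj-sym E i j = bool-ext (flip i j) (flip j i)
      where
      flip : ∀ i j → adj E i j ≡ true → adj E j i ≡ true
      flip i j a with adj⇒ E i j a
      ... | k , k∈ , inj₁ eq = ⇒adj E j i k k∈ (inj₂ eq)
      ... | k , k∈ , inj₂ eq = ⇒adj E j i k k∈ (inj₁ eq)

    adj-irr : ∀ E → Irreflexive (adj E)
    adj-irr E i = bool-ext absurd (λ ())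
      where
      absurd : adj E i i ≡ true → false ≡ true
      absurd a with adj⇒ E i i a
      ... | k , _ , inj₁ eq = ⊥-elim (<-irrefl (cong toℕ (trans (cong proj₁ eq) (sym (cong proj₂ eq))))
        (lo<hi k))
      ... | k , _ , inj₂ eq = ⊥-elim (<-irrefl (cong toℕ (trans (cong proj₁ eq) (sym (cong proj₂ eq))))
        (lo<hi k))

    adj-mono : ∀ F E → (∀ k → lookup F k ≡ true → lookup E k ≡ true) → ∀ i j → adj F i j ≡ true → adj E i j ≡
      true
    adj-mono F E F⊆E i j a with adj⇒ F i j a
    ... | k , k∈ , joins = ⇒adj E i j k (F⊆E k k∈) joins

    edge-sum : ∀ E (θ : Fin n → Fin n → ℕ) →
      sum (λ k → 𝟙 (lookup E k) * (θ (lo k) (hi k) + θ (hi k) (lo k))) ≡ sum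
        (λ i → sum (λ j → 𝟙 (adj E i j) * θ i j))
    edge-sum E θ = trans (sum-cong (λ k → trans (*-distribˡ-+ (𝟙 (lookup E k)) (θ (lo k) (hi k))
      (θ (hi k) (lo k)))
        (cong₂ (λ u v → 𝟙 u * θ (lo k) (hi k) + 𝟙 v * θ (hi k) (lo k)) (sym (adj-slot E k))
          (sym (trans (adj-sym E (hi k) (lo k)) (adj-slot E k))))))
      (slot-sum (λ i j → 𝟙 (adj E i j) * θ i j) (λ i → cong (λ b → 𝟙 b * θ i i) (adj-irr E i)))

    slot-count : m + m + n ≡ n * n
    slot-count = begin
      m + m + n                     ≡⟨ cong (_+ n) (trans (double m) (sym (sum-const m 2))) ⟩
      sum {m} (λ _ → 2) + n         ≡⟨ cong (_+ n) (sum-cong (λ k → sym (two k))) ⟩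
      sum (λ k → off (lo k) (hi k) + off (hi k) (lo k)) + n  ≡⟨ cong₂ _+_ (slot-sum off off-irr)
        (sym (trans (sum-const n 1) (*-identityʳ n))) ⟩
      sum (λ i → sum (λ j → off i j)) + sum {n} (λ _ → 1)   ≡⟨ sum-+ _ _ ⟨
      sum (λ i → sum (λ j → off i j) + 1)                   ≡⟨ sum-cong row ⟩
      sum {n} (λ _ → n)                                     ≡⟨ sum-const n n ⟩
      n * n                                                 ∎
      where
      open ≡-Reasoning
      double : ∀ m → m + m ≡ m * 2
      double = solve-∀
      off : Fin n → Fin n → ℕ
      off i j = 𝟙 (not (⁅ i ⁆ j))
      off-irr : ∀ i → off i i ≡ 0
      off-irr i = cong (λ b → 𝟙 (not b)) (true-does (i Finₚ.≟ i) refl)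
      off-≢ : ∀ {i j} → ¬ (i ≡ j) → off i j ≡ 1
      off-≢ {i} {j} i≢j = cong 𝟙 (not-intro (λ mem → i≢j (∈⁅⁆ i j mem)))
      two : ∀ k → off (lo k) (hi k) + off (hi k) (lo k) ≡ 2
      two k = cong₂ _+_ (off-≢ (λ eq → <-irrefl (cong toℕ eq) (lo<hi k)))
        (off-≢ (λ eq → <-irrefl (cong toℕ (sym eq)) (lo<hi k)))
      row : ∀ i → sum (λ j → off i j) + 1 ≡ n
      row i = trans (cong (sum (λ j → off i j) +_) (trans (sym (#⁅⁆ i)) (#-def ⁅ i ⁆)))
        (trans (sym (sum-+ _ _)) (trans (sum-cong (λ j → bool (⁅ i ⁆ j)))
          (trans (sum-const n 1) (*-identityʳ n))))
        where
        bool : ∀ b → 𝟙 (not b) + 𝟙 b ≡ 1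
        bool true  = refl
        bool false = refl

-- Exceptional events

module ExposureBound where
  open import Data.Nat.Base
  open import Data.Nat.Properties
  open import Data.Fin.Subset using (Subset)
  open import Data.Bool.ListAction using (any)
  open import Data.Vec.Base using (lookup)
  open VertexSets
  open BipartiteDensity
  open ProductMeasure
  open import Defs using (subsets)

  ^-reflects-≤ : ∀ {x y} → 2 ^ x ≤ 2 ^ y → x ≤ y
  ^-reflects-≤ {x} {y} h = ≮⇒≥ λ y<x → <-irrefl refl (<-≤-trans (^-monoʳ-< 2 (s≤s (s≤s z≤n)) y<x) h)

  ^-comm : ∀ x y z → (x ^ y) ^ z ≡ (x ^ z) ^ y
  ^-comm x y z = trans (^-*-assoc x y z) (trans (cong (x ^_) (*-comm y z)) (sym (^-*-assoc x z y)))

  ^-*-distrib : ∀ x y n → (x * y) ^ n ≡ x ^ n * y ^ n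
  ^-*-distrib x y zero    = refl
  ^-*-distrib x y (suc n) = trans (cong (x * y *_) (^-*-distrib x y n)) (interchange x y (x ^ n) (y ^ n))
    where
    interchange : ∀ a b c d → a * b * (c * d) ≡ a * c * (b * d)
    interchange = solve-∀

  -- From (1 + 1/x)^i ≤ x/(x - i) at x = 2k, i = k.
  suc-^-≤ : ∀ k → 0 < k → suc k ^ k ≤ 4 * k ^ k
  suc-^-≤ k 0<k = cancel-* ((4 * k) ^ k) (pow-pos (4 * k) k (*-mono-< {0} {4} z<s 0<k)) (begin
    (4 * k) ^ k * suc k ^ k              ≡⟨ ^-*-distrib (4 * k) (suc k) k ⟨
    (4 * k * suc k) ^ k                  ≤⟨ ^-monoˡ-≤ k (lin 1 (≤-refl {0}) (square k)) ⟩
    (suc x * suc x) ^ k                  ≡⟨ ^-*-distrib (suc x) (suc x) k ⟩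
    suc x ^ k * suc x ^ k                ≤⟨ *-mono-≤ half half ⟩
    2 * x ^ k * (2 * x ^ k)              ≡⟨ regroup (x ^ k) ⟩
    4 * (x ^ k * x ^ k)                  ≡⟨ cong (4 *_) (trans (sym (^-*-distrib x x k))
      (trans (cong (_^ k) (double k)) (^-*-distrib (4 * k) k k))) ⟩
    4 * ((4 * k) ^ k * k ^ k)            ≡⟨ comm ((4 * k) ^ k) (k ^ k) ⟩
    (4 * k) ^ k * (4 * k ^ k)            ∎)
    where
    open ≤-Reasoning
    x = k + k
    pow-pos : ∀ x n → 0 < x → 0 < x ^ n
    pow-pos x n 0<x = m^n>0 x {{>-nonZero 0<x}} n
    square : ∀ k → suc (k + k) * suc (k + k) + 0 ≡ 4 * k * suc k + 0 + 1
    square = solve-∀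
    double : ∀ k → (k + k) * (k + k) ≡ 4 * k * k
    double = solve-∀
    regroup : ∀ t → 2 * t * (2 * t) ≡ 4 * (t * t)
    regroup = solve-∀
    comm : ∀ s t → 4 * (s * t) ≡ s * (4 * t)
    comm = solve-∀
    step : ∀ i j x → i + j ≡ x → suc x ^ i * j ≤ x ^ i * x
    step zero    j x refl = ≤-refl
    step (suc i) j x refl = lin (suc x ^ i * suc i) (x ⊗ step i (suc j) x (+-suc i j))
      (identity i j (suc x ^ i) (x ^ i))
      where
      identity : ∀ i j p q → let x = suc (i + j) in
        x * q * x + x * (p * suc j) ≡ suc x * p * j + x * (q * x) + p * suc i
      identity = solve-∀
    half : suc x ^ k ≤ 2 * x ^ k
    half = cancel-* k 0<k (≤-trans (≤-reflexive (*-comm k (suc x ^ k))) (≤-trans (step k k x refl)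
      (≤-reflexive (reg k (x ^ k)))))
      where
      reg : ∀ k t → t * (k + k) ≡ k * (2 * t)
      reg = solve-∀

  module _ (k : ℕ) (0<k : 0 < k) where

    -- Cancelling the base (1 + 1/k) ≤ 4^(1/k).
    to-exponents : ∀ J u v → k ^ J * 2 ^ u ≤ suc k ^ J * 2 ^ v → k * u ≤ 2 * J + k * v
    to-exponents J u v le = ^-reflects-≤
      (cancel-* ((k ^ k) ^ J) (m^n>0 (k ^ k) {{>-nonZero (m^n>0 k {{>-nonZero 0<k}} k)}} J) (begin
      (k ^ k) ^ J * 2 ^ (k * u)              ≡⟨ cong₂ _*_ (^-comm k k J) (trans (cong (2 ^_) (*-comm k u))
        (sym (^-*-assoc 2 u k))) ⟩
      (k ^ J) ^ k * (2 ^ u) ^ k              ≡⟨ ^-*-distrib (k ^ J) (2 ^ u) k ⟨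
      (k ^ J * 2 ^ u) ^ k                    ≤⟨ ^-monoˡ-≤ k le ⟩
      (suc k ^ J * 2 ^ v) ^ k                ≡⟨ ^-*-distrib (suc k ^ J) (2 ^ v) k ⟩
      (suc k ^ J) ^ k * (2 ^ v) ^ k          ≡⟨ cong₂ _*_ (^-comm (suc k) J k) (trans (^-*-assoc 2 v k)
        (cong (2 ^_) (*-comm v k))) ⟩
      (suc k ^ k) ^ J * 2 ^ (k * v)          ≤⟨ *-monoˡ-≤ (2 ^ (k * v)) (^-monoˡ-≤ J (suc-^-≤ k 0<k)) ⟩
      (4 * k ^ k) ^ J * 2 ^ (k * v)          ≡⟨ cong (_* 2 ^ (k * v)) (trans (^-*-distrib 4 (k ^ k) J)
        (cong (_* (k ^ k) ^ J) (^-*-assoc 2 2 J))) ⟩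
      2 ^ (2 * J) * (k ^ k) ^ J * 2 ^ (k * v)  ≡⟨ comm (2 ^ (2 * J)) ((k ^ k) ^ J) (2 ^ (k * v)) ⟩
      (k ^ k) ^ J * (2 ^ (2 * J) * 2 ^ (k * v))  ≡⟨ cong ((k ^ k) ^ J *_) (^-distribˡ-+-* 2 (2 * J) (k * v)) ⟨
      (k ^ k) ^ J * 2 ^ (2 * J + k * v)      ∎))
      where
      open ≤-Reasoning
      comm : ∀ a b c → a * b * c ≡ b * (a * c)
      comm = solve-∀

    -- F is exposed within the slots SB; afterwards, the edges in the slots selected by
    -- ψ F are counted with weight 2^g.
    module Exposure {m : ℕ} (SB : Fin m → Bool) (ψ : Subset m → Fin m → Bool) (g bits : ℕ) where
      -- The product vanishes unless F lies in E and in `SB`. Slots of `SB` outside F stay free,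
      -- since F will consist of the edges of a subgraph and not of all edges of E there.
      fac : Subset m → Fin m → Bool → ℕ
      fac F i e = if lookup F i then (if SB i then 𝟙 e else 0) else (if ψ F i ∧ e then 2 ^ g else 1)

      N : ℕ
      N = sum (λ i → 𝟙 (SB i))

      Ψ : Subset m → ℕ
      Ψ F = sum (λ i → 𝟙 (ψ F i))

      W : Subset m → Subset m → ℕ
      W F E = sum (λ i → 𝟙 (ψ F i ∧ lookup E i))

      -- The exponent of 1 + 1/k that bounds the total weight: 2^g for each selected slot, and 1 for
      -- each slot of `SB` on account of the sum over all F.
      J : Subset m → ℕ
      J F = 2 ^ g * Ψ F + N

      weight : Subset m → Subset m → ℕ
      weight F E = prod (λ i → fac F i (lookup E i))

      event? : ∀ F E → Dec (suc k ^ J F * 2 ^ bits ≤ k ^ J F * weight F E)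
      event? F E = suc k ^ J F * 2 ^ bits ≤? k ^ J F * weight F E

      event : Subset m → Subset m → Bool
      event F E = does (event? F E)

      -- If F lies in E and in `SB` and avoids the selected slots, its slots contribute 1 and the
      -- weight is exactly 2^(gW).
      no-event : ∀ F E → event F E ≡ false →
        (∀ i → lookup F i ≡ true → lookup E i ≡ true × SB i ≡ true × ψ F i ≡ false) →
        k * (g * W F E) ≤ 2 * J F + k * bits
      no-event F E none F⊆ = to-exponents (J F) (g * W F E) bits
        (≤-trans (≤-reflexive (cong (k ^ J F *_) (sym weight≡)))
          (<⇒≤ (≰⇒> (λ le → case (trans (sym (true-does (event? F E) le)) none)))))
        where
        case : true ≡ false → ⊥
        case ()
        term : ∀ f e s p → (f ≡ true → e ≡ true × s ≡ true × p ≡ false) →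
          (if f then (if s then 𝟙 e else 0) else (if p ∧ e then 2 ^ g else 1)) ≡ (2 ^ g) ^ 𝟙 (p ∧ e)
        term true e s p h with h refl
        ... | refl , refl , refl = refl
        term false true  s true  h = sym (*-identityʳ (2 ^ g))
        term false false s true  h = refl
        term false e     s false h = refl
        weight≡ : weight F E ≡ 2 ^ (g * W F E)
        weight≡ = trans (prod-cong (λ i → term (lookup F i) (lookup E i) (SB i) (ψ F i) (F⊆ i)))
          (trans (prod-^ (2 ^ g) _) (^-*-assoc 2 g (W F E)))

      module _ (a b : ℕ) (ka≤b : k * a ≤ b) where
        open Measure a b {m}

        a≤b : a ≤ b
        a≤b = ≤-trans (m≤n*m a k {{>-nonZero 0<k}}) ka≤b

        φ : Fin m → Bool → ℕ
        φ i f = if f then (if SB i then a else 0) else b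

        -- With p = a/b ≤ 1/k this is (1 - p) + p 2^g ≤ 1 + 2^g/k ≤ (1 + 1/k)^(2^g).
        boost : k ^ 2 ^ g * ((b ∸ a) + a * 2 ^ g) ≤ suc k ^ 2 ^ g * b
        boost = cancel-* k 0<k (begin
          k * (p * ((b ∸ a) + a * c))   ≤⟨ *-monoʳ-≤ k (*-monoʳ-≤ p (+-monoˡ-≤ (a * c) (m∸n≤m b a))) ⟩
          k * (p * (b + a * c))         ≤⟨ lin 0 (p * c ⊗ ka≤b ⊕ b ⊗ bernoulli k c)
            (identity k p a b c (suc k ^ c)) ⟩
          k * (suc k ^ c * b)           ∎)
          where
          open ≤-Reasoning
          c = 2 ^ g
          p = k ^ c
          identity : ∀ k p a b c q → k * (q * b) + (p * c * (k * a) + b * (p * (k + c))) ≡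
            k * (p * (b + a * c)) + (p * c * b + b * (q * k)) + 0
          identity = solve-∀

        term : ∀ f s p → let t = λ e → if f then (if s then 𝟙 e else 0) else (if p ∧ e then 2 ^ g else 1) in
          k ^ (2 ^ g * 𝟙 p) * ((b ∸ a) * t false + a * t true) ≤
          suc k ^ (2 ^ g * 𝟙 p) * (if f then (if s then a else 0) else b)
        term true true p = *-mono-≤ (^-monoˡ-≤ (2 ^ g * 𝟙 p) (n≤1+n k))
          (≤-reflexive (trans (cong₂ _+_ (*-zeroʳ (b ∸ a)) (*-identityʳ a)) refl))
        term true false p = *-mono-≤ (^-monoˡ-≤ (2 ^ g * 𝟙 p) (n≤1+n k))
          (≤-reflexive (cong₂ _+_ (*-zeroʳ (b ∸ a)) (*-zeroʳ a)))
        term false s true = subst₂ _≤_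
          (cong₂ (λ u v → k ^ u * (v + a * 2 ^ g)) (sym (*-identityʳ (2 ^ g))) (sym (*-identityʳ (b ∸ a))))
          (cong (λ u → suc k ^ u * b) (sym (*-identityʳ (2 ^ g)))) boost
        term false s false = *-mono-≤ (^-monoˡ-≤ (2 ^ g * 0) (n≤1+n k))
          (≤-reflexive (trans (cong₂ _+_ (*-identityʳ (b ∸ a)) (*-identityʳ a)) (m∸n+n≡m a≤b)))

        T : Subset m → ℕ
        T F = prod (λ i → (b ∸ a) * fac F i false + a * fac F i true)

        Φ : Subset m → ℕ
        Φ F = prod (λ i → φ i (lookup F i))

        power : ∀ c F → prod (λ i → c ^ (2 ^ g * 𝟙 (ψ F i))) ≡ c ^ (2 ^ g * Ψ F)
        power c F = trans (prod-^ c _) (cong (c ^_) (sum-* (2 ^ g) _))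

        T≤ : ∀ F → k ^ (2 ^ g * Ψ F) * T F ≤ suc k ^ (2 ^ g * Ψ F) * Φ F
        T≤ F = subst₂ _≤_ (trans (prod-* _ _) (cong (_* T F) (power k F)))
          (trans (prod-* _ _) (cong (_* Φ F) (power (suc k) F)))
          (prod-mono (λ i → term (lookup F i) (SB i) (ψ F i)))

        μ-event : ∀ F → suc k ^ N * 2 ^ bits * μ (event F) ≤ k ^ N * Φ F
        μ-event F = cancel-* (suc k ^ (2 ^ g * Ψ F)) (m^n>0 (suc k) (2 ^ g * Ψ F)) (begin
          r * (suc k ^ N * 2 ^ bits * μ (event F))   ≡⟨ trans (assoc r (suc k ^ N) (2 ^ bits) (μ (event F)))
            (cong (λ t → t * 2 ^ bits * μ (event F)) (sym (^-distribˡ-+-* (suc k) (2 ^ g * Ψ F) N))) ⟩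
          suc k ^ J F * 2 ^ bits * μ (event F)       ≤⟨ markov (event F) (weight F) _ (k ^ J F)
            (λ E eq → does-true {P? = event? F E} eq) ⟩
          k ^ J F * listSum (subsets m) (λ E → mass E * weight F E)  ≡⟨ cong (k ^ J F *_) (expectation (fac F))
            ⟩
          k ^ J F * T F                              ≡⟨ trans
            (cong (_* T F) (trans (^-distribˡ-+-* k (2 ^ g * Ψ F) N) (*-comm (k ^ (2 ^ g * Ψ F)) (k ^ N))))
            (*-assoc (k ^ N) (k ^ (2 ^ g * Ψ F)) (T F)) ⟩
          k ^ N * (k ^ (2 ^ g * Ψ F) * T F)          ≤⟨ *-monoʳ-≤ (k ^ N) (T≤ F) ⟩
          k ^ N * (r * Φ F)                          ≡⟨ comm (k ^ N) r (Φ F) ⟩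
          r * (k ^ N * Φ F)                          ∎)
          where
          open ≤-Reasoning
          r = suc k ^ (2 ^ g * Ψ F)
          assoc : ∀ a b c d → a * (b * c * d) ≡ a * b * c * d
          assoc = solve-∀
          comm : ∀ a b c → a * (b * c) ≡ b * (a * c)
          comm = solve-∀

        -- The sum of p^|F| over the subsets F of `SB` is (1 + p)^N. This is the whole cost of
        -- letting the subgraph be arbitrary between S and B.
        ΣΦ≤ : k ^ N * listSum (subsets m) Φ ≤ suc k ^ N * b ^ m
        ΣΦ≤ = subst₂ _≤_ (trans (prod-* _ _) (cong₂ _*_ (prod-^ k _) (sym (sum-prod φ))))
          (trans (prod-* _ _) (cong₂ _*_ (prod-^ (suc k) _) (prod-const m b)))
          (prod-mono (λ i → slot-term (SB i)))
          where
          slot-term : ∀ s → k ^ 𝟙 s * (b + (if s then a else 0)) ≤ suc k ^ 𝟙 s * b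
          slot-term true  = lin 0 ka≤b (identity k a b)
            where
            identity : ∀ k a b → suc k * 1 * b + k * a ≡ k * 1 * (b + a) + b + 0
            identity = solve-∀
          slot-term false = ≤-reflexive (cong (1 *_) (+-identityʳ b))

        μ-exposure : 2 ^ bits * μ (λ E → any (λ F → event F E) (subsets m)) ≤ b ^ m
        μ-exposure = cancel-* (suc k ^ N) (m^n>0 (suc k) N) (begin
          suc k ^ N * (2 ^ bits * μ (λ E → any (λ F → event F E) (subsets m)))
            ≡⟨ *-assoc (suc k ^ N) (2 ^ bits) _ ⟨
          suc k ^ N * 2 ^ bits * μ (λ E → any (λ F → event F E) (subsets m))
            ≤⟨ *-monoʳ-≤ (suc k ^ N * 2 ^ bits) (μ-any event (subsets m)) ⟩
          suc k ^ N * 2 ^ bits * listSum (subsets m) (λ F → μ (event F))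
            ≡⟨ listSum-* (subsets m) (suc k ^ N * 2 ^ bits) _ ⟨
          listSum (subsets m) (λ F → suc k ^ N * 2 ^ bits * μ (event F))
            ≤⟨ listSum-mono (subsets m) μ-event ⟩
          listSum (subsets m) (λ F → k ^ N * Φ F)
            ≡⟨ listSum-* (subsets m) (k ^ N) Φ ⟩
          k ^ N * listSum (subsets m) Φ
            ≤⟨ ΣΦ≤ ⟩
          suc k ^ N * b ^ m  ∎)
          where open ≤-Reasoning

-- A union bound over sets and lists for the expansion property

module ExpansionEvents where
  open import Data.Nat.Base
  open import Data.Nat.Properties
  import Data.Fin.Base as Fin
  import Data.Fin.Properties as Finₚ
  open import Data.Fin.Subset using (Subset)
  open import Data.Bool.ListAction using (any)
  open import Data.List.Base using (List; []; _∷_; length; allFin)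
  open import Data.List.Membership.Propositional using () renaming (_∈_ to _∈ₗ_)
  open import Data.List.Membership.Propositional.Properties using (∈-allFin)
  open import Data.List.Relation.Unary.All using (All; []; _∷_)
  open import Data.Vec.Base using (Vec; []; _∷_; lookup; tabulate; toList)
  open import Data.Vec.Properties using (lookup∘tabulate)
  open import Relation.Binary.Definitions using (tri<; tri≈; tri>)
  open VertexSets
  open BipartiteDensity
  open Coverings
  open ProductMeasure
  open EdgeSlots
  open ExposureBound
  open import Defs using (subsets; EdgeSet)

  -- Lists are brought to the exact length `L` by repeating `v` itself. This does not enlarge the
  -- covered set: `v` lies in Z and is incident with no exposed edge.
  pad : ∀ {A : Set} → A → List A → ∀ L → Vec A L
  pad v xs       zero    = []
  pad v []       (suc L) = v ∷ pad v [] L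
  pad v (u ∷ xs) (suc L) = u ∷ pad v xs L

  cov-pad : ∀ {n} (h h′ : Adjacency n) v xs L y → length xs ≤ L → h v y ≡ false →
    All (λ u → h u y ≡ h′ u y) xs → cov h (toList (pad v xs L)) y ≡ cov h′ xs y
  cov-pad h h′ v []       zero    y len v≁y eqs = refl
  cov-pad h h′ v []       (suc L) y len v≁y []  = trans (cong (_∨ cov h (toList (pad v [] L)) y) v≁y)
    (cov-pad h h′ v [] L y z≤n v≁y [])
  cov-pad h h′ v (u ∷ xs) (suc L) y (s≤s len) v≁y (eq ∷ eqs) = cong₂ _∨_ eq (cov-pad h h′ v xs L y len v≁y eqs)

  any-false : ∀ {A : Set} (p : A → Bool) {x xs} → any p xs ≡ false → x ∈ₗ xs → p x ≡ false
  any-false p {x} none x∈ with p x in eq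
  ... | false = refl
  ... | true  = trans (sym (any-true p x∈ eq)) none

  module ExpansionEvent (n k : ℕ) (0<k : 0 < k) (ℓ L g : ℕ) where
    open Slots n

    -- The first two summands bound the binary logarithm of the number of choices of `c`, `d` and
    -- `X`, given n ≤ 2^ℓ; the last leaves the failure probability 2^(-ℓ).
    bits = 2 * n + ℓ * (L * n) + ℓ

    -- Three disjoint sets, encoded by two.
    S B Z : Subset n → Subset n → VSet n
    S c d i = lookup c i ∧ lookup d i
    B c d i = lookup c i ∧ not (lookup d i)
    Z c d i = not (lookup c i) ∧ lookup d i

    Tables : Set
    Tables = Vec (Vec (Fin n) L) n

    -- Determined by the exposed edges F alone, so the slots from `v` into it are still independent.
    U : Subset n → Subset n → Tables → EdgeSet n → Fin n → VSet n
    U c d X F v = B c d ∖ cov (adj F) (toList (lookup X v))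

    SB : Subset n → Subset n → Fin m → Bool
    SB c d i = S c d (lo i) ∧ B c d (hi i) ∨ S c d (hi i) ∧ B c d (lo i)

    ψ : Subset n → Subset n → Tables → EdgeSet n → Fin m → Bool
    ψ c d X F i = Z c d (lo i) ∧ U c d X F (lo i) (hi i) ∨ Z c d (hi i) ∧ U c d X F (hi i) (lo i)

    module Ex c d X = Exposure k 0<k (SB c d) (ψ c d X) g bits

    tables = vectors (vectors (allFin n) L) n

    bad : EdgeSet n → Bool
    bad E = any (λ c → any (λ d → any (λ X → any (λ F → Ex.event c d X F E) (subsets m)) tables) (subsets n))
      (subsets n)

    μ-bad : ∀ a b → k * a ≤ b → n ≤ 2 ^ ℓ → 2 ^ ℓ * Measure.μ a b bad ≤ b ^ m
    μ-bad a b ka≤b n≤2^ℓ = cancel-* (2 ^ (2 * n + ℓ * (L * n))) (m^n>0 2 (2 * n + ℓ * (L * n))) (begin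
      2 ^ (2 * n + ℓ * (L * n)) * (2 ^ ℓ * μ bad)   ≡⟨ *-assoc (2 ^ (2 * n + ℓ * (L * n))) (2 ^ ℓ) (μ bad) ⟨
      2 ^ (2 * n + ℓ * (L * n)) * 2 ^ ℓ * μ bad     ≡⟨ cong (_* μ bad) (^-distribˡ-+-* 2 (2 * n + ℓ * (L * n))
        ℓ) ⟨
      2 ^ bits * μ bad                              ≤⟨ μ-any-const
        (λ c E → any (λ d → any (λ X → any (λ F → Ex.event c d X F E) (subsets m)) tables) (subsets n))
                                                         (subsets n) (2 ^ bits) (length (subsets n) *
                                                           (length tables * b ^ m)) (λ c →
                                                       μ-any-const (λ d E → any
                                                         (λ X → any (λ F → Ex.event c d X F E) (subsets m))
                                                         tables)
                                                         (subsets n) (2 ^ bits) (length tables * b ^ m) (λ d →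
                                                       μ-any-const (λ X E → any (λ F → Ex.event c d X F E)
                                                         (subsets m))
                                                         tables (2 ^ bits) (b ^ m) (λ X → Ex.μ-exposure c d X a
                                                           b ka≤b))) ⟩
      length (subsets n) * (length (subsets n) * (length tables * b ^ m))
        ≡⟨ cong₂ (λ u v → u * (u * (v * b ^ m))) (length-subsets n) lengths ⟩
      2 ^ n * (2 ^ n * ((n ^ L) ^ n * b ^ m))       ≤⟨ *-monoʳ-≤ (2 ^ n) (*-monoʳ-≤ (2 ^ n) (*-monoˡ-≤ (b ^ m)
                                                         (≤-trans (^-monoˡ-≤ n (^-monoˡ-≤ L n≤2^ℓ))
                                                           (≤-reflexive (trans (cong (_^ n) (^-*-assoc 2 ℓ L))
                                                           (trans (^-*-assoc 2 (ℓ * L) n)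
                                                           (cong (2 ^_) (*-assoc ℓ L n)))))))) ⟩
      2 ^ n * (2 ^ n * (2 ^ (ℓ * (L * n)) * b ^ m)) ≡⟨ regroup (2 ^ n) (2 ^ (ℓ * (L * n))) (b ^ m) ⟩
      2 ^ n * 2 ^ n * 2 ^ (ℓ * (L * n)) * b ^ m     ≡⟨ cong (λ t → t * 2 ^ (ℓ * (L * n)) * b ^ m)
        (trans (sym (^-distribˡ-+-* 2 n n)) (cong (λ t → 2 ^ (n + t)) (sym (+-identityʳ n)))) ⟩
      2 ^ (2 * n) * 2 ^ (ℓ * (L * n)) * b ^ m       ≡⟨ cong (_* b ^ m) (^-distribˡ-+-* 2 (2 * n) (ℓ * (L * n)))
        ⟨
      2 ^ (2 * n + ℓ * (L * n)) * b ^ m             ∎)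
      where
      open ≤-Reasoning
      open Measure a b {m}
      regroup : ∀ a b c → a * (a * (b * c)) ≡ a * a * b * c
      regroup = solve-∀
      lengths : length tables ≡ (n ^ L) ^ n
      lengths = trans (length-vectors (vectors (allFin n) L) n) (cong (_^ n)
        (trans (length-vectors (allFin n) L) (cong (_^ L) (length-tabulate (λ i → i)))))

    no-bad : ∀ E → bad E ≡ false → ∀ c d X F → Ex.event c d X F E ≡ false
    no-bad E none c d X F = any-false (λ F → Ex.event c d X F E)
      (any-false (λ X → any (λ F → Ex.event c d X F E) (subsets m))
      (any-false (λ d → any (λ X → any (λ F → Ex.event c d X F E) (subsets m)) tables)
        (any-false (λ c → any (λ d → any (λ X → any (λ F → Ex.event c d X F E) (subsets m)) tables) (subsets n))
          none (∈-subsets c)) (∈-subsets d))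
      (∈-vectors X (λ i → ∈-vectors (lookup X i) (λ j → ∈-allFin _)))) (∈-subsets F)

    𝟙-∨ : ∀ a b → (a ≡ true → b ≡ true → ⊥) → 𝟙 (a ∨ b) ≡ 𝟙 a + 𝟙 b
    𝟙-∨ true  true  h = ⊥-elim (h refl refl)
    𝟙-∨ true  false h = refl
    𝟙-∨ false b     h = refl

    -- Take for F the edges of `h` between `S₀` and `B₀`. Lists from `S₀` cover the same part of
    -- `B₀` in F as in `h`, so the bound for the events applies to the sets that `h` leaves
    -- uncovered.
    expansion : ∀ E → bad E ≡ false → ∀ h → Symmetric h → (∀ i j → h i j ≡ true → adj E i j ≡ true) → Expansion
      h k ℓ L g
    expansion E none h h-sym h⊆E S₀ B₀ Z₀ S#B S#Z B#Z X₀ X₀-length X₀⊆S = begin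
      g * k * ∑ Z₀ (λ v → # ((B₀ ∖ cov h (X₀ v)) ∩ h v))   ≡⟨ comm g k _ ⟩
      k * (g * ∑ Z₀ (λ v → # ((B₀ ∖ cov h (X₀ v)) ∩ h v))) ≤⟨ *-monoʳ-≤ k (*-monoʳ-≤ g W≥) ⟩
      k * (g * Ex.W c d X F E)                             ≤⟨ Ex.no-event c d X F E (no-bad E none c d X F) F-ok
        ⟩
      2 * Ex.J c d X F + k * bits                          ≡⟨ cong₂ (λ u v → 2 * (2 ^ g * u + v) + k * bits) Ψ≡
        N≡ ⟩
      2 * (2 ^ g * ∑ Z₀ (λ v → # (B₀ ∖ cov h (X₀ v))) + # S₀ * # B₀) + k * bits  ∎
      where
      open ≤-Reasoning
      comm : ∀ g k w → g * k * w ≡ k * (g * w)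
      comm = solve-∀
      c d : Subset n
      c = tabulate (λ i → S₀ i ∨ B₀ i)
      d = tabulate (λ i → S₀ i ∨ Z₀ i)
      S≡ : ∀ i → S c d i ≡ S₀ i
      S≡ i = trans (cong₂ _∧_ (lookup∘tabulate _ i) (lookup∘tabulate _ i)) (bool (S₀ i) (B₀ i) (Z₀ i) (B#Z i))
        where
        bool : ∀ s b z → (b ≡ true → z ≡ true → ⊥) → (s ∨ b) ∧ (s ∨ z) ≡ s
        bool true  b     z     h = refl
        bool false true  true  h = ⊥-elim (h refl refl)
        bool false true  false h = refl
        bool false false z     h = refl
      B≡ : ∀ i → B c d i ≡ B₀ i
      B≡ i = trans (cong₂ (λ u v → u ∧ not v) (lookup∘tabulate _ i) (lookup∘tabulate _ i))
        (bool (S₀ i) (B₀ i) (Z₀ i) (S#B i) (B#Z i))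
        where
        bool : ∀ s b z → (s ≡ true → b ≡ true → ⊥) → (b ≡ true → z ≡ true → ⊥) → (s ∨ b) ∧ not (s ∨ z) ≡ b
        bool true  true  z     h h′ = ⊥-elim (h refl refl)
        bool true  false z     h h′ = refl
        bool false true  true  h h′ = ⊥-elim (h′ refl refl)
        bool false true  false h h′ = refl
        bool false false z     h h′ = refl
      Z≡ : ∀ i → Z c d i ≡ Z₀ i
      Z≡ i = trans (cong₂ (λ u v → not u ∧ v) (lookup∘tabulate _ i) (lookup∘tabulate _ i))
        (bool (S₀ i) (B₀ i) (Z₀ i) (S#Z i) (B#Z i))
        where
        bool : ∀ s b z → (s ≡ true → z ≡ true → ⊥) → (b ≡ true → z ≡ true → ⊥) → not (s ∨ b) ∧ (s ∨ z) ≡ z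
        bool true  b     true  h h′ = ⊥-elim (h refl refl)
        bool true  b     false h h′ = refl
        bool false true  true  h h′ = ⊥-elim (h′ refl refl)
        bool false true  false h h′ = refl
        bool false false z     h h′ = refl
      F : EdgeSet n
      F = tabulate (λ i → SB c d i ∧ h (lo i) (hi i))
      X : Tables
      X = tabulate (λ v → pad v (X₀ v) L)

      F⇒ : ∀ i → lookup F i ≡ true → SB c d i ≡ true × h (lo i) (hi i) ≡ true
      F⇒ i f = let t = trans (sym (lookup∘tabulate _ i)) f in ∧-elimˡ t , ∧-elimʳ {SB c d i} t

      SB⇒ : ∀ i → SB c d i ≡ true → (lo i ∈ S₀ × hi i ∈ B₀) ⊎ (hi i ∈ S₀ × lo i ∈ B₀)
      SB⇒ i t = choose (S c d (lo i) ∧ B c d (hi i)) refl t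
        where
        choose : ∀ b → S c d (lo i) ∧ B c d (hi i) ≡ b → b ∨ S c d (hi i) ∧ B c d (lo i) ≡ true →
          (lo i ∈ S₀ × hi i ∈ B₀) ⊎ (hi i ∈ S₀ × lo i ∈ B₀)
        choose true  eq _ = inj₁ (trans (sym (S≡ (lo i))) (∧-elimˡ eq) , trans (sym (B≡ (hi i)))
          (∧-elimʳ {S c d (lo i)} eq))
        choose false eq t = inj₂ (trans (sym (S≡ (hi i))) (∧-elimˡ t) , trans (sym (B≡ (lo i)))
          (∧-elimʳ {S c d (hi i)} t))

      ψ⇒ : ∀ i → ψ c d X F i ≡ true → (lo i ∈ Z₀ × hi i ∈ B₀) ⊎ (hi i ∈ Z₀ × lo i ∈ B₀)
      ψ⇒ i t = choose (Z c d (lo i) ∧ U c d X F (lo i) (hi i)) refl t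
        where
        choose : ∀ b → Z c d (lo i) ∧ U c d X F (lo i) (hi i) ≡ b → b ∨ Z c d (hi i) ∧ U c d X F (hi i) (lo i) ≡
          true → (lo i ∈ Z₀ × hi i ∈ B₀) ⊎ (hi i ∈ Z₀ × lo i ∈ B₀)
        choose true  eq _ = inj₁ (trans (sym (Z≡ (lo i))) (∧-elimˡ eq) , trans (sym (B≡ (hi i)))
          (∧-elimˡ (∧-elimʳ {Z c d (lo i)} eq)))
        choose false eq t = inj₂ (trans (sym (Z≡ (hi i))) (∧-elimˡ t) , trans (sym (B≡ (lo i)))
          (∧-elimˡ (∧-elimʳ {Z c d (hi i)} t)))

      -- A slot between S and B and a slot between Z and B cannot coincide, as the three sets are
      -- disjoint; hence F avoids the slots that are counted.
      clash : ∀ i → (lo i ∈ S₀ × hi i ∈ B₀) ⊎ (hi i ∈ S₀ × lo i ∈ B₀) → (lo i ∈ Z₀ × hi i ∈ B₀) ⊎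
        (hi i ∈ Z₀ × lo i ∈ B₀) → ⊥
      clash i (inj₁ (s , b)) (inj₁ (z , b′)) = S#Z _ s z
      clash i (inj₁ (s , b)) (inj₂ (z , b′)) = B#Z _ b z
      clash i (inj₂ (s , b)) (inj₁ (z , b′)) = B#Z _ b z
      clash i (inj₂ (s , b)) (inj₂ (z , b′)) = S#Z _ s z

      F-ok : ∀ i → lookup F i ≡ true → lookup E i ≡ true × SB c d i ≡ true × ψ c d X F i ≡ false
      F-ok i f = let sb , e = F⇒ i f in trans (sym (adj-slot E i)) (h⊆E (lo i) (hi i) e) , sb ,
        bool-ext (λ p → ⊥-elim (clash i (SB⇒ i sb) (ψ⇒ i p))) (λ ())

      F⊆h : ∀ i j → adj F i j ≡ true → h i j ≡ true × ((i ∈ S₀ × j ∈ B₀) ⊎ (j ∈ S₀ × i ∈ B₀))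
      F⊆h i j t = choose (adj⇒ F i j t)
        where
        choose : (∃[ κ ] lookup F κ ≡ true × Joins κ i j) → h i j ≡ true ×
          ((i ∈ S₀ × j ∈ B₀) ⊎ (j ∈ S₀ × i ∈ B₀))
        choose (κ , f , inj₁ eq) = subst₂ (λ u v → h u v ≡ true × ((u ∈ S₀ × v ∈ B₀) ⊎ (v ∈ S₀ × u ∈ B₀)))
          (cong proj₁ eq) (cong proj₂ eq)
          (proj₂ (F⇒ κ f) , SB⇒ κ (proj₁ (F⇒ κ f)))
        choose (κ , f , inj₂ eq) = subst₂ (λ u v → h u v ≡ true × ((u ∈ S₀ × v ∈ B₀) ⊎ (v ∈ S₀ × u ∈ B₀)))
          (cong proj₂ eq) (cong proj₁ eq)
          (trans (h-sym (hi κ) (lo κ)) (proj₂ (F⇒ κ f)) , swap-⊎ (SB⇒ κ (proj₁ (F⇒ κ f))))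
          where
          swap-⊎ : ∀ {A B : Set} → A ⊎ B → B ⊎ A
          swap-⊎ (inj₁ a) = inj₂ a
          swap-⊎ (inj₂ b) = inj₁ b

      h⊆F : ∀ i j → h i j ≡ true → i ∈ S₀ → j ∈ B₀ → adj F i j ≡ true
      h⊆F i j e i∈ j∈ = choose (Finₚ.<-cmp i j)
        where
        found : ∀ {x y} κ → pair κ ≡ (x , y) → h x y ≡ true → SB c d κ ≡ true → lookup F κ ≡ true
        found κ refl e sb = trans (lookup∘tabulate _ κ) (∧-intro sb e)
        ∨-introˡ : ∀ {a b} → a ≡ true → a ∨ b ≡ true
        ∨-introˡ refl = refl
        ∨-introʳ : ∀ a {b} → b ≡ true → a ∨ b ≡ true
        ∨-introʳ true  _ = refl
        ∨-introʳ false t = t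
        choose : _ → adj F i j ≡ true
        choose (tri< i<j _ _) = let κ , eq = slot i j i<j in ⇒adj F i j κ (found κ eq e (∨-introˡ (∧-intro
          (subst (λ v → S c d v ≡ true) (sym (cong proj₁ eq)) (trans (S≡ i) i∈)) (subst (λ v → B c d v ≡ true)
            (sym (cong proj₂ eq)) (trans (B≡ j) j∈))))) (inj₁ eq)
        choose (tri≈ _ i≡j _) = ⊥-elim (S#B j (subst (_∈ S₀) i≡j i∈) j∈)
        choose (tri> _ _ j<i) = let κ , eq = slot j i j<i in ⇒adj F i j κ (found κ eq (trans (h-sym j i) e)
                                      (∨-introʳ (S c d (lo κ) ∧ B c d (hi κ)) (∧-intro
          (subst (λ v → S c d v ≡ true) (sym (cong proj₂ eq)) (trans (S≡ i) i∈)) (subst (λ v → B c d v ≡ true)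
            (sym (cong proj₁ eq)) (trans (B≡ j) j∈))))) (inj₂ eq)

      U≡ : ∀ v y → v ∈ Z₀ → U c d X F v y ≡ (B₀ ∖ cov h (X₀ v)) y
      U≡ v y v∈ = trans (cong₂ (λ u xs → u ∧ not (cov (adj F) (toList xs) y)) (B≡ y) (lookup∘tabulate _ v))
        (step (B₀ y) refl)
        where
        eqs : y ∈ B₀ → ∀ xs → All (_∈ S₀) xs → All (λ u → adj F u y ≡ h u y) xs
        eqs y∈ [] [] = []
        eqs y∈ (u ∷ xs) (u∈ ∷ xs⊆) = bool-ext (λ t → proj₁ (F⊆h u y t)) (λ e → h⊆F u y e u∈ y∈) ∷ eqs y∈ xs xs⊆
        v≁y : adj F v y ≡ false
        v≁y = bool-ext (λ t → ⊥-elim (impossible (proj₂ (F⊆h v y t)))) (λ ())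
          where
          impossible : (v ∈ S₀ × y ∈ B₀) ⊎ (y ∈ S₀ × v ∈ B₀) → ⊥
          impossible (inj₁ (s , _)) = S#Z v s v∈
          impossible (inj₂ (_ , b)) = B#Z v b v∈
        step : ∀ b → B₀ y ≡ b → b ∧ not (cov (adj F) (toList (pad v (X₀ v) L)) y) ≡ b ∧ not (cov h (X₀ v) y)
        step true  eq = cong not (cov-pad (adj F) h v (X₀ v) L y (X₀-length v) v≁y (eqs eq (X₀ v) (X₀⊆S v)))
        step false eq = refl

      θ : Fin n → Fin n → ℕ
      θ i j = 𝟙 (Z c d i ∧ U c d X F i j)

      Z#B : ∀ i → i ∈ Z c d → i ∈ B c d → ⊥
      Z#B i z b = B#Z i (trans (sym (B≡ i)) b) (trans (sym (Z≡ i)) z)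

      θ-irr : ∀ i → θ i i ≡ 0
      θ-irr i = cong 𝟙 (bool-ext (λ t → ⊥-elim (Z#B i (∧-elimˡ t) (∧-elimˡ (∧-elimʳ {Z c d i} t)))) (λ ()))

      ψ≡ : ∀ i → 𝟙 (ψ c d X F i) ≡ θ (lo i) (hi i) + θ (hi i) (lo i)
      ψ≡ i = 𝟙-∨ _ _ (λ s t → Z#B (lo i) (∧-elimˡ s) (∧-elimˡ (∧-elimʳ {Z c d (hi i)} t)))

      rows : ∀ (w : Fin n → Fin n → ℕ) → sum (λ i → sum (λ j → w i j * θ i j)) ≡ ∑ Z₀
        (λ v → sum (λ y → w v y * 𝟙 ((B₀ ∖ cov h (X₀ v)) y)))
      rows w = trans (sum-cong (λ i → trans (sum-cong (λ j → row i j (Z₀ i) refl)) (sum-* (𝟙 (Z₀ i)) _)))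
        (sym (∑-def Z₀ _))
        where
        row : ∀ i j b → Z₀ i ≡ b → w i j * θ i j ≡ 𝟙 b * (w i j * 𝟙 ((B₀ ∖ cov h (X₀ i)) j))
        row i j true  eq = trans (cong (λ t → w i j * 𝟙 t) (cong₂ _∧_ (trans (Z≡ i) eq) (U≡ i j eq)))
          (sym (*-identityˡ _))
        row i j false eq = trans (cong (λ t → w i j * 𝟙 (t ∧ U c d X F i j)) (trans (Z≡ i) eq))
          (*-zeroʳ (w i j))

      Ψ≡ : Ex.Ψ c d X F ≡ ∑ Z₀ (λ v → # (B₀ ∖ cov h (X₀ v)))
      Ψ≡ = trans (sum-cong ψ≡) (trans (slot-sum θ θ-irr)
        (trans (sum-cong (λ i → sum-cong (λ j → sym (*-identityˡ (θ i j)))))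
        (trans (rows (λ _ _ → 1)) (∑-cong {X = Z₀} (λ v _ → trans (sum-cong (λ y → *-identityˡ _))
          (sym (#-def _)))))))

      N≡ : Ex.N c d X ≡ # S₀ * # B₀
      N≡ = trans (sum-cong (λ i → 𝟙-∨ _ _ (λ s t → S#B (lo i) (trans (sym (S≡ (lo i))) (∧-elimˡ s))
        (trans (sym (B≡ (lo i))) (∧-elimʳ {S c d (hi i)} t)))))
        (trans (slot-sum (λ i j → 𝟙 (S c d i ∧ B c d j))
          (λ i → cong 𝟙 (bool-ext (λ t → ⊥-elim (S#B i (trans (sym (S≡ i)) (∧-elimˡ t))
          (trans (sym (B≡ i)) (∧-elimʳ {S c d i} t)))) (λ ()))))
        (trans (sum-cong (λ i → trans (sum-cong (λ j → trans (cong 𝟙 (cong₂ _∧_ (S≡ i) (B≡ j)))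
          (𝟙-∧ (S₀ i) (B₀ j)))) (trans (sum-* (𝟙 (S₀ i)) _) (cong (𝟙 (S₀ i) *_) (sym (#-def B₀))))))
        (trans (sym (∑-def S₀ _)) (∑-const S₀ (# B₀)))))

      -- Only an inequality, since E may have edges into the uncovered parts that do not belong to
      -- `h`.
      W≥ : ∑ Z₀ (λ v → # ((B₀ ∖ cov h (X₀ v)) ∩ h v)) ≤ Ex.W c d X F E
      W≥ = begin
        ∑ Z₀ (λ v → # ((B₀ ∖ cov h (X₀ v)) ∩ h v))
          ≤⟨ ∑-mono {X = Z₀} (λ v _ → ≤-trans
            (#-mono (λ y t → ∧-intro (h⊆E v y (∧-elimʳ {(B₀ ∖ cov h (X₀ v)) y} t)) (∧-elimˡ t)))
               (≤-reflexive (trans (#-def (adj E v ∩ (B₀ ∖ cov h (X₀ v))))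
                 (sum-cong (λ y → 𝟙-∧ (adj E v y) ((B₀ ∖ cov h (X₀ v)) y)))))) ⟩
        ∑ Z₀ (λ v → sum (λ y → 𝟙 (adj E v y) * 𝟙 ((B₀ ∖ cov h (X₀ v)) y)))   ≡⟨ rows (λ i j → 𝟙 (adj E i j)) ⟨
        sum (λ i → sum (λ j → 𝟙 (adj E i j) * θ i j))                        ≡⟨ edge-sum E θ ⟨
        sum (λ i → 𝟙 (lookup E i) * (θ (lo i) (hi i) + θ (hi i) (lo i)))     ≡⟨ sum-cong
          (λ i → trans (cong (𝟙 (lookup E i) *_) (sym (ψ≡ i)))
                                                                                 (trans (*-comm (𝟙 (lookup E i)) _) (sym (𝟙-∧ (ψ c d X F i) (lookup E i))))) ⟩
        Ex.W c d X F E  ∎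

-- Codegrees and the total number of edges

module DegreeEvents where
  open import Data.Nat.Base
  open import Data.Nat.Properties
  import Data.Fin.Properties as Finₚ
  open import Data.Fin.Properties using (any?)
  open import Data.Fin.Subset using (Subset)
  open import Data.Bool.Properties using () renaming (_≟_ to _≟B_)
  open import Data.Bool.ListAction using (any)
  open import Data.List.Base using (length; allFin)
  open import Data.List.Membership.Propositional.Properties using (∈-allFin)
  open import Data.Vec.Base using (lookup)
  open import Relation.Nullary.Decidable using (_×-dec_; ¬?)
  open VertexSets
  open BipartiteDensity
  open Coverings
  open ProductMeasure
  open EdgeSlots
  open ExposureBound
  open ExpansionEvents
  open import Defs using (subsets; EdgeSet)

  false-does : ∀ {P : Set} (P? : Dec P) → does P? ≡ false → ¬ P
  false-does (no ¬p) _ = ¬p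

  module CodegreeEvent (n k : ℕ) (0<k : 0 < k) (ℓ : ℕ) where
    open Slots n

    K = k * k

    0<K : 0 < K
    0<K = *-mono-< 0<k 0<k

    common : EdgeSet n → Fin n → Fin n → VSet n
    common E u v = adj E u ∩ adj E v

    -- Of the exponent 3ℓ, the union bound over at most 2^(2ℓ) pairs uses 2ℓ, and ℓ remains for the
    -- failure probability.
    Many : EdgeSet n → Fin n → Fin n → Set
    Many E u v = ¬ (u ≡ v) × suc K ^ n * 2 ^ (3 * ℓ) ≤ K ^ n * 2 ^ # (common E u v)

    many? : ∀ E u v → Dec (Many E u v)
    many? E u v = ¬? (u Finₚ.≟ v) ×-dec (suc K ^ n * 2 ^ (3 * ℓ) ≤? K ^ n * 2 ^ # (common E u v))

    bad : EdgeSet n → Bool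
    bad E = any (λ u → any (λ v → does (many? E u v)) (allFin n)) (allFin n)

    few : ∀ E → bad E ≡ false → 3 * ℓ * K ≤ n → ∀ u v → ¬ (u ≡ v) → K * # (common E u v) ≤ 3 * n
    few E none ℓ-small u v u≢v = ≤-trans (to-exponents K 0<K n (# (common E u v)) (3 * ℓ) (<⇒≤ (≰⇒> λ le →
      false-does (many? E u v) (any-false (λ v → does (many? E u v))
        (any-false (λ u → any (λ v → does (many? E u v)) (allFin n)) none (∈-allFin u)) (∈-allFin v))
        (u≢v , le)))) (≤-trans (+-monoʳ-≤ (2 * n) (≤-trans (≤-reflexive (*-comm K (3 * ℓ))) ℓ-small))
          (≤-reflexive (triple n)))
      where
      triple : ∀ n → 2 * n + n ≡ 3 * n
      triple = solve-∀

    module _ (a b : ℕ) (ka≤b : k * a ≤ b) where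
      open Measure a b {m}

      a≤b : a ≤ b
      a≤b = ≤-trans (m≤n*m a k {{>-nonZero 0<k}}) ka≤b

      -- 2^|common E u v| counts the sets T of common neighbours.
      module _ (u v : Fin n) (u≢v : ¬ (u ≡ v)) where
        D : VSet n
        D i = ⁅ u ⁆ i ∨ ⁅ v ⁆ i

        #D : # D ≡ 2
        #D = trans (#-def D) (trans (sum-cong (λ i → excl i (⁅ u ⁆ i) (⁅ v ⁆ i) refl refl)) (trans (sum-+ _ _)
          (cong₂ _+_ (trans (sym (#-def ⁅ u ⁆)) (#⁅⁆ u)) (trans (sym (#-def ⁅ v ⁆)) (#⁅⁆ v)))))
          where
          excl : ∀ i b c → ⁅ u ⁆ i ≡ b → ⁅ v ⁆ i ≡ c → 𝟙 (b ∨ c) ≡ 𝟙 b + 𝟙 c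
          excl i true  true  p q = ⊥-elim (u≢v (trans (∈⁅⁆ u i p) (sym (∈⁅⁆ v i q))))
          excl i true  false p q = refl
          excl i false c     p q = refl

        req : Subset n → Fin m → Bool
        req T k = D (lo k) ∧ lookup T (hi k) ∨ D (hi k) ∧ lookup T (lo k)

        -- No vertex is its own neighbour, so a set of common neighbours contains neither `u` nor
        -- `v`. Then the slots from `u` and `v` to it are 2|T| distinct ones.
        avoids : Subset n → Bool
        avoids T = not (lookup T u) ∧ not (lookup T v)

        fac : Subset n → Fin m → Bool → ℕ
        fac T k e = if req T k then 𝟙 e else 1

        w : Fin n → Bool → ℕ
        w i t = if t then 1 else K

        choice : EdgeSet n → Fin n → Bool → ℕ
        choice E i t = if t then 𝟙 (common E u v i) else 1

        expand : ∀ E → 2 ^ # (common E u v) ≡ listSum (subsets n) (λ T → prod (λ i → choice E i (lookup T i)))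
        expand E = trans (cong (2 ^_) (#-def (common E u v))) (trans (sym (prod-^ 2 _))
          (trans (prod-cong (λ i → bool (common E u v i))) (sym (sum-prod (choice E)))))
          where
          bool : ∀ c → 2 ^ 𝟙 c ≡ 1 + 𝟙 c
          bool true  = refl
          bool false = refl

        Missing : EdgeSet n → Subset n → Fin n → Set
        Missing E T i = lookup T i ≡ true × common E u v i ≡ false

        dominated : ∀ E T → prod (λ i → choice E i (lookup T i)) ≤ 𝟙 (avoids T) * prod
          (λ k → fac T k (lookup E k))
        dominated E T = split (any? (λ i → lookup T i ≟B true ×-dec common E u v i ≟B false))
          where
          choice≤1 : ∀ i t → choice E i t ≤ 1
          choice≤1 i true  = 𝟙≤1 (common E u v i)
          choice≤1 i false = ≤-refl
          split : Dec (∃[ i ] Missing E T i) → _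
          split (yes (i , t , c)) = ≤-trans (≤-reflexive (prod-0 _ i (trans (cong (choice E i) t) (cong 𝟙 c))))
            z≤n
          split (no none) = ≤-trans (≤-trans (prod-mono (λ i → choice≤1 i (lookup T i)))
            (≤-reflexive (trans (prod-const n 1) (^-zeroˡ n))))
            (≤-reflexive (sym (cong₂ _*_ (cong 𝟙 (∧-intro (not-intro u∉T) (not-intro v∉T)))
              (trans (prod-cong fac≡1) (trans (prod-const m 1) (^-zeroˡ m))))))
            where
            T⊆ : ∀ i → lookup T i ≡ true → adj E u i ≡ true × adj E v i ≡ true
            T⊆ i t = member (common E u v i) refl
              where
              member : ∀ b → common E u v i ≡ b → adj E u i ≡ true × adj E v i ≡ true
              member true  eq = ∧-elimˡ eq , ∧-elimʳ {adj E u i} eq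
              member false eq = ⊥-elim (none (i , t , eq))
            true≢false : ∀ {b} → b ≡ true → b ≡ false → ⊥
            true≢false refl ()
            u∉T : ¬ (lookup T u ≡ true)
            u∉T t = true≢false (proj₁ (T⊆ u t)) (adj-irr E u)
            v∉T : ¬ (lookup T v ≡ true)
            v∉T t = true≢false (proj₂ (T⊆ v t)) (adj-irr E v)
            joined : ∀ i j → D i ∧ lookup T j ≡ true → adj E i j ≡ true
            joined i j t = endpoint (⁅ u ⁆ i) refl (∧-elimˡ {D i} t)
              where
              endpoint : ∀ b → ⁅ u ⁆ i ≡ b → b ∨ ⁅ v ⁆ i ≡ true → adj E i j ≡ true
              endpoint true  eq _ = subst (λ x → adj E x j ≡ true) (∈⁅⁆ u i eq) (proj₁ (T⊆ j (∧-elimʳ {D i} t)))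
              endpoint false eq q = subst (λ x → adj E x j ≡ true) (∈⁅⁆ v i q) (proj₂ (T⊆ j (∧-elimʳ {D i} t)))
            present : ∀ k → req T k ≡ true → lookup E k ≡ true
            present k t = either (D (lo k) ∧ lookup T (hi k)) refl t
              where
              either : ∀ b → D (lo k) ∧ lookup T (hi k) ≡ b → b ∨ D (hi k) ∧ lookup T (lo k) ≡ true → lookup E k
                ≡ true
              either true  eq _ = trans (sym (adj-slot E k)) (joined (lo k) (hi k) eq)
              either false eq q = trans (sym (adj-slot E k)) (trans (adj-sym E (lo k) (hi k))
                (joined (hi k) (lo k) q))
            fac≡1 : ∀ k → fac T k (lookup E k) ≡ 1
            fac≡1 k = value (req T k) refl
              where
              value : ∀ b → req T k ≡ b → (if b then 𝟙 (lookup E k) else 1) ≡ 1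
              value true  eq = cong 𝟙 (present k eq)
              value false eq = refl

        P : Subset n → ℕ
        P T = prod (λ k → (b ∸ a) * fac T k false + a * fac T k true)

        #T : Subset n → ℕ
        #T T = sum (λ i → 𝟙 (lookup T i))

        #req : ∀ T → avoids T ≡ true → sum (λ k → 𝟙 (req T k)) ≡ 2 * #T T
        #req T av = trans (sum-cong (λ k → excl k (D (lo k)) refl))
          (trans (slot-sum (λ i j → 𝟙 (D i ∧ lookup T j)) (λ i → cong 𝟙 (irr i)))
          (trans (sum-cong (λ i → trans (sum-cong (λ j → 𝟙-∧ (D i) (lookup T j))) (sum-* (𝟙 (D i)) _)))
            (trans (sym (∑-def D (λ _ → #T T)))
            (trans (∑-const D (#T T)) (cong (_* #T T) #D)))))
          where
          D∩T : ∀ i → D i ≡ true → lookup T i ≡ true → ⊥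
          D∩T i t s = endpoint (⁅ u ⁆ i) refl t
            where
            endpoint : ∀ b → ⁅ u ⁆ i ≡ b → b ∨ ⁅ v ⁆ i ≡ true → ⊥
            endpoint true  eq _ = not-elim {lookup T u} (∧-elimˡ av) (subst (λ x → lookup T x ≡ true)
              (sym (∈⁅⁆ u i eq)) s)
            endpoint false eq q = not-elim {lookup T v} (∧-elimʳ {not (lookup T u)} av)
              (subst (λ x → lookup T x ≡ true) (sym (∈⁅⁆ v i q)) s)
          irr : ∀ i → D i ∧ lookup T i ≡ false
          irr i = bool-ext (λ t → ⊥-elim (D∩T i (∧-elimˡ t) (∧-elimʳ {D i} t))) (λ ())
          excl : ∀ k b → D (lo k) ≡ b → 𝟙 (b ∧ lookup T (hi k) ∨ D (hi k) ∧ lookup T (lo k)) ≡ 𝟙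
            (b ∧ lookup T (hi k)) + 𝟙 (D (hi k) ∧ lookup T (lo k))
          excl k false eq = refl
          excl k true eq with lookup T (hi k)
          ... | false = refl
          ... | true = cong suc (sym (cong 𝟙 (bool-ext {D (hi k) ∧ lookup T (lo k)} {false}
            (λ t → ⊥-elim (D∩T (lo k) eq (∧-elimʳ {D (hi k)} t))) (λ ()))))

        P≤ : ∀ T → avoids T ≡ true → K ^ #T T * P T ≤ b ^ m
        P≤ T av = begin
          K ^ #T T * P T                                         ≡⟨ cong (_* P T)
            (trans (cong (_^ #T T) (cong (k *_) (sym (*-identityʳ k)))) (^-*-assoc k 2 (#T T))) ⟩
          k ^ (2 * #T T) * P T                                   ≡⟨ cong (λ t → k ^ t * P T) (#req T av) ⟨
          k ^ sum (λ i → 𝟙 (req T i)) * P T                      ≡⟨ trans (cong (_* P T) (sym (prod-^ k _)))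
            (sym (prod-* _ _)) ⟩
          prod (λ i → k ^ 𝟙 (req T i) * ((b ∸ a) * fac T i false + a * fac T i true))  ≤⟨ prod-mono
            (λ i → term (req T i)) ⟩
          prod {m} (λ i → b)                                     ≡⟨ prod-const m b ⟩
          b ^ m                                                  ∎
          where
          open ≤-Reasoning
          term : ∀ r → k ^ 𝟙 r * ((b ∸ a) * (if r then 0 else 1) + a * (if r then 1 else 1)) ≤ b
          term true  = ≤-trans (≤-reflexive (cong₂ _*_ (*-identityʳ k) (cong₂ _+_ (*-zeroʳ (b ∸ a))
            (*-identityʳ a)))) ka≤b
          term false = ≤-reflexive
            (trans (+-identityʳ _) (trans (cong₂ _+_ (*-identityʳ (b ∸ a)) (*-identityʳ a)) (m∸n+n≡m a≤b)))

        term≤ : ∀ T → K ^ n * (𝟙 (avoids T) * P T) ≤ b ^ m * prod (λ i → w i (lookup T i))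
        term≤ T = choose (avoids T) refl
          where
          open ≤-Reasoning
          R = prod (λ i → w i (lookup T i))
          comm : ∀ a b c → a * b * (1 * c) ≡ a * c * b
          comm = solve-∀
          K-split : K ^ n ≡ K ^ #T T * R
          K-split = trans (sym (prod-const n K)) (trans (prod-cong (λ i → bool (lookup T i)))
            (trans (prod-* _ _) (cong (_* R) (prod-^ K _))))
            where
            bool : ∀ t → K ≡ K ^ 𝟙 t * (if t then 1 else K)
            bool true  = sym (trans (*-identityʳ (K * 1)) (*-identityʳ K))
            bool false = sym (+-identityʳ K)
          choose : ∀ c → avoids T ≡ c → K ^ n * (𝟙 c * P T) ≤ b ^ m * R
          choose false eq = ≤-trans (≤-reflexive (*-zeroʳ (K ^ n))) z≤n
          choose true  eq = begin
            K ^ n * (1 * P T)             ≡⟨ cong (_* (1 * P T)) K-split ⟩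
            K ^ #T T * R * (1 * P T)      ≡⟨ comm (K ^ #T T) R (P T) ⟩
            K ^ #T T * P T * R            ≤⟨ *-monoˡ-≤ R (P≤ T eq) ⟩
            b ^ m * R                     ∎

        -- A given T consists of common neighbours with probability at most p^(2|T|) ≤ K^(-|T|), and
        -- the sum of K^(-|T|) over all T is (1 + 1/K)^n.
        moment : K ^ n * listSum (subsets m) (λ E → mass E * 2 ^ # (common E u v)) ≤ b ^ m * suc K ^ n
        moment = begin
          K ^ n * listSum (subsets m) (λ E → mass E * 2 ^ # (common E u v))
            ≤⟨ *-monoʳ-≤ (K ^ n) (listSum-mono (subsets m) (λ E → *-monoʳ-≤ (mass E)
              (≤-trans (≤-reflexive (expand E)) (listSum-mono (subsets n) (dominated E))))) ⟩
          K ^ n * listSum (subsets m) (λ E → mass E * listSum (subsets n) (λ T → 𝟙 (avoids T) * prod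
            (λ k → fac T k (lookup E k))))
            ≡⟨ cong (K ^ n *_) (trans (listSum-cong (subsets m) (λ E → sym (listSum-* (subsets n) (mass E) _)))
              (listSum-swap (subsets m) (subsets n) _)) ⟩
          K ^ n * listSum (subsets n) (λ T → listSum (subsets m)
            (λ E → mass E * (𝟙 (avoids T) * prod (λ k → fac T k (lookup E k)))))
            ≡⟨ cong (K ^ n *_) (listSum-cong (subsets n)
              (λ T → trans (listSum-cong (subsets m) (λ E → comm (mass E) (𝟙 (avoids T)) _))
                 (trans (listSum-* (subsets m) (𝟙 (avoids T)) _)
                   (cong (𝟙 (avoids T) *_) (expectation (fac T)))))) ⟩
          K ^ n * listSum (subsets n) (λ T → 𝟙 (avoids T) * P T)
            ≡⟨ listSum-* (subsets n) (K ^ n) _ ⟨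
          listSum (subsets n) (λ T → K ^ n * (𝟙 (avoids T) * P T))
            ≤⟨ listSum-mono (subsets n) term≤ ⟩
          listSum (subsets n) (λ T → b ^ m * prod (λ i → w i (lookup T i)))
            ≡⟨ trans (listSum-* (subsets n) (b ^ m) _) (cong (b ^ m *_) (trans (sum-prod w)
                 (trans (prod-cong (λ i → +-comm K 1)) (prod-const n (suc K))))) ⟩
          b ^ m * suc K ^ n  ∎
          where
          open ≤-Reasoning
          comm : ∀ a b c → a * (b * c) ≡ b * (a * c)
          comm = solve-∀

        μ-many : 2 ^ (3 * ℓ) * μ (λ E → does (many? E u v)) ≤ b ^ m
        μ-many = cancel-* (suc K ^ n) (m^n>0 (suc K) n) (begin
          suc K ^ n * (2 ^ (3 * ℓ) * μ (λ E → does (many? E u v)))   ≡⟨ *-assoc (suc K ^ n) (2 ^ (3 * ℓ)) _ ⟨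
          suc K ^ n * 2 ^ (3 * ℓ) * μ (λ E → does (many? E u v))
            ≤⟨ markov (λ E → does (many? E u v)) (λ E → 2 ^ # (common E u v)) _ (K ^ n)
              (λ E eq → proj₂ (does-true {P? = many? E u v} eq)) ⟩
          K ^ n * listSum (subsets m) (λ E → mass E * 2 ^ # (common E u v))  ≤⟨ moment ⟩
          b ^ m * suc K ^ n                                          ≡⟨ *-comm (b ^ m) (suc K ^ n) ⟩
          suc K ^ n * b ^ m                                          ∎)
          where open ≤-Reasoning

      μ-many-all : ∀ u v → 2 ^ (3 * ℓ) * μ (λ E → does (many? E u v)) ≤ b ^ m
      μ-many-all u v = choose (u Finₚ.≟ v)
        where
        choose : Dec (u ≡ v) → 2 ^ (3 * ℓ) * μ (λ E → does (many? E u v)) ≤ b ^ m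
        choose (no u≢v) = μ-many u v u≢v
        choose (yes u≡v) = ≤-trans (≤-reflexive (trans (cong (2 ^ (3 * ℓ) *_) (trans (listSum-cong (subsets m)
          (λ E → trans (cong (λ b → mass E * 𝟙 b) (bool-ext {does (many? E u v)} {false}
            (λ t → ⊥-elim (proj₁ (does-true {P? = many? E u v} t) u≡v)) (λ ()))) (*-zeroʳ (mass E))))
          (listSum-0 (subsets m)))) (*-zeroʳ (2 ^ (3 * ℓ))))) z≤n

      μ-bad : n ≤ 2 ^ ℓ → 2 ^ ℓ * μ bad ≤ b ^ m
      μ-bad n≤ = cancel-* (2 ^ ℓ * 2 ^ ℓ) (*-mono-< (m^n>0 2 ℓ) (m^n>0 2 ℓ)) (begin
        2 ^ ℓ * 2 ^ ℓ * (2 ^ ℓ * μ bad)          ≡⟨ regroup (2 ^ ℓ) (μ bad) ⟩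
        (2 ^ ℓ * (2 ^ ℓ * 2 ^ ℓ)) * μ bad        ≡⟨ cong (_* μ bad)
          (trans (cong (2 ^ ℓ *_) (sym (^-distribˡ-+-* 2 ℓ ℓ))) (trans (sym (^-distribˡ-+-* 2 ℓ (ℓ + ℓ)))
          (cong (λ t → 2 ^ (ℓ + (ℓ + t))) (sym (+-identityʳ ℓ))))) ⟩
        2 ^ (3 * ℓ) * μ bad
          ≤⟨ μ-any-const (λ u E → any (λ v → does (many? E u v)) (allFin n)) (allFin n) (2 ^ (3 * ℓ))
            (length (allFin n) * b ^ m) (λ u →
               μ-any-const (λ v E → does (many? E u v)) (allFin n) (2 ^ (3 * ℓ)) (b ^ m) (μ-many-all u)) ⟩
        length (allFin n) * (length (allFin n) * b ^ m)  ≡⟨ cong (λ t → t * (t * b ^ m)) {length (allFin n)} {n}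
          (length-tabulate (λ i → i)) ⟩
        n * (n * b ^ m)                          ≡⟨ *-assoc n n (b ^ m) ⟨
        n * n * b ^ m                            ≤⟨ *-monoˡ-≤ (b ^ m) (*-mono-≤ n≤ n≤) ⟩
        2 ^ ℓ * 2 ^ ℓ * b ^ m                    ∎)
        where
        open ≤-Reasoning
        regroup : ∀ t u → t * t * (t * u) ≡ (t * (t * t)) * u
        regroup = solve-∀

  module FewEdgesEvent (m k : ℕ) (0<k : 0 < k) (ℓ : ℕ) where
    -- The expectation of 2^(-e), with e the number of edges, has a factor 1 - p/2 for each slot. As
    -- p ≥ 1/(8k), this is at most 1 - 1/x ≤ x/(x + 1).
    x = 16 * k

    0<x : 0 < x
    0<x = *-mono-< {0} {16} z<s 0<k

    low : Fin m → Bool → ℕ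
    low _ true  = 1
    low _ false = 2

    g : Subset m → ℕ
    g E = prod (λ i → low i (lookup E i))

    edges : Subset m → ℕ
    edges E = sum (λ i → 𝟙 (lookup E i))

    bad? : ∀ E → Dec (2 ^ m * x ^ m * 2 ^ ℓ ≤ suc x ^ m * g E)
    bad? E = 2 ^ m * x ^ m * 2 ^ ℓ ≤? suc x ^ m * g E

    bad : Subset m → Bool
    bad E = does (bad? E)

    -- Outside the event, (1 + 1/x)^m < 2^(e + ℓ) with e the number of edges. Raising this to the
    -- power x and using (1 + 1/x)^x ≥ 2 gives the bound.
    many : ∀ E → bad E ≡ false → m ≤ x * (edges E + ℓ)
    many E none = subst (m ≤_) (*-comm (edges E + ℓ) x) (^-reflects-≤ {y = (edges E + ℓ) * x}
      (cancel-* ((x ^ x) ^ m) (m^n>0 (x ^ x) {{>-nonZero (m^n>0 x {{>-nonZero 0<x}} x)}} m) (begin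
      (x ^ x) ^ m * 2 ^ m                       ≡⟨ trans (*-comm _ (2 ^ m)) (sym (^-*-distrib 2 (x ^ x) m)) ⟩
      (2 * x ^ x) ^ m                           ≤⟨ ^-monoˡ-≤ m double ⟩
      (suc x ^ x) ^ m                           ≡⟨ ^-comm (suc x) x m ⟩
      (suc x ^ m) ^ x                           ≤⟨ ^-monoˡ-≤ x (<⇒≤ cancelled) ⟩
      (x ^ m * 2 ^ (edges E + ℓ)) ^ x           ≡⟨ trans (^-*-distrib (x ^ m) _ x) (cong₂ _*_ (^-comm x m x)
        (^-*-assoc 2 (edges E + ℓ) x)) ⟩
      (x ^ x) ^ m * 2 ^ ((edges E + ℓ) * x)     ∎)))
      where
      open ≤-Reasoning
      double : 2 * x ^ x ≤ suc x ^ x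
      double = cancel-* x 0<x (≤-trans (≤-reflexive (reg x (x ^ x))) (≤-trans (bernoulli x x)
        (≤-reflexive (*-comm (suc x ^ x) x))))
        where
        reg : ∀ x t → x * (2 * t) ≡ t * (x + x)
        reg = solve-∀
      g≡ : g E * 2 ^ edges E ≡ 2 ^ m
      g≡ = trans (cong (g E *_) (sym (prod-^ 2 _))) (trans (sym (prod-* _ _))
        (trans (prod-cong (λ i → bool i (lookup E i))) (prod-const m 2)))
        where
        bool : ∀ i e → low i e * 2 ^ 𝟙 e ≡ 2
        bool i true  = refl
        bool i false = refl
      cancelled : suc x ^ m < x ^ m * 2 ^ (edges E + ℓ)
      cancelled = *-cancelˡ-< (2 ^ m) _ _ (begin-strict
        2 ^ m * suc x ^ m                            ≡⟨ cong (_* suc x ^ m) (sym g≡) ⟩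
        g E * 2 ^ edges E * suc x ^ m                ≡⟨ reg (g E) (2 ^ edges E) (suc x ^ m) ⟩
        suc x ^ m * g E * 2 ^ edges E                <⟨ *-monoˡ-< (2 ^ edges E)
          {{>-nonZero (m^n>0 2 (edges E))}} (≰⇒> (false-does (bad? E) none)) ⟩
        2 ^ m * x ^ m * 2 ^ ℓ * 2 ^ edges E          ≡⟨ reg′ (2 ^ m) (x ^ m) (2 ^ ℓ) (2 ^ edges E) ⟩
        2 ^ m * (x ^ m * (2 ^ edges E * 2 ^ ℓ))      ≡⟨ cong (λ t → 2 ^ m * (x ^ m * t))
          (sym (^-distribˡ-+-* 2 (edges E) ℓ)) ⟩
        2 ^ m * (x ^ m * 2 ^ (edges E + ℓ))          ∎)
        where
        reg : ∀ a b c → a * b * c ≡ c * a * b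
        reg = solve-∀
        reg′ : ∀ a b c d → a * b * c * d ≡ a * (b * (d * c))
        reg′ = solve-∀

    module _ (a b : ℕ) (a≤b : a ≤ b) (b≤8ka : b ≤ 8 * k * a) where
      open Measure a b {m}

      μ-bad : 2 ^ ℓ * μ bad ≤ b ^ m
      μ-bad = cancel-* (2 ^ m * x ^ m) (*-mono-< (m^n>0 2 m) (m^n>0 x {{>-nonZero 0<x}} m)) (begin
        2 ^ m * x ^ m * (2 ^ ℓ * μ bad)     ≡⟨ *-assoc (2 ^ m * x ^ m) (2 ^ ℓ) (μ bad) ⟨
        2 ^ m * x ^ m * 2 ^ ℓ * μ bad       ≤⟨ markov bad g _ (suc x ^ m) (λ E eq → does-true {P? = bad? E} eq)
          ⟩
        suc x ^ m * listSum (subsets m) (λ E → mass E * g E)  ≡⟨ cong (suc x ^ m *_) (trans (expectation low)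
          (prod-const m _)) ⟩
        suc x ^ m * ((b ∸ a) * 2 + a * 1) ^ m   ≡⟨ ^-*-distrib (suc x) _ m ⟨
        (suc x * ((b ∸ a) * 2 + a * 1)) ^ m     ≤⟨ ^-monoˡ-≤ m (arith k a (b ∸ a) b (m∸n+n≡m a≤b) b≤8ka) ⟩
        (2 * x * b) ^ m                         ≡⟨ trans (^-*-distrib (2 * x) b m)
          (cong (_* b ^ m) (^-*-distrib 2 x m)) ⟩
        2 ^ m * x ^ m * b ^ m                   ∎)
        where
        open ≤-Reasoning
        arith : ∀ k a c b → c + a ≡ b → b ≤ 8 * k * a → suc (16 * k) * (c * 2 + a * 1) ≤ 2 * (16 * k) * b
        arith k a c _ refl h = lin a (2 ⊗ h) (identity k a c)
          where
          identity : ∀ k a c → 2 * (16 * k) * (c + a) + 2 * (c + a) ≡ suc (16 * k) * (c * 2 + a * 1) + 2 *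
            (8 * k * a) + a
          identity = solve-∀

-- The good event and the grid that it guarantees

module GoodEvent where
  open import Data.Nat.Base
  open import Data.Nat.Properties
  open import Data.Nat.DivMod using (_/_)
  open import Data.Fin.Subset using (Subset) renaming (∣_∣ to card)
  open import Data.Vec.Base using (lookup; []; _∷_)
  open VertexSets
  open BipartiteDensity
  open Coverings
  open RowByRow
  open DeterministicEmbedding
  open ProductMeasure
  open EdgeSlots
  open ExposureBound
  open ExpansionEvents
  open DegreeEvents
  open import Defs using (EdgeSet)

  card≡sum : ∀ {m} (E : Subset m) → card E ≡ sum (λ i → 𝟙 (lookup E i))
  card≡sum []          = sym (sum-zero _)
  card≡sum (true ∷ E)  = trans (cong suc (card≡sum E)) (sym (sum-suc _))
  card≡sum (false ∷ E) = trans (card≡sum E) (sym (sum-suc _))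

  module Core (a′ a G E₁ E′ Θ Λ : ℕ) (0<a′ : 0 < a′) (a≡ : a ≡ 256 * a′) (G≡ : G ≡ suc (768 * a))
    (E′≡ : E′ ≡ 512 * a * 2 ^ suc G) (E≡ : suc E₁ ≡ 2 * E′)
    (Θ≡ : Θ ≡ 2 * (8 * a * suc E₁ ^ (5 * a * (2 * (suc E₁ * suc E₁)))))
    (λ₁ : 6 * a + 1 ≤ Λ) (λ₂ : 3 * (Θ * Θ) ≤ Λ) (λ₃ : Θ * Θ * (3 + 8 * a * (E′ * E′)) ≤ Λ)
    (λ₄ : Θ * (256 * (a * a) * E′) ≤ Λ) (λ₅ : Θ * (2048 * a) ≤ Λ)
    (λ₆ : Θ * Θ * (128 * a * (128 * a)) * 12 + 1 ≤ Λ) (λ₇ : 256 ≤ Λ)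
    (n k ℓ : ℕ) (0<k : 0 < k) (0<ℓ : 0 < ℓ) (n≤2^ℓ : n ≤ 2 ^ ℓ) (n-large : Λ * (k * k * ℓ) ≤ n) where

    open Slots n

    κ = k * k * ℓ

    k²≤κ : k * k ≤ κ
    k²≤κ = m≤m*n (k * k) ℓ {{>-nonZero 0<ℓ}}

    k≤k² : k ≤ k * k
    k≤k² = m≤m*n k k {{>-nonZero 0<k}}

    k≤κ : k ≤ κ
    k≤κ = ≤-trans k≤k² k²≤κ

    1≤κ : 1 ≤ κ
    1≤κ = ≤-trans 0<k k≤κ

    kℓ≤κ : k * ℓ ≤ κ
    kℓ≤κ = *-monoˡ-≤ ℓ k≤k²

    ℓ≤κ : ℓ ≤ κ
    ℓ≤κ = m≤n*m ℓ (k * k) {{>-nonZero (*-mono-< 0<k 0<k)}}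

    from-Λ : ∀ {c} → c ≤ Λ → c * κ ≤ n
    from-Λ c≤Λ = ≤-trans (*-monoˡ-≤ κ c≤Λ) n-large

    0<a : 0 < a
    0<a = subst (0 <_) (sym a≡) (*-mono-< {0} {256} z<s 0<a′)

    P = 8 * a * suc E₁ ^ (5 * a * (2 * (suc E₁ * suc E₁)))

    0<P : 0 < P
    0<P = *-mono-< {0} {8 * a} (*-mono-< {0} {8} z<s 0<a) (m^n>0 (suc E₁) (5 * a * (2 * (suc E₁ * suc E₁))))

    instance
      P-nonZero : NonZero P
      P-nonZero = >-nonZero 0<P

    0<Θ : 0 < Θ
    0<Θ = subst (0 <_) (sym Θ≡) (*-mono-< {0} {2} z<s 0<P)

    -- `P` is 8a times the total shrinkage over all rounds of the increment; `Θ`, its double,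
    -- absorbs the rounding.
    y₀ = n / P

    n≤Θy₀ : n ≤ Θ * y₀
    n≤Θy₀ = subst (λ θ → n ≤ θ * y₀) (sym Θ≡) (arith n P y₀ Θ≤n (<-suc-/-* P n))
      where
      Θ≤n : 2 * P ≤ n
      Θ≤n = subst (_≤ n) Θ≡ (≤-trans
        (≤-trans (m≤m*n Θ (3 * Θ * κ) {{>-nonZero (*-mono-< {0} {3 * Θ} (*-mono-< {0} {3} z<s 0<Θ) 1≤κ)}})
        (≤-reflexive (reg Θ κ))) (from-Λ {3 * (Θ * Θ)} λ₂))
        where
        reg : ∀ t κ → t * (3 * t * κ) ≡ 3 * (t * t) * κ
        reg = solve-∀
      arith : ∀ n P y → 2 * P ≤ n → n < suc y * P → n ≤ 2 * P * y
      arith n P zero    h₁ h₂ = ⊥-elim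
        (<-irrefl refl (<-≤-trans h₂ (≤-trans (*-monoˡ-≤ P {1} {2} (s≤s z≤n)) h₁)))
      arith n P (suc y) h₁ h₂ = ≤-trans (<⇒≤ h₂) (lin (P * y) (≤-refl {0}) (identity P y))
        where
        identity : ∀ P y → 2 * P * suc y + 0 ≡ suc (suc y) * P + 0 + P * y
        identity = solve-∀

    κ≤n : κ ≤ n
    κ≤n = ≤-trans (≤-reflexive (sym (*-identityˡ κ))) (from-Λ {1} (≤-trans (s≤s z≤n) λ₇))

    0<n : 0 < n
    0<n = <-≤-trans 1≤κ κ≤n

    ℓ≤n : ℓ ≤ n
    ℓ≤n = ≤-trans ℓ≤κ κ≤n

    by-y₀ : ∀ {u} → Θ * u ≤ n → u ≤ y₀
    by-y₀ le = cancel-* Θ 0<Θ (≤-trans le n≤Θy₀)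

    by-y₀² : ∀ {u} → Θ * Θ * u ≤ n * n → u ≤ y₀ * y₀
    by-y₀² {u} le = cancel-* (Θ * Θ) (*-mono-< 0<Θ 0<Θ)
      (≤-trans le (≤-trans (*-mono-≤ n≤Θy₀ n≤Θy₀) (≤-reflexive (reg Θ y₀))))
      where
      reg : ∀ t y → t * y * (t * y) ≡ t * t * (y * y)
      reg = solve-∀

    0<y₀ : 0 < y₀
    0<y₀ = ≰⇒> λ y≤0 → <-irrefl refl
      (<-≤-trans 0<n (≤-trans n≤Θy₀ (≤-trans (*-monoʳ-≤ Θ y≤0) (≤-reflexive (*-zeroʳ Θ)))))

    L = 8 * (a * k) * (E′ * E′)

    y₀-large₁ : 3 * (n * k) ≤ y₀ * y₀
    y₀-large₁ = by-y₀² (arith (Θ * Θ) n k κ k≤κ (from-Λ {3 * (Θ * Θ)} λ₂))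
      where
      arith : ∀ t n k κ → k ≤ κ → 3 * t * κ ≤ n → t * (3 * (n * k)) ≤ n * n
      arith t n k κ h₁ h₂ = lin 0 (3 * t * n ⊗ h₁ ⊕ n ⊗ h₂) (identity t n k κ)
        where
        identity : ∀ t n k κ → n * n + (3 * t * n * k + n * (3 * t * κ)) ≡ t * (3 * (n * k)) +
          (3 * t * n * κ + n * n) + 0
        identity = solve-∀

    -- The decisive use of n ≥ Λk²ℓ: as `L` is of order k, the lists contribute a term of order
    -- k²ℓn, which must stay below y₀², a constant fraction of n².
    y₀-large₂ : k * (2 * n + ℓ * (L * n) + ℓ) ≤ y₀ * y₀
    y₀-large₂ = by-y₀² (arith (Θ * Θ) n k ℓ a (E′ * E′) k≤κ ℓ≤n (from-Λ {Θ * Θ * (3 + 8 * a * (E′ * E′))} λ₃))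
      where
      arith : ∀ t n k ℓ a e → k ≤ k * k * ℓ → ℓ ≤ n → t * (3 + 8 * a * e) * (k * k * ℓ) ≤ n →
        t * (k * (2 * n + ℓ * (8 * (a * k) * e * n) + ℓ)) ≤ n * n
      arith t n k ℓ a e h₁ h₂ h₃ = lin 0 (t * k ⊗ h₂ ⊕ 3 * t * n ⊗ h₁ ⊕ n ⊗ h₃) (identity t n k ℓ a e)
        where
        identity : ∀ t n k ℓ a e → n * n + (t * k * ℓ + 3 * t * n * k + n * (t * (3 + 8 * a * e) * (k * k * ℓ)))
          ≡
          t * (k * (2 * n + ℓ * (8 * (a * k) * e * n) + ℓ)) + (t * k * n + 3 * t * n * (k * k * ℓ) + n * n) + 0
        identity = solve-∀

    y₀-large₃ : 128 * (a * k) * (2 * (a * k) * E′) ≤ y₀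
    y₀-large₃ = by-y₀ (≤-trans (≤-reflexive (reg Θ a k E′)) (≤-trans (*-monoʳ-≤ (Θ * (256 * (a * a) * E′)) k²≤κ)
      (from-Λ {Θ * (256 * (a * a) * E′)} λ₄)))
      where
      reg : ∀ t a k e → t * (128 * (a * k) * (2 * (a * k) * e)) ≡ t * (256 * (a * a) * e) * (k * k)
      reg = solve-∀

    y₀-large₄ : 128 * (a * k) * (16 * k) ≤ y₀
    y₀-large₄ = by-y₀ (≤-trans (≤-reflexive (reg Θ a k)) (≤-trans (*-monoʳ-≤ (Θ * (2048 * a)) k²≤κ)
      (from-Λ {Θ * (2048 * a)} λ₅)))
      where
      reg : ∀ t a k → t * (128 * (a * k) * (16 * k)) ≡ t * (2048 * a) * (k * k)
      reg = solve-∀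

    y₀-large₅ : 128 * (a * k) * (128 * (a * k)) * (12 * n) < y₀ * y₀
    y₀-large₅ = *-cancelˡ-< (Θ * Θ) _ _
      (<-≤-trans (arith (Θ * Θ) a n k κ 0<n 1≤κ k²≤κ (from-Λ {Θ * Θ * (128 * a * (128 * a)) * 12 + 1} λ₆))
      (≤-trans (*-mono-≤ n≤Θy₀ n≤Θy₀) (≤-reflexive (reg Θ y₀))))
      where
      reg : ∀ t y → t * y * (t * y) ≡ t * t * (y * y)
      reg = solve-∀
      arith : ∀ t a n k κ → 0 < n → 1 ≤ κ → k * k ≤ κ → (t * (128 * a * (128 * a)) * 12 + 1) * κ ≤ n →
        t * (128 * (a * k) * (128 * (a * k)) * (12 * n)) < n * n
      arith t a n k κ 0<n h₁ h₂ h₃ = lin 0 (0<n ⊕ n ⊗ h₁ ⊕ t * (128 * a * (128 * a)) * 12 * n ⊗ h₂ ⊕ n ⊗ h₃)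
        (identity t (128 * a * (128 * a)) n κ (k * k) _ (shape t a n k))
        where
        shape : ∀ t a n k → t * (128 * (a * k) * (128 * (a * k)) * (12 * n)) ≡ t * (128 * a * (128 * a)) * 12 *
          n * (k * k)
        shape = solve-∀
        ring : ∀ t A n κ K → n * n + (1 + n * 1 + t * A * 12 * n * K + n * ((t * A * 12 + 1) * κ)) ≡
          suc (t * A * 12 * n * K) + (n + n * κ + t * A * 12 * n * κ + n * n) + 0
        ring = solve-∀
        identity : ∀ t A n κ K w → w ≡ t * A * 12 * n * K → n * n + (1 + n * 1 + t * A * 12 * n * K + n *
          ((t * A * 12 + 1) * κ)) ≡
          suc w + (n + n * κ + t * A * 12 * n * κ + n * n) + 0
        identity t A n κ K _ refl = ring t A n κ K

    n>6ak : 6 * (a * k) < n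
    n>6ak = ≤-trans (arith a k κ 1≤κ k≤κ) (from-Λ {6 * a + 1} λ₁)
      where
      arith : ∀ a k κ → 1 ≤ κ → k ≤ κ → suc (6 * (a * k)) ≤ (6 * a + 1) * κ
      arith a k κ h₁ h₂ = lin 0 (h₁ ⊕ 6 * a ⊗ h₂) (identity a k κ)
        where
        identity : ∀ a k κ → (6 * a + 1) * κ + (1 + 6 * a * k) ≡ suc (6 * (a * k)) + (κ + 6 * a * κ) + 0
        identity = solve-∀

    module Ev₁ = ExpansionEvent n k 0<k ℓ 0 1
    module Ev₂ = ExpansionEvent n k 0<k ℓ L (suc G)
    module Ev₃ = CodegreeEvent n k 0<k ℓ
    module Ev₄ = FewEdgesEvent m k 0<k ℓ

    bad : EdgeSet n → Bool
    bad E = Ev₁.bad E ∨ (Ev₂.bad E ∨ (Ev₃.bad E ∨ Ev₄.bad E))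

    -- Determined by n, k, ℓ and the constants, without p, so that one and the same event serves all
    -- rational approximants of p.
    χ : EdgeSet n → Bool
    χ E = not (bad E)

    μ-bad : ∀ p q → k * p ≤ q → q ≤ 8 * k * p → 2 ^ ℓ * Measure.μ p q bad ≤ 4 * q ^ m
    μ-bad p q kp≤q q≤8kp = arith (2 ^ ℓ) (q ^ m) _ _ _ _ _ (μ-∨ Ev₁.bad _)
        (≤-trans (μ-∨ Ev₂.bad _) (+-monoʳ-≤ (μ Ev₂.bad) (μ-∨ Ev₃.bad Ev₄.bad)))
        (Ev₁.μ-bad p q kp≤q n≤2^ℓ) (Ev₂.μ-bad p q kp≤q n≤2^ℓ) (Ev₃.μ-bad p q kp≤q n≤2^ℓ)
        (Ev₄.μ-bad p q (≤-trans (m≤n*m p k {{>-nonZero 0<k}}) kp≤q) q≤8kp)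
      where
      open Measure p q {m}
      arith : ∀ t M u u₁ u₂ u₃ u₄ {v} → u ≤ u₁ + v → v ≤ u₂ + (u₃ + u₄) → t * u₁ ≤ M → t * u₂ ≤ M → t * u₃ ≤ M →
        t * u₄ ≤ M → t * u ≤ 4 * M
      arith t M u u₁ u₂ u₃ u₄ {v} h h′ h₁ h₂ h₃ h₄ = lin 0 (t ⊗ h ⊕ t ⊗ h′ ⊕ h₁ ⊕ h₂ ⊕ h₃ ⊕ h₄)
        (identity t M u u₁ u₂ u₃ u₄ v)
        where
        identity : ∀ t M u u₁ u₂ u₃ u₄ v → 4 * M + (t * u + t * v + t * u₁ + t * u₂ + t * u₃ + t * u₄) ≡
          t * u + (t * (u₁ + v) + t * (u₂ + (u₃ + u₄)) + M + M + M + M) + 0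
        identity = solve-∀

    μ-χ : ∀ p q → k * p ≤ q → q ≤ 8 * k * p → 2 ^ ℓ * q ^ m ≤ 2 ^ ℓ * Measure.μ p q χ + 4 * q ^ m
    μ-χ p q kp≤q q≤8kp = begin
      2 ^ ℓ * q ^ m                      ≡⟨ cong (2 ^ ℓ *_)
        (sym (trans (μ-not bad) (total (≤-trans (m≤n*m p k {{>-nonZero 0<k}}) kp≤q)))) ⟩
      2 ^ ℓ * (μ bad + μ χ)              ≡⟨ trans (*-distribˡ-+ (2 ^ ℓ) (μ bad) (μ χ))
        (+-comm (2 ^ ℓ * μ bad) (2 ^ ℓ * μ χ)) ⟩
      2 ^ ℓ * μ χ + 2 ^ ℓ * μ bad        ≤⟨ +-monoʳ-≤ (2 ^ ℓ * μ χ) (μ-bad p q kp≤q q≤8kp) ⟩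
      2 ^ ℓ * μ χ + 4 * q ^ m            ∎
      where
      open ≤-Reasoning
      open Measure p q {m}

    ∨-false : ∀ a {b} → a ∨ b ≡ false → a ≡ false × b ≡ false
    ∨-false false h = refl , h

    module _ (E : EdgeSet n) (E-good : χ E ≡ true) (F : EdgeSet n)
      (F⊆E : ∀ i → lookup F i ≡ true → lookup E i ≡ true) (dense : card E ≤ a′ * card F + 1) where

      not-bad : bad E ≡ false
      not-bad = value (bad E) E-good
        where
        value : ∀ b → not b ≡ true → b ≡ false
        value false _ = refl

      good₁ = proj₁ (∨-false (Ev₁.bad E) not-bad)
      rest₁ = proj₂ (∨-false (Ev₁.bad E) not-bad)
      good₂ = proj₁ (∨-false (Ev₂.bad E) rest₁)
      rest₂ = proj₂ (∨-false (Ev₂.bad E) rest₁)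
      good₃ = proj₁ (∨-false (Ev₃.bad E) rest₂)
      good₄ = proj₂ (∨-false (Ev₃.bad E) rest₂)

      h : Adjacency n
      h = adj F

      h⊆ : ∀ i j → h i j ≡ true → adj E i j ≡ true
      h⊆ = adj-mono F E F⊆E

      degree-sum : sum (λ i → sum (λ j → 𝟙 (h i j))) ≡ 2 * card F
      degree-sum = trans (sum-cong (λ i → sum-cong (λ j → sym (*-identityʳ (𝟙 (h i j))))))
        (trans (sym (edge-sum F (λ _ _ → 1))) (trans (sum-cong (λ i → *-comm (𝟙 (lookup F i)) 2))
          (trans (sum-* 2 _) (cong (2 *_) (sym (card≡sum F))))))

      -- The host graph has at least m/(16k) - ℓ edges. The factor 256 in `a` leaves room for the
      -- subtracted ℓ, for replacing 2m by n², and for the `+ 1` in `dense`, which comes from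
      -- comparing real numbers up to a tolerance.
      edges : 4 * (n * n) ≤ a * k * sum (λ i → sum (λ j → 𝟙 (h i j)))
      edges = subst₂ (λ u v → 4 * (n * n) ≤ u * k * v) (sym a≡) (sym degree-sum)
        (arith n k ℓ m a′ (card E) (card F) κ n≥4 0<ℓ (subst (λ t → m ≤ 16 * k * (t + ℓ)) (sym (card≡sum E))
          (Ev₄.many E good₄)) slot-count dense kℓ≤κ (from-Λ {256} λ₇))
        where
        n≥4 : 4 ≤ n
        n≥4 = ≤-trans (≤-trans (m≤m+n 4 252) (m≤m*n 256 κ {{>-nonZero 1≤κ}})) (from-Λ {256} λ₇)
        arith : ∀ n k ℓ m a′ e f κ → 4 ≤ n → 0 < ℓ → m ≤ 16 * k * (e + ℓ) → m + m + n ≡ n * n → e ≤ a′ * f + 1 →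
          k * ℓ ≤ κ → 256 * κ ≤ n → 4 * (n * n) ≤ 256 * a′ * k * (2 * f)
        arith n k ℓ m a′ e f κ h₁ h₂ h₃ h₄ h₅ h₆ h₇ =
          lin (7 * (n * n)) (16 ⊗ ≤-reflexive (sym h₄) ⊕ 32 ⊗ h₃ ⊕ 512 * k ⊗ h₅ ⊕ 512 * k ⊗ h₂ ⊕ 1024 ⊗ h₆ ⊕ 4 ⊗
            h₇ ⊕ 5 * n ⊗ h₁)
            (identity n k ℓ m a′ e f κ)
          where
          identity : ∀ n k ℓ m a′ e f κ →
            256 * a′ * k * (2 * f) + (16 * (n * n) + 32 * m + 512 * k * e + 512 * k * 1 + 1024 * (k * ℓ) + 4 *
              (256 * κ) + 5 * n * 4) ≡
            4 * (n * n) + (16 * (m + m + n) + 32 * (16 * k * (e + ℓ)) + 512 * k * (a′ * f + 1) + 512 * k * ℓ +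
              1024 * κ + 4 * n + 5 * n * n)
              + 7 * (n * n)
          identity = solve-∀

      module _ (s : ℕ) (small : 384 * a * Θ * suc s ≤ k) where
        s≤k : suc s ≤ k
        s≤k = ≤-trans (m≤n*m (suc s) (384 * a * Θ)
          {{>-nonZero (*-mono-< {0} {384 * a} (*-mono-< {0} {384} z<s 0<a) 0<Θ)}}) small

        y₀-large₆ : 128 * a * (suc s * (3 * n)) ≤ k * y₀
        y₀-large₆ = arith a (suc s) n k y₀ Θ n≤Θy₀ small
          where
          arith : ∀ a s n k y t → n ≤ t * y → 384 * a * t * s ≤ k → 128 * a * (s * (3 * n)) ≤ k * y
          arith a s n k y t h₁ h₂ = lin 0 (384 * a * s ⊗ h₁ ⊕ y ⊗ h₂) (identity a s n k y t)
            where
            identity : ∀ a s n k y t → k * y + (384 * a * s * n + y * (384 * a * t * s)) ≡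
              128 * a * (s * (3 * n)) + (384 * a * s * (t * y) + y * k) + 0
            identity = solve-∀

        small′ : 8 * a * (suc E₁ ^ (5 * a * (2 * (suc E₁ * suc E₁))) * y₀) ≤ n
        small′ = ≤-trans (≤-reflexive (sym (*-assoc (8 * a) (suc E₁ ^ (5 * a * (2 * (suc E₁ * suc E₁)))) y₀)))
          (*-/-≤ P n)

        codegree : ∀ u v → ¬ (u ≡ v) → k * k * # (h u ∩ h v) ≤ 3 * n
        codegree u v u≢v = ≤-trans
          (*-monoʳ-≤ (k * k) (#-mono (λ i t → ∧-intro (h⊆ u i (∧-elimˡ t)) (h⊆ v i (∧-elimʳ {h u i} t)))))
          (Ev₃.few E good₃ (≤-trans (≤-reflexive (reg ℓ k)) (from-Λ {3} (≤-trans (m≤m+n 3 253) λ₇))) u v u≢v)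
          where
          reg : ∀ ℓ k → 3 * ℓ * (k * k) ≡ 3 * (k * k * ℓ)
          reg = solve-∀

        grid-in : GridIn h (suc s)
        grid-in = Deterministic.result h (adj-sym F) (adj-irr F) k a ℓ y₀ E₁ E′ L G 0<k 0<a 0<y₀ ℓ≤n G≡ E′≡ E≡
          refl
          (Ev₁.expansion E good₁ h (adj-sym F) h⊆) (Ev₂.expansion E good₂ h (adj-sym F) h⊆) codegree edges
          small′ n>6ak y₀-large₁ y₀-large₂ y₀-large₃ y₀-large₄ y₀-large₅ s s≤k y₀-large₆

-- Passing to real numbers

module RationalArithmetic where
  open import Data.Integer.Base as ℤ using (+_; 1ℤ)
  import Data.Integer.Properties as ℤₚ
  open import Data.Nat.Base as ℕ using (ℕ; suc; NonZero)
  import Data.Nat.Properties as ℕₚ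
  open import Data.Rational.Base as ℚ using (ℚ; 0ℚ; 1ℚ; mkℚ)
  import Data.Rational.Properties as ℚₚ
  open import Data.Rational.Solver using (module +-*-Solver)
  import Data.Rational.Unnormalised.Base as ℚᵘ
  import Data.Rational.Unnormalised.Properties as ℚᵘₚ

  opaque
    [_] : ℕ → ℚ
    [ m ] = (+ m) ℚ./ 1

    []-def : ∀ m → [ m ] ≡ (+ m) ℚ./ 1
    []-def m = refl

    [0]≡0 : [ 0 ] ≡ 0ℚ
    [0]≡0 = refl

    [1]≡1 : [ 1 ] ≡ 1ℚ
    [1]≡1 = refl

    []ᵘ : ∀ m → ℚ.toℚᵘ [ m ] ℚᵘ.≃ ℚᵘ.mkℚᵘ (+ m) 0
    []ᵘ m = ℚₚ.toℚᵘ-fromℚᵘ (ℚᵘ.mkℚᵘ (+ m) 0)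

    []-+ : ∀ m n → [ m ℕ.+ n ] ≡ [ m ] ℚ.+ [ n ]
    []-+ m n = ℚₚ.toℚᵘ-injective (ℚᵘₚ.≃-trans ([]ᵘ (m ℕ.+ n)) (ℚᵘₚ.≃-trans
      (ℚᵘ.*≡* (cong (ℤ._* 1ℤ) (trans (ℤₚ.pos-+ m n) (cong₂ ℤ._+_ (sym (ℤₚ.*-identityʳ (+ m)))
        (sym (ℤₚ.*-identityʳ (+ n)))))))
      (ℚᵘₚ.≃-sym (ℚᵘₚ.≃-trans (ℚₚ.toℚᵘ-homo-+ [ m ] [ n ]) (ℚᵘₚ.+-cong ([]ᵘ m) ([]ᵘ n))))))

    []-* : ∀ m n → [ m ℕ.* n ] ≡ [ m ] ℚ.* [ n ]
    []-* m n = ℚₚ.toℚᵘ-injective (ℚᵘₚ.≃-trans ([]ᵘ (m ℕ.* n)) (ℚᵘₚ.≃-trans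
      (ℚᵘ.*≡* (cong (ℤ._* 1ℤ) (ℤₚ.pos-* m n)))
      (ℚᵘₚ.≃-sym (ℚᵘₚ.≃-trans (ℚₚ.toℚᵘ-homo-* [ m ] [ n ]) (ℚᵘₚ.*-cong ([]ᵘ m) ([]ᵘ n))))))

    []-mono : ∀ {m n} → m ℕ.≤ n → [ m ] ℚ.≤ [ n ]
    []-mono {m} {n} m≤n = ℚₚ.toℚᵘ-cancel-≤ (ℚᵘₚ.≤-trans (ℚᵘₚ.≤-reflexive ([]ᵘ m)) (ℚᵘₚ.≤-trans
      (ℚᵘ.*≤* (ℤₚ.*-monoʳ-≤-nonNeg 1ℤ (ℤ.+≤+ m≤n))) (ℚᵘₚ.≤-reflexive (ℚᵘₚ.≃-sym ([]ᵘ n)))))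

    []-reflects : ∀ {m n} → [ m ] ℚ.≤ [ n ] → m ℕ.≤ n
    []-reflects {m} {n} h with ℚᵘₚ.≤-trans (ℚᵘₚ.≤-reflexive (ℚᵘₚ.≃-sym ([]ᵘ m))) (ℚᵘₚ.≤-trans (ℚₚ.toℚᵘ-mono-≤ h) (ℚᵘₚ.≤-reflexive ([]ᵘ n)))
    ... | ℚᵘ.*≤* le = ℤₚ.drop‿+≤+ (subst₂ ℤ._≤_ (ℤₚ.*-identityʳ (+ m)) (ℤₚ.*-identityʳ (+ n)) le)

    [n]*1/n : ∀ n .{{_ : NonZero n}} → [ n ] ℚ.* (1ℤ ℚ./ n) ≡ 1ℚ
    [n]*1/n (suc d) = ℚₚ.toℚᵘ-injective (ℚᵘₚ.≃-trans (ℚₚ.toℚᵘ-homo-* [ suc d ] (1ℤ ℚ./ suc d))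
      (ℚᵘₚ.≃-trans (ℚᵘₚ.*-cong ([]ᵘ (suc d)) (ℚₚ.toℚᵘ-fromℚᵘ (ℚᵘ.mkℚᵘ 1ℤ d)))
        (ℚᵘ.*≡* (trans (ℤₚ.*-identityʳ _) (trans (ℤₚ.*-identityʳ (+ suc d))
          (sym (trans (ℤₚ.*-identityˡ _) (cong (λ t → + suc t) (ℕₚ.+-identityʳ d)))))))))

    fraction : ∀ q → 0ℚ ℚ.≤ q → ∃[ A ] ∃[ B ] q ℚ.* [ suc B ] ≡ [ A ]
    fraction (mkℚ (+ A) B c) _ = A , B , ℚₚ.toℚᵘ-injective (ℚᵘₚ.≃-trans (ℚₚ.toℚᵘ-homo-* (mkℚ (+ A) B c) [ suc B
      ])
      (ℚᵘₚ.≃-trans (ℚᵘₚ.*-cong (ℚᵘₚ.≃-refl {ℚᵘ.mkℚᵘ (+ A) B}) ([]ᵘ (suc B))) (ℚᵘₚ.≃-trans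
        (ℚᵘ.*≡* (trans (ℤₚ.*-identityʳ _) (cong ((+ A) ℤ.*_) (cong (λ t → + suc t) (sym (ℕₚ.*-identityʳ B))))))
          (ℚᵘₚ.≃-sym ([]ᵘ A)))))
    fraction (mkℚ ℤ.-[1+ A ] B c) (ℚ.*≤* ())

  [suc] : ∀ m → [ suc m ] ≡ 1ℚ ℚ.+ [ m ]
  [suc] m = trans ([]-+ 1 m) (cong (ℚ._+ [ m ]) [1]≡1)

  [2]≡ : [ 2 ] ≡ 1ℚ ℚ.+ 1ℚ
  [2]≡ = trans ([suc] 1) (cong (1ℚ ℚ.+_) [1]≡1)

  [4]≡ : [ 4 ] ≡ (1ℚ ℚ.+ 1ℚ) ℚ.+ (1ℚ ℚ.+ 1ℚ)
  [4]≡ = trans ([]-+ 2 2) (cong₂ ℚ._+_ [2]≡ [2]≡)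

  0≤[] : ∀ m → 0ℚ ℚ.≤ [ m ]
  0≤[] m = subst (ℚ._≤ [ m ]) [0]≡0 ([]-mono {0} {m} ℕ.z≤n)

  0<[] : ∀ m .{{_ : NonZero m}} → 0ℚ ℚ.< [ m ]
  0<[] m@(suc _) = ℚₚ.≰⇒> λ h → ℕₚ.<-irrefl refl (ℕₚ.<-≤-trans (ℕ.s≤s ℕ.z≤n)
    ([]-reflects {m} {0} (subst ([ m ] ℚ.≤_) (sym [0]≡0) h)))

  linℚ : ∀ {x y P Q} s → 0ℚ ℚ.≤ s → P ℚ.≤ Q → y ℚ.+ P ≡ x ℚ.+ Q ℚ.+ s → x ℚ.≤ y
  linℚ {x} {y} {P} {Q} s 0≤s P≤Q eq = subst₂ ℚ._≤_ (cancel x P) (cancel y P) (ℚₚ.+-monoˡ-≤ (ℚ.- P) (begin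
    x ℚ.+ P            ≤⟨ ℚₚ.+-monoʳ-≤ x P≤Q ⟩
    x ℚ.+ Q            ≡⟨ ℚₚ.+-identityʳ (x ℚ.+ Q) ⟨
    x ℚ.+ Q ℚ.+ 0ℚ     ≤⟨ ℚₚ.+-monoʳ-≤ (x ℚ.+ Q) 0≤s ⟩
    x ℚ.+ Q ℚ.+ s      ≡⟨ eq ⟨
    y ℚ.+ P            ∎))
    where
    open ℚₚ.≤-Reasoning
    cancel : ∀ a b → a ℚ.+ b ℚ.+ (ℚ.- b) ≡ a
    cancel = solve 2 (λ a b → a :+ b :+ (:- b) := a) refl
      where open +-*-Solver

  infixl 6 _⊞_
  _⊞_ : ∀ {a b c d} → a ℚ.≤ b → c ℚ.≤ d → a ℚ.+ c ℚ.≤ b ℚ.+ d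
  _⊞_ = ℚₚ.+-mono-≤

  scale : ∀ {a b} c → 0ℚ ℚ.≤ c → a ℚ.≤ b → c ℚ.* a ℚ.≤ c ℚ.* b
  scale c 0≤c = ℚₚ.*-monoˡ-≤-nonNeg c {{ℚ.nonNegative 0≤c}}

  0≤* : ∀ {a b} → 0ℚ ℚ.≤ a → 0ℚ ℚ.≤ b → 0ℚ ℚ.≤ a ℚ.* b
  0≤* {a} {b} 0≤a 0≤b = subst (ℚ._≤ a ℚ.* b) (ℚₚ.*-zeroʳ a) (scale a 0≤a 0≤b)

  unscale : ∀ {a b} c → 0ℚ ℚ.< c → c ℚ.* a ℚ.≤ c ℚ.* b → a ℚ.≤ b
  unscale c 0<c = ℚₚ.*-cancelˡ-≤-pos c {{ℚ.positive 0<c}}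

-- Probabilities at rational approximants, and a lower bound for the logarithm

module ProbabilityAndLogarithm where
  open import Data.Fin.Subset using (Subset; inside; outside)
  open import Data.Integer.Base as ℤ using (+_; 1ℤ)
  open import Data.List.Base as List using (List; []; _∷_; _++_; map; foldr; filterᵇ)
  open import Data.Nat.Base as ℕ using (ℕ; zero; suc; NonZero)
  import Data.Nat.Properties as ℕₚ
  open import Data.Rational.Base as ℚ using (ℚ; 0ℚ; 1ℚ; ½)
  import Data.Rational.Properties as ℚₚ
  open import Data.Rational.Solver using (module +-*-Solver)
  open import Data.Vec.Base using ([]; _∷_)
  open VertexSets using (𝟙)
  open ProductMeasure
  open RationalArithmetic
  open import Defs using (ℝ; seq; 0ℝ; weight; prob; subsets; mercator; _^ℚ_; module LogLemmas)
  open LogLemmas using (0≤y^; 1/n-pos)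

  filter-reject : ∀ {A : Set} {χ : A → Bool} {x xs} → χ x ≡ false → filterᵇ χ (x ∷ xs) ≡ filterᵇ χ xs
  filter-reject eq rewrite eq = refl

  filter-accept : ∀ {A : Set} {χ : A → Bool} {x xs} → χ x ≡ true → filterᵇ χ (x ∷ xs) ≡ x ∷ filterᵇ χ xs
  filter-accept eq rewrite eq = refl

  module _ (p : ℝ) (j : ℕ) where
    q = seq p j

    value : List ℝ → ℚ
    value xs = seq (foldr Defs._+_ 0ℝ xs) j

    value-++ : ∀ xs ys → value (xs ++ ys) ≡ value xs ℚ.+ value ys
    value-++ []       ys = sym (ℚₚ.+-identityˡ (value ys))
    value-++ (x ∷ xs) ys = trans (cong (seq x j ℚ.+_) (value-++ xs ys))
      (sym (ℚₚ.+-assoc (seq x j) (value xs) (value ys)))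

    value-map : ∀ {m} b (xs : List (Subset m)) →
      value (map (weight p) (map (b ∷_) xs)) ≡ (if b then q else (1ℚ ℚ.+ ℚ.- q)) ℚ.* value (map (weight p) xs)
    value-map b []       = sym (ℚₚ.*-zeroʳ (if b then q else (1ℚ ℚ.+ ℚ.- q)))
    value-map true  (E ∷ xs) = trans (cong (q ℚ.* seq (weight p E) j ℚ.+_) (value-map true xs))
      (sym (ℚₚ.*-distribˡ-+ q _ _))
    value-map false (E ∷ xs) = trans (cong ((1ℚ ℚ.+ ℚ.- q) ℚ.* seq (weight p E) j ℚ.+_) (value-map false xs))
      (sym (ℚₚ.*-distribˡ-+ (1ℚ ℚ.+ ℚ.- q) _ _))

    total-probability : ∀ m → value (map (weight p) (subsets m)) ≡ 1ℚ
    total-probability zero    = ℚₚ.+-identityʳ 1ℚ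
    total-probability (suc m) = begin
      value (map (weight p) (map (outside ∷_) (subsets m) ++ map (inside ∷_) (subsets m)))
        ≡⟨ cong value (map-++ (weight p) (map (outside ∷_) (subsets m)) _) ⟩
      value (map (weight p) (map (outside ∷_) (subsets m)) ++ map (weight p) (map (inside ∷_) (subsets m)))
        ≡⟨ value-++ (map (weight p) (map (outside ∷_) (subsets m))) _ ⟩
      value (map (weight p) (map (outside ∷_) (subsets m))) ℚ.+ value
        (map (weight p) (map (inside ∷_) (subsets m)))
        ≡⟨ cong₂ ℚ._+_ (trans (value-map false (subsets m)) (cong ((1ℚ ℚ.+ ℚ.- q) ℚ.*_) (total-probability m)))
                       (trans (value-map true (subsets m)) (cong (q ℚ.*_) (total-probability m))) ⟩
      (1ℚ ℚ.+ ℚ.- q) ℚ.* 1ℚ ℚ.+ q ℚ.* 1ℚ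
        ≡⟨ solve 1 (λ q → (con 1ℚ :+ (:- q)) :* con 1ℚ :+ q :* con 1ℚ := con 1ℚ) refl q ⟩
      1ℚ  ∎
      where
      open ≡-Reasoning
      open +-*-Solver
      open import Data.List.Properties using (map-++)

    prob-true : ∀ {m} → seq (prob {m} p (λ _ → true)) j ≡ 1ℚ
    prob-true {m} = trans (cong (λ xs → value (map (weight p) xs)) (all-kept (subsets m))) (total-probability m)
      where
      all-kept : ∀ (xs : List (Subset m)) → filterᵇ (λ _ → true) xs ≡ xs
      all-kept []       = refl
      all-kept (x ∷ xs) = cong (x ∷_) (all-kept xs)

    module _ (A B : ℕ) (A≤B : A ℕ.≤ B) (q≡ : q ℚ.* [ B ] ≡ [ A ]) where
      open Measure A B

      1-q≡ : (1ℚ ℚ.+ ℚ.- q) ℚ.* [ B ] ≡ [ B ℕ.∸ A ]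
      1-q≡ = trans (solve 2 (λ q b → (con 1ℚ :+ (:- q)) :* b := b :+ (:- (q :* b))) refl q [ B ])
        (trans (cong₂ (λ u v → u ℚ.+ ℚ.- v) (trans (cong [_] (sym (ℕₚ.m∸n+n≡m A≤B))) ([]-+ (B ℕ.∸ A) A)) q≡)
          (solve 2 (λ a b → a :+ b :+ (:- b) := a) refl [ B ℕ.∸ A ] [ A ]))
        where open +-*-Solver

      interchange : ∀ a b c d → a ℚ.* b ℚ.* (c ℚ.* d) ≡ a ℚ.* c ℚ.* (b ℚ.* d)
      interchange = solve 4 (λ a b c d → a :* b :* (c :* d) := a :* c :* (b :* d)) refl
        where open +-*-Solver

      weight≡mass : ∀ {m} (E : Subset m) → seq (weight p E) j ℚ.* [ B ℕ.^ m ] ≡ [ mass E ]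
      weight≡mass [] = trans (ℚₚ.*-identityˡ [ 1 ]) (cong [_] (sym (prod-zero _)))
      weight≡mass {suc m} (inside ∷ E) = trans (cong (q ℚ.* seq (weight p E) j ℚ.*_) ([]-* B (B ℕ.^ m)))
        (trans (interchange q (seq (weight p E) j) [ B ] [ B ℕ.^ m ]) (trans (cong₂ ℚ._*_ q≡ (weight≡mass E))
          (trans (sym ([]-* A (mass E))) (cong [_] (sym (prod-suc _))))))
      weight≡mass {suc m} (outside ∷ E) = trans (cong ((1ℚ ℚ.+ ℚ.- q) ℚ.* seq (weight p E) j ℚ.*_)
        ([]-* B (B ℕ.^ m)))
        (trans (interchange (1ℚ ℚ.+ ℚ.- q) (seq (weight p E) j) [ B ] [ B ℕ.^ m ])
          (trans (cong₂ ℚ._*_ 1-q≡ (weight≡mass E)) (trans (sym ([]-* (B ℕ.∸ A) (mass E)))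
          (cong [_] (sym (prod-suc _))))))

      kept : ∀ {m} {χ : Subset m → Bool} E xs → value (map (weight p) (filterᵇ χ (E ∷ xs))) ≡
        seq (weight p E) j ℚ.* [ 𝟙 (χ E) ] ℚ.+ value (map (weight p) (filterᵇ χ xs))
      kept {χ = χ} E xs = choose (χ E) refl
        where
        W = seq (weight p E) j
        V = value (map (weight p) (filterᵇ χ xs))
        discarded : ∀ {b} → b ≡ false → V ≡ W ℚ.* [ 𝟙 b ] ℚ.+ V
        discarded refl = sym (trans (cong (ℚ._+ V) (trans (cong (W ℚ.*_) [0]≡0) (ℚₚ.*-zeroʳ W)))
          (ℚₚ.+-identityˡ V))
        retained : ∀ {b} → b ≡ true → W ℚ.+ V ≡ W ℚ.* [ 𝟙 b ] ℚ.+ V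
        retained refl = sym (cong (ℚ._+ V) (trans (cong (W ℚ.*_) [1]≡1) (ℚₚ.*-identityʳ W)))
        choose : ∀ b → χ E ≡ b → value (map (weight p) (filterᵇ χ (E ∷ xs))) ≡ W ℚ.* [ 𝟙 (χ E) ] ℚ.+ V
        choose false eq = trans (cong (λ ys → value (map (weight p) ys)) (filter-reject {χ = χ} {E} {xs} eq))
          (discarded {χ E} eq)
        choose true  eq = trans (cong (λ ys → value (map (weight p) ys)) (filter-accept {χ = χ} {E} {xs} eq))
          (retained {χ E} eq)

      -- Real arithmetic is termwise, so term j of the probability is exactly the probability at the
      -- j-th approximant A/B of p.
      prob≡μ : ∀ {m} (χ : Subset m → Bool) → seq (prob p χ) j ℚ.* [ B ℕ.^ m ] ≡ [ μ χ ]
      prob≡μ {m} χ = go (subsets m)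
        where
        M = [ B ℕ.^ m ]
        go : ∀ xs → value (map (weight p) (filterᵇ χ xs)) ℚ.* M ≡ [ listSum xs (λ E → mass E ℕ.* 𝟙 (χ E)) ]
        go [] = trans (ℚₚ.*-zeroˡ M) (sym [0]≡0)
        go (E ∷ xs) = trans (cong (ℚ._* M) (kept E xs))
          (trans (ℚₚ.*-distribʳ-+ M (seq (weight p E) j ℚ.* [ 𝟙 (χ E) ])
          (value (map (weight p) (filterᵇ χ xs))))
          (trans (cong₂ ℚ._+_ (trans (swap (seq (weight p E) j) [ 𝟙 (χ E) ] M)
            (trans (cong (ℚ._* [ 𝟙 (χ E) ]) (weight≡mass E)) (sym ([]-* (mass E) (𝟙 (χ E)))))) (go xs))
            (sym ([]-+ (mass E ℕ.* 𝟙 (χ E)) (listSum xs (λ E → mass E ℕ.* 𝟙 (χ E)))))))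
          where
          swap : ∀ a b c → a ℚ.* b ℚ.* c ≡ a ℚ.* c ℚ.* b
          swap = solve 3 (λ a b c → a :* b :* c := a :* c :* b) refl
            where open +-*-Solver

  -- Partial sums of the Mercator series for log n: the terms y^j / j with 2j ≤ n are at
  -- least 1/(2j), and a dyadic block of them is at least 1/4.
  module LogBound (n : ℕ) .{{_ : NonZero n}} where
    u y : ℚ
    u = 1ℤ ℚ./ n
    y = 1ℚ ℚ.- u

    0≤u : 0ℚ ℚ.≤ u
    0≤u = ℚₚ.<⇒≤ (1/n-pos n)

    nu≡1 : [ n ] ℚ.* u ≡ 1ℚ
    nu≡1 = [n]*1/n n

    ju≤1 : ∀ j → j ℕ.≤ n → [ j ] ℚ.* u ℚ.≤ 1ℚ
    ju≤1 j j≤n = subst ([ j ] ℚ.* u ℚ.≤_) nu≡1 (ℚₚ.*-monoʳ-≤-nonNeg u {{ℚ.nonNegative 0≤u}} ([]-mono j≤n))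

    0≤y : 1 ℕ.≤ n → 0ℚ ℚ.≤ y
    0≤y 1≤n = linℚ 0ℚ ℚₚ.≤-refl (subst (ℚ._≤ 1ℚ) (trans (cong (ℚ._* u) [1]≡1) (ℚₚ.*-identityˡ u)) (ju≤1 1 1≤n))
      (solve 1 (λ u → (con 1ℚ :- u) :+ u := con 0ℚ :+ con 1ℚ :+ con 0ℚ) refl u)
      where open +-*-Solver

    bernoulliℚ : 1 ℕ.≤ n → ∀ j → 1ℚ ℚ.- [ j ] ℚ.* u ℚ.≤ y ^ℚ j
    bernoulliℚ 1≤n zero    = ℚₚ.≤-reflexive (trans (cong (λ t → 1ℚ ℚ.- t ℚ.* u) [0]≡0)
      (trans (cong (λ t → 1ℚ ℚ.- t) (ℚₚ.*-zeroˡ u)) (ℚₚ.+-identityʳ 1ℚ)))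
    bernoulliℚ 1≤n (suc j) = linℚ ([ j ] ℚ.* (u ℚ.* u)) (0≤* (0≤[] j) (0≤* 0≤u 0≤u))
      (scale y (0≤y 1≤n) (bernoulliℚ 1≤n j))
      (trans (identity u [ j ] (y ^ℚ j)) (cong (λ t → 1ℚ ℚ.- t ℚ.* u ℚ.+ y ℚ.* y ^ℚ j ℚ.+ [ j ] ℚ.* (u ℚ.* u))
        (sym ([suc] j))))
      where
      identity : ∀ u J p → (1ℚ ℚ.- u) ℚ.* p ℚ.+ (1ℚ ℚ.- u) ℚ.* (1ℚ ℚ.- J ℚ.* u) ≡
        1ℚ ℚ.- (1ℚ ℚ.+ J) ℚ.* u ℚ.+ (1ℚ ℚ.- u) ℚ.* p ℚ.+ J ℚ.* (u ℚ.* u)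
      identity = solve 3 (λ u J p → (con 1ℚ :- u) :* p :+ (con 1ℚ :- u) :* (con 1ℚ :- J :* u) :=
        con 1ℚ :- (con 1ℚ :+ J) :* u :+ (con 1ℚ :- u) :* p :+ J :* (u :* u)) refl
        where open +-*-Solver

    half≤y^ : 1 ℕ.≤ n → ∀ j → 2 ℕ.* j ℕ.≤ n → ½ ℚ.≤ y ^ℚ j
    half≤y^ 1≤n j 2j≤n = ℚₚ.≤-trans (linℚ 0ℚ ℚₚ.≤-refl (scale ½ (ℚₚ.nonNegative⁻¹ ½) (ju≤1 (2 ℕ.* j) 2j≤n))
      (trans (cong (λ t → 1ℚ ℚ.- [ j ] ℚ.* u ℚ.+ ½ ℚ.* (t ℚ.* u)) (trans ([]-* 2 j) (cong (ℚ._* [ j ]) [2]≡)))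
        (identity u [ j ]))) (bernoulliℚ 1≤n j)
      where
      identity : ∀ u J → 1ℚ ℚ.- J ℚ.* u ℚ.+ ½ ℚ.* ((1ℚ ℚ.+ 1ℚ) ℚ.* J ℚ.* u) ≡ ½ ℚ.+ ½ ℚ.* 1ℚ ℚ.+ 0ℚ
      identity = solve 2 (λ u J → con 1ℚ :- J :* u :+ con ½ :* ((con 1ℚ :+ con 1ℚ) :* J :* u) := con ½ :+ con ½
        :* con 1ℚ :+ con 0ℚ) refl
        where open +-*-Solver

    term : ℕ → ℚ
    term j = (y ^ℚ suc j) ℚ.* (1ℤ ℚ./ suc j)

    ≤-add : ∀ a {t} → 0ℚ ℚ.≤ t → a ℚ.≤ a ℚ.+ t
    ≤-add a 0≤t = subst (ℚ._≤ a ℚ.+ _) (ℚₚ.+-identityʳ a) (ℚₚ.+-monoʳ-≤ a 0≤t)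

    mercator-mono : 1 ℕ.≤ n → ∀ i d → mercator y i ℚ.≤ mercator y (d ℕ.+ i)
    mercator-mono 1≤n i zero    = ℚₚ.≤-refl
    mercator-mono 1≤n i (suc d) = ℚₚ.≤-trans (mercator-mono 1≤n i d)
      (≤-add (mercator y (d ℕ.+ i)) (0≤* (0≤y^ (0≤y 1≤n) (suc (d ℕ.+ i))) (ℚₚ.<⇒≤ (1/n-pos (suc (d ℕ.+ i))))))

    reciprocal-mono : ∀ i M .{{_ : NonZero i}} .{{_ : NonZero M}} → i ℕ.≤ M → 1ℤ ℚ./ M ℚ.≤ 1ℤ ℚ./ i
    reciprocal-mono i M i≤M = subst₂ ℚ._≤_
      (trans (ℚₚ.*-assoc w [ i ] v) (trans (cong (w ℚ.*_) ([n]*1/n i)) (ℚₚ.*-identityʳ w)))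
      (trans (cong (ℚ._* v) (trans (ℚₚ.*-comm w [ M ]) ([n]*1/n M))) (ℚₚ.*-identityˡ v))
      (ℚₚ.*-monoʳ-≤-nonNeg v {{ℚ.nonNegative (ℚₚ.<⇒≤ (1/n-pos i))}} (scale w (ℚₚ.<⇒≤ (1/n-pos M))
        ([]-mono i≤M)))
      where
      v = 1ℤ ℚ./ i
      w = 1ℤ ℚ./ M

    block : 1 ℕ.≤ n → ∀ M .{{_ : NonZero M}} → 2 ℕ.* M ℕ.≤ n → ∀ N t → t ℕ.+ N ℕ.≤ M →
      mercator y N ℚ.+ [ t ] ℚ.* (½ ℚ.* (1ℤ ℚ./ M)) ℚ.≤ mercator y (t ℕ.+ N)
    block 1≤n M 2M≤n N zero    le = ℚₚ.≤-reflexive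
      (trans (cong (mercator y N ℚ.+_) (trans (cong (ℚ._* (½ ℚ.* (1ℤ ℚ./ M))) [0]≡0)
      (ℚₚ.*-zeroˡ (½ ℚ.* (1ℤ ℚ./ M))))) (ℚₚ.+-identityʳ _))
    block 1≤n M 2M≤n N (suc t) le = linℚ 0ℚ ℚₚ.≤-refl (block 1≤n M 2M≤n N t (ℕₚ.≤-trans (ℕₚ.n≤1+n _) le) ⊞
      large)
      (trans (identity (mercator y N) (mercator y (t ℕ.+ N)) [ t ] c (term (t ℕ.+ N)))
        (cong (λ s → mercator y N ℚ.+ s ℚ.* c ℚ.+ (mercator y (t ℕ.+ N) ℚ.+ term (t ℕ.+ N)) ℚ.+ 0ℚ)
          (sym ([suc] t))))
      where
      c = ½ ℚ.* (1ℤ ℚ./ M)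
      large : c ℚ.≤ term (t ℕ.+ N)
      large = ℚₚ.≤-trans (scale ½ (ℚₚ.nonNegative⁻¹ ½) (reciprocal-mono (suc (t ℕ.+ N)) M le))
        (ℚₚ.*-monoʳ-≤-nonNeg (1ℤ ℚ./ suc (t ℕ.+ N)) {{ℚ.nonNegative (ℚₚ.<⇒≤ (1/n-pos (suc (t ℕ.+ N))))}}
          (half≤y^ 1≤n (suc (t ℕ.+ N)) (ℕₚ.≤-trans (ℕₚ.*-monoʳ-≤ 2 le) 2M≤n)))
      identity : ∀ a b t c s → b ℚ.+ s ℚ.+ (a ℚ.+ t ℚ.* c ℚ.+ c) ≡ a ℚ.+ (1ℚ ℚ.+ t) ℚ.* c ℚ.+ (b ℚ.+ s) ℚ.+ 0ℚ
      identity = solve 5 (λ a b t c s → b :+ s :+ (a :+ t :* c :+ c) := a :+ (con 1ℚ :+ t) :* c :+ (b :+ s) :+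
        con 0ℚ) refl
        where open +-*-Solver

    -- The first term of the series is at least 1/2, which is two quarters, and each doubling of the
    -- number of terms adds a block worth another quarter.
    dyadic : 1 ℕ.≤ n → ∀ i → 2 ℕ.^ suc i ℕ.≤ n → ½ ℚ.* ½ ℚ.* [ suc (suc i) ] ℚ.≤ mercator y (2 ℕ.^ i)
    dyadic 1≤n zero    2≤n = subst₂ ℚ._≤_
      (trans (cong₂ (λ t v → 0ℚ ℚ.+ t ℚ.* (½ ℚ.* v)) [1]≡1 1/1) (trans start (cong (½ ℚ.* ½ ℚ.*_) (sym [2]≡))))
      refl (block 1≤n 1 2≤n 0 1 ℕₚ.≤-refl)
      where
      1/1 : 1ℤ ℚ./ 1 ≡ 1ℚ
      1/1 = refl
      start : 0ℚ ℚ.+ 1ℚ ℚ.* (½ ℚ.* 1ℚ) ≡ ½ ℚ.* ½ ℚ.* (1ℚ ℚ.+ 1ℚ)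
      start = refl
    dyadic 1≤n (suc i) h = linℚ 0ℚ ℚₚ.≤-refl
      (dyadic 1≤n i (ℕₚ.≤-trans (ℕₚ.m≤n*m (2 ℕ.^ suc i) 2) h) ⊞ step)
      (trans (cong (λ t → b ℚ.+ (½ ℚ.* ½ ℚ.* [ suc (suc i) ] ℚ.+ (a ℚ.+ t))) quarter)
        (trans (identity a b (½ ℚ.* ½) [ suc (suc i) ]) (cong (λ t → ½ ℚ.* ½ ℚ.* t ℚ.+ (a ℚ.+ b) ℚ.+ 0ℚ)
          (sym ([suc] (suc (suc i)))))))
      where
      M = 2 ℕ.^ suc i
      instance
        M-nonZero : NonZero M
        M-nonZero = ℕ.>-nonZero (ℕₚ.m^n>0 2 (suc i))
      a = mercator y (2 ℕ.^ i)
      b = mercator y (2 ℕ.^ suc i)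
      v = 1ℤ ℚ./ M
      doubled : 2 ℕ.^ i ℕ.+ 2 ℕ.^ i ≡ M
      doubled = cong (2 ℕ.^ i ℕ.+_) (sym (ℕₚ.+-identityʳ (2 ℕ.^ i)))
      step : a ℚ.+ [ 2 ℕ.^ i ] ℚ.* (½ ℚ.* v) ℚ.≤ b
      step = subst (λ t → a ℚ.+ [ 2 ℕ.^ i ] ℚ.* (½ ℚ.* v) ℚ.≤ mercator y t) doubled
        (block 1≤n M h (2 ℕ.^ i) (2 ℕ.^ i) (ℕₚ.≤-reflexive doubled))
      quarter : [ 2 ℕ.^ i ] ℚ.* (½ ℚ.* v) ≡ ½ ℚ.* ½
      quarter = trans (regroup [ 2 ℕ.^ i ] v) (trans (cong (λ t → ½ ℚ.* ½ ℚ.* (t ℚ.* [ 2 ℕ.^ i ] ℚ.* v))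
        (sym [2]≡))
        (trans (cong (λ t → ½ ℚ.* ½ ℚ.* (t ℚ.* v)) (sym ([]-* 2 (2 ℕ.^ i))))
          (trans (cong (½ ℚ.* ½ ℚ.*_) ([n]*1/n M)) (ℚₚ.*-identityʳ (½ ℚ.* ½)))))
        where
        regroup : ∀ N w → N ℚ.* (½ ℚ.* w) ≡ ½ ℚ.* ½ ℚ.* ((1ℚ ℚ.+ 1ℚ) ℚ.* N ℚ.* w)
        regroup = solve 2 (λ N w → N :* (con ½ :* w) := con ½ :* con ½ :* ((con 1ℚ :+ con 1ℚ) :* N :* w)) refl
          where open +-*-Solver
      identity : ∀ a b c ℓ → b ℚ.+ (c ℚ.* ℓ ℚ.+ (a ℚ.+ c)) ≡ c ℚ.* (1ℚ ℚ.+ ℓ) ℚ.+ (a ℚ.+ b) ℚ.+ 0ℚ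
      identity = solve 4 (λ a b c ℓ → b :+ (c :* ℓ :+ (a :+ c)) := c :* (con 1ℚ :+ ℓ) :+ (a :+ b) :+ con 0ℚ)
        refl
        where open +-*-Solver

  -- `suc (suc i)` will be ℓ. The upper bound n ≤ 2^ℓ counts vertices in the union bounds; the lower
  -- bound on n is what `dyadic` needs to compare ℓ with log n.
  digits : ∀ n → 2 ℕ.≤ n → ∃[ i ] 2 ℕ.^ suc i ℕ.≤ n × n ℕ.≤ 2 ℕ.^ suc (suc i)
  digits (suc zero) (ℕ.s≤s ())
  digits (suc (suc zero)) _ = 0 , ℕₚ.≤-refl , ℕₚ.m≤m+n 2 2
  digits (suc n@(suc (suc _))) _ = extend (digits n (ℕ.s≤s (ℕ.s≤s ℕ.z≤n)))
    where
    extend : (∃[ i ] 2 ℕ.^ suc i ℕ.≤ n × n ℕ.≤ 2 ℕ.^ suc (suc i)) → ∃[ i ] 2 ℕ.^ suc i ℕ.≤ suc n × suc n ℕ.≤ 2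
      ℕ.^ suc (suc i)
    extend (i , lo , hi) = choose (suc n ℕₚ.≤? 2 ℕ.^ suc (suc i))
      where
      open import Relation.Nullary using (Dec; yes; no)
      choose : Dec (suc n ℕ.≤ 2 ℕ.^ suc (suc i)) → ∃[ i ] 2 ℕ.^ suc i ℕ.≤ suc n × suc n ℕ.≤ 2 ℕ.^ suc (suc i)
      choose (yes le) = i , ℕₚ.m≤n⇒m≤1+n lo , le
      choose (no ¬le) = suc i , ℕₚ.<⇒≤ (ℕₚ.≰⇒> ¬le) , ℕₚ.≤-trans (ℕ.s≤s hi)
        (ℕₚ.+-mono-≤ (ℕₚ.m^n>0 2 (suc (suc i))) (ℕₚ.m≤m+n (2 ℕ.^ suc (suc i)) 0))

-- Constants, copies of the grid, and the integer k with p ≈ 1/k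

module CopiesAndBrackets where
  open import Data.Fin.Subset using (_∈_)
  open import Data.Integer.Base as ℤ using (+_)
  import Data.List.Base as List
  open import Data.Nat.Base as ℕ using (ℕ; zero; suc; NonZero)
  open import Data.Nat.DivMod using () renaming (_/_ to _div_)
  import Data.Nat.Properties as ℕₚ
  open import Data.Rational.Base as ℚ using (ℚ; 0ℚ; 1ℚ; ½)
  import Data.Rational.Properties as ℚₚ
  open import Data.Rational.Solver using (module +-*-Solver)
  open import Data.Vec.Properties using (lookup⇒[]=)
  open VertexSets using (lin)
  open RowByRow using (GridIn)
  open DeterministicEmbedding using (*-/-≤; <-suc-/-*)
  open EdgeSlots
  open GoodEvent
  open RationalArithmetic
  open ProbabilityAndLogarithm
  open import Defs
  open LogLemmas using (archimedean; 1/n-pos)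
  open CauchyLemmas using (*-pos)

  -- 1/(ak) is the density of the lower-regular pair, 2^G the weight in the exponential
  -- moments, 1/(2E′) the regularity scale, n/Θ the size of the parts, and Λ comes from
  -- n ≥ Λ k² log n.
  record Constants (a′ : ℕ) : Set where
    field
      a G E₁ E′ Θ Λ : ℕ
      a≡ : a ≡ 256 ℕ.* a′
      G≡ : G ≡ suc (768 ℕ.* a)
      E′≡ : E′ ≡ 512 ℕ.* a ℕ.* 2 ℕ.^ suc G
      E≡ : suc E₁ ≡ 2 ℕ.* E′
      Θ≡ : Θ ≡ 2 ℕ.* (8 ℕ.* a ℕ.* suc E₁ ℕ.^ (5 ℕ.* a ℕ.* (2 ℕ.* (suc E₁ ℕ.* suc E₁))))
      λ₁ : 6 ℕ.* a ℕ.+ 1 ℕ.≤ Λ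
      λ₂ : 3 ℕ.* (Θ ℕ.* Θ) ℕ.≤ Λ
      λ₃ : Θ ℕ.* Θ ℕ.* (3 ℕ.+ 8 ℕ.* a ℕ.* (E′ ℕ.* E′)) ℕ.≤ Λ
      λ₄ : Θ ℕ.* (256 ℕ.* (a ℕ.* a) ℕ.* E′) ℕ.≤ Λ
      λ₅ : Θ ℕ.* (2048 ℕ.* a) ℕ.≤ Λ
      λ₆ : Θ ℕ.* Θ ℕ.* (128 ℕ.* a ℕ.* (128 ℕ.* a)) ℕ.* 12 ℕ.+ 1 ℕ.≤ Λ
      λ₇ : 256 ℕ.≤ Λ
      0<c₁ : 0 ℕ.< 384 ℕ.* a ℕ.* Θ

  -- `Λ` is the sum of its seven lower bounds. The constants involve iterated exponentials, so they
  -- are carried as variables with defining equations and stay symbolic.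
  make-constants : ∀ a′ a G E₁ E′ Θ → 0 ℕ.< a → 0 ℕ.< Θ → a ≡ 256 ℕ.* a′ → G ≡ suc (768 ℕ.* a) →
    E′ ≡ 512 ℕ.* a ℕ.* 2 ℕ.^ suc G → suc E₁ ≡ 2 ℕ.* E′ →
    Θ ≡ 2 ℕ.* (8 ℕ.* a ℕ.* suc E₁ ℕ.^ (5 ℕ.* a ℕ.* (2 ℕ.* (suc E₁ ℕ.* suc E₁)))) → Constants a′
  make-constants a′ a G E₁ E′ Θ 0<a 0<Θ a≡ G≡ E′≡ E≡ Θ≡ =
    seven (6 ℕ.* a ℕ.+ 1) (3 ℕ.* (Θ ℕ.* Θ)) (Θ ℕ.* Θ ℕ.* (3 ℕ.+ 8 ℕ.* a ℕ.* (E′ ℕ.* E′)))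
      (Θ ℕ.* (256 ℕ.* (a ℕ.* a) ℕ.* E′))
      (Θ ℕ.* (2048 ℕ.* a)) (Θ ℕ.* Θ ℕ.* (128 ℕ.* a ℕ.* (128 ℕ.* a)) ℕ.* 12 ℕ.+ 1) 256 λ Λ λ₁ λ₂ λ₃ λ₄ λ₅ λ₆ λ₇ →
        record
      { a = a ; G = G ; E₁ = E₁ ; E′ = E′ ; Θ = Θ ; Λ = Λ ; a≡ = a≡ ; G≡ = G≡ ; E′≡ = E′≡ ; E≡ = E≡ ; Θ≡ = Θ≡
      ; λ₁ = λ₁ ; λ₂ = λ₂ ; λ₃ = λ₃ ; λ₄ = λ₄ ; λ₅ = λ₅ ; λ₆ = λ₆ ; λ₇ = λ₇
      ; 0<c₁ = positive 384 a Θ ℕ.z<s 0<a 0<Θ }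
    where
    positive : ∀ x y z → 0 ℕ.< x → 0 ℕ.< y → 0 ℕ.< z → 0 ℕ.< x ℕ.* y ℕ.* z
    positive x y z p q r = ℕₚ.*-mono-< {0} {x ℕ.* y} {0} {z} (ℕₚ.*-mono-< {0} {x} {0} {y} p q) r
    seven : ∀ {C : Set} x₁ x₂ x₃ x₄ x₅ x₆ x₇ → (∀ Λ → x₁ ℕ.≤ Λ → x₂ ℕ.≤ Λ → x₃ ℕ.≤ Λ → x₄ ℕ.≤ Λ → x₅ ℕ.≤ Λ → x₆
      ℕ.≤ Λ → x₇ ℕ.≤ Λ → C) → C
    seven x₁ x₂ x₃ x₄ x₅ x₆ x₇ k = k (x₁ ℕ.+ (x₂ ℕ.+ (x₃ ℕ.+ (x₄ ℕ.+ (x₅ ℕ.+ (x₆ ℕ.+ x₇))))))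
      (ℕₚ.m≤m+n x₁ _) (right x₁ (ℕₚ.m≤m+n x₂ _)) (right x₁ (right x₂ (ℕₚ.m≤m+n x₃ _)))
      (right x₁ (right x₂ (right x₃ (ℕₚ.m≤m+n x₄ _))))
        (right x₁ (right x₂ (right x₃ (right x₄ (ℕₚ.m≤m+n x₅ _)))))
      (right x₁ (right x₂ (right x₃ (right x₄ (right x₅ (ℕₚ.m≤m+n x₆ _))))))
      (right x₁ (right x₂ (right x₃ (right x₄ (right x₅ (ℕₚ.m≤n+m x₇ x₆))))))
      where
      right : ∀ x {y z} → y ℕ.≤ z → y ℕ.≤ x ℕ.+ z
      right x {y} {z} le = ℕₚ.≤-trans le (ℕₚ.m≤n+m z x)

  constants : ∀ a′ → 0 ℕ.< a′ → Constants a′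
  constants a′ 0<a′ = with-a (256 ℕ.* a′) refl
    where
    positive : ∀ x y → 0 ℕ.< x → 0 ℕ.< y → 0 ℕ.< x ℕ.* y
    positive x y = ℕₚ.*-mono-< {0} {x} {0} {y}
    module _ (a : ℕ) (a≡ : a ≡ 256 ℕ.* a′) where
      0<a : 0 ℕ.< a
      0<a = subst (0 ℕ.<_) (sym a≡) (positive 256 a′ ℕ.z<s 0<a′)
      with-E₁ : ∀ G E′ E₁ → G ≡ suc (768 ℕ.* a) → E′ ≡ 512 ℕ.* a ℕ.* 2 ℕ.^ suc G → suc E₁ ≡ 2 ℕ.* E′ → Constants a′
      with-E₁ G E′ E₁ G≡ E′≡ E≡ = make-constants a′ a G E₁ E′ _ 0<a
        (positive 2 (8 ℕ.* a ℕ.* suc E₁ ℕ.^ (5 ℕ.* a ℕ.* (2 ℕ.* (suc E₁ ℕ.* suc E₁)))) ℕ.z<s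
          (positive (8 ℕ.* a) (suc E₁ ℕ.^ (5 ℕ.* a ℕ.* (2 ℕ.* (suc E₁ ℕ.* suc E₁)))) (positive 8 a ℕ.z<s 0<a)
            (ℕₚ.m^n>0 (suc E₁) (5 ℕ.* a ℕ.* (2 ℕ.* (suc E₁ ℕ.* suc E₁)))))) a≡ G≡ E′≡ E≡ refl
      with-E′ : ∀ G E′ → G ≡ suc (768 ℕ.* a) → E′ ≡ 512 ℕ.* a ℕ.* 2 ℕ.^ suc G → 0 ℕ.< E′ → Constants a′
      with-E′ G E′ G≡ E′≡ 0<E′ = with-E₁ G E′ (ℕ.pred (2 ℕ.* E′)) G≡ E′≡ (ℕₚ.suc-pred (2 ℕ.* E′) {{ℕ.>-nonZero (positive 2 E′ ℕ.z<s 0<E′)}})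
      with-G : ∀ G → G ≡ suc (768 ℕ.* a) → Constants a′
      with-G G G≡ = with-E′ G (512 ℕ.* a ℕ.* 2 ℕ.^ suc G) G≡ refl (positive (512 ℕ.* a) (2 ℕ.^ suc G) (positive 512 a ℕ.z<s 0<a) (ℕₚ.m^n>0 2 (suc G)))
    with-a : ∀ a → a ≡ 256 ℕ.* a′ → Constants a′
    with-a a a≡ = with-G a a≡ (suc (768 ℕ.* a)) refl

  distance-1 : ∀ x y → ℕ.∣ x - y ∣ ≡ 1 → y ≡ suc x ⊎ x ≡ suc y
  distance-1 zero    y       eq = inj₁ eq
  distance-1 (suc x) zero    eq = inj₂ eq
  distance-1 (suc x) (suc y) eq with distance-1 x y eq
  ... | inj₁ p = inj₁ (cong suc p)
  ... | inj₂ p = inj₂ (cong suc p)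

  grid-copy : ∀ {n} (H : Graph n) s → GridIn (Slots.adj n (edges H)) s → ContainsCopy (GridAdj s s) H
  grid-copy {n} H s grid = (λ (i , j) → f i j) , injective , (λ (i , j) → in-verts i j) , adjacent
    where
    open GridIn grid
    open Slots n
    injective : ∀ {x y} → f (proj₁ x) (proj₂ x) ≡ f (proj₁ y) (proj₂ y) → x ≡ y
    injective {i , j} {i′ , j′} eq = cong₂ _,_ (proj₁ (inj i i′ j j′ eq)) (proj₂ (inj i i′ j j′ eq))
    edge : ∀ u v → adj (edges H) u v ≡ true → Adj H u v
    edge u v a = let k , k∈ , joins = adj⇒ (edges H) u v a in k , lookup⇒[]= k (edges H) k∈ , joins
    Adj-sym : ∀ u v → Adj H u v → Adj H v u
    Adj-sym u v (k , k∈ , inj₁ p) = k , k∈ , inj₂ p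
    Adj-sym u v (k , k∈ , inj₂ p) = k , k∈ , inj₁ p
    Adj-verts : ∀ u v → Adj H u v → u ∈ verts H
    Adj-verts u v (k , k∈ , inj₁ p) = subst (_∈ verts H) (cong proj₁ p) (proj₁ (incident H k∈))
    Adj-verts u v (k , k∈ , inj₂ p) = subst (_∈ verts H) (cong proj₂ p) (proj₂ (incident H k∈))
    in-verts : ∀ i j → f i j ∈ verts H
    in-verts i j = let w , a = touched i j in Adj-verts (f i j) w (edge (f i j) w a)
    adjacent : ∀ {u v} → GridAdj s s u v → Adj H (f (proj₁ u) (proj₂ u)) (f (proj₁ v) (proj₂ v))
    adjacent {i , j} {i′ , .j} (inj₁ (dist , refl)) with distance-1 (toℕ i) (toℕ i′) dist
    ... | inj₁ p = edge (f i j) (f i′ j) (down i i′ j p)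
    ... | inj₂ p = Adj-sym (f i′ j) (f i j) (edge (f i′ j) (f i j) (down i′ i j p))
    adjacent {i , j} {.i , j′} (inj₂ (refl , dist)) with distance-1 (toℕ j) (toℕ j′) dist
    ... | inj₁ p = edge (f i j) (f i j′) (across i j j′ p)
    ... | inj₂ p = Adj-sym (f i j′) (f i j) (edge (f i j′) (f i j) (across i j′ j p))

  at-index : ∀ {x y : ℕ → ℚ} {P : ℕ → Set} → (Eventually λ j → x j ℚ.≤ y j) → Eventually P → ∃[ j ] x j ℚ.≤ y j
    × P j
  at-index (I , f) (J , g) = I ℕ.⊔ J , f (I ℕ.⊔ J) (ℕₚ.m≤m⊔n I J) , g (I ℕ.⊔ J) (ℕₚ.m≤n⊔m I J)

  eventually-× : ∀ {P Q : ℕ → Set} → Eventually P → Eventually Q → Eventually (λ j → P j × Q j)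
  eventually-× (I , f) (J , g) = I ℕ.⊔ J , λ j h → f j (ℕₚ.m⊔n≤o⇒m≤o I J h) , g j (ℕₚ.m⊔n≤o⇒n≤o I J h)

  0≤½ : 0ℚ ℚ.≤ ½
  0≤½ = ℚₚ.nonNegative⁻¹ ½

  ∣∣-upper : ∀ {a b ε} → ℚ.∣ a ℚ.- b ∣ ℚ.≤ ε → a ℚ.≤ b ℚ.+ ε
  ∣∣-upper {a} {b} {ε} h = linℚ 0ℚ ℚₚ.≤-refl (ℚₚ.≤-trans (p≤∣p∣ (a ℚ.- b)) h) (identity a b ε)
    where
    p≤∣p∣ : ∀ p → p ℚ.≤ ℚ.∣ p ∣
    p≤∣p∣ p with ℚₚ.≤-total 0ℚ p
    ... | inj₁ 0≤p = ℚₚ.≤-reflexive (sym (ℚₚ.0≤p⇒∣p∣≡p 0≤p))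
    ... | inj₂ p≤0 = ℚₚ.≤-trans p≤0 (ℚₚ.0≤∣p∣ p)
    identity : ∀ a b ε → b ℚ.+ ε ℚ.+ (a ℚ.- b) ≡ a ℚ.+ ε ℚ.+ 0ℚ
    identity = solve 3 (λ a b ε → b :+ ε :+ (a :- b) := a :+ ε :+ con 0ℚ) refl
      where open +-*-Solver

  ∣∣-lower : ∀ {a b ε} → ℚ.∣ a ℚ.- b ∣ ℚ.≤ ε → b ℚ.≤ a ℚ.+ ε
  ∣∣-lower {a} {b} {ε} h = ∣∣-upper {b} {a} (subst (ℚ._≤ ε) (trans (sym (ℚₚ.∣-p∣≡∣p∣ (a ℚ.- b)))
    (cong ℚ.∣_∣ (neg a b))) h)
    where
    neg : ∀ a b → ℚ.- (a ℚ.- b) ≡ b ℚ.- a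
    neg = solve 2 (λ a b → :- (a :- b) := b :- a) refl
      where open +-*-Solver

  Bracket : ℝ → ℕ → Set
  Bracket x k = Eventually λ j → 0ℚ ℚ.≤ seq x j × [ k ] ℚ.* seq x j ℚ.≤ 1ℚ × 1ℚ ℚ.≤ [ 8 ℕ.* k ] ℚ.* seq x j

  half-arith : ∀ q s t → s ≡ 1ℚ → t ≡ 1ℚ ℚ.+ 1ℚ → s ℚ.≤ t ℚ.* q → ½ ℚ.≤ q
  half-arith q _ _ refl refl h = subst₂ ℚ._≤_ (ℚₚ.*-identityʳ ½) (identity q) (scale ½ 0≤½ h)
    where
    identity : ∀ q → ½ ℚ.* ((1ℚ ℚ.+ 1ℚ) ℚ.* q) ≡ q
    identity q = trans (solve 2 (λ q h → h :* ((con 1ℚ :+ con 1ℚ) :* q) := (h :+ h) :* q) refl q ½)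
      (ℚₚ.*-identityˡ q)
      where open +-*-Solver

  -- The order of real numbers is undecidable, so the cases are told apart at one approximant q₀
  -- from which later terms differ by at most q₀/2. If q₀ > 1/2, these are at least 1/4. Otherwise k
  -- is 1/(2q₀) rounded down, so that kq₀ ≤ 1/2 and 4kq₀ ≥ 1; later terms lie between q₀/2 and
  -- 3q₀/2, whence the factor 8 in `Bracket`.
  bracket : ∀ x → 0ℝ < x → (Eventually λ j → ½ ℚ.* ½ ℚ.≤ seq x j) ⊎ (∃[ k ] 0 ℕ.< k × Bracket x k)
  bracket x (ε , 0<ε , I , low) = choose (2 ℕ.* A ℕₚ.≤? suc B)
    where
    close = cauchy x (ε ℚ.* ½) (*-pos 0<ε (ℚₚ.positive⁻¹ ½))
    J = I ℕ.⊔ proj₁ close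
    q₀ = seq x J
    ε≤ : ∀ j → J ℕ.≤ j → ε ℚ.≤ seq x j
    ε≤ j h = subst (ℚ._≤ seq x j) (ℚₚ.+-identityˡ ε) (low j (ℕₚ.m⊔n≤o⇒m≤o I (proj₁ close) h))
    near : ∀ j → J ℕ.≤ j → ℚ.∣ seq x j ℚ.- q₀ ∣ ℚ.≤ q₀ ℚ.* ½
    near j h = ℚₚ.≤-trans (proj₂ close j J (ℕₚ.m⊔n≤o⇒n≤o I (proj₁ close) h) (ℕₚ.m≤n⊔m I (proj₁ close)))
      (ℚₚ.*-monoʳ-≤-nonNeg ½ (ε≤ J ℕₚ.≤-refl))
    0<q₀ : 0ℚ ℚ.< q₀
    0<q₀ = ℚₚ.<-≤-trans 0<ε (ε≤ J ℕₚ.≤-refl)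
    frac = fraction q₀ (ℚₚ.<⇒≤ 0<q₀)
    A = proj₁ frac
    B = proj₁ (proj₂ frac)
    q₀≡ : q₀ ℚ.* [ suc B ] ≡ [ A ]
    q₀≡ = proj₂ (proj₂ frac)
    half≤ : ∀ j → J ℕ.≤ j → q₀ ℚ.* ½ ℚ.≤ seq x j
    half≤ j h = linℚ 0ℚ ℚₚ.≤-refl (∣∣-lower {seq x j} {q₀} (near j h)) (identity q₀ (seq x j))
      where
      identity : ∀ q y → y ℚ.+ q ≡ q ℚ.* ½ ℚ.+ (y ℚ.+ q ℚ.* ½) ℚ.+ 0ℚ
      identity = solve 2 (λ q y → y :+ q := q :* con ½ :+ (y :+ q :* con ½) :+ con 0ℚ) refl
        where open +-*-Solver
    B≡ : ∀ m → [ m ] ℚ.* q₀ ℚ.* [ suc B ] ≡ [ m ℕ.* A ]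
    B≡ m = trans (ℚₚ.*-assoc [ m ] q₀ [ suc B ]) (trans (cong ([ m ] ℚ.*_) q₀≡) (sym ([]-* m A)))
    from-ℕ : ∀ m t → t ℕ.* suc B ℕ.≤ m ℕ.* A → [ t ] ℚ.≤ [ m ] ℚ.* q₀
    from-ℕ m t h = unscale [ suc B ] (0<[] (suc B))
      (subst₂ ℚ._≤_ (trans ([]-* t (suc B)) (ℚₚ.*-comm [ t ] [ suc B ]))
      (trans (sym (B≡ m)) (ℚₚ.*-comm ([ m ] ℚ.* q₀) [ suc B ])) ([]-mono h))
    to-ℕ : ∀ m t → m ℕ.* A ℕ.≤ t ℕ.* suc B → [ m ] ℚ.* q₀ ℚ.≤ [ t ]
    to-ℕ m t h = unscale [ suc B ] (0<[] (suc B))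
      (subst₂ ℚ._≤_ (trans (sym (B≡ m)) (ℚₚ.*-comm ([ m ] ℚ.* q₀) [ suc B ]))
      (trans ([]-* t (suc B)) (ℚₚ.*-comm [ t ] [ suc B ])) ([]-mono h))
    0<A : 0 ℕ.< A
    0<A = ℕₚ.≰⇒> λ A≤0 → ℚₚ.<-irrefl refl
      (ℚₚ.<-≤-trans (ℚₚ.<-≤-trans 0<q₀
      (ℚₚ.≤-reflexive (sym (trans (cong (ℚ._* q₀) [1]≡1) (ℚₚ.*-identityˡ q₀)))))
      (subst ([ 1 ] ℚ.* q₀ ℚ.≤_) [0]≡0 (to-ℕ 1 0 (ℕₚ.≤-trans (ℕₚ.≤-reflexive (ℕₚ.*-identityˡ A)) A≤0))))
    bounds : ∀ k → 0 ℕ.< k → 2 ℕ.* A ℕ.* k ℕ.≤ suc B → suc B ℕ.≤ suc k ℕ.* (2 ℕ.* A) → Bracket x k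
    bounds k 0<k k-small k-large = J , λ j h → ℚₚ.≤-trans (ℚₚ.<⇒≤ 0<ε) (ε≤ j h) , upper j h , lower j h
      where
      kq₀≤ : [ 2 ℕ.* k ] ℚ.* q₀ ℚ.≤ [ 1 ]
      kq₀≤ = to-ℕ (2 ℕ.* k) 1 (ℕₚ.≤-trans (ℕₚ.≤-reflexive (reg k A))
        (ℕₚ.≤-trans k-small (ℕₚ.≤-reflexive (sym (ℕₚ.*-identityˡ (suc B))))))
        where
        reg : ∀ k A → 2 ℕ.* k ℕ.* A ≡ 2 ℕ.* A ℕ.* k
        reg = solve-∀
      kq₀≥ : [ 1 ] ℚ.≤ [ 4 ℕ.* k ] ℚ.* q₀
      kq₀≥ = from-ℕ (4 ℕ.* k) 1 (ℕₚ.≤-trans (ℕₚ.≤-reflexive (ℕₚ.*-identityˡ (suc B)))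
        (arith k A (suc B) 0<k k-large))
        where
        arith : ∀ k A b → 0 ℕ.< k → b ℕ.≤ suc k ℕ.* (2 ℕ.* A) → b ℕ.≤ 4 ℕ.* k ℕ.* A
        arith (suc k) A b _ h = ℕₚ.≤-trans h (lin (2 ℕ.* k ℕ.* A) (ℕₚ.≤-refl {0}) (identity k A))
          where
          identity : ∀ k A → 4 ℕ.* suc k ℕ.* A ℕ.+ 0 ≡ suc (suc k) ℕ.* (2 ℕ.* A) ℕ.+ 0 ℕ.+ 2 ℕ.* k ℕ.* A
          identity = solve-∀
      upper : ∀ j → J ℕ.≤ j → [ k ] ℚ.* seq x j ℚ.≤ 1ℚ
      upper j h = linℚ (½ ℚ.* ½) (ℚₚ.nonNegative⁻¹ (½ ℚ.* ½))
        (scale [ k ] (0≤[] k) (∣∣-upper {seq x j} {q₀} (near j h)) ⊞ scale (½ ℚ.+ ½ ℚ.* ½)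
        (ℚₚ.nonNegative⁻¹ (½ ℚ.+ ½ ℚ.* ½)) kq₀≤)
        (trans (cong (λ s → 1ℚ ℚ.+ ([ k ] ℚ.* seq x j ℚ.+ (½ ℚ.+ ½ ℚ.* ½) ℚ.* (s ℚ.* q₀)))
          (trans ([]-* 2 k) (cong (ℚ._* [ k ]) [2]≡)))
          (trans (identity [ k ] (seq x j) q₀)
            (cong (λ t → [ k ] ℚ.* seq x j ℚ.+ ([ k ] ℚ.* (q₀ ℚ.+ q₀ ℚ.* ½) ℚ.+ (½ ℚ.+ ½ ℚ.* ½) ℚ.* t) ℚ.+ ½ ℚ.*
            ½) (sym [1]≡1))))
        where
        identity : ∀ k y q → 1ℚ ℚ.+ (k ℚ.* y ℚ.+ (½ ℚ.+ ½ ℚ.* ½) ℚ.* ((1ℚ ℚ.+ 1ℚ) ℚ.* k ℚ.* q)) ≡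
          k ℚ.* y ℚ.+ (k ℚ.* (q ℚ.+ q ℚ.* ½) ℚ.+ (½ ℚ.+ ½ ℚ.* ½) ℚ.* 1ℚ) ℚ.+ ½ ℚ.* ½
        identity = solve 3 (λ k y q → con 1ℚ :+ (k :* y :+ (con ½ :+ con ½ :* con ½) :* ((con 1ℚ :+ con 1ℚ) :* k
          :* q)) :=
          k :* y :+ (k :* (q :+ q :* con ½) :+ (con ½ :+ con ½ :* con ½) :* con 1ℚ) :+ con ½ :* con ½) refl
          where open +-*-Solver
      lower : ∀ j → J ℕ.≤ j → 1ℚ ℚ.≤ [ 8 ℕ.* k ] ℚ.* seq x j
      lower j h = ℚₚ.≤-trans (ℚₚ.≤-reflexive (sym [1]≡1)) (ℚₚ.≤-trans kq₀≥ (ℚₚ.≤-trans (ℚₚ.≤-reflexive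
        (trans (identity [ 4 ℕ.* k ] q₀) (cong (ℚ._* (q₀ ℚ.* ½)) (trans (cong (ℚ._* [ 4 ℕ.* k ]) (sym [2]≡))
          (trans (sym ([]-* 2 (4 ℕ.* k))) (cong [_] (reg k)))))))
        (scale [ 8 ℕ.* k ] (0≤[] (8 ℕ.* k)) (half≤ j h))))
        where
        reg : ∀ k → 2 ℕ.* (4 ℕ.* k) ≡ 8 ℕ.* k
        reg = solve-∀
        identity : ∀ k q → k ℚ.* q ≡ (1ℚ ℚ.+ 1ℚ) ℚ.* k ℚ.* (q ℚ.* ½)
        identity = solve 2 (λ k q → k :* q := (con 1ℚ :+ con 1ℚ) :* k :* (q :* con ½)) refl
          where open +-*-Solver
    choose : Dec (2 ℕ.* A ℕ.≤ suc B) → (Eventually λ j → ½ ℚ.* ½ ℚ.≤ seq x j) ⊎ (∃[ k ] 0 ℕ.< k × Bracket x k)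
    choose (no ¬h) = inj₁ (J , λ j h → ℚₚ.≤-trans (ℚₚ.*-monoʳ-≤-nonNeg ½ half) (half≤ j h))
      where
      half : ½ ℚ.≤ q₀
      half = half-arith q₀ [ 1 ] [ 2 ] [1]≡1 [2]≡
        (from-ℕ 2 1 (ℕₚ.≤-trans (ℕₚ.≤-reflexive (ℕₚ.*-identityˡ (suc B))) (ℕₚ.<⇒≤ (ℕₚ.≰⇒> ¬h))))
    choose (yes 2A≤B) = inj₂ (suc B div (2 ℕ.* A) , 0<k , bounds (suc B div (2 ℕ.* A)) 0<k
      (*-/-≤ (2 ℕ.* A) (suc B))
      (ℕₚ.<⇒≤ (<-suc-/-* (2 ℕ.* A) (suc B))))
      where
      instance
        2A-nonZero : NonZero (2 ℕ.* A)
        2A-nonZero = ℕ.>-nonZero (ℕₚ.*-mono-< {0} {2} ℕ.z<s 0<A)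
      0<k : 0 ℕ.< suc B div (2 ℕ.* A)
      0<k = ℕₚ.≰⇒> λ k≤0 → ℕₚ.<-irrefl refl (ℕₚ.<-≤-trans (<-suc-/-* (2 ℕ.* A) (suc B))
        (ℕₚ.≤-trans (ℕₚ.*-monoˡ-≤ (2 ℕ.* A) (ℕ.s≤s k≤0)) (ℕₚ.≤-trans (ℕₚ.≤-reflexive (ℕₚ.*-identityˡ (2 ℕ.* A)))
          2A≤B)))

-- From the real hypotheses to inequalities between natural numbers

module RealBounds where
  open import Data.Integer.Base as ℤ using (+_; 1ℤ)
  open import Data.Nat.Base as ℕ using (ℕ; suc; NonZero)
  import Data.Nat.Properties as ℕₚ
  open import Data.Rational.Base as ℚ using (ℚ; 0ℚ; 1ℚ; ½)
  import Data.Rational.Properties as ℚₚ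
  open import Data.Rational.Solver using (module +-*-Solver)
  open EdgeSlots
  open GoodEvent
  open RationalArithmetic
  open ProbabilityAndLogarithm
  open CopiesAndBrackets
  open import Defs
  open LogLemmas using (archimedean; 1/n-pos)
  open CauchyLemmas using (*-pos)

  fromℕ-seq : ∀ m j → seq (fromℕ m) j ≡ [ m ]
  fromℕ-seq m j = sym ([]-def m)

  -- Here L = 2^ℓ, M = B^m, and μ′ = M P is the integral measure of the event.
  probability-bound : ∀ P M L ε μ′ → 0ℚ ℚ.< M → 0ℚ ℚ.< L → P ℚ.* M ≡ μ′ →
    L ℚ.* M ℚ.≤ L ℚ.* μ′ ℚ.+ [ 4 ] ℚ.* M → 1ℚ ℚ.≤ L ℚ.* (ε ℚ.* ½ ℚ.* ½) → 1ℚ ℚ.- ε ℚ.≤ P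
  probability-bound P M L ε _ 0<M 0<L refl h₁ h₂ = unscale L 0<L (unscale M 0<M (linℚ 0ℚ ℚₚ.≤-refl
    (h₁ ⊞ scale ([ 4 ] ℚ.* M) (0≤* (0≤[] 4) (ℚₚ.<⇒≤ 0<M)) h₂)
    (trans (cong (λ f → M ℚ.* (L ℚ.* P) ℚ.+ (L ℚ.* M ℚ.+ f ℚ.* M ℚ.* 1ℚ)) [4]≡)
      (trans (identity P M L ε) (cong (λ f → M ℚ.* (L ℚ.* (1ℚ ℚ.- ε)) ℚ.+ (L ℚ.* (P ℚ.* M) ℚ.+ f ℚ.* M ℚ.+ f ℚ.*
        M ℚ.* (L ℚ.* (ε ℚ.* ½ ℚ.* ½))) ℚ.+ 0ℚ) (sym [4]≡))))))
    where
    identity : ∀ P M L ε → let f = (1ℚ ℚ.+ 1ℚ) ℚ.+ (1ℚ ℚ.+ 1ℚ) in M ℚ.* (L ℚ.* P) ℚ.+ (L ℚ.* M ℚ.+ f ℚ.* M ℚ.*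
                                 1ℚ) ≡
      M ℚ.* (L ℚ.* (1ℚ ℚ.- ε)) ℚ.+ (L ℚ.* (P ℚ.* M) ℚ.+ f ℚ.* M ℚ.+ f ℚ.* M ℚ.* (L ℚ.* (ε ℚ.* ½ ℚ.* ½))) ℚ.+ 0ℚ
    identity = solve 4 (λ P M L ε → let f = (con 1ℚ :+ con 1ℚ) :+ (con 1ℚ :+ con 1ℚ) in M :* (L :* P) :+
                                          (L :* M :+ f :* M :* con 1ℚ) :=
      M :* (L :* (con 1ℚ :- ε)) :+ (L :* (P :* M) :+ f :* M :+ f :* M :* (L :* (ε :* con ½ :* con ½))) :+ con
        0ℚ) refl
      where open +-*-Solver

  -- At an approximant the hypothesis holds up to any positive tolerance. The tolerance 1/a′,
  -- multiplied by a′, becomes the `+ 1`.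
  edge-bound : ∀ (α : ℝ) a′ .{{_ : NonZero a′}} eG eH → (Eventually λ j → 1ℤ ℚ./ a′ ℚ.≤ seq α j) →
    α * fromℕ eG ≤ fromℕ eH → eG ℕ.≤ a′ ℕ.* eH ℕ.+ 1
  edge-bound α a′ eG eH α≥ le = let j , le′ , w≤α = at-index (le w (1/n-pos a′)) α≥ in
    []-reflects (subst₂ ℚ._≤_ refl (sym (trans ([]-+ (a′ ℕ.* eH) 1) (cong₂ ℚ._+_ ([]-* a′ eH) [1]≡1)))
      (arith [ eG ] [ eH ] (seq α j) [ a′ ] w (0≤[] eG) (0≤[] a′) ([n]*1/n a′) w≤α
        (subst₂ (λ s t → seq α j ℚ.* s ℚ.≤ t ℚ.+ w) (fromℕ-seq eG j) (fromℕ-seq eH j) le′)))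
    where
    w = 1ℤ ℚ./ a′
    arith : ∀ g h α a w → 0ℚ ℚ.≤ g → 0ℚ ℚ.≤ a → a ℚ.* w ≡ 1ℚ → w ℚ.≤ α → α ℚ.* g ℚ.≤ h ℚ.+ w → g ℚ.≤ a ℚ.* h ℚ.+
      1ℚ
    arith g h α a w 0≤g 0≤a aw h₁ h₂ = ℚₚ.≤-trans
      (ℚₚ.≤-reflexive (trans (sym (ℚₚ.*-identityˡ g)) (trans (cong (ℚ._* g) (sym aw)) (ℚₚ.*-assoc a w g))))
      (ℚₚ.≤-trans (scale a 0≤a (ℚₚ.≤-trans (ℚₚ.*-monoʳ-≤-nonNeg g {{ℚ.nonNegative 0≤g}} h₁) h₂))
        (ℚₚ.≤-reflexive (trans (ℚₚ.*-distribˡ-+ a h w) (cong (a ℚ.* h ℚ.+_) aw))))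

  -- From r² = log n / n and C r ≤ p ≤ 1/k to C² k² log n ≤ n, up to constants.
  size-arith : ∀ k C n r q lg ℓ δ δ′ u → 0ℚ ℚ.≤ k → 0ℚ ℚ.≤ C → 0ℚ ℚ.≤ n → 1ℚ ℚ.≤ C →
    0ℚ ℚ.≤ δ → k ℚ.* C ℚ.* δ ≡ 1ℚ → n ℚ.* u ≡ 1ℚ → n ℚ.* δ′ ≡ ½ ℚ.* ½ ℚ.* ½ → 1ℚ ℚ.≤ ℓ →
    0ℚ ℚ.≤ r ℚ.+ δ → lg ℚ.* u ℚ.≤ r ℚ.* r ℚ.+ δ′ → C ℚ.* r ℚ.≤ q ℚ.+ δ → k ℚ.* q ℚ.≤ 1ℚ → ½ ℚ.* ½ ℚ.* ℓ ℚ.≤ lg →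
    k ℚ.* C ℚ.* (k ℚ.* C) ℚ.* (½ ℚ.* ½ ℚ.* ½ ℚ.* ℓ) ℚ.≤ n ℚ.* ((1ℚ ℚ.+ 1ℚ) ℚ.* (1ℚ ℚ.+ 1ℚ))
  size-arith k C n r q lg ℓ δ δ′ u 0≤k 0≤C 0≤n 1≤C 0≤δ kCδ nu nδ′ 1≤ℓ r≥ lg≤ Cr≤ kq≤ ℓ≤ = ℚₚ.≤-trans
    (scale (K ℚ.* K) (0≤* 0≤K 0≤K) small)
    (ℚₚ.≤-trans (ℚₚ.≤-reflexive (regroup K n r)) (scale n 0≤n square))
    where
    open +-*-Solver
    K = k ℚ.* C
    0≤K : 0ℚ ℚ.≤ K
    0≤K = 0≤* 0≤k 0≤C
    two = 1ℚ ℚ.+ 1ℚ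
    regroup : ∀ K n r → K ℚ.* K ℚ.* (n ℚ.* (r ℚ.* r)) ≡ n ℚ.* (K ℚ.* r ℚ.* (K ℚ.* r))
    regroup = solve 3 (λ K n r → K :* K :* (n :* (r :* r)) := n :* (K :* r :* (K :* r))) refl
    kδ≤1 : k ℚ.* δ ℚ.≤ 1ℚ
    kδ≤1 = ℚₚ.≤-trans (ℚₚ.≤-reflexive (sym (ℚₚ.*-identityʳ (k ℚ.* δ))))
      (ℚₚ.≤-trans (scale (k ℚ.* δ) (0≤* 0≤k 0≤δ) 1≤C)
      (ℚₚ.≤-reflexive (trans (solve 3 (λ k δ C → k :* δ :* C := k :* C :* δ) refl k δ C) kCδ)))
    upper : K ℚ.* r ℚ.≤ two
    upper = linℚ 0ℚ ℚₚ.≤-refl (scale k 0≤k Cr≤ ⊞ kq≤ ⊞ kδ≤1)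
      (solve 5 (λ k C r q δ → (con 1ℚ :+ con 1ℚ) :+ (k :* (C :* r) :+ k :* q :+ k :* δ) := k :* C :* r :+
        (k :* (q :+ δ) :+ con 1ℚ :+ con 1ℚ) :+ con 0ℚ) refl k C r q δ)
    lower : 0ℚ ℚ.≤ K ℚ.* r ℚ.+ two
    lower = linℚ 1ℚ (ℚₚ.nonNegative⁻¹ 1ℚ)
      (subst (0ℚ ℚ.≤_) (trans (ℚₚ.*-distribˡ-+ K r δ) (cong (K ℚ.* r ℚ.+_) kCδ)) (0≤* 0≤K r≥))
      (solve 1 (λ x → x :+ (con 1ℚ :+ con 1ℚ) :+ con 0ℚ := con 0ℚ :+ (x :+ con 1ℚ) :+ con 1ℚ) refl (K ℚ.* r))
    gap : 0ℚ ℚ.≤ two ℚ.- K ℚ.* r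
    gap = linℚ 0ℚ ℚₚ.≤-refl upper (solve 2 (λ x t → t :- x :+ x := con 0ℚ :+ t :+ con 0ℚ) refl (K ℚ.* r) two)
    -- An approximant of `r` may be slightly negative, so an upper bound for `K * r` alone cannot be
    -- squared; the product of `gap` and `lower` is nonnegative instead.
    square : K ℚ.* r ℚ.* (K ℚ.* r) ℚ.≤ two ℚ.* two
    square = linℚ 0ℚ ℚₚ.≤-refl (0≤* {two ℚ.- K ℚ.* r} {K ℚ.* r ℚ.+ two} gap lower)
      (solve 2 (λ x t → t :* t :+ con 0ℚ := x :* x :+ (t :- x) :* (x :+ t) :+ con 0ℚ) refl (K ℚ.* r) two)
    n-lg : n ℚ.* (lg ℚ.* u) ≡ lg
    n-lg = trans (solve 3 (λ n l u → n :* (l :* u) := l :* (n :* u)) refl n lg u) (trans (cong (lg ℚ.*_) nu)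
      (ℚₚ.*-identityʳ lg))
    small : ½ ℚ.* ½ ℚ.* ½ ℚ.* ℓ ℚ.≤ n ℚ.* (r ℚ.* r)
    small = linℚ 0ℚ ℚₚ.≤-refl
      (ℚₚ.≤-trans ℓ≤ (ℚₚ.≤-trans (ℚₚ.≤-reflexive (sym n-lg)) (ℚₚ.≤-trans (scale n 0≤n lg≤)
        (ℚₚ.≤-reflexive (trans (ℚₚ.*-distribˡ-+ n (r ℚ.* r) δ′) (cong (n ℚ.* (r ℚ.* r) ℚ.+_) nδ′)))))
        ⊞ scale (½ ℚ.* ½ ℚ.* ½) (ℚₚ.nonNegative⁻¹ (½ ℚ.* ½ ℚ.* ½)) 1≤ℓ)
      (trans (solve 3 (λ h ℓ x → x :+ (h :* h :* ℓ :+ h :* h :* h :* con 1ℚ) := h :* h :* ℓ :+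
        (x :+ h :* h :* h)) refl ½ ℓ (n ℚ.* (r ℚ.* r)))
        (trans (cong (λ t → t ℚ.* ℓ ℚ.+ (n ℚ.* (r ℚ.* r) ℚ.+ ½ ℚ.* ½ ℚ.* ½)) quarter)
          (solve 3 (λ h ℓ x → (h :+ h) :* ℓ :+ (x :+ h) := h :* ℓ :+ (x :+ h :+ h :* ℓ) :+ con 0ℚ) refl
            (½ ℚ.* ½ ℚ.* ½) ℓ (n ℚ.* (r ℚ.* r)))))
      where
      quarter : ½ ℚ.* ½ ≡ ½ ℚ.* ½ ℚ.* ½ ℚ.+ ½ ℚ.* ½ ℚ.* ½
      quarter = refl

  -- `size-arith` yields (kC)²ℓ/8 ≤ 4n. With C = 32Λ this reads 32Λ²k²ℓ ≤ n, which implies the claim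
  -- because Λ ≥ 1.
  size-bound : ∀ n .{{_ : NonZero n}} Λ (x r : ℝ) k i → 0 ℕ.< Λ → 0 ℕ.< k → 2 ℕ.^ suc i ℕ.≤ n → Bracket x k →
    r isSqrtOf (log n * fromℚ (1ℤ ℚ./ n)) → fromℕ (32 ℕ.* Λ) * r ≤ x → Λ ℕ.* (k ℕ.* k ℕ.* suc (suc i)) ℕ.≤ n
  size-bound n Λ x r k i 0<Λ 0<k digits (J₁ , br) (r≥0 , r²) Cr≤x = to-ℕ (bound facts)
    where
    C = 32 ℕ.* Λ
    ℓ = suc (suc i)
    instance
      kC-nonZero : NonZero (k ℕ.* C)
      kC-nonZero = ℕ.>-nonZero (ℕₚ.*-mono-< 0<k (ℕₚ.*-mono-< {0} {32} ℕ.z<s 0<Λ))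
    1≤n : 1 ℕ.≤ n
    1≤n = ℕₚ.≤-trans (ℕₚ.m^n>0 2 (suc i)) digits
    u = 1ℤ ℚ./ n
    -- The tolerances are chosen so that kCδ = 1 and nδ′ = 1/8, constants which the estimates can
    -- afford.
    δ = 1ℤ ℚ./ (k ℕ.* C)
    δ′ = u ℚ.* (½ ℚ.* ½ ℚ.* ½)
    0<δ′ : 0ℚ ℚ.< δ′
    0<δ′ = *-pos (1/n-pos n) (ℚₚ.positive⁻¹ (½ ℚ.* ½ ℚ.* ½))
    open LogBound n using (dyadic; mercator-mono)
    log≥ : Eventually λ j → ½ ℚ.* ½ ℚ.* [ ℓ ] ℚ.≤ seq (log n) j
    log≥ = 2 ℕ.^ i , λ j h → subst (λ t → ½ ℚ.* ½ ℚ.* [ ℓ ] ℚ.≤ seq (log n) t) (ℕₚ.m∸n+n≡m h)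
      (ℚₚ.≤-trans (dyadic 1≤n i digits) (mercator-mono 1≤n (2 ℕ.^ i) (j ℕ.∸ 2 ℕ.^ i)))
    all = eventually-× (eventually-× (r≥0 δ (1/n-pos (k ℕ.* C))) (r² δ′ 0<δ′))
      (eventually-× (Cr≤x δ (1/n-pos (k ℕ.* C))) (eventually-× (J₁ , br) log≥))
    index = proj₁ all
    facts = proj₂ all index ℕₚ.≤-refl
    Goalℚ = [ k ] ℚ.* [ C ] ℚ.* ([ k ] ℚ.* [ C ]) ℚ.* (½ ℚ.* ½ ℚ.* ½ ℚ.* [ ℓ ]) ℚ.≤ [ n ] ℚ.*
      ((1ℚ ℚ.+ 1ℚ) ℚ.* (1ℚ ℚ.+ 1ℚ))
    bound : _ → Goalℚ
    bound ((f₁ , f₂) , (f₃ , ((_ , f₄ , _) , f₅))) =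
      size-arith [ k ] [ C ] [ n ] (seq r index) (seq x index) (seq (log n) index) [ ℓ ] δ δ′ u (0≤[] k)
        (0≤[] C) (0≤[] n)
        (subst (ℚ._≤ [ C ]) [1]≡1 ([]-mono (ℕₚ.*-mono-< {0} {32} ℕ.z<s 0<Λ)))
        (ℚₚ.<⇒≤ (1/n-pos (k ℕ.* C))) (trans (cong (ℚ._* δ) (sym ([]-* k C))) ([n]*1/n (k ℕ.* C))) ([n]*1/n n)
        (trans (sym (ℚₚ.*-assoc [ n ] u (½ ℚ.* ½ ℚ.* ½))) (trans (cong (ℚ._* (½ ℚ.* ½ ℚ.* ½)) ([n]*1/n n))
          (ℚₚ.*-identityˡ (½ ℚ.* ½ ℚ.* ½))))
        (subst (ℚ._≤ [ ℓ ]) [1]≡1 ([]-mono (ℕ.s≤s ℕ.z≤n)))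
        f₁ (∣∣-lower {seq r index ℚ.* seq r index} f₂) (subst (λ t → t ℚ.* seq r index ℚ.≤ seq x index ℚ.+ δ)
          (fromℕ-seq C index) f₃) f₄ f₅
    eight : ∀ a → (½ ℚ.* ½ ℚ.* ½ ℚ.* a) ℚ.* [ 8 ] ≡ a
    eight a = trans (solve 3 (λ h a e → h :* h :* h :* a :* e := a :* (h :* h :* h :* e)) refl ½ a [ 8 ])
      (trans (cong (a ℚ.*_) eighth) (ℚₚ.*-identityʳ a))
      where
      open +-*-Solver
      eighth : ½ ℚ.* ½ ℚ.* ½ ℚ.* [ 8 ] ≡ 1ℚ
      eighth = cong (½ ℚ.* ½ ℚ.* ½ ℚ.*_) ([]-def 8)
    to-ℕ : Goalℚ → Λ ℕ.* (k ℕ.* k ℕ.* ℓ) ℕ.≤ n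
    to-ℕ g = arith k Λ ℓ n 0<Λ
      ([]-reflects (subst₂ ℚ._≤_ left right (ℚₚ.*-monoʳ-≤-nonNeg [ 8 ] {{ℚ.nonNegative (0≤[] 8)}} g)))
      where
      left : [ k ] ℚ.* [ C ] ℚ.* ([ k ] ℚ.* [ C ]) ℚ.* (½ ℚ.* ½ ℚ.* ½ ℚ.* [ ℓ ]) ℚ.* [ 8 ] ≡ [ k ℕ.* C ℕ.*
        (k ℕ.* C) ℕ.* ℓ ]
      left = trans (ℚₚ.*-assoc ([ k ] ℚ.* [ C ] ℚ.* ([ k ] ℚ.* [ C ])) (½ ℚ.* ½ ℚ.* ½ ℚ.* [ ℓ ]) [ 8 ])
        (trans (cong ([ k ] ℚ.* [ C ] ℚ.* ([ k ] ℚ.* [ C ]) ℚ.*_) (eight [ ℓ ]))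
        (trans (cong (λ t → t ℚ.* t ℚ.* [ ℓ ]) (sym ([]-* k C)))
          (trans (cong (ℚ._* [ ℓ ]) (sym ([]-* (k ℕ.* C) (k ℕ.* C)))) (sym ([]-* (k ℕ.* C ℕ.* (k ℕ.* C)) ℓ)))))
      right : [ n ] ℚ.* ((1ℚ ℚ.+ 1ℚ) ℚ.* (1ℚ ℚ.+ 1ℚ)) ℚ.* [ 8 ] ≡ [ n ℕ.* (2 ℕ.* 2) ℕ.* 8 ]
      right = trans (cong (λ t → [ n ] ℚ.* (t ℚ.* t) ℚ.* [ 8 ]) (sym [2]≡))
        (trans (cong (λ t → [ n ] ℚ.* t ℚ.* [ 8 ]) (sym ([]-* 2 2)))
        (trans (cong (ℚ._* [ 8 ]) (sym ([]-* n (2 ℕ.* 2)))) (sym ([]-* (n ℕ.* (2 ℕ.* 2)) 8))))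
      arith : ∀ k Λ ℓ n → 0 ℕ.< Λ → k ℕ.* (32 ℕ.* Λ) ℕ.* (k ℕ.* (32 ℕ.* Λ)) ℕ.* ℓ ℕ.≤ n ℕ.* (2 ℕ.* 2) ℕ.* 8 → Λ
        ℕ.* (k ℕ.* k ℕ.* ℓ) ℕ.≤ n
      arith k Λ ℓ n 0<Λ h = ℕₚ.*-cancelˡ-≤ 32 (ℕₚ.≤-trans (ℕₚ.m≤n*m (32 ℕ.* (Λ ℕ.* (k ℕ.* k ℕ.* ℓ))) (32 ℕ.* Λ)
        {{ℕ.>-nonZero (ℕₚ.*-mono-< {0} {32} ℕ.z<s 0<Λ)}})
        (ℕₚ.≤-trans (ℕₚ.≤-reflexive (reg k Λ ℓ)) (ℕₚ.≤-trans h (ℕₚ.≤-reflexive (reg′ n)))))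
        where
        reg : ∀ k Λ ℓ → 32 ℕ.* Λ ℕ.* (32 ℕ.* (Λ ℕ.* (k ℕ.* k ℕ.* ℓ))) ≡ k ℕ.* (32 ℕ.* Λ) ℕ.* (k ℕ.* (32 ℕ.* Λ))
          ℕ.* ℓ
        reg = solve-∀
        reg′ : ∀ n → n ℕ.* (2 ℕ.* 2) ℕ.* 8 ≡ 32 ℕ.* n
        reg′ = solve-∀

-- The choice of c and C, and the limit

module MainArgument where
  open import Data.Bool.Base using (T)
  open import Data.Fin.Subset using (_∈_) renaming (∣_∣ to card)
  open import Data.Integer.Base as ℤ using (+_; 1ℤ)
  open import Data.Nat.Base as ℕ using (ℕ; suc; NonZero)
  import Data.Nat.Properties as ℕₚ
  open import Data.Rational.Base as ℚ using (ℚ; 0ℚ; 1ℚ; ½)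
  import Data.Rational.Properties as ℚₚ
  open import Data.Rational.Solver using (module +-*-Solver)
  open import Data.Vec.Properties using (lookup⇒[]=; []=⇒lookup)
  open RowByRow using (GridIn)
  open ProductMeasure using (module Measure)
  open EdgeSlots
  open GoodEvent
  open RationalArithmetic
  open ProbabilityAndLogarithm
  open CopiesAndBrackets
  open RealBounds
  open import Defs
  open LogLemmas using (archimedean; 1/n-pos)
  open CauchyLemmas using (*-pos)

  T⇒≡ : ∀ {b} → T b → b ≡ true
  T⇒≡ {true} _ = refl

  module Main (α′ : ℝ) (a′ : ℕ) (0<a′ : 0 ℕ.< a′) (α≥ : .{{_ : NonZero a′}} → Eventually λ j → 1ℤ ℚ./ a′ ℚ.≤ seq α′ j) where
    open Constants (constants a′ 0<a′)

    -- The codegrees in a row sum to at most 3n(s + 1)/k², which must not exceed r ≥ m/(128ak) with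
    -- m ≥ y₀ ≥ n/Θ; and 384 = 3 · 128.
    c₁ = 384 ℕ.* a ℕ.* Θ

    0<16c₁ : 0 ℕ.< 16 ℕ.* c₁
    0<16c₁ = ℕₚ.*-mono-< {0} {16} {0} {c₁} ℕ.z<s 0<c₁

    instance
      16c₁-nonZero : NonZero (16 ℕ.* c₁)
      16c₁-nonZero = ℕ.>-nonZero 0<16c₁
      a′-nonZero : NonZero a′
      a′-nonZero = ℕ.>-nonZero 0<a′

    0<Λ : 0 ℕ.< Λ
    0<Λ = ℕₚ.≤-trans (ℕ.s≤s ℕ.z≤n) λ₇

    -- Of the factor 16, 8 comes from `Bracket` and 2 from the tolerance with which s p ≤ c is read
    -- at an approximant: s ≤ 8k(s p) ≤ 16kc = k/c₁.
    cℚ : ℚ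
    cℚ = 1ℤ ℚ./ (16 ℕ.* c₁)

    0<cℚ : 0ℚ ℚ.< cℚ
    0<cℚ = 1/n-pos (16 ℕ.* c₁)

    c : ℝ
    c = fromℚ cℚ

    C : ℝ
    C = fromℕ (32 ℕ.* Λ)

    0<c : 0ℝ < c
    0<c = cℚ , 0<cℚ , 0 , λ _ _ → ℚₚ.≤-reflexive (ℚₚ.+-identityˡ cℚ)

    1≤C : 1ℝ ≤ C
    1≤C ε 0<ε = 0 , λ j _ → subst₂ ℚ._≤_ [1]≡1 (cong (ℚ._+ ε) (sym (fromℕ-seq (32 ℕ.* Λ) j)))
      (ℚₚ.≤-trans ([]-mono (ℕₚ.*-mono-< {0} {32} {0} {Λ} ℕ.z<s 0<Λ))
        (ℚₚ.≤-trans (ℚₚ.≤-reflexive (sym (ℚₚ.+-identityʳ [ 32 ℕ.* Λ ])))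
        (ℚₚ.+-monoʳ-≤ [ 32 ℕ.* Λ ] (ℚₚ.<⇒≤ 0<ε))))

    Property : ℝ → ∀ n → Graph n → Set
    Property p n G = ∀ (H : Graph n) → H ⊑ G → α′ * fromℕ (e G) ≤ fromℕ (e H) →
      ∀ (s : ℕ) → 1 ℕ.≤ s → fromℕ s * p ≤ c → ContainsCopy (GridAdj s s) H

    at-c : ∀ {P} p s → fromℕ s * p ≤ c → Eventually P → ∃[ j ] [ s ] ℚ.* seq p j ℚ.≤ cℚ ℚ.+ cℚ × P j
    at-c p s le ev = let j , h , pj = at-index (le cℚ 0<cℚ) ev in
      j , subst (λ t → t ℚ.* seq p j ℚ.≤ cℚ ℚ.+ cℚ) (fromℕ-seq s j) h , pj

    M = [ 16 ℕ.* c₁ ]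

    2cM : ∀ K → M ℚ.* (K ℚ.* (cℚ ℚ.+ cℚ)) ≡ (1ℚ ℚ.+ 1ℚ) ℚ.* K
    2cM K = trans (solve 3 (λ M K c → M :* (K :* (c :+ c)) := (M :* c :+ M :* c) :* K) refl M K cℚ)
      (cong (λ t → (t ℚ.+ t) ℚ.* K) ([n]*1/n (16 ℕ.* c₁)))
      where open +-*-Solver

    -- If p is at least 1/4 along the approximants, s ≥ 1 would give 1/4 ≤ s p ≤ 2c ≤ 1/8.
    vacuous : ∀ p → (Eventually λ j → ½ ℚ.* ½ ℚ.≤ seq p j) → ∀ s → 1 ℕ.≤ s → fromℕ s * p ≤ c → ⊥
    vacuous p low s 1≤s le = let j , sp≤ , q≥ = at-c p s le low in
      ℕₚ.<-irrefl refl (ℕₚ.<-≤-trans (ℕₚ.m≤m+n 9 7) (ℕₚ.≤-trans (ℕₚ.*-monoʳ-≤ 16 0<c₁) ([]-reflects {16 ℕ.* c₁}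
        {8} (begin
        M                                                     ≡⟨ four M ⟩
        M ℚ.* ((1ℚ ℚ.+ 1ℚ) ℚ.* (1ℚ ℚ.+ 1ℚ) ℚ.* (½ ℚ.* ½))      ≤⟨ scale M (0≤[] (16 ℕ.* c₁))
          (scale K 0≤K (ℚₚ.≤-trans q≥ (ℚₚ.≤-trans (one≤ j q≥) sp≤))) ⟩
        M ℚ.* ((1ℚ ℚ.+ 1ℚ) ℚ.* (1ℚ ℚ.+ 1ℚ) ℚ.* (cℚ ℚ.+ cℚ))    ≡⟨ 2cM K ⟩
        (1ℚ ℚ.+ 1ℚ) ℚ.* K                                     ≡⟨ cong (λ t → t ℚ.* (t ℚ.* t)) (sym [2]≡) ⟩
        [ 2 ] ℚ.* ([ 2 ] ℚ.* [ 2 ])                           ≡⟨ trans (cong ([ 2 ] ℚ.*_) (sym ([]-* 2 2)))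
          (sym ([]-* 2 4)) ⟩
        [ 8 ]                                                 ∎))))
      where
      open ℚₚ.≤-Reasoning
      K = (1ℚ ℚ.+ 1ℚ) ℚ.* (1ℚ ℚ.+ 1ℚ)
      0≤K : 0ℚ ℚ.≤ K
      0≤K = ℚₚ.nonNegative⁻¹ K
      four : ∀ m → m ≡ m ℚ.* ((1ℚ ℚ.+ 1ℚ) ℚ.* (1ℚ ℚ.+ 1ℚ) ℚ.* (½ ℚ.* ½))
      four m = sym (ℚₚ.*-identityʳ m)
      one≤ : ∀ j → ½ ℚ.* ½ ℚ.≤ seq p j → seq p j ℚ.≤ [ s ] ℚ.* seq p j
      one≤ j q≥ = ℚₚ.≤-trans (ℚₚ.≤-reflexive
        (sym (trans (cong (ℚ._* seq p j) [1]≡1) (ℚₚ.*-identityˡ (seq p j)))))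
        (ℚₚ.*-monoʳ-≤-nonNeg (seq p j) {{ℚ.nonNegative (ℚₚ.≤-trans (ℚₚ.nonNegative⁻¹ (½ ℚ.* ½)) q≥)}}
          ([]-mono 1≤s))

    small-side : ∀ p k → Bracket p k → ∀ s → fromℕ s * p ≤ c → c₁ ℕ.* s ℕ.≤ k
    small-side p k br s le = let j , sp≤ , (0≤q , _ , kq≥) = at-c p s le br in
      ℕₚ.*-cancelˡ-≤ 16 ([]-reflects (begin
        [ 16 ℕ.* (c₁ ℕ.* s) ]                               ≡⟨ trans (cong [_] (sym (ℕₚ.*-assoc 16 c₁ s)))
          ([]-* (16 ℕ.* c₁) s) ⟩
        M ℚ.* [ s ]                                         ≡⟨ cong (M ℚ.*_) (sym (ℚₚ.*-identityʳ [ s ])) ⟩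
        M ℚ.* ([ s ] ℚ.* 1ℚ)                                ≤⟨ scale M (0≤[] (16 ℕ.* c₁))
          (scale [ s ] (0≤[] s) kq≥) ⟩
        M ℚ.* ([ s ] ℚ.* ([ 8 ℕ.* k ] ℚ.* seq p j))         ≡⟨ cong (M ℚ.*_) (comm [ s ] [ 8 ℕ.* k ] (seq p j))
          ⟩
        M ℚ.* ([ 8 ℕ.* k ] ℚ.* ([ s ] ℚ.* seq p j))         ≤⟨ scale M (0≤[] (16 ℕ.* c₁))
          (scale [ 8 ℕ.* k ] (0≤[] (8 ℕ.* k)) sp≤) ⟩
        M ℚ.* ([ 8 ℕ.* k ] ℚ.* (cℚ ℚ.+ cℚ))                 ≡⟨ 2cM [ 8 ℕ.* k ] ⟩
        (1ℚ ℚ.+ 1ℚ) ℚ.* [ 8 ℕ.* k ]                         ≡⟨ trans (cong (ℚ._* [ 8 ℕ.* k ]) (sym [2]≡))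
          (trans (sym ([]-* 2 (8 ℕ.* k))) (cong [_] (reg k))) ⟩
        [ 16 ℕ.* k ]                                        ∎))
      where
      open ℚₚ.≤-Reasoning
      comm : ∀ a b c → a ℚ.* (b ℚ.* c) ≡ b ℚ.* (a ℚ.* c)
      comm = solve 3 (λ a b c → a :* (b :* c) := b :* (a :* c)) refl
        where open +-*-Solver
      reg : ∀ k → 2 ℕ.* (8 ℕ.* k) ≡ 16 ℕ.* k
      reg = solve-∀

    vacuous-case : ∀ n (p ε : ℝ) → 0ℝ < ε → (Eventually λ j → ½ ℚ.* ½ ℚ.≤ seq p j) → ProbAtLeast p
      (Property p n) (1ℝ - ε)
    vacuous-case n p ε (ε₁ , 0<ε₁ , I , low) q≥ = (λ _ → true) , (λ E _ H _ _ s 1≤s le → ⊥-elim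
      (vacuous p q≥ s 1≤s le)) ,
      λ δ 0<δ → I , λ j h → subst (λ t → 1ℚ ℚ.+ ℚ.- seq ε j ℚ.≤ t ℚ.+ δ) (sym (prob-true p j {Slots.m n}))
        (linℚ (seq ε j) (ℚₚ.≤-trans (ℚₚ.<⇒≤ 0<ε₁) (subst (ℚ._≤ seq ε j) (ℚₚ.+-identityˡ ε₁) (low j h)))
          (ℚₚ.<⇒≤ 0<δ)
          (identity (seq ε j) δ))
      where
      identity : ∀ e δ → 1ℚ ℚ.+ δ ℚ.+ 0ℚ ≡ 1ℚ ℚ.+ ℚ.- e ℚ.+ δ ℚ.+ e
      identity = solve 2 (λ e δ → con 1ℚ :+ δ :+ con 0ℚ := con 1ℚ :+ (:- e) :+ δ :+ e) refl
        where open +-*-Solver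

    module Dense (n k ℓ : ℕ) (p : ℝ) (0<k : 0 ℕ.< k) (0<ℓ : 0 ℕ.< ℓ) (n≤2^ℓ : n ℕ.≤ 2 ℕ.^ ℓ)
      (n-large : Λ ℕ.* (k ℕ.* k ℕ.* ℓ) ℕ.≤ n) (br : Bracket p k) where
      open Core a′ a G E₁ E′ Θ Λ 0<a′ a≡ G≡ E′≡ E≡ Θ≡ λ₁ λ₂ λ₃ λ₄ λ₅ λ₆ λ₇ n k ℓ 0<k 0<ℓ n≤2^ℓ n-large using
        (χ; μ-χ; grid-in)
      open Slots n using (m; adj)

      holds : ∀ E → T (χ E) → Property p n (spanning E)
      holds E good H (_ , H⊆E) dense s 1≤s sp≤c = grid-copy H s (sized s 1≤s (small-side p k br s sp≤c))
        where
        sized : ∀ s → 1 ℕ.≤ s → c₁ ℕ.* s ℕ.≤ k → GridIn (adj (edges H)) s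
        sized (suc s) _ small = grid-in E (T⇒≡ good) (edges H)
          (λ i t → []=⇒lookup (H⊆E (lookup⇒[]= i (edges H) t)))
          (edge-bound α′ a′ (card E) (card (edges H)) α≥ dense) s small

      module _ (ε : ℝ) (ε₁ : ℚ) (n-large-ε : 1ℚ ℚ.≤ [ 2 ℕ.^ ℓ ] ℚ.* (ε₁ ℚ.* ½ ℚ.* ½)) where
        -- The approximant is written as a fraction A/(B + 1), to which the integral bound `μ-χ`
        -- applies with `χ` fixed.
        at : ∀ j → 0ℚ ℚ.≤ seq p j → [ k ] ℚ.* seq p j ℚ.≤ 1ℚ → 1ℚ ℚ.≤ [ 8 ℕ.* k ] ℚ.* seq p j → 1ℚ ℚ.- ε₁ ℚ.≤
          seq (prob p χ) j
        at j 0≤q kq≤ kq≥ = from-fraction (fraction (seq p j) 0≤q)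
          where
          from-fraction : (∃[ A ] ∃[ B ] seq p j ℚ.* [ suc B ] ≡ [ A ]) → 1ℚ ℚ.- ε₁ ℚ.≤ seq (prob p χ) j
          from-fraction (A , B , q≡) = probability-bound (seq (prob p χ) j) [ suc B ℕ.^ m ] [ 2 ℕ.^ ℓ ] ε₁ [
            Measure.μ A (suc B) χ ]
            (0<[] (suc B ℕ.^ m) {{ℕ.>-nonZero (ℕₚ.m^n>0 (suc B) m)}})
              (0<[] (2 ℕ.^ ℓ) {{ℕ.>-nonZero (ℕₚ.m^n>0 2 ℓ)}})
            (prob≡μ p j A (suc B) A≤B q≡ χ)
            (subst₂ ℚ._≤_ ([]-* (2 ℕ.^ ℓ) (suc B ℕ.^ m))
              (trans ([]-+ (2 ℕ.^ ℓ ℕ.* Measure.μ A (suc B) χ) (4 ℕ.* suc B ℕ.^ m))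
                (cong₂ ℚ._+_ ([]-* (2 ℕ.^ ℓ) (Measure.μ A (suc B) χ)) ([]-* 4 (suc B ℕ.^ m))))
              ([]-mono (μ-χ A (suc B) kA≤B B≤8kA)))
            n-large-ε
            where
            times : ∀ t → [ t ℕ.* A ] ≡ [ suc B ] ℚ.* ([ t ] ℚ.* seq p j)
            times t = trans ([]-* t A) (trans (cong ([ t ] ℚ.*_) (sym q≡)) (comm [ t ] (seq p j) [ suc B ]))
              where
              comm : ∀ a b c → a ℚ.* (b ℚ.* c) ≡ c ℚ.* (a ℚ.* b)
              comm = solve 3 (λ a b c → a :* (b :* c) := c :* (a :* b)) refl
                where open +-*-Solver
            kA≤B : k ℕ.* A ℕ.≤ suc B
            kA≤B = []-reflects (subst₂ ℚ._≤_ (sym (times k)) (ℚₚ.*-identityʳ [ suc B ])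
              (scale [ suc B ] (0≤[] (suc B)) kq≤))
            B≤8kA : suc B ℕ.≤ 8 ℕ.* k ℕ.* A
            B≤8kA = []-reflects (subst₂ ℚ._≤_ (ℚₚ.*-identityʳ [ suc B ]) (sym (times (8 ℕ.* k)))
              (scale [ suc B ] (0≤[] (suc B)) kq≥))
            A≤B : A ℕ.≤ suc B
            A≤B = ℕₚ.≤-trans (ℕₚ.m≤n*m A k {{ℕ.>-nonZero 0<k}}) kA≤B

        likely : (Eventually λ j → 0ℚ ℚ.+ ε₁ ℚ.≤ seq ε j) → ProbAtLeast p (Property p n) (1ℝ - ε)
        likely low = χ , holds , λ δ 0<δ → let J , facts = eventually-× low br in J , λ j h →
          let ε₁≤ , (0≤q , kq≤ , kq≥) = facts j h in
          linℚ δ (ℚₚ.<⇒≤ 0<δ) (at j 0≤q kq≤ kq≥ ⊞ ε₁≤) (identity ε₁ (seq ε j) (seq (prob p χ) j) δ)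
          where
          identity : ∀ a e P δ → P ℚ.+ δ ℚ.+ (1ℚ ℚ.- a ℚ.+ (0ℚ ℚ.+ a)) ≡ 1ℚ ℚ.+ ℚ.- e ℚ.+ (P ℚ.+ e) ℚ.+ δ
          identity = solve 4 (λ a e P δ → P :+ δ :+ (con 1ℚ :- a :+ (con 0ℚ :+ a)) := con 1ℚ :+ (:- e) :+
            (P :+ e) :+ δ) refl
            where open +-*-Solver

    aas : (p : ℕ → ℝ) → (∀ n → 0ℝ < p n × p n ≤ 1ℝ) →
      Eventually (λ n → .{{_ : NonZero n}} → Σ[ r ∈ ℝ ] r isSqrtOf (log n * fromℚ (1ℤ ℚ./ n)) × C * r ≤ p n) →
      AAS p (λ n → Property (p n) n)
    aas p p∈ (N₀ , large) ε 0<ε@(ε₁ , 0<ε₁ , low) = (N₀ ℕ.⊔ suc N₁) ℕ.⊔ 2 , λ n h → choose n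
      (bracket (p n) (proj₁ (p∈ n)))
        (ℕₚ.m⊔n≤o⇒m≤o N₀ (suc N₁) (ℕₚ.m⊔n≤o⇒m≤o (N₀ ℕ.⊔ suc N₁) 2 h))
        (ℕₚ.m⊔n≤o⇒n≤o N₀ (suc N₁) (ℕₚ.m⊔n≤o⇒m≤o (N₀ ℕ.⊔ suc N₁) 2 h))
        (ℕₚ.m⊔n≤o⇒n≤o (N₀ ℕ.⊔ suc N₁) 2 h)
      where
      ε₂ = ε₁ ℚ.* ½ ℚ.* ½
      0<ε₂ : 0ℚ ℚ.< ε₂
      0<ε₂ = *-pos (*-pos 0<ε₁ (ℚₚ.positive⁻¹ ½)) (ℚₚ.positive⁻¹ ½)
      -- 1/(N₁ + 1) ≤ ε₁/4 and 2^ℓ ≥ n > N₁, so four exceptional events of probability at most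
      -- 2^(-ℓ) each cost at most ε₁.
      N₁ = proj₁ (archimedean ε₂ 0<ε₂)
      choose : ∀ n → (Eventually λ j → ½ ℚ.* ½ ℚ.≤ seq (p n) j) ⊎ (∃[ k ] 0 ℕ.< k × Bracket (p n) k) →
        N₀ ℕ.≤ n → suc N₁ ℕ.≤ n → 2 ℕ.≤ n → ProbAtLeast (p n) (Property (p n) n) (1ℝ - ε)
      choose n (inj₁ q≥) _ _ _ = vacuous-case n (p n) ε 0<ε q≥
      choose n (inj₂ (k , 0<k , br)) N₀≤n N₁<n 2≤n = sized (digits n 2≤n)
        where
        instance
          n-nonZero : NonZero n
          n-nonZero = ℕ.>-nonZero (ℕₚ.≤-trans (ℕ.s≤s ℕ.z≤n) 2≤n)
        sized : (∃[ i ] 2 ℕ.^ suc i ℕ.≤ n × n ℕ.≤ 2 ℕ.^ suc (suc i)) → ProbAtLeast (p n) (Property (p n) n)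
          (1ℝ - ε)
        sized (i , lo , hi) = Dense.likely n k (suc (suc i)) (p n) 0<k ℕ.z<s hi
          (size-bound n Λ (p n) (proj₁ (large n N₀≤n)) k i 0<Λ 0<k lo br (proj₁ (proj₂ (large n N₀≤n)))
            (proj₂ (proj₂ (large n N₀≤n))))
          br ε ε₁ (ℚₚ.≤-trans (ℚₚ.≤-reflexive (sym ([n]*1/n (suc N₁)))) (ℚₚ.≤-trans
            (scale [ suc N₁ ] (0≤[] (suc N₁)) (proj₂ (archimedean ε₂ 0<ε₂) N₁ ℕₚ.≤-refl))
            (ℚₚ.*-monoʳ-≤-nonNeg ε₂ {{ℚ.nonNegative (ℚₚ.<⇒≤ 0<ε₂)}} ([]-mono (ℕₚ.≤-trans N₁<n hi))))) low

open import Defs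
open import Data.Integer.Base using (1ℤ)
open import Data.Nat.Base as ℕ using (ℕ; NonZero)
import Data.Nat.Properties as ℕₚ
import Data.Rational.Base as ℚ
import Data.Rational.Properties as ℚₚ
open LogLemmas using (archimedean)
open MainArgument using (module Main)

theorem1p1 : (α′ : ℝ) → 0ℝ < α′ →
    Σ[ c ∈ ℝ ] Σ[ C ∈ ℝ ] 0ℝ < c × 1ℝ ≤ C ×
    ((p : ℕ → ℝ) →
    (∀ n → 0ℝ < p n × p n ≤ 1ℝ) →
    Eventually (λ n → .{{_ : NonZero n}} →
    Σ[ r ∈ ℝ ] r isSqrtOf (log n * fromℚ (1ℤ ℚ./ n)) × C * r ≤ p n) →
    AAS p (λ n G →
    ∀ (H : Graph n) → H ⊑ G → α′ * fromℕ (e G) ≤ fromℕ (e H) →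
    -- s * p n ≤ c is s ≤ c / p n, as p n is positive
    ∀ (s : ℕ) → 1 ℕ.≤ s → fromℕ s * p n ≤ c → ContainsCopy (GridAdj s s) H))
theorem1p1 α′ (ε₀ , 0<ε₀ , J , low) = c , C , 0<c , 1≤C , aas
  where
  -- α′ is eventually at least ε₀ ≥ 1/(d + 1), so `suc d` serves as the integer a′ with α′ ≥ 1/a′.
  d = proj₁ (archimedean ε₀ 0<ε₀)
  open Main α′ (ℕ.suc d) ℕ.z<s (J , λ j h → ℚₚ.≤-trans (proj₂ (archimedean ε₀ 0<ε₀) d ℕₚ.≤-refl)
    (subst (ℚ._≤ seq α′ j) (ℚₚ.+-identityˡ ε₀) (low j h)))
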